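{- Let $\gamma = \lim_{n\to\infty} (\mathcal{W}_2(1,n)/n!)^{1/n} = 1.1926743412\ldots$. There exists a constant $\alpha = 0.2963720490\ldots$ such that, with $\kappa = 2/(3\gamma) < 1$, $$\frac{\mathcal{W}_2(1,n)}{n!} = \alpha\,\gamma^{n-1}\bigl(1 + O(\kappa^n)\bigr) \quad (n\to\infty).$$ More generally, for every fixed integer $s \ge 1$, there exists a polynomial $P_s(n)$ with leading term $(\alpha/\gamma)^s\, n^{s-1}/(s-1)!$ such that $$\frac{\mathcal{W}_2(s,n)}{n!} = P_s(n)\,\gamma^{n}\bigl(1 + O(\kappa^n)\bigr) \quad (n\to\infty).$$
   Context: $\mathbb{N}_0$ denotes the nonnegative integers. For positive integers $\ell, n$, let $$\mathcal{U}_2(\ell,n) = \#\{(a_1,\ldots,a_n)\in\mathbb{N}_0^n : 2^{a_1}+2^{a_2}+\cdots+2^{a_n}=\ell\}$$ be the number of representations of $\ell$ as an ordered sum of $n$ powers of $2$. For a positive integer $s$, $\mathcal{W}_2(s,n)$ is the maximum of $\mathcal{U}_2(\ell,n)$ over all positive integers $\ell$ whose binary sum of digits equals $s$. (Equivalently, $\mathcal{W}_2(1,n)$ is the number of $n$-tuples $(k_1,\ldots,k_n)$ of nonnegative integers with $2^{ -k_1}+\cdots+2^{ -k_n}=1$.) It is known (Molteni) that the limit $\lim_{n\to\infty}(\mathcal{W}_2(1,n)/n!)^{1/n}$ exists. The implied constants in the $O$-terms may depend on $s$. -}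

module Defs where

open import Data.Integer.Base using (+_)
open import Data.List.Base using (List; []; _∷_; [_]; length; filter; upTo; cartesianProductWith)
open import Data.List.Membership.Propositional using (_∈_)
open import Data.List.Membership.Propositional.Properties
  using (∈-filter⁺; ∈-filter⁻; ∈-upTo⁺; ∈-cartesianProductWith⁺)
open import Data.List.Relation.Unary.All as All using ()
open import Data.List.Relation.Unary.AllPairs as AllPairs using ()
open import Data.List.Relation.Unary.Any using (here)
open import Data.List.Relation.Unary.Unique.Propositional using (Unique)
open import Data.List.Relation.Unary.Unique.Propositional.Properties
  using (filter⁺; upTo⁺; cartesianProductWith⁺)
open import Data.Digit using (toNatDigits)
open import Data.Nat.Base as ℕ using (ℕ; zero; suc; _!)
import Data.Nat.ListAction as List
import Data.Nat.Properties as ℕ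
open import Data.Product.Base using (Σ-syntax; ∃-syntax; _×_; _,_; proj₁; proj₂)
open import Data.Rational.Base as ℚ using (ℚ; 0ℚ; 1ℚ; ½; 1/_)
import Data.Rational.Properties as ℚ
open import Data.Rational.Solver using (module +-*-Solver)
open import Data.Sum.Base using (inj₁; inj₂)
open import Data.Vec.Base as Vec using (Vec; []; _∷_)
open import Data.Vec.Properties using (∷-injective)
open import Relation.Binary.PropositionalEquality
  using (_≡_; refl; sym; trans; cong; cong₂; subst)

infix  4 _≃_ _≤_ _<_ _⟶_ _=O_ _^1/n⟶_ _≈_[1+O_] _≐_·10⁻¹⁰…
infixl 6 _+_ _-_
infixl 7 _*_ _÷_[_] _/_!
infix  8 -_
infixr 8 _^_

------------------------------------------------------------------------
-- Representations as ordered sums of powers of 2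

powerSum : ∀ {n} → Vec ℕ n → ℕ
powerSum a = Vec.sum (Vec.map (2 ℕ.^_) a)

tuples : List ℕ → (n : ℕ) → List (Vec ℕ n)
tuples xs zero    = [ [] ]
tuples xs (suc n) = cartesianProductWith _∷_ xs (tuples xs n)

-- Exponents are only searched below ℓ, because a < 2 ^ a ≤ ℓ for every
-- exponent a that occurs; see representations-complete.
representations : (ℓ n : ℕ) → List (Vec ℕ n)
representations ℓ n = filter (λ a → powerSum a ℕ.≟ ℓ) (tuples (upTo ℓ) n)

𝒰₂ : ℕ → ℕ → ℕ
𝒰₂ ℓ n = length (representations ℓ n)

representations-unique : ∀ ℓ n → Unique (representations ℓ n)
representations-unique ℓ n = filter⁺ (λ a → powerSum a ℕ.≟ ℓ) (tuples-unique n)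
  where
  tuples-unique : ∀ n → Unique (tuples (upTo ℓ) n)
  tuples-unique zero    = All.[] AllPairs.∷ AllPairs.[]
  tuples-unique (suc n) =
    cartesianProductWith⁺ _∷_ ∷-injective (upTo⁺ ℓ) (tuples-unique n)

representations-sound : ∀ ℓ n {a} → a ∈ representations ℓ n → powerSum a ≡ ℓ
representations-sound ℓ n a∈ =
  proj₂ (∈-filter⁻ (λ a → powerSum a ℕ.≟ ℓ) {xs = tuples (upTo ℓ) n} a∈)

m<2^m : ∀ m → m ℕ.< 2 ℕ.^ m
m<2^m zero    = ℕ.s≤s ℕ.z≤n
m<2^m (suc m) = begin-strict
  suc m                   ≤⟨ m<2^m m ⟩
  2 ℕ.^ m                 <⟨ ℕ.m<m+n (2 ℕ.^ m) (ℕ.<-≤-trans (ℕ.m^n>0 2 m) (ℕ.m≤m+n _ 0)) ⟩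
  2 ℕ.^ m ℕ.+ (2 ℕ.^ m ℕ.+ 0) ∎
  where open ℕ.≤-Reasoning

representations-complete : ∀ ℓ n (a : Vec ℕ n) → powerSum a ≡ ℓ → a ∈ representations ℓ n
representations-complete ℓ n a eq =
  ∈-filter⁺ (λ a → powerSum a ℕ.≟ ℓ) (∈-tuples a (ℕ.≤-reflexive eq)) eq
  where
  ∈-tuples : ∀ {n} (a : Vec ℕ n) → powerSum a ℕ.≤ ℓ → a ∈ tuples (upTo ℓ) n
  ∈-tuples []      _ = here refl
  ∈-tuples (x ∷ a) p = ∈-cartesianProductWith⁺ _∷_
    (∈-upTo⁺ (ℕ.<-≤-trans (m<2^m x) (ℕ.m+n≤o⇒m≤o (2 ℕ.^ x) p)))
    (∈-tuples a (ℕ.m+n≤o⇒n≤o (2 ℕ.^ x) p))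

binaryDigitSum : ℕ → ℕ
binaryDigitSum ℓ = List.sum (toNatDigits 2 ℓ)

-- w is the maximum of 𝒰₂ ℓ n over the positive ℓ with binary digit sum s.
record IsMaximum (s n w : ℕ) : Set where
  field
    attained   : ∃[ ℓ ] 1 ℕ.≤ ℓ × binaryDigitSum ℓ ≡ s × 𝒰₂ ℓ n ≡ w
    upperBound : ∀ ℓ → 1 ℕ.≤ ℓ → binaryDigitSum ℓ ≡ s → 𝒰₂ ℓ n ℕ.≤ w

Is𝒲₂ : (ℕ → ℕ → ℕ) → Set
Is𝒲₂ 𝒲₂ = ∀ s n → 1 ℕ.≤ s → 1 ℕ.≤ n → IsMaximum s n (𝒲₂ s n)

------------------------------------------------------------------------
-- Real numbers: Cauchy sequences of rationals, with the equality _≃_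

record ℝ : Set where
  constructor mkℝ
  field
    seq    : ℕ → ℚ
    cauchy : ∀ ε → 0ℚ ℚ.< ε → ∃[ N ] ∀ m n → N ℕ.≤ m → N ℕ.≤ n →
             ℚ.∣ seq m ℚ.- seq n ∣ ℚ.≤ ε
open ℝ public

_≃_ : ℝ → ℝ → Set
x ≃ y = ∀ ε → 0ℚ ℚ.< ε → ∃[ N ] ∀ n → N ℕ.≤ n → ℚ.∣ seq x n ℚ.- seq y n ∣ ℚ.≤ ε

_≤_ : ℝ → ℝ → Set
x ≤ y = ∀ ε → 0ℚ ℚ.< ε → ∃[ N ] ∀ n → N ℕ.≤ n → seq x n ℚ.≤ seq y n ℚ.+ ε

_<_ : ℝ → ℝ → Set
x < y = ∃[ ε ] 0ℚ ℚ.< ε × ∃[ N ] ∀ n → N ℕ.≤ n → seq x n ℚ.+ ε ℚ.≤ seq y n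

private
  open ℚ.≤-Reasoning

  half>0 : ∀ {ε} → 0ℚ ℚ.< ε → 0ℚ ℚ.< ε ℚ.* ½
  half>0 {ε} 0<ε = ℚ.positive⁻¹ (ε ℚ.* ½) {{ℚ.pos*pos⇒pos ε {{ℚ.positive 0<ε}} ½}}

  half+half : ∀ ε → ε ℚ.* ½ ℚ.+ ε ℚ.* ½ ≡ ε
  half+half ε = trans (sym (ℚ.*-distribˡ-+ ε ½ ½)) (ℚ.*-identityʳ ε)

  ∣∣-least : ∀ {p q} → p ℚ.≤ q → ℚ.- p ℚ.≤ q → ℚ.∣ p ∣ ℚ.≤ q
  ∣∣-least {p} p≤q -p≤q with ℚ.∣p∣≡p∨∣p∣≡-p p
  ... | inj₁ e = subst (ℚ._≤ _) (sym e) p≤q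
  ... | inj₂ e = subst (ℚ._≤ _) (sym e) -p≤q

  ∣p-q∣≡∣q-p∣ : ∀ p q → ℚ.∣ p ℚ.- q ∣ ≡ ℚ.∣ q ℚ.- p ∣
  ∣p-q∣≡∣q-p∣ p q = trans (sym (ℚ.∣-p∣≡∣p∣ (p ℚ.- q)))
    (cong ℚ.∣_∣ (solve 2 (λ p q → :- (p :- q) := q :- p) refl p q))
    where open +-*-Solver

  ∣p∣-∣q∣≤∣p-q∣ : ∀ p q → ℚ.∣ p ∣ ℚ.- ℚ.∣ q ∣ ℚ.≤ ℚ.∣ p ℚ.- q ∣
  ∣p∣-∣q∣≤∣p-q∣ p q = begin
    ℚ.∣ p ∣ ℚ.- ℚ.∣ q ∣
      ≡⟨ cong (λ r → ℚ.∣ r ∣ ℚ.- ℚ.∣ q ∣) (solve 2 (λ p q → p := (p :- q) :+ q) refl p q) ⟩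
    ℚ.∣ (p ℚ.- q) ℚ.+ q ∣ ℚ.- ℚ.∣ q ∣
      ≤⟨ ℚ.+-monoˡ-≤ (ℚ.- ℚ.∣ q ∣) (ℚ.∣p+q∣≤∣p∣+∣q∣ (p ℚ.- q) q) ⟩
    ℚ.∣ p ℚ.- q ∣ ℚ.+ ℚ.∣ q ∣ ℚ.- ℚ.∣ q ∣
      ≡⟨ solve 2 (λ a b → a :+ b :- b := a) refl ℚ.∣ p ℚ.- q ∣ ℚ.∣ q ∣ ⟩
    ℚ.∣ p ℚ.- q ∣ ∎
    where open +-*-Solver

  ∣∣p∣-∣q∣∣≤∣p-q∣ : ∀ p q → ℚ.∣ ℚ.∣ p ∣ ℚ.- ℚ.∣ q ∣ ∣ ℚ.≤ ℚ.∣ p ℚ.- q ∣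
  ∣∣p∣-∣q∣∣≤∣p-q∣ p q = ∣∣-least (∣p∣-∣q∣≤∣p-q∣ p q) (begin
    ℚ.- (ℚ.∣ p ∣ ℚ.- ℚ.∣ q ∣)
      ≡⟨ solve 2 (λ a b → :- (a :- b) := b :- a) refl ℚ.∣ p ∣ ℚ.∣ q ∣ ⟩
    ℚ.∣ q ∣ ℚ.- ℚ.∣ p ∣ ≤⟨ ∣p∣-∣q∣≤∣p-q∣ q p ⟩
    ℚ.∣ q ℚ.- p ∣       ≡⟨ ∣p-q∣≡∣q-p∣ q p ⟩
    ℚ.∣ p ℚ.- q ∣       ∎)
    where open +-*-Solver

  nonNeg-∣∣ : ∀ p → ℚ.NonNegative ℚ.∣ p ∣
  nonNeg-∣∣ = ℚ.∣-∣-nonNeg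

  *-mono-≤-nonNeg : ∀ {p q r s} → .{{ℚ.NonNegative q}} → .{{ℚ.NonNegative r}} →
                    p ℚ.≤ q → r ℚ.≤ s → p ℚ.* r ℚ.≤ q ℚ.* s
  *-mono-≤-nonNeg {q = q} {r} p≤q r≤s =
    ℚ.≤-trans (ℚ.*-monoʳ-≤-nonNeg r p≤q) (ℚ.*-monoˡ-≤-nonNeg q r≤s)

  eventuallyBounded : (x : ℝ) → ∃[ B ] ℚ.Positive B ×
                      ∃[ N ] (∀ n → N ℕ.≤ n → ℚ.∣ seq x n ∣ ℚ.≤ B)
  eventuallyBounded x with cauchy x 1ℚ (ℚ.positive⁻¹ 1ℚ)
  ... | N , close = ℚ.∣ seq x N ∣ ℚ.+ 1ℚ
                  , ℚ.nonNeg+pos⇒pos ℚ.∣ seq x N ∣ {{nonNeg-∣∣ (seq x N)}} 1ℚ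
                  , N , λ n N≤n → begin
    ℚ.∣ seq x n ∣
      ≡⟨ solve 2 (λ a b → a := b :+ (a :- b)) refl ℚ.∣ seq x n ∣ ℚ.∣ seq x N ∣ ⟩
    ℚ.∣ seq x N ∣ ℚ.+ (ℚ.∣ seq x n ∣ ℚ.- ℚ.∣ seq x N ∣)
      ≤⟨ ℚ.+-monoʳ-≤ ℚ.∣ seq x N ∣ (ℚ.≤-trans (∣p∣-∣q∣≤∣p-q∣ (seq x n) (seq x N))
                                              (close n N N≤n ℕ.≤-refl)) ⟩
    ℚ.∣ seq x N ∣ ℚ.+ 1ℚ ∎
    where open +-*-Solver

  scaled>0 : ∀ {ε} → 0ℚ ℚ.< ε → (B : ℚ) (B>0 : ℚ.Positive B) →
             0ℚ ℚ.< ε ℚ.* (1/ B) {{ℚ.pos⇒nonZero B {{B>0}}}}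
  scaled>0 {ε} 0<ε B B>0 = ℚ.positive⁻¹ _
    {{ℚ.pos*pos⇒pos ε {{ℚ.positive 0<ε}} ((1/ B) {{ℚ.pos⇒nonZero B {{B>0}}}}) {{ℚ.1/pos⇒pos B {{B>0}}}}}}

  unscale : ∀ ε B .{{_ : ℚ.NonZero B}} → B ℚ.* (ε ℚ.* 1/ B) ≡ ε
  unscale ε B = begin-equality
    B ℚ.* (ε ℚ.* 1/ B) ≡⟨ solve 3 (λ b e c → b :* (e :* c) := e :* (b :* c)) refl B ε (1/ B) ⟩
    ε ℚ.* (B ℚ.* 1/ B) ≡⟨ cong (ε ℚ.*_) (ℚ.*-inverseʳ B) ⟩
    ε ℚ.* 1ℚ           ≡⟨ ℚ.*-identityʳ ε ⟩
    ε                  ∎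
    where open +-*-Solver

  product-difference : ∀ a b c d → a ℚ.* b ℚ.- c ℚ.* d ≡ a ℚ.* (b ℚ.- d) ℚ.+ d ℚ.* (a ℚ.- c)
  product-difference =
    solve 4 (λ a b c d → a :* b :- c :* d := a :* (b :- d) :+ d :* (a :- c)) refl
    where open +-*-Solver

  ∣product-difference∣≤ : ∀ a b c d →
    ℚ.∣ a ℚ.* b ℚ.- c ℚ.* d ∣ ℚ.≤ ℚ.∣ a ∣ ℚ.* ℚ.∣ b ℚ.- d ∣ ℚ.+ ℚ.∣ d ∣ ℚ.* ℚ.∣ a ℚ.- c ∣
  ∣product-difference∣≤ a b c d = begin
    ℚ.∣ a ℚ.* b ℚ.- c ℚ.* d ∣
      ≡⟨ cong ℚ.∣_∣ (product-difference a b c d) ⟩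
    ℚ.∣ a ℚ.* (b ℚ.- d) ℚ.+ d ℚ.* (a ℚ.- c) ∣
      ≤⟨ ℚ.∣p+q∣≤∣p∣+∣q∣ (a ℚ.* (b ℚ.- d)) (d ℚ.* (a ℚ.- c)) ⟩
    ℚ.∣ a ℚ.* (b ℚ.- d) ∣ ℚ.+ ℚ.∣ d ℚ.* (a ℚ.- c) ∣
      ≡⟨ cong₂ ℚ._+_ (ℚ.∣p*q∣≡∣p∣*∣q∣ a (b ℚ.- d)) (ℚ.∣p*q∣≡∣p∣*∣q∣ d (a ℚ.- c)) ⟩
    ℚ.∣ a ∣ ℚ.* ℚ.∣ b ℚ.- d ∣ ℚ.+ ℚ.∣ d ∣ ℚ.* ℚ.∣ a ℚ.- c ∣ ∎

  product-bound : ∀ {ε p q r s} (B C : ℚ) (B>0 : ℚ.Positive B) (C>0 : ℚ.Positive C) →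
    .{{ℚ.NonNegative q}} → .{{ℚ.NonNegative s}} →
    p ℚ.≤ B → q ℚ.≤ ε ℚ.* ½ ℚ.* (1/ B) {{ℚ.pos⇒nonZero B {{B>0}}}} →
    r ℚ.≤ C → s ℚ.≤ ε ℚ.* ½ ℚ.* (1/ C) {{ℚ.pos⇒nonZero C {{C>0}}}} →
    p ℚ.* q ℚ.+ r ℚ.* s ℚ.≤ ε
  product-bound {ε} {p} {q} {r} {s} B C B>0 C>0 p≤ q≤ r≤ s≤ = begin
    p ℚ.* q ℚ.+ r ℚ.* s
      ≤⟨ ℚ.+-mono-≤ (*-mono-≤-nonNeg {{ℚ.pos⇒nonNeg B {{B>0}}}} p≤ q≤)
                    (*-mono-≤-nonNeg {{ℚ.pos⇒nonNeg C {{C>0}}}} r≤ s≤) ⟩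
    B ℚ.* (ε ℚ.* ½ ℚ.* (1/ B) {{B≢0}}) ℚ.+ C ℚ.* (ε ℚ.* ½ ℚ.* (1/ C) {{C≢0}})
      ≡⟨ cong₂ ℚ._+_ (unscale (ε ℚ.* ½) B {{B≢0}}) (unscale (ε ℚ.* ½) C {{C≢0}}) ⟩
    ε ℚ.* ½ ℚ.+ ε ℚ.* ½
      ≡⟨ half+half ε ⟩
    ε ∎
    where
    B≢0 = ℚ.pos⇒nonZero B {{B>0}}
    C≢0 = ℚ.pos⇒nonZero C {{C>0}}

fromℚ : ℚ → ℝ
fromℚ p = mkℝ (λ _ → p) λ ε 0<ε →
  0 , λ _ _ _ _ → ℚ.≤-trans (ℚ.≤-reflexive (cong ℚ.∣_∣ (ℚ.+-inverseʳ p))) (ℚ.<⇒≤ 0<ε)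

fromℕ : ℕ → ℝ
fromℕ n = fromℚ (+ n ℚ./ 1)

0ℝ 1ℝ : ℝ
0ℝ = fromℚ 0ℚ
1ℝ = fromℚ 1ℚ

_+_ : ℝ → ℝ → ℝ
x + y = mkℝ (λ n → seq x n ℚ.+ seq y n) λ ε 0<ε →
  let M , p = cauchy x (ε ℚ.* ½) (half>0 0<ε)
      N , q = cauchy y (ε ℚ.* ½) (half>0 0<ε)
  in M ℕ.⊔ N , λ m n h k → begin
    ℚ.∣ (seq x m ℚ.+ seq y m) ℚ.- (seq x n ℚ.+ seq y n) ∣
      ≡⟨ cong ℚ.∣_∣ (solve 4 (λ a b c d → (a :+ b) :- (c :+ d) := (a :- c) :+ (b :- d)) refl
                             (seq x m) (seq y m) (seq x n) (seq y n)) ⟩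
    ℚ.∣ (seq x m ℚ.- seq x n) ℚ.+ (seq y m ℚ.- seq y n) ∣
      ≤⟨ ℚ.∣p+q∣≤∣p∣+∣q∣ (seq x m ℚ.- seq x n) (seq y m ℚ.- seq y n) ⟩
    ℚ.∣ seq x m ℚ.- seq x n ∣ ℚ.+ ℚ.∣ seq y m ℚ.- seq y n ∣
      ≤⟨ ℚ.+-mono-≤ (p m n (ℕ.m⊔n≤o⇒m≤o M N h) (ℕ.m⊔n≤o⇒m≤o M N k))
                    (q m n (ℕ.m⊔n≤o⇒n≤o M N h) (ℕ.m⊔n≤o⇒n≤o M N k)) ⟩
    ε ℚ.* ½ ℚ.+ ε ℚ.* ½
      ≡⟨ half+half ε ⟩
    ε ∎
  where open +-*-Solver

-_ : ℝ → ℝ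
- x = mkℝ (λ n → ℚ.- seq x n) λ ε 0<ε →
  let N , p = cauchy x ε 0<ε
  in N , λ m n h k → begin
    ℚ.∣ ℚ.- seq x m ℚ.- ℚ.- seq x n ∣
      ≡⟨ cong ℚ.∣_∣ (solve 2 (λ a b → :- a :- :- b := b :- a) refl (seq x m) (seq x n)) ⟩
    ℚ.∣ seq x n ℚ.- seq x m ∣ ≤⟨ p n m k h ⟩
    ε ∎
  where open +-*-Solver

_-_ : ℝ → ℝ → ℝ
x - y = x + - y

∣_∣ : ℝ → ℝ
∣ x ∣ = mkℝ (λ n → ℚ.∣ seq x n ∣) λ ε 0<ε →
  let N , p = cauchy x ε 0<ε
  in N , λ m n h k → ℚ.≤-trans (∣∣p∣-∣q∣∣≤∣p-q∣ (seq x m) (seq x n)) (p m n h k)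

_*_ : ℝ → ℝ → ℝ
x * y = mkℝ (λ n → seq x n ℚ.* seq y n) λ ε 0<ε →
  let B , B>0 , M , boundx = eventuallyBounded x
      C , C>0 , N , boundy = eventuallyBounded y
      M′ , closex = cauchy x _ (scaled>0 (half>0 0<ε) C C>0)
      N′ , closey = cauchy y _ (scaled>0 (half>0 0<ε) B B>0)
  in (M ℕ.⊔ N) ℕ.⊔ (M′ ℕ.⊔ N′) , λ m n h k →
    let h₁ = ℕ.m⊔n≤o⇒m≤o (M ℕ.⊔ N) (M′ ℕ.⊔ N′) h
        h₂ = ℕ.m⊔n≤o⇒n≤o (M ℕ.⊔ N) (M′ ℕ.⊔ N′) h
        k₁ = ℕ.m⊔n≤o⇒m≤o (M ℕ.⊔ N) (M′ ℕ.⊔ N′) k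
        k₂ = ℕ.m⊔n≤o⇒n≤o (M ℕ.⊔ N) (M′ ℕ.⊔ N′) k
    in ℚ.≤-trans (∣product-difference∣≤ (seq x m) (seq y m) (seq x n) (seq y n))
         (product-bound B C B>0 C>0
           {{nonNeg-∣∣ (seq y m ℚ.- seq y n)}} {{nonNeg-∣∣ (seq x m ℚ.- seq x n)}}
           (boundx m (ℕ.m⊔n≤o⇒m≤o M N h₁))
           (closey m n (ℕ.m⊔n≤o⇒n≤o M′ N′ h₂) (ℕ.m⊔n≤o⇒n≤o M′ N′ k₂))
           (boundy n (ℕ.m⊔n≤o⇒n≤o M N k₁))
           (closex m n (ℕ.m⊔n≤o⇒m≤o M′ N′ h₂) (ℕ.m⊔n≤o⇒m≤o M′ N′ k₂)))

-- The sequence of x is cut off below at a positive rational that it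
-- eventually dominates, so every term of the quotient sequence is defined.
inverse : (x : ℝ) → 0ℝ < x → ℝ
inverse x (δ , 0<δ , N , δ≤x) = mkℝ (λ n → inv (seq x n)) inv-cauchy
  where
  open +-*-Solver
  cut : ℚ → ℚ
  cut p = p ℚ.⊔ δ

  cut>0 : ∀ p → ℚ.Positive (cut p)
  cut>0 p = ℚ.positive (ℚ.<-≤-trans 0<δ (ℚ.p≤q⊔p p δ))

  inv : ℚ → ℚ
  inv p = (1/ cut p) {{ℚ.pos⇒nonZero (cut p) {{cut>0 p}}}}

  inv>0 : ∀ p → ℚ.Positive (inv p)
  inv>0 p = ℚ.1/pos⇒pos (cut p) {{cut>0 p}}

  cut*inv : ∀ p → cut p ℚ.* inv p ≡ 1ℚ
  cut*inv p = ℚ.*-inverseʳ (cut p) {{ℚ.pos⇒nonZero (cut p) {{cut>0 p}}}}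

  instance
    δ>0 : ℚ.Positive δ
    δ>0 = ℚ.positive 0<δ
    δ≢0 : ℚ.NonZero δ
    δ≢0 = ℚ.pos⇒nonZero δ

  1/δ>0 : ℚ.Positive (1/ δ)
  1/δ>0 = ℚ.1/pos⇒pos δ

  inv≤ : ∀ p → inv p ℚ.≤ 1/ δ
  inv≤ p = begin
    inv p                        ≡⟨ ℚ.*-identityʳ (inv p) ⟨
    inv p ℚ.* 1ℚ                 ≡⟨ cong (inv p ℚ.*_) (ℚ.*-inverseʳ δ) ⟨
    inv p ℚ.* (δ ℚ.* 1/ δ)       ≤⟨ ℚ.*-monoˡ-≤-nonNeg (inv p) {{ℚ.pos⇒nonNeg (inv p) {{inv>0 p}}}}
                                      (ℚ.*-monoʳ-≤-nonNeg (1/ δ) {{ℚ.pos⇒nonNeg (1/ δ) {{1/δ>0}}}}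
                                        (ℚ.p≤q⊔p p δ)) ⟩
    inv p ℚ.* (cut p ℚ.* 1/ δ)   ≡⟨ solve 3 (λ a b c → a :* (b :* c) := (b :* a) :* c) refl
                                            (inv p) (cut p) (1/ δ) ⟩
    (cut p ℚ.* inv p) ℚ.* 1/ δ   ≡⟨ cong (ℚ._* 1/ δ) (cut*inv p) ⟩
    1ℚ ℚ.* 1/ δ                  ≡⟨ ℚ.*-identityˡ (1/ δ) ⟩
    1/ δ                         ∎

  inv-difference : ∀ p q → inv p ℚ.- inv q ≡ (cut q ℚ.- cut p) ℚ.* (inv p ℚ.* inv q)
  inv-difference p q = begin-equality
    inv p ℚ.- inv q
      ≡⟨ cong₂ ℚ._-_ (ℚ.*-identityˡ (inv p)) (ℚ.*-identityˡ (inv q)) ⟨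
    1ℚ ℚ.* inv p ℚ.- 1ℚ ℚ.* inv q
      ≡⟨ cong₂ (λ r s → r ℚ.* inv p ℚ.- s ℚ.* inv q) (cut*inv q) (cut*inv p) ⟨
    cut q ℚ.* inv q ℚ.* inv p ℚ.- cut p ℚ.* inv p ℚ.* inv q
      ≡⟨ solve 4 (λ a b c d → b :* d :* c :- a :* c :* d := (b :- a) :* (c :* d)) refl
                 (cut p) (cut q) (inv p) (inv q) ⟩
    (cut q ℚ.- cut p) ℚ.* (inv p ℚ.* inv q) ∎

  cut-eventually : ∀ n → N ℕ.≤ n → cut (seq x n) ≡ seq x n
  cut-eventually n N≤n =
    ℚ.p≥q⇒p⊔q≡p (subst (ℚ._≤ seq x n) (ℚ.+-identityˡ δ) (δ≤x n N≤n))

  inv-cauchy : ∀ ε → 0ℚ ℚ.< ε → ∃[ M ] ∀ m n → M ℕ.≤ m → M ℕ.≤ n →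
               ℚ.∣ inv (seq x m) ℚ.- inv (seq x n) ∣ ℚ.≤ ε
  inv-cauchy ε 0<ε with cauchy x (ε ℚ.* δ ℚ.* δ) (ℚ.positive⁻¹ _
    {{ℚ.pos*pos⇒pos (ε ℚ.* δ) {{ℚ.pos*pos⇒pos ε {{ℚ.positive 0<ε}} δ}} δ}})
  ... | M , close = M ℕ.⊔ N , λ m n h k →
    let p = seq x m ; q = seq x n
    in begin
    ℚ.∣ inv p ℚ.- inv q ∣
      ≡⟨ cong ℚ.∣_∣ (inv-difference p q) ⟩
    ℚ.∣ (cut q ℚ.- cut p) ℚ.* (inv p ℚ.* inv q) ∣
      ≡⟨ cong₂ (λ r s → ℚ.∣ (r ℚ.- s) ℚ.* (inv p ℚ.* inv q) ∣)
               (cut-eventually n (ℕ.m⊔n≤o⇒n≤o M N k)) (cut-eventually m (ℕ.m⊔n≤o⇒n≤o M N h)) ⟩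
    ℚ.∣ (q ℚ.- p) ℚ.* (inv p ℚ.* inv q) ∣
      ≡⟨ ℚ.∣p*q∣≡∣p∣*∣q∣ (q ℚ.- p) (inv p ℚ.* inv q) ⟩
    ℚ.∣ q ℚ.- p ∣ ℚ.* ℚ.∣ inv p ℚ.* inv q ∣
      ≡⟨ cong (ℚ.∣ q ℚ.- p ∣ ℚ.*_) (ℚ.0≤p⇒∣p∣≡p (ℚ.<⇒≤ (ℚ.positive⁻¹ _ {{inv*inv>0 p q}}))) ⟩
    ℚ.∣ q ℚ.- p ∣ ℚ.* (inv p ℚ.* inv q)
      ≤⟨ *-mono-≤-nonNeg {{ℚ.pos⇒nonNeg (ε ℚ.* δ ℚ.* δ) {{ε*δ*δ>0}}}}
           {{ℚ.pos⇒nonNeg (inv p ℚ.* inv q) {{inv*inv>0 p q}}}}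
           (close n m (ℕ.m⊔n≤o⇒m≤o M N k) (ℕ.m⊔n≤o⇒m≤o M N h))
           (*-mono-≤-nonNeg {{ℚ.pos⇒nonNeg (1/ δ) {{1/δ>0}}}}
             {{ℚ.pos⇒nonNeg (inv q) {{inv>0 q}}}} (inv≤ p) (inv≤ q)) ⟩
    ε ℚ.* δ ℚ.* δ ℚ.* (1/ δ ℚ.* 1/ δ)
      ≡⟨ solve 3 (λ e d i → e :* d :* d :* (i :* i) := e :* ((d :* i) :* (d :* i))) refl ε δ (1/ δ) ⟩
    ε ℚ.* ((δ ℚ.* 1/ δ) ℚ.* (δ ℚ.* 1/ δ))
      ≡⟨ cong (λ r → ε ℚ.* (r ℚ.* r)) (ℚ.*-inverseʳ δ) ⟩
    ε ℚ.* (1ℚ ℚ.* 1ℚ)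
      ≡⟨ ℚ.*-identityʳ ε ⟩
    ε ∎
    where
    inv*inv>0 : ∀ p q → ℚ.Positive (inv p ℚ.* inv q)
    inv*inv>0 p q = ℚ.pos*pos⇒pos (inv p) {{inv>0 p}} (inv q) {{inv>0 q}}

    ε*δ*δ>0 : ℚ.Positive (ε ℚ.* δ ℚ.* δ)
    ε*δ*δ>0 = ℚ.pos*pos⇒pos (ε ℚ.* δ) {{ℚ.pos*pos⇒pos ε {{ℚ.positive 0<ε}} δ}} δ

_÷_[_] : ℝ → (y : ℝ) → 0ℝ < y → ℝ
x ÷ y [ 0<y ] = x * inverse y 0<y

_^_ : ℝ → ℕ → ℝ
x ^ zero  = 1ℝ
x ^ suc n = x * x ^ n

*-pos : ∀ {x y} → 0ℝ < x → 0ℝ < y → 0ℝ < x * y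
*-pos {x} {y} (δ , 0<δ , M , p) (ε , 0<ε , N , q) =
  δ ℚ.* ε , ℚ.positive⁻¹ _ {{ℚ.pos*pos⇒pos δ {{ℚ.positive 0<δ}} ε {{ℚ.positive 0<ε}}}} ,
  M ℕ.⊔ N , λ n h → begin
    0ℚ ℚ.+ δ ℚ.* ε
      ≡⟨ ℚ.+-identityˡ (δ ℚ.* ε) ⟩
    δ ℚ.* ε
      ≡⟨ cong₂ ℚ._*_ (ℚ.+-identityˡ δ) (ℚ.+-identityˡ ε) ⟨
    (0ℚ ℚ.+ δ) ℚ.* (0ℚ ℚ.+ ε)
      ≤⟨ *-mono-≤-nonNeg
           {{ℚ.nonNegative (ℚ.≤-trans (0≤0+ 0<δ) (p n (ℕ.m⊔n≤o⇒m≤o M N h)))}}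
           {{ℚ.nonNegative (0≤0+ 0<ε)}}
           (p n (ℕ.m⊔n≤o⇒m≤o M N h)) (q n (ℕ.m⊔n≤o⇒n≤o M N h)) ⟩
    seq x n ℚ.* seq y n ∎
  where
  0≤0+ : ∀ {ε} → 0ℚ ℚ.< ε → 0ℚ ℚ.≤ 0ℚ ℚ.+ ε
  0≤0+ {ε} 0<ε = ℚ.≤-trans (ℚ.<⇒≤ 0<ε) (ℚ.≤-reflexive (sym (ℚ.+-identityˡ ε)))

------------------------------------------------------------------------
-- Asymptotics

_⟶_ : (ℕ → ℝ) → ℝ → Set
u ⟶ x = ∀ ε → 0ℝ < ε → ∃[ N ] ∀ n → N ℕ.≤ n → ∣ u n - x ∣ ≤ ε

_=O_ : (ℕ → ℝ) → (ℕ → ℝ) → Set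
u =O v = ∃[ C ] ∃[ N ] ∀ n → N ℕ.≤ n → ∣ u n ∣ ≤ C * ∣ v n ∣

-- u n = v n · (1 + O(w n)) as n → ∞
_≈_[1+O_] : (ℕ → ℝ) → (ℕ → ℝ) → (ℕ → ℝ) → Set
u ≈ v [1+O w ] = Σ[ e ∈ (ℕ → ℝ) ] e =O w ×
  ∃[ N ] ∀ n → N ℕ.≤ n → u n ≃ v n * (1ℝ + e n)

-- r is the n-th root of x, for n ≥ 1 and x ≥ 0.
IsRoot : ℕ → ℝ → ℝ → Set
IsRoot n x r = 0ℝ ≤ r × r ^ n ≃ x

-- uₙ^(1/n) → x
_^1/n⟶_ : (ℕ → ℝ) → ℝ → Set
u ^1/n⟶ x = Σ[ r ∈ (ℕ → ℝ) ] (∀ n → 1 ℕ.≤ n → IsRoot n (u n) (r n)) × r ⟶ x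

-- Coefficients are listed from the constant term upwards, so a polynomial
-- in Vec ℝ (suc d) has the term  last P · xᵈ.
evaluate : ∀ {d} → Vec ℝ d → ℝ → ℝ
evaluate []      x = 0ℝ
evaluate (c ∷ P) x = c + x * evaluate P x

_/_! : ℕ → ℕ → ℝ
w / n ! = fromℚ (ℚ._/_ (+ w) (n !) {{n ℕ.!≢0}})

-- The decimal expansion of x starts with the 10 decimals of m / 10¹⁰.
_≐_·10⁻¹⁰… : ℝ → ℕ → Set
x ≐ m ·10⁻¹⁰… = fromℚ (+ m ℚ./ 10000000000) ≤ x × x < fromℚ (+ suc m ℚ./ 10000000000)

module Submission where

-- Counting the representations of ℓ by the number of summands 1, and halving
-- the other summands, gives a linear recursion for the power series
-- f ℓ = Σ 𝒰₂(ℓ, n) (3z/2)ⁿ / n!.  It implies f (2ᵇ + L) ≤ f (2ᵇ) f L for L < 2ᵇ,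
-- with equality up to any given order once the binary digit 2ᵇ is far from the
-- digits of L.  Hence wˢ, where w is the limit of the f (2ᵇ), is the generating
-- function of 𝒲₂(s, ·).
--
-- The recursion also maps the sequence of the f (2ᵇ - t) to that of the
-- f (2ᵇ⁺¹ - t) by an operator 𝒜 that does not depend on b.  A sequence v that 𝒜
-- fixes away from index 1 yields a series D such that D w is explicit.  A
-- numerical approximation of v with certified errors shows that, up to an
-- invertible factor, D lies within ℓ¹-distance 11/50 of 1 - g₀ z for a rational
-- g₀; so w has a single pole 1/Γ in the unit disc, it is simple, and
-- w n = c Γⁿ + h n with a summable h.  Since γ = (2/3)Γ and κ = 1/Γ, this is the
-- claim for s = 1, and the powers of w give the general one.  The decimals of γ
-- and α follow from the exact values of w 63 and w 64.

import Algebra.Properties.Ring as RingProperties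
import Algebra.Solver.Ring as RingSolver
import Algebra.Solver.Ring.AlmostCommutativeRing as ACR
import Data.Integer.Base as ℤ
import Data.Integer.Properties as ℤ
import Data.List.Properties as List
open import Data.Nat.Base as ℕ using (ℕ; zero; suc; z≤n; s≤s)
import Data.Nat.Properties as ℕ
import Data.Nat.Solver
open import Data.Product.Base using (Σ-syntax; ∃-syntax; _×_; _,_; proj₁; proj₂)
open import Data.Rational.Base as ℚ using (ℚ; 0ℚ; 1ℚ)
import Data.Rational.Properties as ℚ
import Data.Rational.Solver
import Data.Rational.Unnormalised.Base as ℚᵘ
import Data.Rational.Unnormalised.Properties as ℚᵘ
open import Data.Sum.Base using (_⊎_; inj₁; inj₂)
open import Data.Unit.Base using (tt)
import Defs as ℝ
open import Function.Base using (_∘_)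
open import Relation.Binary.PropositionalEquality as ≡ using (_≡_; refl)
import Relation.Binary.Reasoning.Preorder as PreorderReasoning

-- The factor 3/2 fits the claimed error: a summable remainder of w is O(1), and undoing the factor
-- makes it O((2/3)ⁿ), where (2/3)ⁿ = γⁿκⁿ. All estimates can therefore be made in the Banach
-- algebra ℓ¹, through norms of initial segments; these are rational and need no convergence, so
-- real numbers enter only with Γ, the limit of approximate poles found at each finite order. The
-- obstacle is that `𝒜` is no contraction there: its diagonal entries aₜzᵗ have norm 3/2 in row 1
-- and 9/8 in row 2, but 9/16 in row 3. So entry 2 of the eigenvector is prescribed freely, and only
-- the rows t ≥ 3 are solved by iteration. Row 2 contains entry 1 with coefficient 1 and thereby
-- determines it, while the rows t ≥ 3 do not contain it. The defect that remains in row 1 is D. The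
-- freedom in entry 2 serves to bring D close to 10⁵(1 - g₀z)(1 - βz) with 0 < β < 1; the second
-- factor is invertible in ℓ¹.

module NormedAlgebras where

  -- Ordered normed algebras, power series and their ℓ¹ norms

  open import Algebra.Bundles using (CommutativeRing)
  open import Algebra.Structures using (IsCommutativeRing)
  open import Data.Maybe.Base using (Maybe; just; nothing)
  open import Relation.Binary.Bundles using (Preorder)
  open import Relation.Nullary.Decidable using (yes; no)

  -- An ordered commutative ℚ-algebra with an absolute value: what ℚ and ℝ
  -- have in common.
  record NormedAlgebra : Set₁ where
    infix  4 _≈_ _≤_
    infixl 6 _+_ _-_
    infixl 7 _*_
    infix  8 -_
    field
      Carrier           : Set
      _≈_ _≤_           : Carrier → Carrier → Set
      _+_ _*_           : Carrier → Carrier → Carrier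
      -_ ∣_∣            : Carrier → Carrier
      0# 1#             : Carrier
      ι                 : ℚ → Carrier
      isCommutativeRing : IsCommutativeRing _≈_ _+_ _*_ -_ 0# 1#
      ≤-reflexive       : ∀ {x y} → x ≈ y → x ≤ y
      ≤-trans           : ∀ {x y z} → x ≤ y → y ≤ z → x ≤ z
      +-mono-≤          : ∀ {x y u v} → x ≤ y → u ≤ v → x + u ≤ y + v
      *-monoˡ-≤         : ∀ {x y z} → 0# ≤ x → y ≤ z → x * y ≤ x * z
      ∣∣-cong           : ∀ {x y} → x ≈ y → ∣ x ∣ ≈ ∣ y ∣
      ∣+∣≤              : ∀ x y → ∣ x + y ∣ ≤ ∣ x ∣ + ∣ y ∣
      ∣*∣               : ∀ x y → ∣ x * y ∣ ≈ ∣ x ∣ * ∣ y ∣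
      ∣-∣               : ∀ x → ∣ - x ∣ ≈ ∣ x ∣
      ≤∣∣               : ∀ x → x ≤ ∣ x ∣
      0≤∣∣              : ∀ x → 0# ≤ ∣ x ∣
      ∣∣-least          : ∀ {x b} → x ≤ b → - x ≤ b → ∣ x ∣ ≤ b
      ι-+               : ∀ p q → ι (p ℚ.+ q) ≈ ι p + ι q
      ι-*               : ∀ p q → ι (p ℚ.* q) ≈ ι p * ι q
      ι-neg             : ∀ p → ι (ℚ.- p) ≈ - ι p
      ι-0               : ι 0ℚ ≈ 0#
      ι-1               : ι 1ℚ ≈ 1#
      ι-mono            : ∀ {p q} → p ℚ.≤ q → ι p ≤ ι q

    _-_ : Carrier → Carrier → Carrier
    x - y = x + - y

  -- The radii r m are elements of the algebra; their rational bounds b m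
  -- only serve to express that they tend to 0.
  record CompleteAlgebra : Set₁ where
    field
      normedAlgebra : NormedAlgebra
    open NormedAlgebra normedAlgebra
    field
      bounded : ∀ x → ∃[ B ] 0ℚ ℚ.≤ B × ∣ x ∣ ≤ ι B
      limit   : ∀ (x r : ℕ → Carrier) (b : ℕ → ℚ) →
                (∀ ε → 0ℚ ℚ.< ε → ∃[ n ] b n ℚ.≤ ε) → (∀ m → r m ≤ ι (b m)) →
                (∀ m n → m ℕ.≤ n → ∣ x n - x m ∣ ≤ r m) → ∃[ L ] (∀ m → ∣ L - x m ∣ ≤ r m)

  module NormedAlgebraProperties (𝔸 : NormedAlgebra) where
    open NormedAlgebra 𝔸 public
    open IsCommutativeRing isCommutativeRing public
      using (+-cong; +-congˡ; +-congʳ; *-cong; *-congˡ; *-congʳ; -‿cong; +-assoc; +-comm;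
             +-identityˡ; +-identityʳ; *-assoc; *-comm; *-identityˡ; *-identityʳ;
             distribˡ; distribʳ; zeroˡ; zeroʳ; -‿inverseˡ; -‿inverseʳ; isEquivalence)
      renaming (refl to ≈-refl; sym to ≈-sym; trans to ≈-trans; reflexive to ≈-reflexive)

    commutativeRing : CommutativeRing _ _
    commutativeRing = record { isCommutativeRing = isCommutativeRing }

    open RingProperties (CommutativeRing.ring commutativeRing) public
      using (-0#≈0#; -‿involutive)

    ≤-refl : ∀ {x} → x ≤ x
    ≤-refl = ≤-reflexive ≈-refl

    ≤-preorder : Preorder _ _ _
    ≤-preorder = record
      { isPreorder = record { isEquivalence = isEquivalence ; reflexive = ≤-reflexive ; trans = ≤-trans } }

    module ≤-Reasoning = PreorderReasoning ≤-preorder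
    open ≤-Reasoning

    private
      ring = ACR.fromCommutativeRing commutativeRing
      ι-morphism : CommutativeRing.rawRing ℚ.+-*-commutativeRing ACR.-Raw-AlmostCommutative⟶ ring
      ι-morphism = record
        { ⟦_⟧ = ι ; +-homo = ι-+ ; *-homo = ι-* ; -‿homo = ι-neg ; 0-homo = ι-0 ; 1-homo = ι-1 }

      ι-≟ : ∀ p q → Maybe (ι p ≈ ι q)
      ι-≟ p q with p ℚ.≟ q
      ... | yes p≡q = just (≈-reflexive (≡.cong ι p≡q))
      ... | no _    = nothing

    module Solver = RingSolver (CommutativeRing.rawRing ℚ.+-*-commutativeRing) ring ι-morphism ι-≟
    open Solver using (solve; _:=_; _:+_; _:*_; _:-_; :-_)

    0≤ι : ∀ {p} → 0ℚ ℚ.≤ p → 0# ≤ ι p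
    0≤ι 0≤p = ≤-trans (≤-reflexive (≈-sym ι-0)) (ι-mono 0≤p)

    +-monoʳ-≤ : ∀ x {y z} → y ≤ z → x + y ≤ x + z
    +-monoʳ-≤ x = +-mono-≤ ≤-refl

    +-monoˡ-≤ : ∀ x {y z} → y ≤ z → y + x ≤ z + x
    +-monoˡ-≤ x p = +-mono-≤ p ≤-refl

    *-monoʳ-≤ : ∀ {x y z} → 0# ≤ x → y ≤ z → y * x ≤ z * x
    *-monoʳ-≤ {x} {y} {z} 0≤x y≤z = begin
      y * x ≈⟨ *-comm y x ⟩
      x * y ≲⟨ *-monoˡ-≤ 0≤x y≤z ⟩
      x * z ≈⟨ *-comm x z ⟩
      z * x ∎

    *-mono-≤ : ∀ {x y u v} → 0# ≤ y → 0# ≤ u → x ≤ y → u ≤ v → x * u ≤ y * v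
    *-mono-≤ 0≤y 0≤u x≤y u≤v = ≤-trans (*-monoʳ-≤ 0≤u x≤y) (*-monoˡ-≤ 0≤y u≤v)

    0≤-+ : ∀ {x y} → 0# ≤ x → 0# ≤ y → 0# ≤ x + y
    0≤-+ p q = ≤-trans (≤-reflexive (≈-sym (+-identityˡ 0#))) (+-mono-≤ p q)

    0≤-* : ∀ {x y} → 0# ≤ x → 0# ≤ y → 0# ≤ x * y
    0≤-* {x} p q = ≤-trans (≤-reflexive (≈-sym (zeroʳ x))) (*-monoˡ-≤ p q)

    x≤x+y : ∀ {x y} → 0# ≤ y → x ≤ x + y
    x≤x+y {x} p = ≤-trans (≤-reflexive (≈-sym (+-identityʳ x))) (+-monoʳ-≤ x p)

    x≤y+x : ∀ {x y} → 0# ≤ y → x ≤ y + x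
    x≤y+x {x} p = ≤-trans (≤-reflexive (≈-sym (+-identityˡ x))) (+-monoˡ-≤ x p)

    0≤y-x : ∀ {x y} → x ≤ y → 0# ≤ y - x
    0≤y-x {x} p = ≤-trans (≤-reflexive (≈-sym (-‿inverseʳ x))) (+-monoˡ-≤ (- x) p)

    -- The equation is meant for the ring solver: it turns an inequality into
    -- a nonnegative combination of hypotheses of the form 0 ≤ b - a.
    ≤-by : ∀ {x y z} → y ≈ x + z → 0# ≤ z → x ≤ y
    ≤-by e p = ≤-trans (x≤x+y p) (≤-reflexive (≈-sym e))

    -‿anti-≤ : ∀ {x y} → x ≤ y → - y ≤ - x
    -‿anti-≤ {x} {y} p = ≤-by (solve 2 (λ x y → :- x := :- y :+ (y :- x)) ≈-refl x y) (0≤y-x p)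

    0≤x⇒∣x∣≈x : ∀ {x} → 0# ≤ x → ∣ x ∣ ≤ x
    0≤x⇒∣x∣≈x {x} p = ∣∣-least ≤-refl (begin
      - x  ≲⟨ -‿anti-≤ p ⟩
      - 0# ≈⟨ -0#≈0# ⟩
      0#   ≲⟨ p ⟩
      x    ∎)

    ∣0∣≤0 : ∣ 0# ∣ ≤ 0#
    ∣0∣≤0 = 0≤x⇒∣x∣≈x ≤-refl

    ∣-∣≤ : ∀ x y → ∣ x - y ∣ ≤ ∣ x ∣ + ∣ y ∣
    ∣-∣≤ x y = begin
      ∣ x - y ∣       ≲⟨ ∣+∣≤ x (- y) ⟩
      ∣ x ∣ + ∣ - y ∣ ≈⟨ +-congˡ (∣-∣ y) ⟩
      ∣ x ∣ + ∣ y ∣   ∎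

    ∣*∣≤ : ∀ {x y b c} → ∣ x ∣ ≤ b → ∣ y ∣ ≤ c → ∣ x * y ∣ ≤ b * c
    ∣*∣≤ {x} {y} p q = ≤-trans (≤-reflexive (∣*∣ x y)) (*-mono-≤ (≤-trans (0≤∣∣ x) p) (0≤∣∣ y) p q)

    Series : Set
    Series = ℕ → Carrier

    infix 4 _≋_
    _≋_ : Series → Series → Set
    f ≋ g = ∀ n → f n ≈ g n

    sum : ℕ → Series → Carrier
    sum zero    f = 0#
    sum (suc n) f = f 0 + sum n (λ i → f (suc i))

    sum-cong : ∀ n {f g} → (∀ i → i ℕ.< n → f i ≈ g i) → sum n f ≈ sum n g
    sum-cong zero    e = ≈-refl
    sum-cong (suc n) e = +-cong (e 0 ℕ.z<s) (sum-cong n λ i i<n → e (suc i) (ℕ.s<s i<n))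

    sum-mono : ∀ n {f g} → (∀ i → i ℕ.< n → f i ≤ g i) → sum n f ≤ sum n g
    sum-mono zero    e = ≤-refl
    sum-mono (suc n) e = +-mono-≤ (e 0 ℕ.z<s) (sum-mono n λ i i<n → e (suc i) (ℕ.s<s i<n))

    sum-nonneg : ∀ n {f} → (∀ i → 0# ≤ f i) → 0# ≤ sum n f
    sum-nonneg zero    p = ≤-refl
    sum-nonneg (suc n) p = 0≤-+ (p 0) (sum-nonneg n λ i → p (suc i))

    +-interchange : ∀ a b c d → (a + b) + (c + d) ≈ (a + c) + (b + d)
    +-interchange = solve 4 (λ a b c d → (a :+ b) :+ (c :+ d) := (a :+ c) :+ (b :+ d)) ≈-refl

    sum-+ : ∀ n f g → sum n (λ i → f i + g i) ≈ sum n f + sum n g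
    sum-+ zero    f g = ≈-sym (+-identityˡ 0#)
    sum-+ (suc n) f g = ≈-trans (+-congˡ (sum-+ n _ _)) (+-interchange _ _ _ _)

    sum-*ˡ : ∀ n x f → sum n (λ i → x * f i) ≈ x * sum n f
    sum-*ˡ zero    x f = ≈-sym (zeroʳ x)
    sum-*ˡ (suc n) x f = ≈-trans (+-congˡ (sum-*ˡ n x _)) (≈-sym (distribˡ x _ _))

    sum-last : ∀ n f → sum (suc n) f ≈ sum n f + f n
    sum-last zero    f = +-comm _ _
    sum-last (suc n) f = ≈-trans (+-congˡ (sum-last n _)) (≈-sym (+-assoc _ _ _))

    sum-split : ∀ m n f → sum (m ℕ.+ n) f ≈ sum m f + sum n (λ i → f (m ℕ.+ i))
    sum-split zero    n f = ≈-sym (+-identityˡ _)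
    sum-split (suc m) n f = ≈-trans (+-congˡ (sum-split m n λ i → f (suc i))) (≈-sym (+-assoc _ _ _))

    sum-mono-ℕ : ∀ {m n f} → (∀ i → 0# ≤ f i) → m ℕ.≤ n → sum m f ≤ sum n f
    sum-mono-ℕ {n = n} p ℕ.z≤n       = sum-nonneg n p
    sum-mono-ℕ         p (ℕ.s≤s m≤n) = +-monoʳ-≤ _ (sum-mono-ℕ (λ i → p (suc i)) m≤n)

    sum-term : ∀ {n f} i → (∀ i → 0# ≤ f i) → i ℕ.< n → f i ≤ sum n f
    sum-term {suc n} zero    p _ = x≤x+y (sum-nonneg n λ i → p (suc i))
    sum-term {suc n} (suc i) p (ℕ.s≤s i<n) =
      ≤-trans (sum-term i (λ i → p (suc i)) i<n) (x≤y+x (p 0))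

    -- Antidiagonal sums: ad n g is the sum of g i j over i + j = n

    ad : ℕ → (ℕ → ℕ → Carrier) → Carrier
    ad zero    g = g 0 0
    ad (suc n) g = g 0 (suc n) + ad n (λ i j → g (suc i) j)

    ad-cong : ∀ n {g h} → (∀ i j → i ℕ.+ j ≡ n → g i j ≈ h i j) → ad n g ≈ ad n h
    ad-cong zero    e = e 0 0 refl
    ad-cong (suc n) e =
      +-cong (e 0 (suc n) refl) (ad-cong n λ i j p → e (suc i) j (≡.cong suc p))

    ad-mono : ∀ n {g h} → (∀ i j → i ℕ.+ j ≡ n → g i j ≤ h i j) → ad n g ≤ ad n h
    ad-mono zero    e = e 0 0 refl
    ad-mono (suc n) e =
      +-mono-≤ (e 0 (suc n) refl) (ad-mono n λ i j p → e (suc i) j (≡.cong suc p))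

    ad-zero : ∀ n {g} → (∀ i j → i ℕ.+ j ≡ n → g i j ≈ 0#) → ad n g ≈ 0#
    ad-zero zero    e = e 0 0 refl
    ad-zero (suc n) e = ≈-trans
      (+-cong (e 0 (suc n) refl) (ad-zero n λ i j p → e (suc i) j (≡.cong suc p))) (+-identityˡ 0#)

    ad-nonneg : ∀ n {g} → (∀ i j → i ℕ.+ j ≡ n → 0# ≤ g i j) → 0# ≤ ad n g
    ad-nonneg zero    p = p 0 0 refl
    ad-nonneg (suc n) p =
      0≤-+ (p 0 (suc n) refl) (ad-nonneg n λ i j e → p (suc i) j (≡.cong suc e))

    ad-+ : ∀ n g h → ad n (λ i j → g i j + h i j) ≈ ad n g + ad n h
    ad-+ zero    g h = ≈-refl
    ad-+ (suc n) g h = ≈-trans (+-congˡ (ad-+ n _ _)) (+-interchange _ _ _ _)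

    ad-*ˡ : ∀ n x g → ad n (λ i j → x * g i j) ≈ x * ad n g
    ad-*ˡ zero    x g = ≈-refl
    ad-*ˡ (suc n) x g = ≈-trans (+-congˡ (ad-*ˡ n x _)) (≈-sym (distribˡ x _ _))

    ad-neg : ∀ n g → ad n (λ i j → - g i j) ≈ - ad n g
    ad-neg zero    g = ≈-refl
    ad-neg (suc n) g = ≈-trans (+-congˡ (ad-neg n _))
      (solve 2 (λ a b → :- a :+ :- b := :- (a :+ b)) ≈-refl _ _)

    ad-last : ∀ n g → ad (suc n) g ≈ ad n (λ i j → g i (suc j)) + g (suc n) 0
    ad-last zero    g = ≈-refl
    ad-last (suc n) g = ≈-trans (+-congˡ (ad-last n λ i j → g (suc i) j)) (≈-sym (+-assoc _ _ _))

    ad-swap : ∀ n g → ad n g ≈ ad n (λ i j → g j i)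
    ad-swap zero    g = ≈-refl
    ad-swap (suc n) g = ≈-trans (ad-last n g) (≈-trans (+-comm _ _) (+-congˡ (ad-swap n _)))

    -- Both sides run over the triples with i + j + k = n.
    ad-assoc : ∀ n (h : ℕ → ℕ → ℕ → Carrier) →
               ad n (λ i m → ad m (λ j k → h i j k)) ≈ ad n (λ m k → ad m (λ i j → h i j k))
    ad-assoc zero    h = ≈-refl
    ad-assoc (suc n) h = begin-equality
      (h 0 0 (suc n) + ad n (λ j k → h 0 (suc j) k)) + ad n (λ i m → ad m (h (suc i)))
        ≈⟨ +-assoc _ _ _ ⟩
      h 0 0 (suc n) + (ad n (λ j k → h 0 (suc j) k) + ad n (λ i m → ad m (h (suc i))))
        ≈⟨ +-congˡ (+-congˡ (ad-assoc n λ i → h (suc i))) ⟩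
      h 0 0 (suc n) + (ad n (λ j k → h 0 (suc j) k) + ad n (λ m k → ad m (λ i j → h (suc i) j k)))
        ≈⟨ +-congˡ (ad-+ n _ _) ⟨
      h 0 0 (suc n) + ad n (λ m k → h 0 (suc m) k + ad m (λ i j → h (suc i) j k)) ∎

    ∣ad∣≤ : ∀ n g → ∣ ad n g ∣ ≤ ad n (λ i j → ∣ g i j ∣)
    ∣ad∣≤ zero    g = ≤-refl
    ∣ad∣≤ (suc n) g = ≤-trans (∣+∣≤ _ _) (+-monoʳ-≤ _ (∣ad∣≤ n _))

    -- The pairs with i + j < n form a triangle inside the square i, j < n. This is what makes the
    -- norms of initial segments submultiplicative.
    sum-ad≤ : ∀ n {g} → (∀ i j → 0# ≤ g i j) →
              sum n (λ m → ad m g) ≤ sum n (λ i → sum n (g i))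
    sum-ad≤ zero        p = ≤-refl
    sum-ad≤ (suc n) {g} p = begin
      g 0 0 + sum n (λ m → g 0 (suc m) + ad m (λ i → g (suc i)))
        ≈⟨ +-congˡ (sum-+ n _ _) ⟩
      g 0 0 + (sum n (λ m → g 0 (suc m)) + sum n (λ m → ad m (λ i → g (suc i))))
        ≈⟨ +-assoc _ _ _ ⟨
      sum (suc n) (g 0) + sum n (λ m → ad m (λ i → g (suc i)))
        ≲⟨ +-monoʳ-≤ _ (≤-trans (sum-ad≤ n λ i → p (suc i))
             (sum-mono n λ i _ → sum-mono-ℕ (p (suc i)) (ℕ.n≤1+n n))) ⟩
      sum (suc n) (g 0) + sum n (λ i → sum (suc n) (g (suc i))) ∎

    infixl 7 _⊛_
    infixl 6 _⊕_
    _⊛_ : Series → Series → Series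
    (f ⊛ g) n = ad n (λ i j → f i * g j)

    _⊕_ : Series → Series → Series
    (f ⊕ g) n = f n + g n

    𝟘 𝟙 : Series
    𝟘 _       = 0#
    𝟙 zero    = 1#
    𝟙 (suc _) = 0#

    infixr 8 _⊛^_
    _⊛^_ : Series → ℕ → Series
    f ⊛^ zero  = 𝟙
    f ⊛^ suc s = f ⊛ f ⊛^ s

    linear : Carrier → Series
    linear x zero          = 1#
    linear x (suc zero)    = - x
    linear x (suc (suc n)) = 0#

    -- The coefficients of 1/(1 - xz). As `geometric x n` is xⁿ, it also serves as the power
    -- function later on.
    geometric : Carrier → Series
    geometric x zero    = 1#
    geometric x (suc n) = x * geometric x n

    ⊛-congˡ : ∀ f {g h} → g ≋ h → f ⊛ g ≋ f ⊛ h
    ⊛-congˡ f e n = ad-cong n λ i j _ → *-congˡ (e j)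

    ⊛-congʳ : ∀ f {g h} → g ≋ h → g ⊛ f ≋ h ⊛ f
    ⊛-congʳ f e n = ad-cong n λ i j _ → *-congʳ (e i)

    ⊛-comm : ∀ f g → f ⊛ g ≋ g ⊛ f
    ⊛-comm f g n = ≈-trans (ad-swap n _) (ad-cong n λ i j _ → *-comm _ _)

    ⊛-assoc : ∀ f g h → (f ⊛ g) ⊛ h ≋ f ⊛ (g ⊛ h)
    ⊛-assoc f g h n = begin-equality
      ad n (λ m k → ad m (λ i j → f i * g j) * h k)
        ≈⟨ ad-cong n (λ m k _ → ≈-trans (*-comm _ _) (≈-sym (ad-*ˡ m (h k) _))) ⟩
      ad n (λ m k → ad m (λ i j → h k * (f i * g j)))
        ≈⟨ ad-assoc n (λ i j k → h k * (f i * g j)) ⟨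
      ad n (λ i m → ad m (λ j k → h k * (f i * g j)))
        ≈⟨ ad-cong n (λ i m _ → ≈-trans
             (ad-cong m λ j k _ → solve 3 (λ a b c → c :* (a :* b) := a :* (b :* c)) ≈-refl _ _ _)
             (ad-*ˡ m (f i) _)) ⟩
      ad n (λ i m → f i * ad m (λ j k → g j * h k)) ∎

    ⊛-distribˡ : ∀ f g h → f ⊛ (g ⊕ h) ≋ (f ⊛ g) ⊕ (f ⊛ h)
    ⊛-distribˡ f g h n = ≈-trans (ad-cong n λ i j _ → distribˡ _ _ _) (ad-+ n _ _)

    ⊛-distribʳ : ∀ f g h → (g ⊕ h) ⊛ f ≋ (g ⊛ f) ⊕ (h ⊛ f)
    ⊛-distribʳ f g h n = ≈-trans (ad-cong n λ i j _ → distribʳ _ _ _) (ad-+ n _ _)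

    ⊛-scaleˡ : ∀ x f g → (λ n → x * f n) ⊛ g ≋ (λ n → x * (f ⊛ g) n)
    ⊛-scaleˡ x f g n = ≈-trans (ad-cong n λ i j _ → *-assoc _ _ _) (ad-*ˡ n x _)

    ⊛-zeroˡ : ∀ g → 𝟘 ⊛ g ≋ 𝟘
    ⊛-zeroˡ g n = ad-zero n λ i j _ → zeroˡ _

    ⊛-identityˡ : ∀ g → 𝟙 ⊛ g ≋ g
    ⊛-identityˡ g zero    = *-identityˡ _
    ⊛-identityˡ g (suc n) =
      ≈-trans (+-cong (*-identityˡ _) (ad-zero n λ i j _ → zeroˡ _)) (+-identityʳ _)

    ⊛-identityʳ : ∀ g → g ⊛ 𝟙 ≋ g
    ⊛-identityʳ g n = ≈-trans (⊛-comm g 𝟙 n) (⊛-identityˡ g n)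

    linear-⊛ : ∀ x f n → (linear x ⊛ f) (suc n) ≈ f (suc n) - x * f n
    linear-⊛ x f zero    = +-cong (*-identityˡ _) (solve 2 (λ a b → :- a :* b := :- (a :* b)) ≈-refl _ _)
    linear-⊛ x f (suc n) = +-cong (*-identityˡ _) (begin-equality
      - x * f (suc n) + ad n (λ i j → 0# * f j)
        ≈⟨ +-cong (solve 2 (λ a b → :- a :* b := :- (a :* b)) ≈-refl _ _) (ad-zero n λ i j _ → zeroˡ _) ⟩
      - (x * f (suc n)) + 0#
        ≈⟨ +-identityʳ _ ⟩
      - (x * f (suc n)) ∎)

    linear-⊛-0 : ∀ x f → (linear x ⊛ f) 0 ≈ f 0
    linear-⊛-0 x f = *-identityˡ (f 0)

    geometric-⊛ : ∀ x f n → (geometric x ⊛ f) (suc n) ≈ f (suc n) + x * (geometric x ⊛ f) n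
    geometric-⊛ x f n =
      +-cong (*-identityˡ _) (≈-trans (ad-cong n λ i j _ → *-assoc _ _ _) (ad-*ˡ n x _))

    linear-⊛-geometric : ∀ x → linear x ⊛ geometric x ≋ 𝟙
    linear-⊛-geometric x zero    = *-identityˡ 1#
    linear-⊛-geometric x (suc n) = ≈-trans (linear-⊛ x (geometric x) n) (-‿inverseʳ _)

    geometric-linear-cancel : ∀ x f → geometric x ⊛ (linear x ⊛ f) ≋ f
    geometric-linear-cancel x f n = begin-equality
      (geometric x ⊛ (linear x ⊛ f)) n ≈⟨ ⊛-assoc (geometric x) (linear x) f n ⟨
      ((geometric x ⊛ linear x) ⊛ f) n ≈⟨ ⊛-congʳ f (λ m → ≈-trans (⊛-comm (geometric x) (linear x) m)
                                            (linear-⊛-geometric x m)) n ⟩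
      (𝟙 ⊛ f) n                        ≈⟨ ⊛-identityˡ f n ⟩
      f n                              ∎

    -- Multiplication by g commutes with h ↦ Σ cₖzᵏ h k. This makes the recursions for the
    -- generating functions linear over power series.
    ⊛-ad : ∀ (c g : Series) (h : ℕ → Series) n → ad n (λ k j → c k * (g ⊛ h k) j)
                                     ≈ (g ⊛ (λ m → ad m (λ k j → c k * h k j))) n
    ⊛-ad c g h n = begin-equality
      ad n (λ k m → c k * ad m (λ i l → g i * h k l))
        ≈⟨ ad-cong n (λ k m _ → ad-*ˡ m (c k) _) ⟨
      ad n (λ k m → ad m (λ i l → c k * (g i * h k l)))
        ≈⟨ ad-assoc n (λ k i l → c k * (g i * h k l)) ⟩
      ad n (λ m l → ad m (λ k i → c k * (g i * h k l)))
        ≈⟨ ad-cong n (λ m l _ → ≈-trans (ad-swap m _) (ad-cong m λ i k _ →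
             solve 3 (λ a b c → b :* (a :* c) := a :* (b :* c)) ≈-refl (g i) (c k) (h k l))) ⟩
      ad n (λ m l → ad m (λ i k → g i * (c k * h k l)))
        ≈⟨ ad-assoc n (λ i k l → g i * (c k * h k l)) ⟨
      ad n (λ i m → ad m (λ k l → g i * (c k * h k l)))
        ≈⟨ ad-cong n (λ i m _ → ad-*ˡ m (g i) _) ⟩
      ad n (λ i m → g i * ad m (λ k l → c k * h k l)) ∎

    ‖_‖ : Series → ℕ → Carrier
    ‖ f ‖ n = sum n (λ i → ∣ f i ∣)

    ‖‖-nonneg : ∀ f n → 0# ≤ ‖ f ‖ n
    ‖‖-nonneg f n = sum-nonneg n λ i → 0≤∣∣ (f i)

    ‖‖-mono-ℕ : ∀ f {m n} → m ℕ.≤ n → ‖ f ‖ m ≤ ‖ f ‖ n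
    ‖‖-mono-ℕ f = sum-mono-ℕ λ i → 0≤∣∣ (f i)

    ‖‖-cong : ∀ n {f g} → (∀ i → i ℕ.< n → f i ≈ g i) → ‖ f ‖ n ≈ ‖ g ‖ n
    ‖‖-cong n e = sum-cong n λ i i<n → ∣∣-cong (e i i<n)

    ‖⊕‖≤ : ∀ f g n → ‖ f ⊕ g ‖ n ≤ ‖ f ‖ n + ‖ g ‖ n
    ‖⊕‖≤ f g n = ≤-trans (sum-mono n λ i _ → ∣+∣≤ _ _) (≤-reflexive (sum-+ n _ _))

    ‖scale‖ : ∀ x f n → ‖ (λ i → x * f i) ‖ n ≈ ∣ x ∣ * ‖ f ‖ n
    ‖scale‖ x f n = ≈-trans (sum-cong n λ i _ → ∣*∣ x (f i)) (sum-*ˡ n ∣ x ∣ _)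

    ‖ad‖≤ : ∀ g n → ‖ (λ m → ad m g) ‖ n ≤ sum n (λ i → ‖ g i ‖ n)
    ‖ad‖≤ g n = ≤-trans (sum-mono n λ m _ → ∣ad∣≤ m g) (sum-ad≤ n λ i j → 0≤∣∣ (g i j))

    -- Holds at every finite order n, so that ℓ¹ estimates of products and quotients never involve
    -- an infinite sum.
    ‖⊛‖≤ : ∀ f g n → ‖ f ⊛ g ‖ n ≤ ‖ f ‖ n * ‖ g ‖ n
    ‖⊛‖≤ f g n = begin
      ‖ f ⊛ g ‖ n                     ≲⟨ ‖ad‖≤ (λ i j → f i * g j) n ⟩
      sum n (λ i → ‖ (λ j → f i * g j) ‖ n)
        ≈⟨ sum-cong n (λ i _ → ≈-trans (‖scale‖ (f i) g n) (*-comm _ _)) ⟩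
      sum n (λ i → ‖ g ‖ n * ∣ f i ∣) ≈⟨ sum-*ˡ n (‖ g ‖ n) _ ⟩
      ‖ g ‖ n * ‖ f ‖ n               ≈⟨ *-comm _ _ ⟩
      ‖ f ‖ n * ‖ g ‖ n               ∎

    -- Solving e (n + 1) = g e n + k n backwards contracts by the factor 1/g.
    backward : ∀ {g} (e k : Series) → 0# ≤ g → (∀ n → e (suc n) ≈ g * e n + k n) →
               ∀ n → g * ‖ e ‖ n ≤ ‖ e ‖ n + (∣ e n ∣ + ‖ k ‖ n)
    backward {g} e k 0≤g step n = begin
      g * ‖ e ‖ n
        ≈⟨ sum-*ˡ n g _ ⟨
      sum n (λ i → g * ∣ e i ∣)
        ≲⟨ sum-mono n (λ i _ → term i) ⟩
      sum n (λ i → ∣ e (suc i) ∣ + ∣ k i ∣)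
        ≈⟨ sum-+ n _ _ ⟩
      sum n (λ i → ∣ e (suc i) ∣) + ‖ k ‖ n
        ≲⟨ +-monoˡ-≤ _ (x≤y+x (0≤∣∣ (e 0))) ⟩
      ‖ e ‖ (suc n) + ‖ k ‖ n
        ≈⟨ ≈-trans (+-congʳ (sum-last n _)) (+-assoc _ _ _) ⟩
      ‖ e ‖ n + (∣ e n ∣ + ‖ k ‖ n) ∎
      where
      term : ∀ i → g * ∣ e i ∣ ≤ ∣ e (suc i) ∣ + ∣ k i ∣
      term i = begin
        g * ∣ e i ∣             ≲⟨ *-monoʳ-≤ (0≤∣∣ (e i)) (≤∣∣ g) ⟩
        ∣ g ∣ * ∣ e i ∣         ≈⟨ ∣*∣ g (e i) ⟨
        ∣ g * e i ∣             ≈⟨ ∣∣-cong (≈-trans (solve 2 (λ x y → x := (x :+ y) :- y) ≈-refl (g * e i) (k i))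
                                                    (+-congʳ (≈-sym (step i)))) ⟩
        ∣ e (suc i) - k i ∣     ≲⟨ ∣-∣≤ (e (suc i)) (k i) ⟩
        ∣ e (suc i) ∣ + ∣ k i ∣ ∎

  private
    ∣∣-least-ℚ : ∀ {p b} → p ℚ.≤ b → ℚ.- p ℚ.≤ b → ℚ.∣ p ∣ ℚ.≤ b
    ∣∣-least-ℚ {p} p≤b -p≤b with ℚ.∣p∣≡p∨∣p∣≡-p p
    ... | inj₁ e = ≡.subst (ℚ._≤ _) (≡.sym e) p≤b
    ... | inj₂ e = ≡.subst (ℚ._≤ _) (≡.sym e) -p≤b

    p≤∣p∣-ℚ : ∀ p → p ℚ.≤ ℚ.∣ p ∣
    p≤∣p∣-ℚ p with ℚ.≤-total 0ℚ p
    ... | inj₁ 0≤p = ℚ.≤-reflexive (≡.sym (ℚ.0≤p⇒∣p∣≡p 0≤p))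
    ... | inj₂ p≤0 = ℚ.≤-trans p≤0 (ℚ.0≤∣p∣ p)

  ℚ-normedAlgebra : NormedAlgebra
  ℚ-normedAlgebra = record
    { Carrier = ℚ ; _≈_ = _≡_ ; _≤_ = ℚ._≤_ ; _+_ = ℚ._+_ ; _*_ = ℚ._*_ ; -_ = ℚ.-_ ; ∣_∣ = ℚ.∣_∣
    ; 0# = 0ℚ ; 1# = 1ℚ ; ι = λ p → p
    ; isCommutativeRing = ℚ.+-*-isCommutativeRing
    ; ≤-reflexive = ℚ.≤-reflexive
    ; ≤-trans = ℚ.≤-trans
    ; +-mono-≤ = ℚ.+-mono-≤
    ; *-monoˡ-≤ = λ {x} 0≤x → ℚ.*-monoˡ-≤-nonNeg x {{ℚ.nonNegative 0≤x}}
    ; ∣∣-cong = ≡.cong ℚ.∣_∣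
    ; ∣+∣≤ = ℚ.∣p+q∣≤∣p∣+∣q∣
    ; ∣*∣ = ℚ.∣p*q∣≡∣p∣*∣q∣
    ; ∣-∣ = ℚ.∣-p∣≡∣p∣
    ; ≤∣∣ = p≤∣p∣-ℚ
    ; 0≤∣∣ = ℚ.0≤∣p∣
    ; ∣∣-least = ∣∣-least-ℚ
    ; ι-+ = λ _ _ → refl ; ι-* = λ _ _ → refl ; ι-neg = λ _ → refl ; ι-0 = refl ; ι-1 = refl
    ; ι-mono = λ p≤q → p≤q
    }

-- Recursions for the number of representations

module Representations where

  open import Defs using (powerSum; tuples; 𝒰₂)
  open import Data.List.Base using (List; []; _∷_; _++_; map; filter; length; upTo; applyUpTo; cartesianProductWith)
  open import Data.Nat.Base
  open import Data.Nat.Properties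
  open import Data.Nat.Solver using (module +-*-Solver)
  open import Data.Vec.Base using (Vec; []; _∷_)
  open import Function.Base using (id)
  open import Relation.Binary.PropositionalEquality
  open import Relation.Nullary.Decidable using (Dec; yes; no)

  module Shift {A : Set} (0A : A) where

    -- Multiplication by qᵏ, if x is read as the coefficients of x(q). The entries are kept abstract
    -- because counts, rational numbers, power series and polynomials all get shifted.
    sh : ℕ → (ℕ → A) → ℕ → A
    sh zero    x ℓ       = x ℓ
    sh (suc k) x zero    = 0A
    sh (suc k) x (suc ℓ) = sh k x ℓ

    -- The coefficients of x(q²), given those of x(q).
    dil : (ℕ → A) → ℕ → A
    dil x zero          = x 0
    dil x (suc zero)    = 0A
    dil x (suc (suc m)) = dil (x ∘ suc) m

    sh-+ : ∀ k x ℓ → sh k x (k + ℓ) ≡ x ℓ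
    sh-+ zero    x ℓ = refl
    sh-+ (suc k) x ℓ = sh-+ k x ℓ

    sh-< : ∀ {k} x {ℓ} → ℓ < k → sh k x ℓ ≡ 0A
    sh-< {suc k} x {zero}  _         = refl
    sh-< {suc k} x {suc ℓ} (s≤s ℓ<k) = sh-< x ℓ<k

    sh-cong : ∀ k {x y} ℓ → (∀ m → m ≤ ℓ → x m ≡ y m) → sh k x ℓ ≡ sh k y ℓ
    sh-cong zero    ℓ       e = e ℓ ≤-refl
    sh-cong (suc k) zero    e = refl
    sh-cong (suc k) (suc ℓ) e = sh-cong k ℓ λ m m≤ℓ → e m (m≤n⇒m≤1+n m≤ℓ)

    -- An entry of `dil x` is either the default or some `x m` with 2m = s; arguing this way avoids
    -- any division by 2.
    dil-elim : (Q : A → Set) → Q 0A → ∀ x s → (∀ m → m + m ≡ s → Q (x m)) → Q (dil x s)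
    dil-elim Q q x zero          h = h 0 refl
    dil-elim Q q x (suc zero)    h = q
    dil-elim Q q x (suc (suc s)) h = dil-elim Q q (x ∘ suc) s λ m e →
      h (suc m) (cong suc (trans (+-suc m m) (cong suc e)))

    sh-sh : ∀ k m x ℓ → sh k (sh m x) ℓ ≡ sh (k + m) x ℓ
    sh-sh zero    m x ℓ       = refl
    sh-sh (suc k) m x zero    = refl
    sh-sh (suc k) m x (suc ℓ) = sh-sh k m x ℓ

    sh-comm : ∀ k m x ℓ → sh k (sh m x) ℓ ≡ sh m (sh k x) ℓ
    sh-comm k m x ℓ = trans (sh-sh k m x ℓ)
      (trans (cong (λ i → sh i x ℓ) (+-comm k m)) (sym (sh-sh m k x ℓ)))

    dil-cong : ∀ {x y} ℓ → (∀ m → m ≤ ℓ → x m ≡ y m) → dil x ℓ ≡ dil y ℓ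
    dil-cong zero          e = e 0 z≤n
    dil-cong (suc zero)    e = refl
    dil-cong (suc (suc ℓ)) e = dil-cong ℓ λ m m≤ℓ → e (suc m) (s≤s (m≤n⇒m≤1+n m≤ℓ))

    dil-double : ∀ x m → dil x (m + m) ≡ x m
    dil-double x zero    = refl
    dil-double x (suc m) = trans (cong (dil x ∘ suc) (+-suc m m)) (dil-double (x ∘ suc) m)

    dil-odd : ∀ x m → dil x (suc (m + m)) ≡ 0A
    dil-odd x zero    = refl
    dil-odd x (suc m) = trans (cong (dil (x ∘ suc)) (+-suc m m)) (dil-odd (x ∘ suc) m)

    dil-+ : ∀ x p m → dil x (p + (m + m)) ≡ dil (λ q → x (q + m)) p
    dil-+ x zero          m = dil-double x m
    dil-+ x (suc zero)    m = dil-odd x m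
    dil-+ x (suc (suc p)) m = dil-+ (x ∘ suc) p m

    -- Both sides are the coefficients of q²ᵏ x(q²).
    dil-sh : ∀ k x ℓ → sh (k + k) (dil x) ℓ ≡ dil (sh k x) ℓ
    dil-sh zero    x ℓ             = refl
    dil-sh (suc k) x zero          = refl
    dil-sh (suc k) x (suc zero)    = trans (cong (λ i → sh i (dil x) 0) (+-suc k k)) refl
    dil-sh (suc k) x (suc (suc ℓ)) =
      trans (cong (λ i → sh i (dil x) (suc ℓ)) (+-suc k k)) (dil-sh k x ℓ)

    -- Read from the top 2M downwards, the sequence dil x is the dilation of x
    -- read from M downwards.
    sh-dil-double : ∀ s x M → sh s (dil x) (M + M) ≡ dil (λ t → sh t x M) s
    sh-dil-double zero          x M       = dil-double x M
    sh-dil-double (suc zero)    x zero    = refl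
    sh-dil-double (suc zero)    x (suc M) = trans (cong (dil x) (+-suc M M)) (dil-odd x M)
    sh-dil-double (suc (suc s)) x zero    = sym (dil-const s)
      where
      dil-const : ∀ s → dil (λ _ → 0A) s ≡ 0A
      dil-const zero          = refl
      dil-const (suc zero)    = refl
      dil-const (suc (suc s)) = dil-const s
    sh-dil-double (suc (suc s)) x (suc M) =
      trans (cong (sh (suc s) (dil x)) (+-suc M M)) (sh-dil-double s x M)

  module _ {A B : Set} {0A : A} {0B : B} (P : A → B → Set) (P-0 : P 0A 0B) where
    open Shift

    -- A relation between two types of entries that holds for the defaults survives shifts and,
    -- below, dilations. Counts are compared with series in this way, and integer polynomials with
    -- the series they denote.
    sh-rel : ∀ k {x y} ℓ → (∀ m → m ≤ ℓ → P (x m) (y m)) → P (sh 0A k x ℓ) (sh 0B k y ℓ)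
    sh-rel zero    ℓ       h = h ℓ ≤-refl
    sh-rel (suc k) zero    h = P-0
    sh-rel (suc k) (suc ℓ) h = sh-rel k ℓ λ m m≤ℓ → h m (m≤n⇒m≤1+n m≤ℓ)

    dil-rel : ∀ {x y} ℓ → (∀ m → m + m ≤ ℓ → P (x m) (y m)) → P (dil 0A x ℓ) (dil 0B y ℓ)
    dil-rel zero          h = h 0 z≤n
    dil-rel (suc zero)    h = P-0
    dil-rel (suc (suc ℓ)) h = dil-rel ℓ λ m m+m≤ℓ →
      h (suc m) (s≤s (≤-trans (≤-reflexive (+-suc m m)) (s≤s m+m≤ℓ)))

  open Shift 0

  -- Counting by the first summand

  -- The sum of x (ℓ - 2ⁱe) over i < B with 2ⁱe ≤ ℓ.
  peel : ℕ → ℕ → (ℕ → ℕ) → ℕ → ℕ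
  peel zero    e x ℓ = 0
  peel (suc B) e x ℓ = sh e x ℓ + peel B (e + e) x ℓ

  -- Recursion on the first summand 2ⁱ. Restricting to i < ℓ loses nothing, because i < 2ⁱ ≤ ℓ.
  U : ℕ → ℕ → ℕ
  U zero    zero    = 1
  U zero    (suc _) = 0
  U (suc n) ℓ       = peel ℓ 1 (U n) ℓ

  peel-cong : ∀ B e {x y} ℓ → (∀ m → m ≤ ℓ → x m ≡ y m) → peel B e x ℓ ≡ peel B e y ℓ
  peel-cong zero    e ℓ h = refl
  peel-cong (suc B) e ℓ h = cong₂ _+_ (sh-cong e ℓ h) (peel-cong B (e + e) ℓ h)

  -- Each doubling raises e by at least 1, so after B doublings it exceeds ℓ and the additional term
  -- vanishes.
  peel-suc : ∀ B e x ℓ → 0 < e → ℓ < e + B → peel (suc B) e x ℓ ≡ peel B e x ℓ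
  peel-suc zero    e x ℓ 0<e ℓ<e = trans (+-identityʳ _) (sh-< x (subst (ℓ <_) (+-identityʳ e) ℓ<e))
  peel-suc (suc B) e x ℓ 0<e ℓ<e+B = cong (sh e x ℓ +_)
    (peel-suc B (e + e) x ℓ (≤-trans 0<e (m≤m+n e e)) (begin-strict
      ℓ           <⟨ ℓ<e+B ⟩
      e + suc B   ≤⟨ +-monoʳ-≤ e (+-monoˡ-≤ B 0<e) ⟩
      e + (e + B) ≡⟨ +-assoc e e B ⟨
      e + e + B   ∎))
    where open ≤-Reasoning

  peel-stable : ∀ {B} x {ℓ} → ℓ ≤ B → peel B 1 x ℓ ≡ peel ℓ 1 x ℓ
  peel-stable x {ℓ} ℓ≤B = go (≤⇒≤′ ℓ≤B)
    where
    go : ∀ {B} → ℓ ≤′ B → peel B 1 x ℓ ≡ peel ℓ 1 x ℓ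
    go ≤′-refl       = refl
    go (≤′-step ℓ≤B) = trans (peel-suc _ 1 x ℓ z<s (s≤s (≤′⇒≤ ℓ≤B))) (go ℓ≤B)

  private
    count : ∀ {n} → ℕ → List (Vec ℕ n) → ℕ
    count ℓ ys = length (filter (λ a → powerSum a ≟ ℓ) ys)

    count-step : ∀ {n} ℓ (a : Vec ℕ n) ys → powerSum a ≡ ℓ → count ℓ (a ∷ ys) ≡ suc (count ℓ ys)
    count-step ℓ a ys e = cong length (List.filter-accept (λ a → powerSum a ≟ ℓ) {x = a} {xs = ys} e)

    count-skip : ∀ {n} ℓ (a : Vec ℕ n) ys → powerSum a ≢ ℓ → count ℓ (a ∷ ys) ≡ count ℓ ys
    count-skip ℓ a ys ¬e = cong length (List.filter-reject (λ a → powerSum a ≟ ℓ) {x = a} {xs = ys} ¬e)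

    count-map-≤ : ∀ {n} x ℓ (ys : List (Vec ℕ n)) → count (2 ^ x + ℓ) (map (x ∷_) ys) ≡ count ℓ ys
    count-map-≤ x ℓ []       = refl
    count-map-≤ x ℓ (a ∷ ys) = by-cases (powerSum a ≟ ℓ)
      where
      by-cases : Dec (powerSum a ≡ ℓ) → count (2 ^ x + ℓ) (map (x ∷_) (a ∷ ys)) ≡ count ℓ (a ∷ ys)
      by-cases (yes e) = trans (count-step (2 ^ x + ℓ) (x ∷ a) (map (x ∷_) ys) (cong (2 ^ x +_) e))
        (trans (cong suc (count-map-≤ x ℓ ys)) (sym (count-step ℓ a ys e)))
      by-cases (no ¬e) =
        trans (count-skip (2 ^ x + ℓ) (x ∷ a) (map (x ∷_) ys) (¬e ∘ +-cancelˡ-≡ (2 ^ x) _ _))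
          (trans (count-map-≤ x ℓ ys) (sym (count-skip ℓ a ys ¬e)))

    count-map-> : ∀ {n} x ℓ (ys : List (Vec ℕ n)) → ℓ < 2 ^ x → count ℓ (map (x ∷_) ys) ≡ 0
    count-map-> x ℓ []       _ = refl
    count-map-> x ℓ (a ∷ ys) p =
      trans (count-skip ℓ (x ∷ a) (map (x ∷_) ys) λ e →
               <-irrefl refl (<-≤-trans p (≤-trans (m≤m+n (2 ^ x) (powerSum a)) (≤-reflexive e))))
            (count-map-> x ℓ ys p)

    count-map : ∀ {n} x ℓ (ys : List (Vec ℕ n)) →
                count ℓ (map (x ∷_) ys) ≡ sh (2 ^ x) (λ m → count m ys) ℓ
    count-map x ℓ ys with 2 ^ x ≤? ℓ
    ... | no p  = trans (count-map-> x ℓ ys (≰⇒> p)) (sym (sh-< _ (≰⇒> p)))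
    ... | yes p = begin
      count ℓ (map (x ∷_) ys)
        ≡⟨ cong (λ m → count m (map (x ∷_) ys)) (m+[n∸m]≡n p) ⟨
      count (2 ^ x + (ℓ ∸ 2 ^ x)) (map (x ∷_) ys)
        ≡⟨ count-map-≤ x (ℓ ∸ 2 ^ x) ys ⟩
      count (ℓ ∸ 2 ^ x) ys
        ≡⟨ sh-+ (2 ^ x) (λ m → count m ys) (ℓ ∸ 2 ^ x) ⟨
      sh (2 ^ x) (λ m → count m ys) (2 ^ x + (ℓ ∸ 2 ^ x))
        ≡⟨ cong (sh (2 ^ x) (λ m → count m ys)) (m+[n∸m]≡n p) ⟩
      sh (2 ^ x) (λ m → count m ys) ℓ ∎
      where open ≡-Reasoning

    count-++ : ∀ {n} ℓ (xs ys : List (Vec ℕ n)) → count ℓ (xs ++ ys) ≡ count ℓ xs + count ℓ ys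
    count-++ ℓ xs ys = trans (cong length (List.filter-++ (λ a → powerSum a ≟ ℓ) xs ys))
                             (List.length-++ (filter (λ a → powerSum a ≟ ℓ) xs))

    -- The exponents are given by a general f because the tail of `applyUpTo` composes it with
    -- `suc`; the equation for 2^(f i) ties them to the doublings of e in `peel`.
    count-product : ∀ {n} ℓ B e (f : ℕ → ℕ) (ys : List (Vec ℕ n)) → (∀ i → 2 ^ f i ≡ e * 2 ^ i) →
      count ℓ (cartesianProductWith _∷_ (applyUpTo f B) ys) ≡ peel B e (λ m → count m ys) ℓ
    count-product ℓ zero    e f ys h = refl
    count-product ℓ (suc B) e f ys h = trans
      (count-++ ℓ (map (f 0 ∷_) ys) _)
      (cong₂ _+_
        (trans (count-map (f 0) ℓ ys)
               (cong (λ k → sh k (λ m → count m ys) ℓ) (trans (h 0) (*-identityʳ e))))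
        (count-product ℓ B (e + e) (f ∘ suc) ys λ i → trans (h (suc i))
          (solve 2 (λ e p → e :* (p :+ (p :+ con 0)) := (e :+ e) :* p) refl e (2 ^ i))))
      where open +-*-Solver

    -- The bound B on the exponents stays fixed while ℓ decreases, so `peel-stable` has to adjust it
    -- for every ℓ that occurs.
    count-tuples : ∀ B n ℓ → ℓ ≤ B → count ℓ (tuples (upTo B) n) ≡ U n ℓ
    count-tuples B zero    zero    _ = refl
    count-tuples B zero    (suc ℓ) _ = refl
    count-tuples B (suc n) ℓ     ℓ≤B = begin
      count ℓ (cartesianProductWith _∷_ (upTo B) (tuples (upTo B) n))
        ≡⟨ count-product ℓ B 1 id (tuples (upTo B) n) (λ i → sym (+-identityʳ (2 ^ i))) ⟩
      peel B 1 (λ m → count m (tuples (upTo B) n)) ℓ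
        ≡⟨ peel-stable _ ℓ≤B ⟩
      peel ℓ 1 (λ m → count m (tuples (upTo B) n)) ℓ
        ≡⟨ peel-cong ℓ 1 ℓ (λ m m≤ℓ → count-tuples B n m (≤-trans m≤ℓ ℓ≤B)) ⟩
      U (suc n) ℓ ∎
      where open ≡-Reasoning

  𝒰₂≡U : ∀ ℓ n → 𝒰₂ ℓ n ≡ U n ℓ
  𝒰₂≡U ℓ n = count-tuples ℓ n ℓ ≤-refl

  -- Counting by the number of summands 1

  -- Σ C(n, k) g k (n - k), unfolded by Pascal's rule so that no binomial coefficient appears.
  binomialSum : ℕ → (ℕ → ℕ → ℕ) → ℕ
  binomialSum zero    g = g 0 0
  binomialSum (suc n) g = binomialSum n (λ k j → g (suc k) j) + binomialSum n (λ k j → g k (suc j))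

  private
    +-interchange : ∀ a b c d → (a + b) + (c + d) ≡ (a + c) + (b + d)
    +-interchange = solve 4 (λ a b c d → (a :+ b) :+ (c :+ d) := (a :+ c) :+ (b :+ d)) refl
      where open +-*-Solver

  binomialSum-cong : ∀ n {g h} → (∀ k j → g k j ≡ h k j) → binomialSum n g ≡ binomialSum n h
  binomialSum-cong zero    e = e 0 0
  binomialSum-cong (suc n) e = cong₂ _+_ (binomialSum-cong n λ k j → e (suc k) j)
                                         (binomialSum-cong n λ k j → e k (suc j))

  binomialSum-+ : ∀ n g h → binomialSum n (λ k j → g k j + h k j) ≡ binomialSum n g + binomialSum n h
  binomialSum-+ zero    g h = refl
  binomialSum-+ (suc n) g h =
    trans (cong₂ _+_ (binomialSum-+ n _ _) (binomialSum-+ n _ _))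
          (+-interchange (binomialSum n λ k j → g (suc k) j) _ _ _)

  sh-additive : ∀ k x y ℓ → sh k (λ m → x m + y m) ℓ ≡ sh k x ℓ + sh k y ℓ
  sh-additive zero    x y ℓ       = refl
  sh-additive (suc k) x y zero    = refl
  sh-additive (suc k) x y (suc ℓ) = sh-additive k x y ℓ

  dil-additive : ∀ x y ℓ → dil (λ m → x m + y m) ℓ ≡ dil x ℓ + dil y ℓ
  dil-additive x y zero          = refl
  dil-additive x y (suc zero)    = refl
  dil-additive x y (suc (suc ℓ)) = dil-additive (x ∘ suc) (y ∘ suc) ℓ

  sh-binomialSum : ∀ k n (g : ℕ → ℕ → ℕ → ℕ) ℓ →
    sh k (λ m → binomialSum n (λ i j → g i j m)) ℓ ≡ binomialSum n (λ i j → sh k (g i j) ℓ)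
  sh-binomialSum k zero    g ℓ = refl
  sh-binomialSum k (suc n) g ℓ =
    trans (sh-additive k (λ m → binomialSum n (λ i j → g (suc i) j m)) _ ℓ)
          (cong₂ _+_ (sh-binomialSum k n _ ℓ) (sh-binomialSum k n _ ℓ))

  peel-binomialSum : ∀ B e n (g : ℕ → ℕ → ℕ → ℕ) ℓ →
    peel B e (λ m → binomialSum n (λ i j → g i j m)) ℓ ≡ binomialSum n (λ i j → peel B e (g i j) ℓ)
  peel-binomialSum zero    e n g ℓ = sym (zeros n)
    where
    zeros : ∀ n → binomialSum n (λ _ _ → 0) ≡ 0
    zeros zero    = refl
    zeros (suc n) = cong₂ _+_ (zeros n) (zeros n)
  peel-binomialSum (suc B) e n g ℓ =
    trans (cong₂ _+_ (sh-binomialSum e n g ℓ) (peel-binomialSum B (e + e) n g ℓ))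
          (sym (binomialSum-+ n _ _))

  peel-sh : ∀ B e k x ℓ → peel B e (sh k x) ℓ ≡ sh k (peel B e x) ℓ
  peel-sh zero    e k x ℓ = sym (sh-zero k ℓ)
    where
    sh-zero : ∀ k ℓ → sh k (λ _ → 0) ℓ ≡ 0
    sh-zero zero    ℓ       = refl
    sh-zero (suc k) zero    = refl
    sh-zero (suc k) (suc ℓ) = sh-zero k ℓ
  peel-sh (suc B) e k x ℓ =
    trans (cong₂ _+_ (sh-comm e k x ℓ) (peel-sh B (e + e) k x ℓ)) (sym (sh-additive k _ _ ℓ))

  -- Subtracting 2·2ⁱe before halving is subtracting 2ⁱe after it.
  peel-dil : ∀ B e x ℓ → peel B (e + e) (dil x) ℓ ≡ dil (peel B e x) ℓ
  peel-dil zero    e x ℓ = sym (dil-zero ℓ)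
    where
    dil-zero : ∀ ℓ → dil (λ _ → 0) ℓ ≡ 0
    dil-zero zero          = refl
    dil-zero (suc zero)    = refl
    dil-zero (suc (suc ℓ)) = dil-zero ℓ
  peel-dil (suc B) e x ℓ =
    trans (cong₂ _+_ (dil-sh e x ℓ) (peel-dil B (e + e) x ℓ)) (sym (dil-additive _ _ ℓ))

  -- Choose which k of the n summands are 1; the other summands are even, and halving them gives a
  -- representation of (ℓ - k)/2. The proof is an induction on n in which the first summand is
  -- either 1, the first term of `peel`, or even, the remaining terms.
  U-ones : ∀ n ℓ → U n ℓ ≡ binomialSum n (λ k j → sh k (dil (U j)) ℓ)
  U-ones zero    zero          = refl
  U-ones zero    (suc zero)    = refl
  U-ones zero    (suc (suc ℓ)) = sym (zeros ℓ)
    where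
    zeros : ∀ ℓ → dil (λ m → U 0 (suc m)) ℓ ≡ 0
    zeros zero          = refl
    zeros (suc zero)    = refl
    zeros (suc (suc ℓ)) = dil-zero ℓ
      where
      dil-zero : ∀ ℓ → dil (λ _ → 0) ℓ ≡ 0
      dil-zero zero          = refl
      dil-zero (suc zero)    = refl
      dil-zero (suc (suc ℓ)) = dil-zero ℓ
  U-ones (suc n) ℓ = begin
    peel ℓ 1 (U n) ℓ
      -- One more term than necessary, so that ℓ terms are left once the summand 1 is split off.
      ≡⟨ peel-stable (U n) (n≤1+n ℓ) ⟨
    peel (suc ℓ) 1 (U n) ℓ
      ≡⟨ peel-cong (suc ℓ) 1 ℓ (λ m _ → U-ones n m) ⟩
    peel (suc ℓ) 1 (λ m → binomialSum n (λ k j → sh k (dil (U j)) m)) ℓ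
      ≡⟨ peel-binomialSum (suc ℓ) 1 n (λ k j → sh k (dil (U j))) ℓ ⟩
    binomialSum n (λ k j → peel (suc ℓ) 1 (sh k (dil (U j))) ℓ)
      ≡⟨ binomialSum-cong n step ⟩
    binomialSum n (λ k j → sh (suc k) (dil (U j)) ℓ + sh k (dil (U (suc j))) ℓ)
      ≡⟨ binomialSum-+ n _ _ ⟩
    binomialSum (suc n) (λ k j → sh k (dil (U j)) ℓ) ∎
    where
    open ≡-Reasoning
    step : ∀ k j → peel (suc ℓ) 1 (sh k (dil (U j))) ℓ
                 ≡ sh (suc k) (dil (U j)) ℓ + sh k (dil (U (suc j))) ℓ
    step k j = begin
      peel (suc ℓ) 1 (sh k (dil (U j))) ℓ
        ≡⟨ peel-sh (suc ℓ) 1 k (dil (U j)) ℓ ⟩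
      sh k (peel (suc ℓ) 1 (dil (U j))) ℓ
        ≡⟨ sh-cong k ℓ (λ m m≤ℓ → cong (sh 1 (dil (U j)) m +_) (trans (peel-dil ℓ 1 (U j) m)
             (dil-cong m λ i i≤m → peel-stable (U j) (≤-trans i≤m m≤ℓ)))) ⟩
      sh k (λ m → sh 1 (dil (U j)) m + dil (U (suc j)) m) ℓ
        ≡⟨ sh-additive k (sh 1 (dil (U j))) _ ℓ ⟩
      sh k (sh 1 (dil (U j))) ℓ + sh k (dil (U (suc j))) ℓ
        ≡⟨ cong (_+ sh k (dil (U (suc j))) ℓ)
                (trans (sh-sh k 1 (dil (U j)) ℓ) (cong (λ i → sh i (dil (U j)) ℓ) (+-comm k 1))) ⟩
      sh (suc k) (dil (U j)) ℓ + sh k (dil (U (suc j))) ℓ ∎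

-- Rational arithmetic and the weighted generating functions

module Weights where

  open import Data.Integer.Base using (ℤ; +_)
  open import Data.Nat.Base using (NonZero)
  open import Data.Rational.Base using (_/_; fromℚᵘ; toℚᵘ)
  open import Data.Rational.Unnormalised.Base using (ℚᵘ; mkℚᵘ; *≡*; *≤*)
  open NormedAlgebras
  open Representations
  open import Relation.Binary.PropositionalEquality

  fromℚᵘ-+ : ∀ p q → fromℚᵘ (p ℚᵘ.+ q) ≡ fromℚᵘ p ℚ.+ fromℚᵘ q
  fromℚᵘ-+ p q = trans
    (ℚ.fromℚᵘ-cong (ℚᵘ.≃-sym (ℚᵘ.≃-trans (ℚ.toℚᵘ-homo-+ (fromℚᵘ p) (fromℚᵘ q))
      (ℚᵘ.+-cong (ℚ.toℚᵘ-fromℚᵘ p) (ℚ.toℚᵘ-fromℚᵘ q)))))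
    (ℚ.fromℚᵘ-toℚᵘ _)

  fromℚᵘ-* : ∀ p q → fromℚᵘ (p ℚᵘ.* q) ≡ fromℚᵘ p ℚ.* fromℚᵘ q
  fromℚᵘ-* p q = trans
    (ℚ.fromℚᵘ-cong (ℚᵘ.≃-sym (ℚᵘ.≃-trans (ℚ.toℚᵘ-homo-* (fromℚᵘ p) (fromℚᵘ q))
      (ℚᵘ.*-cong {x = toℚᵘ (fromℚᵘ p)} (ℚ.toℚᵘ-fromℚᵘ p) (ℚ.toℚᵘ-fromℚᵘ q)))))
    (ℚ.fromℚᵘ-toℚᵘ _)

  /-≡ : ∀ i m j n .{{_ : NonZero m}} .{{_ : NonZero n}} → i ℤ.* + n ≡ j ℤ.* + m → i / m ≡ j / n
  /-≡ i m@(suc _) j n@(suc _) e = ℚ.fromℚᵘ-cong {mkℚᵘ i _} {mkℚᵘ j _} (*≡* e)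

  /-≤ : ∀ i m j n .{{_ : NonZero m}} .{{_ : NonZero n}} → i ℤ.* + n ℤ.≤ j ℤ.* + m → i / m ℚ.≤ j / n
  /-≤ i m@(suc _) j n@(suc _) e = ℚ.toℚᵘ-cancel-≤
    (ℚᵘ.≤-trans (ℚᵘ.≤-reflexive (ℚ.toℚᵘ-fromℚᵘ (mkℚᵘ i _)))
      (ℚᵘ.≤-trans (*≤* e) (ℚᵘ.≤-reflexive (ℚᵘ.≃-sym (ℚ.toℚᵘ-fromℚᵘ (mkℚᵘ j _))))))

  /-* : ∀ i m j n .{{_ : NonZero m}} .{{_ : NonZero n}} .{{_ : NonZero (m ℕ.* n)}} →
        (i / m) ℚ.* (j / n) ≡ (i ℤ.* j) / (m ℕ.* n)
  /-* i m@(suc _) j n@(suc _) = sym (fromℚᵘ-* (mkℚᵘ i _) (mkℚᵘ j _))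

  abstract
    toℚ : ℕ → ℚ
    toℚ n = + n / 1

    toℚ-def : ∀ n → toℚ n ≡ + n / 1
    toℚ-def n = refl

    toℚ-0 : toℚ 0 ≡ 0ℚ
    toℚ-0 = refl

    toℚ-1 : toℚ 1 ≡ 1ℚ
    toℚ-1 = refl

    toℚ-+ : ∀ m n → toℚ (m ℕ.+ n) ≡ toℚ m ℚ.+ toℚ n
    toℚ-+ m n = trans (/-≡ (+ (m ℕ.+ n)) 1 (+ m ℤ.* + 1 ℤ.+ + n ℤ.* + 1) 1
        (cong (ℤ._* + 1) (cong₂ ℤ._+_ (sym (ℤ.*-identityʳ (+ m))) (sym (ℤ.*-identityʳ (+ n))))))
      (fromℚᵘ-+ (mkℚᵘ (+ m) 0) (mkℚᵘ (+ n) 0))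

    toℚ-* : ∀ m n → toℚ (m ℕ.* n) ≡ toℚ m ℚ.* toℚ n
    toℚ-* m n = trans (cong (_/ 1) (ℤ.pos-* m n)) (fromℚᵘ-* (mkℚᵘ (+ m) 0) (mkℚᵘ (+ n) 0))

    toℚ-mono : ∀ {m n} → m ℕ.≤ n → toℚ m ℚ.≤ toℚ n
    toℚ-mono {m} {n} m≤n = /-≤ (+ m) 1 (+ n) 1 (ℤ.*-monoʳ-≤-nonNeg (+ 1) (ℤ.+≤+ m≤n))

    0≤toℚ : ∀ n → 0ℚ ℚ.≤ toℚ n
    0≤toℚ n = toℚ-mono {0} {n} ℕ.z≤n

    toℚ-cancel : ∀ {m n} → toℚ m ℚ.≤ toℚ n → m ℕ.≤ n
    toℚ-cancel {m} {n} p with ℚᵘ.≤-trans (ℚᵘ.≤-reflexive (ℚᵘ.≃-sym (ℚ.toℚᵘ-fromℚᵘ (mkℚᵘ (+ m) 0))))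
           (ℚᵘ.≤-trans (ℚ.toℚᵘ-mono-≤ p) (ℚᵘ.≤-reflexive (ℚ.toℚᵘ-fromℚᵘ (mkℚᵘ (+ n) 0))))
    ... | *≤* q = ℤ.drop‿+≤+ (subst₂ ℤ._≤_ (ℤ.*-identityʳ (+ m)) (ℤ.*-identityʳ (+ n)) q)

  toℚ-suc : ∀ n → toℚ (suc n) ≡ 1ℚ ℚ.+ toℚ n
  toℚ-suc n = trans (toℚ-+ 1 n) (cong (ℚ._+ toℚ n) toℚ-1)

  0<toℚ-suc : ∀ n → 0ℚ ℚ.< toℚ (suc n)
  0<toℚ-suc n = ℚ.<-≤-trans (ℚ.positive⁻¹ 1ℚ) (subst (ℚ._≤ toℚ (suc n)) toℚ-1 (toℚ-mono (ℕ.s≤s ℕ.z≤n)))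

  -- The absolute value of the numerator will do, since denominators are at least 1.
  archimedean : ∀ p → ∃[ n ] p ℚ.≤ toℚ n
  archimedean p = ℤ.∣ ℚ.↥ p ∣ , subst₂ ℚ._≤_ (ℚ.↥p/↧p≡p p) (sym (toℚ-def _))
    (/-≤ (ℚ.↥ p) (ℚ.↧ₙ p) (+ ℤ.∣ ℚ.↥ p ∣) 1 (bound (ℚ.↥ p) (ℚ.denominator-1 p)))
    where
    bound : ∀ i d → i ℤ.* + 1 ℤ.≤ + ℤ.∣ i ∣ ℤ.* + suc d
    bound i d = ℤ.≤-trans (ℤ.≤-reflexive (ℤ.*-identityʳ i)) (ℤ.≤-trans (i≤∣i∣ i)
      (ℤ.≤-trans (ℤ.≤-reflexive (sym (ℤ.*-identityʳ (+ ℤ.∣ i ∣))))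
        (ℤ.*-monoˡ-≤-nonNeg (+ ℤ.∣ i ∣) (ℤ.+≤+ (ℕ.s≤s ℕ.z≤n)))))
      where
      i≤∣i∣ : ∀ i → i ℤ.≤ + ℤ.∣ i ∣
      i≤∣i∣ (+ n)         = ℤ.≤-refl
      i≤∣i∣ (ℤ.-[1+ n ]) = ℤ.-≤+

  -- Weights and the numbers f ℓ n = 𝒰₂ ℓ n (3/2)ⁿ / n!

  abstract
    R : ℚ
    R = + 3 / 2

    R-def : R ≡ + 3 / 2
    R-def = refl

    -- (3/2)ᵏ / k!
    a : ℕ → ℚ
    a zero    = 1ℚ
    a (suc k) = a k ℚ.* (+ 3 / (2 ℕ.* suc k))

    a-0 : a 0 ≡ 1ℚ
    a-0 = refl

    a-suc : ∀ k → a (suc k) ≡ a k ℚ.* (+ 3 / (2 ℕ.* suc k))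
    a-suc k = refl

    -- The series Σ aₖzᵏ is exp(3z/2), so its derivative is 3/2 times itself. Factorials are avoided
    -- by using only this property.
    suc*a : ∀ k → toℚ (suc k) ℚ.* a (suc k) ≡ R ℚ.* a k
    suc*a k = begin
      toℚ (suc k) ℚ.* (a k ℚ.* (+ 3 / (2 ℕ.* suc k)))
        ≡⟨ solve 3 (λ x y z → x :* (y :* z) := (x :* z) :* y) refl (toℚ (suc k)) (a k) _ ⟩
      toℚ (suc k) ℚ.* (+ 3 / (2 ℕ.* suc k)) ℚ.* a k
        ≡⟨ cong (λ x → x ℚ.* (+ 3 / (2 ℕ.* suc k)) ℚ.* a k) (toℚ-def (suc k)) ⟩
      (+ suc k / 1) ℚ.* (+ 3 / (2 ℕ.* suc k)) ℚ.* a k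
        ≡⟨ cong (ℚ._* a k) (/-* (+ suc k) 1 (+ 3) (2 ℕ.* suc k)) ⟩
      ((+ suc k ℤ.* + 3) / (1 ℕ.* (2 ℕ.* suc k))) ℚ.* a k
        ≡⟨ cong (ℚ._* a k) (/-≡ (+ suc k ℤ.* + 3) (1 ℕ.* (2 ℕ.* suc k)) (+ 3) 2 (cong +_
             (ℕSolver.solve 1 (λ k → k ℕSolver.:* ℕSolver.con 3 ℕSolver.:* ℕSolver.con 2
                ℕSolver.:= ℕSolver.con 3 ℕSolver.:* (ℕSolver.con 1 ℕSolver.:* (ℕSolver.con 2 ℕSolver.:* k)))
                refl (suc k)))) ⟩
      R ℚ.* a k ∎
      where
      open ≡-Reasoning
      open Data.Rational.Solver.+-*-Solver
      module ℕSolver = Data.Nat.Solver.+-*-Solver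

  private module 𝔸 = NormedAlgebraProperties ℚ-normedAlgebra
  open 𝔸 hiding (-_; ∣_∣; _≈_; _+_; _*_; _≤_; _-_)
  open Shift

  0≤a : ∀ k → 0ℚ ℚ.≤ a k
  0≤a zero    = subst (0ℚ ℚ.≤_) (sym a-0) (ℚ.nonNegative⁻¹ 1ℚ)
  0≤a (suc k) = subst (0ℚ ℚ.≤_) (sym (a-suc k)) (0≤-* (0≤a k) (ℚ.nonNegative⁻¹ _ {{ℚ.normalize-nonNeg 3 (2 ℕ.* suc k)}}))

  private
    open Data.Rational.Solver.+-*-Solver using (solve; _:=_; _:*_; _:+_)

    *-cancelˡ : ∀ n {x y} → toℚ (suc n) ℚ.* x ≡ toℚ (suc n) ℚ.* y → x ≡ y
    *-cancelˡ n {x} {y} e = ℚ.≤-antisym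
      (ℚ.*-cancelˡ-≤-pos (toℚ (suc n)) {{ℚ.positive (0<toℚ-suc n)}} (ℚ.≤-reflexive e))
      (ℚ.*-cancelˡ-≤-pos (toℚ (suc n)) {{ℚ.positive (0<toℚ-suc n)}} (ℚ.≤-reflexive (sym e)))

  -- The product rule for (Σ aᵢ gᵢⱼ aⱼ)′.
  ad-a-suc : ∀ n (g : ℕ → ℕ → ℚ) → toℚ (suc n) ℚ.* ad (suc n) (λ i j → a i ℚ.* a j ℚ.* g i j)
           ≡ R ℚ.* (ad n (λ i j → a i ℚ.* a j ℚ.* g (suc i) j) ℚ.+ ad n (λ i j → a i ℚ.* a j ℚ.* g i (suc j)))
  ad-a-suc n g = begin
    toℚ (suc n) ℚ.* ad (suc n) h
      ≡⟨ ad-*ˡ (suc n) (toℚ (suc n)) h ⟨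
    ad (suc n) (λ i j → toℚ (suc n) ℚ.* h i j)
      ≡⟨ ad-cong (suc n) (λ i j e → trans (cong (λ m → toℚ m ℚ.* h i j) (sym e))
           (trans (cong (ℚ._* h i j) (toℚ-+ i j)) (ℚ.*-distribʳ-+ (h i j) (toℚ i) (toℚ j)))) ⟩
    ad (suc n) (λ i j → toℚ i ℚ.* h i j ℚ.+ toℚ j ℚ.* h i j)
      ≡⟨ ad-+ (suc n) (λ i j → toℚ i ℚ.* h i j) (λ i j → toℚ j ℚ.* h i j) ⟩
    ad (suc n) (λ i j → toℚ i ℚ.* h i j) ℚ.+ ad (suc n) (λ i j → toℚ j ℚ.* h i j)
      ≡⟨ cong₂ ℚ._+_ left right ⟩
    R ℚ.* ad n (λ i j → a i ℚ.* a j ℚ.* g (suc i) j) ℚ.+ R ℚ.* ad n (λ i j → a i ℚ.* a j ℚ.* g i (suc j))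
      ≡⟨ ℚ.*-distribˡ-+ R (ad n (λ i j → a i ℚ.* a j ℚ.* g (suc i) j)) _ ⟨
    R ℚ.* (ad n (λ i j → a i ℚ.* a j ℚ.* g (suc i) j) ℚ.+ ad n (λ i j → a i ℚ.* a j ℚ.* g i (suc j))) ∎
    where
    open ≡-Reasoning
    h : ℕ → ℕ → ℚ
    h i j = a i ℚ.* a j ℚ.* g i j
    0* : ∀ x → toℚ 0 ℚ.* x ≡ 0ℚ
    0* x = trans (cong (ℚ._* x) toℚ-0) (ℚ.*-zeroˡ x)
    left : ad (suc n) (λ i j → toℚ i ℚ.* h i j) ≡ R ℚ.* ad n (λ i j → a i ℚ.* a j ℚ.* g (suc i) j)
    left = trans (cong₂ ℚ._+_ (0* (h 0 (suc n))) (trans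
      (ad-cong n λ i j _ → trans
        (solve 4 (λ n x y z → n :* (x :* y :* z) := (n :* x) :* (y :* z)) refl (toℚ (suc i)) (a (suc i)) (a j) (g (suc i) j))
        (trans (cong (ℚ._* (a j ℚ.* g (suc i) j)) (suc*a i))
          (solve 4 (λ n x y z → (n :* x) :* (y :* z) := n :* (x :* y :* z)) refl R (a i) (a j) (g (suc i) j))))
      (ad-*ˡ n R (λ i j → a i ℚ.* a j ℚ.* g (suc i) j)))) (ℚ.+-identityˡ _)
    right : ad (suc n) (λ i j → toℚ j ℚ.* h i j) ≡ R ℚ.* ad n (λ i j → a i ℚ.* a j ℚ.* g i (suc j))
    right = trans (ad-last n (λ i j → toℚ j ℚ.* h i j)) (trans (cong₂ ℚ._+_ (trans
      (ad-cong n λ i j _ → trans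
        (solve 4 (λ n x y z → n :* (x :* y :* z) := (n :* y) :* (x :* z)) refl (toℚ (suc j)) (a i) (a (suc j)) (g i (suc j)))
        (trans (cong (ℚ._* (a i ℚ.* g i (suc j))) (suc*a j))
          (solve 4 (λ n x y z → (n :* y) :* (x :* z) := n :* (x :* y :* z)) refl R (a i) (a j) (g i (suc j)))))
      (ad-*ˡ n R (λ i j → a i ℚ.* a j ℚ.* g i (suc j)))) (0* (h (suc n) 0))) (ℚ.+-identityʳ _))

  -- In effect C(n, k) aₙ = aₖ aₙ₋ₖ, the product formula for exponential generating functions. It is
  -- obtained by differentiating: Pascal's rule on the left matches the product rule `ad-a-suc` on
  -- the right.
  binomialSum-ad : ∀ n g → toℚ (binomialSum n g) ℚ.* a n ≡ ad n (λ i j → a i ℚ.* a j ℚ.* toℚ (g i j))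
  binomialSum-ad zero    g = trans (cong (toℚ (g 0 0) ℚ.*_) (trans a-0 (sym (cong₂ ℚ._*_ a-0 a-0))))
    (ℚ.*-comm (toℚ (g 0 0)) (a 0 ℚ.* a 0))
  binomialSum-ad (suc n) g = *-cancelˡ n (begin
    toℚ (suc n) ℚ.* (toℚ (binomialSum (suc n) g) ℚ.* a (suc n))
      ≡⟨ cong (λ x → toℚ (suc n) ℚ.* (x ℚ.* a (suc n))) (toℚ-+ X Y) ⟩
    toℚ (suc n) ℚ.* ((toℚ X ℚ.+ toℚ Y) ℚ.* a (suc n))
      ≡⟨ solve 3 (λ m x y → m :* (x :* y) := (m :* y) :* x) refl (toℚ (suc n)) (toℚ X ℚ.+ toℚ Y) (a (suc n)) ⟩
    toℚ (suc n) ℚ.* a (suc n) ℚ.* (toℚ X ℚ.+ toℚ Y)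
      ≡⟨ cong (ℚ._* (toℚ X ℚ.+ toℚ Y)) (suc*a n) ⟩
    R ℚ.* a n ℚ.* (toℚ X ℚ.+ toℚ Y)
      ≡⟨ solve 4 (λ r k x y → r :* k :* (x :+ y) := r :* (x :* k :+ y :* k)) refl R (a n) (toℚ X) (toℚ Y) ⟩
    R ℚ.* (toℚ X ℚ.* a n ℚ.+ toℚ Y ℚ.* a n)
      ≡⟨ cong (R ℚ.*_) (cong₂ ℚ._+_ (binomialSum-ad n λ i j → g (suc i) j) (binomialSum-ad n λ i j → g i (suc j))) ⟩
    R ℚ.* (ad n (λ i j → a i ℚ.* a j ℚ.* toℚ (g (suc i) j)) ℚ.+ ad n (λ i j → a i ℚ.* a j ℚ.* toℚ (g i (suc j))))
      ≡⟨ ad-a-suc n (λ i j → toℚ (g i j)) ⟨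
    toℚ (suc n) ℚ.* ad (suc n) (λ i j → a i ℚ.* a j ℚ.* toℚ (g i j)) ∎)
    where
    open ≡-Reasoning
    X = binomialSum n (λ i j → g (suc i) j)
    Y = binomialSum n (λ i j → g i (suc j))

  f : ℕ → Series
  f ℓ n = toℚ (U n ℓ) ℚ.* a n

  -- `U-ones` in terms of series: f ℓ is the sum of aₖzᵏ f((ℓ - k)/2) over the k ≤ ℓ of the same
  -- parity as ℓ.
  f-ones : ∀ ℓ n → f ℓ n ≡ ad n (λ k j → a k ℚ.* sh 𝟘 k (dil 𝟘 f) ℓ j)
  f-ones ℓ n = begin
    toℚ (U n ℓ) ℚ.* a n
      ≡⟨ cong (λ x → toℚ x ℚ.* a n) (U-ones n ℓ) ⟩
    toℚ (binomialSum n (λ k j → sh 0 k (dil 0 (U j)) ℓ)) ℚ.* a n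
      ≡⟨ binomialSum-ad n _ ⟩
    ad n (λ k j → a k ℚ.* a j ℚ.* toℚ (sh 0 k (dil 0 (U j)) ℓ))
      ≡⟨ ad-cong n (λ k j _ → trans (solve 3 (λ x y z → x :* y :* z := x :* (z :* y)) refl (a k) (a j) _)
           (cong (a k ℚ.*_) (term k j))) ⟩
    ad n (λ k j → a k ℚ.* sh 𝟘 k (dil 𝟘 f) ℓ j) ∎
    where
    open ≡-Reasoning
    term : ∀ k j → toℚ (sh 0 k (dil 0 (U j)) ℓ) ℚ.* a j ≡ sh 𝟘 k (dil 𝟘 f) ℓ j
    term k j = begin
      toℚ (sh 0 k (dil 0 (U j)) ℓ) ℚ.* a j
        ≡⟨ sh-rel P P-0 k ℓ (λ m _ → dil-rel P P-0 m λ _ _ → refl) ⟩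
      sh 𝟘 k (dil 𝟘 f) ℓ j ∎
      where
      P : ℕ → Series → Set
      P u s = toℚ u ℚ.* a j ≡ s j
      P-0 : P 0 𝟘
      P-0 = trans (cong (ℚ._* a j) toℚ-0) (ℚ.*-zeroˡ (a j))

-- Binary digit sums as sums of distinct powers of 2

module DigitSums where

  open import Defs using (binaryDigitSum)
  open import Data.Digit using (toNatDigits)
  open import Data.Bool.Base using (true; false)
  open import Data.List.Base using (List; []; _∷_)
  open import Data.Nat.Base
  open import Data.Nat.DivMod
  open import Data.Nat.Induction using (Acc; acc; <-wellFounded-fast)
  open import Data.Nat.ListAction using (sum)
  open import Data.Nat.Properties
  open import Data.Nat.Solver using (module +-*-Solver)
  open import Relation.Binary.Definitions using (tri<; tri≈; tri>)
  open import Relation.Binary.PropositionalEquality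
  open import Relation.Nullary.Decidable using (Dec; no; does)
  open import Relation.Nullary.Negation using (¬_; contradiction)

  -- PowerSum s ℓ: ℓ is a sum of s distinct powers of 2, the largest one last.
  data PowerSum : ℕ → ℕ → Set where
    []  : PowerSum 0 0
    add : ∀ {s ℓ} b → ℓ < 2 ^ b → PowerSum s ℓ → PowerSum (suc s) (ℓ + 2 ^ b)

  2^-suc : ∀ b → 2 ^ suc b ≡ 2 ^ b + 2 ^ b
  2^-suc b = cong (2 ^ b +_) (+-identityʳ (2 ^ b))

  <-double : ∀ {ℓ n} → ℓ < n → suc (ℓ + ℓ) < n + n
  <-double {ℓ} {n} p = begin-strict
    suc (ℓ + ℓ)     <⟨ n<1+n _ ⟩
    suc (suc (ℓ + ℓ)) ≡⟨ cong suc (+-suc ℓ ℓ) ⟨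
    suc ℓ + suc ℓ   ≤⟨ +-mono-≤ p p ⟩
    n + n           ∎
    where open ≤-Reasoning

  private
    double-add : ∀ ℓ b d → d + (ℓ + ℓ) + 2 ^ suc b ≡ d + ((ℓ + 2 ^ b) + (ℓ + 2 ^ b))
    double-add ℓ b d = solve 3 (λ d l p → d :+ (l :+ l) :+ (p :+ (p :+ con 0))
      := d :+ ((l :+ p) :+ (l :+ p))) refl d ℓ (2 ^ b)
      where open +-*-Solver

  double : ∀ {s ℓ} → PowerSum s ℓ → PowerSum s (ℓ + ℓ)
  double []              = []
  double (add {s} {ℓ} b p r) = subst (PowerSum (suc s)) (double-add ℓ b 0)
    (add (suc b) (subst (ℓ + ℓ <_) (sym (2^-suc b)) (<-trans (n<1+n _) (<-double p))) (double r))

  suc-double : ∀ {s ℓ} → PowerSum s ℓ → PowerSum (suc s) (suc (ℓ + ℓ))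
  suc-double []              = add 0 z<s []
  suc-double (add {s} {ℓ} b p r) = subst (PowerSum (suc (suc s))) (double-add ℓ b 1)
    (add (suc b) (subst (suc (ℓ + ℓ) <_) (sym (2^-suc b)) (<-double p)) (suc-double r))

  private
    top-≮ : ∀ {ℓ ℓ′ b b′} → ℓ < 2 ^ b → ℓ + 2 ^ b ≡ ℓ′ + 2 ^ b′ → b ≮ b′
    top-≮ {ℓ} {ℓ′} {b} {b′} p e b<b′ = <-irrefl e (begin-strict
      ℓ + 2 ^ b     <⟨ +-monoˡ-< (2 ^ b) p ⟩
      2 ^ b + 2 ^ b ≡⟨ 2^-suc b ⟨
      2 ^ suc b     ≤⟨ ^-monoʳ-≤ 2 b<b′ ⟩
      2 ^ b′        ≤⟨ m≤n+m (2 ^ b′) ℓ′ ⟩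
      ℓ′ + 2 ^ b′   ∎)
      where open ≤-Reasoning

    0<ℓ+2^ : ∀ ℓ b → 0 < ℓ + 2 ^ b
    0<ℓ+2^ ℓ b = ≤-trans (m^n>0 2 b) (m≤n+m (2 ^ b) ℓ)

  -- A power sum with largest term 2ᵇ lies between 2ᵇ and 2ᵇ⁺¹, the latter excluded; this determines
  -- b, and the rest follows by induction.
  PowerSum-unique : ∀ {s t ℓ m} → PowerSum s ℓ → PowerSum t m → ℓ ≡ m → s ≡ t
  PowerSum-unique []                []                _ = refl
  PowerSum-unique []                (add {ℓ = m} c _ _) e = contradiction e (<⇒≢ (0<ℓ+2^ m c))
  PowerSum-unique (add {ℓ = ℓ} b _ _) []              e = contradiction (sym e) (<⇒≢ (0<ℓ+2^ ℓ b))
  PowerSum-unique (add {ℓ = ℓ} b p r) (add {ℓ = m} c q t) e with <-cmp b c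
  ... | tri< b<c _ _ = contradiction b<c (top-≮ p e)
  ... | tri> _ _ c<b = contradiction c<b (top-≮ q (sym e))
  ... | tri≈ _ refl _ = cong suc (PowerSum-unique r t (+-cancelʳ-≡ (2 ^ b) ℓ m e))

  private
    halve : ∀ m → m % 2 + (m / 2 + m / 2) ≡ m
    halve m = trans (cong (m % 2 +_) (trans (cong (m / 2 +_) (sym (+-identityʳ (m / 2)))) (*-comm 2 (m / 2))))
                    (sym (m≡m%n+[m/n]*n m 2))

    append : ∀ {s ℓ} d → d < 2 → PowerSum s ℓ → PowerSum (d + s) (d + (ℓ + ℓ))
    append zero          _ = double
    append (suc zero)    _ = suc-double
    append (suc (suc d)) (s≤s (s≤s ()))

    -- ys consists of the binary digits of k, followed by xs.
    record Digits (k : ℕ) (xs ys : List ℕ) : Set where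
      constructor digits
      field
        {s}   : ℕ
        rep   : PowerSum s k
        total : sum ys ≡ s + sum xs

    unacc : ∀ {m n} → Acc _<_ n → m < n → Acc _<_ m
    unacc (acc r) p = r p

    -- The last digit of m leaves the list of digits already produced and becomes part of the
    -- represented number.
    Digits-step : ∀ m {xs ys} → Digits (m / 2) (m % 2 ∷ xs) ys → Digits m xs ys
    Digits-step m {xs} (digits {s} r e) = digits
      (subst (PowerSum (m % 2 + s)) (halve m) (append (m % 2) (m%n<n m 2) r))
      (trans e (solve 3 (λ s d x → s :+ (d :+ x) := (d :+ s) :+ x) refl s (m % 2) (sum xs)))
      where open +-*-Solver

    does-false : ∀ {P : Set} (d : Dec P) → does d ≡ false → ¬ P
    does-false (no p) _ = p

    Digits-0 : ∀ m {xs} → does (0 <? m / 2) ≡ false → Digits m xs (m % 2 ∷ xs)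
    Digits-0 m {xs} e = Digits-step m (subst (λ k → Digits k (m % 2 ∷ xs) (m % 2 ∷ xs))
      (sym (n≤0⇒n≡0 (≮⇒≥ (does-false (0 <? m / 2) e)))) (digits [] refl))

    -- The auxiliary function of toNatDigits is local to it, so the underscore is
    -- the only way to refer to it; it is solved by the call in digits-suc, whose
    -- arguments are generalised to variables for that purpose.
    mutual
      aux : ∀ m k → Acc _<_ k → List ℕ → List ℕ
      aux = _

      digits-aux : ∀ m k (ac : Acc _<_ k) xs → Digits k xs (aux m k ac xs)

      digits-suc : ∀ m → does (0 <? suc m / 2) ≡ true →
                   Digits (suc m / 2) (suc m % 2 ∷ []) (toNatDigits 2 (suc m))
      digits-suc m e with does (0 <? suc m / 2)
      digits-suc m refl | true
        with suc m / 2 | unacc (<-wellFounded-fast (suc m)) (m/n<m (suc m) 2 sz<ss) | suc m % 2 ∷ []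
      ... | k | ac | xs = digits-aux m k ac xs

      digits-aux m zero    ac       xs = digits [] refl
      digits-aux m (suc k) (acc wf) xs with does (0 <? suc k / 2) in eq
      ... | true  = Digits-step (suc k) (digits-aux m (suc k / 2) (wf (m/n<m (suc k) 2 sz<ss)) (suc k % 2 ∷ xs))
      ... | false = Digits-0 (suc k) eq

    digits-all : ∀ m → Digits m [] (toNatDigits 2 m)
    digits-all zero    = digits [] refl
    digits-all (suc m) = by-cases (does (0 <? suc m / 2)) refl
      where
      small : ∀ m → does (0 <? suc m / 2) ≡ false → suc m % 2 ∷ [] ≡ toNatDigits 2 (suc m)
      small m e with does (0 <? suc m / 2)
      small m refl | false = refl
      by-cases : ∀ b → does (0 <? suc m / 2) ≡ b → Digits (suc m) [] (toNatDigits 2 (suc m))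
      by-cases true  e = Digits-step (suc m) (digits-suc m e)
      by-cases false e = subst (Digits (suc m) []) (small m e) (Digits-0 (suc m) e)

  PowerSum-binaryDigitSum : ∀ ℓ → PowerSum (binaryDigitSum ℓ) ℓ
  PowerSum-binaryDigitSum ℓ with digits-all ℓ
  ... | digits {s} r e = subst (λ t → PowerSum t ℓ) (sym (trans e (+-identityʳ s))) r

  binaryDigitSum≡ : ∀ {s ℓ} → PowerSum s ℓ → binaryDigitSum ℓ ≡ s
  binaryDigitSum≡ {ℓ = ℓ} r = PowerSum-unique (PowerSum-binaryDigitSum ℓ) r refl

-- The maximal count and the powers of w

module MaximalCount where

  open import Defs using (𝒰₂; Is𝒲₂; binaryDigitSum)
  open import Data.Nat.Base using (z<s; _^_; ≤′-refl; ≤′-step)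
  open import Data.Nat.Solver using (module +-*-Solver)
  open import Data.Rational.Base using (_/_)
  open import Relation.Binary.PropositionalEquality
  open import Relation.Nullary.Negation using (contradiction)
  open NormedAlgebras
  open Representations
  open Weights
  open DigitSums

  private module 𝔸 = NormedAlgebraProperties ℚ-normedAlgebra
  open 𝔸
  open Shift 𝟘

  0≤1 : 0ℚ ≤ 1ℚ
  0≤1 = ℚ.nonNegative⁻¹ 1ℚ

  0≤f : ∀ ℓ n → 0ℚ ≤ f ℓ n
  0≤f ℓ n = 0≤-* (0≤toℚ (U n ℓ)) (0≤a n)

  -- The transition operator

  Family : Set
  Family = ℕ → Series

  -- Row t is Σ aₖzᵏ x((t + k)/2) over the k with t + k even: removing k summands 1 from a
  -- representation of 2ᵇ⁺¹ - t and halving the others leaves one of 2ᵇ - (t + k)/2.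
  𝒜 : Family → Family
  𝒜 x t n = ad n (λ k j → a k * dil x (t ℕ.+ k) j)

  -- If y (suc b) = 𝒜 (y b) on positive indices, then the coefficients of y b
  -- vanish up to n + t ≤ b: each step up from t to (t + k)/2 costs zᵏ.
  𝒜-vanish : (y : ℕ → Family) → (∀ b t n → 1 ℕ.≤ t → y (suc b) t n ≡ 𝒜 (y b) t n ⊎ y (suc b) t n ≡ 0ℚ) →
             ∀ b t n → 1 ℕ.≤ t → n ℕ.+ t ℕ.≤ b → y b t n ≡ 0ℚ
  𝒜-vanish y step zero    t n 1≤t h = contradiction (ℕ.≤-trans 1≤t (ℕ.≤-trans (ℕ.m≤n+m t n) h)) λ ()
  𝒜-vanish y step (suc b) t n 1≤t h with step b t n 1≤t
  ... | inj₂ zero-step = zero-step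
  ... | inj₁ 𝒜-step    = trans 𝒜-step (ad-zero n λ k j e →
    trans (cong (a k *_) (dil-elim (λ s → s j ≡ 0ℚ) refl (y b) (t ℕ.+ k) (λ m → go k j m e)))
          (ℚ.*-zeroʳ (a k)))
    where
    go : ∀ k j m → k ℕ.+ j ≡ n → m ℕ.+ m ≡ t ℕ.+ k → y b m j ≡ 0ℚ
    go k j zero    e e′ = contradiction (ℕ.≤-trans 1≤t (ℕ.≤-trans (ℕ.m≤m+n t k) (ℕ.≤-reflexive (sym e′)))) λ ()
    go k j (suc m) e e′ = 𝒜-vanish y step b (suc m) j (s≤s z≤n) (ℕ.≤-pred (begin
      suc (j ℕ.+ suc m)       ≤⟨ s≤s (ℕ.m≤m+n (j ℕ.+ suc m) m) ⟩
      suc (j ℕ.+ suc m ℕ.+ m) ≡⟨ solve 2 (λ j m → con 1 :+ (j :+ (con 1 :+ m) :+ m) := j :+ ((con 1 :+ m) :+ (con 1 :+ m))) refl j m ⟩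
      j ℕ.+ (suc m ℕ.+ suc m) ≡⟨ cong (j ℕ.+_) e′ ⟩
      j ℕ.+ (t ℕ.+ k)         ≡⟨ solve 3 (λ j t k → j :+ (t :+ k) := (k :+ j) :+ t) refl j t k ⟩
      (k ℕ.+ j) ℕ.+ t         ≡⟨ cong (ℕ._+ t) e ⟩
      n ℕ.+ t                 ≤⟨ h ⟩
      suc b                   ∎))
      where
      open ℕ.≤-Reasoning
      open +-*-Solver

  -- The generating functions of 2ᵇ - t.
  below : ℕ → Family
  below b t = sh t f (2 ^ b)

  private
    sh-ad : ∀ t n (g : ℕ → ℕ → ℕ → ℚ) ℓ →
            Shift.sh 0ℚ t (λ m → ad n (λ k j → g k j m)) ℓ ≡ ad n (λ k j → Shift.sh 0ℚ t (g k j) ℓ)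
    sh-ad zero    n g ℓ       = refl
    sh-ad (suc t) n g zero    = sym (ad-zero n λ _ _ _ → refl)
    sh-ad (suc t) n g (suc ℓ) = sh-ad t n g ℓ

  -- This is `f-ones` at 2ᵇ⁺¹ - t. Read downwards from 2·2ᵇ, the dilation in it refers to distances
  -- from 2ᵇ, which removes b from the coefficients.
  below-step : ∀ b t n → below (suc b) t n ≡ 𝒜 (below b) t n
  below-step b t n = begin
    sh t f (2 ^ suc b) n
      ≡⟨ cong (λ ℓ → sh t f ℓ n) (2^-suc b) ⟩
    sh t f (M ℕ.+ M) n
      ≡⟨ sh-rel {0A = 𝟘} {0B = 0ℚ} (λ s x → s n ≡ x) refl t {x = f} (M ℕ.+ M) (λ m _ → f-ones m n) ⟩
    Shift.sh 0ℚ t (λ ℓ → ad n (λ k j → a k * sh k (dil f) ℓ j)) (M ℕ.+ M)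
      ≡⟨ sh-ad t n _ (M ℕ.+ M) ⟩
    ad n (λ k j → Shift.sh 0ℚ t (λ ℓ → a k * sh k (dil f) ℓ j) (M ℕ.+ M))
      ≡⟨ ad-cong n (λ k j _ → term k j) ⟩
    𝒜 (below b) t n ∎
    where
    open ≡-Reasoning
    M = 2 ^ b
    term : ∀ k j → Shift.sh 0ℚ t (λ ℓ → a k * sh k (dil f) ℓ j) (M ℕ.+ M) ≡ a k * dil (below b) (t ℕ.+ k) j
    term k j = begin
      Shift.sh 0ℚ t (λ ℓ → a k * sh k (dil f) ℓ j) (M ℕ.+ M)
        ≡⟨ sh-rel {0A = 0ℚ} {0B = 𝟘} (λ x s → x ≡ a k * s j) (sym (ℚ.*-zeroʳ (a k))) t {y = sh k (dil f)} (M ℕ.+ M) (λ _ _ → refl) ⟩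
      a k * sh t (sh k (dil f)) (M ℕ.+ M) j
        ≡⟨ cong (λ s → a k * s j) (sh-sh t k (dil f) (M ℕ.+ M)) ⟩
      a k * sh (t ℕ.+ k) (dil f) (M ℕ.+ M) j
        ≡⟨ cong (λ s → a k * s j) (sh-dil-double (t ℕ.+ k) f M) ⟩
      a k * dil (below b) (t ℕ.+ k) j ∎

  -- Numbers slightly below 2ᵇ have many binary digits 1, hence need many summands.
  below-vanish : ∀ b t n → 1 ℕ.≤ t → n ℕ.+ t ℕ.≤ b → below b t n ≡ 0ℚ
  below-vanish = 𝒜-vanish below λ b t n _ → inj₁ (below-step b t n)

  -- Splitting off the leading binary digit

  -- The terms k > L of a family E, shifted so that E i sits at k = L + i.
  tail : Family → ℕ → Family
  tail E zero    zero    = 𝟘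
  tail E zero    (suc k) = E (suc k)
  tail E (suc L) zero    = 𝟘
  tail E (suc L) (suc k) = tail E L k

  -- The k units that are subtracted either fit into L, or they use up L and take the remaining k -
  -- L from m.
  sh-split : ∀ L k x m j →
    sh k x (L ℕ.+ m) j ≡ sh k (λ p → x (p ℕ.+ m)) L j + tail (λ i → sh i x m) L k j
  sh-split zero    zero    x m j = sym (ℚ.+-identityʳ _)
  sh-split zero    (suc k) x m j = sym (ℚ.+-identityˡ _)
  sh-split (suc L) zero    x m j = sym (ℚ.+-identityʳ _)
  sh-split (suc L) (suc k) x m j = sh-split L k x m j

  tail-elim : (Q : ℕ → Series → Set) (E : Family) → (∀ k → Q k 𝟘) →
    ∀ L k → (∀ i → L ℕ.+ suc i ≡ k → Q k (E (suc i))) → Q k (tail E L k)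
  tail-elim Q E q zero    zero    h = q 0
  tail-elim Q E q zero    (suc k) h = h k refl
  tail-elim Q E q (suc L) zero    h = q 0
  tail-elim Q E q (suc L) (suc k) h = tail-elim (Q ∘ suc) E (q ∘ suc) L k λ i e → h i (cong suc e)

  -- The contribution to 2 ^ suc b + L of the representations with more than L
  -- summands 1.
  carry : ℕ → ℕ → Series
  carry b L n = ad n (λ k j → a k * tail (dil (below b)) L k j)

  -- With at most L summands 1, these are taken from L alone, and halving the other summands leaves
  -- the leading power 2ᵇ whole; with more of them the leading power is broken, which is the carry.
  f-split : ∀ b L n → f (L ℕ.+ 2 ^ suc b) n
          ≡ ad n (λ k j → a k * sh k (dil (λ q → f (q ℕ.+ 2 ^ b))) L j) + carry b L n
  f-split b L n = begin
    f (L ℕ.+ 2 ^ suc b) n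
      ≡⟨ cong (λ ℓ → f (L ℕ.+ ℓ) n) (2^-suc b) ⟩
    f (L ℕ.+ (M ℕ.+ M)) n
      ≡⟨ f-ones (L ℕ.+ (M ℕ.+ M)) n ⟩
    ad n (λ k j → a k * sh k (dil f) (L ℕ.+ (M ℕ.+ M)) j)
      ≡⟨ ad-cong n (λ k j _ → trans (cong (a k *_) (trans (sh-split L k (dil f) (M ℕ.+ M) j)
           (cong₂ _+_ (cong (λ s → s j) (sh-cong k L (λ p _ → dil-+ f p M))) (tail-cong L k j))))
           (ℚ.*-distribˡ-+ (a k) _ _)) ⟩
    ad n (λ k j → a k * sh k (dil (λ q → f (q ℕ.+ M))) L j + a k * tail (dil (below b)) L k j)
      ≡⟨ ad-+ n _ _ ⟩
    ad n (λ k j → a k * sh k (dil (λ q → f (q ℕ.+ M))) L j) + carry b L n ∎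
    where
    open ≡-Reasoning
    M = 2 ^ b
    tail-cong : ∀ L k j → tail (λ i → sh i (dil f) (M ℕ.+ M)) L k j ≡ tail (dil (below b)) L k j
    tail-cong zero    zero    j = refl
    tail-cong zero    (suc k) j = cong (λ s → s j) (sh-dil-double (suc k) f M)
    tail-cong (suc L) zero    j = refl
    tail-cong (suc L) (suc k) j = tail-cong L k j

  0≤below : ∀ b t n → 0ℚ ≤ below b t n
  0≤below b t n = sh-rel {0A = 𝟘} {0B = 𝟘} (λ s _ → 0ℚ ≤ s n) ℚ.≤-refl t {x = f} {y = f} (2 ^ b) (λ m _ → 0≤f m n)

  0≤dil-below : ∀ b s n → 0ℚ ≤ dil (below b) s n
  0≤dil-below b s n = dil-elim (λ x → 0ℚ ≤ x n) ℚ.≤-refl (below b) s (λ m _ → 0≤below b m n)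

  0≤carry : ∀ b L n → 0ℚ ≤ carry b L n
  0≤carry b L n = ad-nonneg n λ k j _ → 0≤-* (0≤a k)
    (tail-elim (λ _ s → 0ℚ ≤ s j) (dil (below b)) (λ _ → ℚ.≤-refl) L k (λ i _ → 0≤dil-below b (suc i) j))

  -- Only entries of `below b` at positive indices contribute, and index m is reached from zᵏ with k
  -- = L + 2m, so `below-vanish` applies.
  carry-vanish : ∀ b L n → n ℕ.≤ suc b → carry b L n ≡ 0ℚ
  carry-vanish b L n h = ad-zero n λ k j e → trans (cong (a k *_)
    (tail-elim (λ k s → k ℕ.+ j ≡ n → s j ≡ 0ℚ) (dil (below b)) (λ _ _ → refl) L k (λ i e₁ e₂ →
      dil-elim (λ s → s j ≡ 0ℚ) refl (below b) (suc i) λ m e₃ → go i m j (trans (cong (ℕ._+ j) e₁) e₂) e₃) e))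
    (ℚ.*-zeroʳ (a k))
    where
    open +-*-Solver
    go : ∀ i m j → L ℕ.+ suc i ℕ.+ j ≡ n → m ℕ.+ m ≡ suc i → below b m j ≡ 0ℚ
    go i (suc m) j e e′ = below-vanish b (suc m) j (s≤s z≤n) (ℕ.≤-pred (ℕ.≤-trans (begin
      suc (j ℕ.+ suc m)       ≤⟨ s≤s (ℕ.m≤m+n _ (L ℕ.+ m)) ⟩
      suc (j ℕ.+ suc m ℕ.+ (L ℕ.+ m))
        ≡⟨ solve 3 (λ j m l → con 1 :+ (j :+ (con 1 :+ m) :+ (l :+ m)) := l :+ ((con 1 :+ m) :+ (con 1 :+ m)) :+ j) refl j m L ⟩
      L ℕ.+ (suc m ℕ.+ suc m) ℕ.+ j ≡⟨ cong (λ i → L ℕ.+ i ℕ.+ j) e′ ⟩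
      L ℕ.+ suc i ℕ.+ j ≡⟨ e ⟩
      n ∎) h))
      where open ℕ.≤-Reasoning

  f-0 : ∀ n → f 0 n ≡ 𝟙 n
  f-0 zero    = trans (cong₂ _*_ toℚ-1 a-0) (ℚ.*-identityˡ 1ℚ)
  f-0 (suc n) = trans (cong (_* a (suc n)) toℚ-0) (ℚ.*-zeroˡ (a (suc n)))

  ad-first : ∀ n (g : ℕ → ℕ → ℚ) → (∀ k j → g (suc k) j ≡ 0ℚ) → ad n g ≡ g 0 n
  ad-first zero    g e = refl
  ad-first (suc n) g e = trans (cong (g 0 (suc n) +_) (ad-zero n λ k j _ → e k j)) (ℚ.+-identityʳ _)

  f-double : ∀ b n → f (2 ^ suc b) n ≡ f (2 ^ b) n + carry b 0 n
  f-double b n = trans (f-split b 0 n) (cong (_+ carry b 0 n) (trans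
    (ad-first n _ λ k j → ℚ.*-zeroʳ (a (suc k)))
    (trans (cong (_* f (2 ^ b) n) a-0) (ℚ.*-identityˡ (f (2 ^ b) n)))))

  -- Multiplication by a fixed series commutes with removing summands 1.
  f-⊛-ones : ∀ (g : Series) L n → ad n (λ k j → a k * sh k (dil (λ q → g ⊛ f q)) L j) ≡ (g ⊛ f L) n
  f-⊛-ones g L n = begin
    ad n (λ k j → a k * sh k (dil (λ q → g ⊛ f q)) L j)
      ≡⟨ ad-cong n (λ k j _ → cong (a k *_) (sh-rel P P-0 k L (λ m _ → dil-rel P P-0 {y = f} m λ _ _ _ → refl) j)) ⟩
    ad n (λ k j → a k * (g ⊛ sh k (dil f) L) j)
      ≡⟨ ⊛-ad a g (λ k → sh k (dil f) L) n ⟩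
    (g ⊛ (λ m → ad m (λ k j → a k * sh k (dil f) L j))) n
      ≡⟨ ⊛-congˡ g (λ m → sym (f-ones L m)) n ⟩
    (g ⊛ f L) n ∎
    where
    open ≡-Reasoning
    P : Series → Series → Set
    P s t = ∀ j → s j ≡ (g ⊛ t) j
    P-0 : P 𝟘 𝟘
    P-0 j = sym (trans (⊛-comm g 𝟘 j) (⊛-zeroˡ g j))

  -- This is L! i! ≤ (L + i)!.
  a-+≤ : ∀ L i → a (L ℕ.+ i) ≤ a L * a i
  a-+≤ L zero    = ℚ.≤-reflexive (trans (cong a (ℕ.+-identityʳ L)) (sym (trans (cong (a L *_) a-0) (ℚ.*-identityʳ (a L)))))
  a-+≤ L (suc i) = begin
    a (L ℕ.+ suc i)                                  ≡⟨ trans (cong a (ℕ.+-suc L i)) (a-suc (L ℕ.+ i)) ⟩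
    a (L ℕ.+ i) * (ℤ.+ 3 / (2 ℕ.* suc (L ℕ.+ i)))      ≲⟨ *-mono-≤ (0≤-* (0≤a L) (0≤a i)) (0≤3/ (L ℕ.+ i)) (a-+≤ L i) smaller ⟩
    a L * a i * (ℤ.+ 3 / (2 ℕ.* suc i))                ≡⟨ trans (ℚ.*-assoc (a L) (a i) _) (cong (a L *_) (sym (a-suc i))) ⟩
    a L * a (suc i)                                  ∎
    where
    open ≤-Reasoning
    0≤3/ : ∀ i → 0ℚ ≤ ℤ.+ 3 / (2 ℕ.* suc i)
    0≤3/ i = ℚ.nonNegative⁻¹ _ {{ℚ.normalize-nonNeg 3 (2 ℕ.* suc i)}}
    smaller : ℤ.+ 3 / (2 ℕ.* suc (L ℕ.+ i)) ≤ ℤ.+ 3 / (2 ℕ.* suc i)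
    smaller = /-≤ (ℤ.+ 3) (2 ℕ.* suc (L ℕ.+ i)) (ℤ.+ 3) (2 ℕ.* suc i)
      (ℤ.*-monoˡ-≤-nonNeg (ℤ.+ 3) (ℤ.+≤+ (ℕ.*-monoʳ-≤ 2 (s≤s (ℕ.m≤n+m i L)))))

  private
    -- The weights are generalised from a because each step of the induction shifts them by one;
    -- `a-+≤` is the case that is needed.
    tail-shift : ∀ L n (w : ℕ → ℚ) v (E : Family) → 0ℚ ≤ v → (∀ k j → 0ℚ ≤ E k j) →
      (∀ i → w (L ℕ.+ i) ≤ v * a i) →
      ad n (λ k j → w k * tail E L k j) ≤ v * Shift.sh 0ℚ L (λ m → ad m (λ k j → a k * tail E 0 k j)) n
    tail-shift zero    n w v E 0≤v 0≤E h = ℚ.≤-trans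
      (ad-mono n λ k j _ → ℚ.≤-trans (*-monoʳ-≤ (0≤tail k j) (h k)) (ℚ.≤-reflexive (ℚ.*-assoc v (a k) _)))
      (ℚ.≤-reflexive (ad-*ˡ n v _))
      where
      0≤tail : ∀ k j → 0ℚ ≤ tail E 0 k j
      0≤tail zero    j = ℚ.≤-refl
      0≤tail (suc k) j = 0≤E (suc k) j
    tail-shift (suc L) zero    w v E 0≤v 0≤E h =
      ℚ.≤-reflexive (trans (ℚ.*-zeroʳ (w 0)) (sym (ℚ.*-zeroʳ v)))
    tail-shift (suc L) (suc n) w v E 0≤v 0≤E h = ℚ.≤-trans
      (ℚ.≤-reflexive (trans (cong (_+ ad n (λ k j → w (suc k) * tail E L k j)) (ℚ.*-zeroʳ (w 0))) (ℚ.+-identityˡ _)))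
      (tail-shift L n (w ∘ suc) v E 0≤v 0≤E h)

    ⊛-term : ∀ {g h : Series} → (∀ n → 0ℚ ≤ g n) → (∀ n → 0ℚ ≤ h n) → ∀ L n → g L * Shift.sh 0ℚ L h n ≤ (g ⊛ h) n
    ⊛-term p q zero    zero    = ℚ.≤-refl
    ⊛-term p q zero    (suc n) = x≤x+y (ad-nonneg n λ i j _ → 0≤-* (p (suc i)) (q j))
    ⊛-term {g} p q (suc L) zero    = ℚ.≤-trans (ℚ.≤-reflexive (ℚ.*-zeroʳ (g (suc L)))) (0≤-* (p 0) (q 0))
    ⊛-term p q (suc L) (suc n) = ℚ.≤-trans (⊛-term (p ∘ suc) q L n) (x≤y+x (0≤-* (p 0) (q (suc n))))

    ad-term-last : ∀ n (g : ℕ → ℕ → ℚ) → (∀ i j → 0ℚ ≤ g i j) → g n 0 ≤ ad n g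
    ad-term-last zero    g p = ℚ.≤-refl
    ad-term-last (suc n) g p = ℚ.≤-trans (ad-term-last n (g ∘ suc) (p ∘ suc)) (x≤y+x (p 0 (suc n)))

  -- L is the sum of L summands 1.
  a≤f : ∀ L → a L ≤ f L L
  a≤f L = begin
    a L                             ≡⟨ ℚ.*-identityʳ (a L) ⟨
    a L * 1ℚ                        ≡⟨ cong (a L *_) (f-0 0) ⟨
    a L * f 0 0                     ≡⟨ cong (λ s → a L * s 0) (trans (cong (sh L (dil f)) (sym (ℕ.+-identityʳ L))) (sh-+ L (dil f) 0)) ⟨
    a L * sh L (dil f) L 0          ≲⟨ ad-term-last L _ (λ k j → 0≤-* (0≤a k) (sh-rel {0A = 𝟘} {0B = 𝟘} (λ s _ → 0ℚ ≤ s j) ℚ.≤-refl k {x = dil f} {y = f} L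
                                         λ m _ → dil-elim (λ s → 0ℚ ≤ s j) ℚ.≤-refl f m λ q _ → 0≤f q j)) ⟩
    ad L (λ k j → a k * sh k (dil f) L j) ≡⟨ f-ones L L ⟨
    f L L                           ∎
    where open ≤-Reasoning

  -- Of more than L summands 1, let L represent L itself; the others belong to the carry of the
  -- power of 2 alone. `a-+≤` compares the weights.
  carry≤ : ∀ b L n → carry b L n ≤ (f L ⊛ carry b 0) n
  carry≤ b L n = begin
    carry b L n
      ≲⟨ tail-shift L n a (a L) (dil (below b)) (0≤a L) (0≤dil-below b) (a-+≤ L) ⟩
    a L * Shift.sh 0ℚ L (carry b 0) n
      ≲⟨ *-monoʳ-≤ (sh-rel {0A = 0ℚ} {0B = 0ℚ} (λ s _ → 0ℚ ≤ s) ℚ.≤-refl L {x = carry b 0} {y = carry b 0} n λ m _ → 0≤carry b 0 m) (a≤f L) ⟩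
    f L L * Shift.sh 0ℚ L (carry b 0) n
      ≲⟨ ⊛-term (0≤f L) (0≤carry b 0) L n ⟩
    (f L ⊛ carry b 0) n ∎
    where open ≤-Reasoning

  private
    halve-< : ∀ {q L} b → q ℕ.+ q ℕ.≤ L → L ℕ.< 2 ^ suc b → q ℕ.< 2 ^ b
    halve-< {q} {L} b q+q≤L L< = ℕ.≰⇒> λ p → ℕ.<-irrefl refl (ℕ.<-≤-trans L<
      (ℕ.≤-trans (ℕ.≤-reflexive (2^-suc b)) (ℕ.≤-trans (ℕ.+-mono-≤ p p) q+q≤L)))

  -- Induction on b. In the first part of `f-split`, halving lowers the leading power, and the
  -- induction hypothesis takes out the factor f(2ᵇ); `carry≤` bounds the second part by f L times
  -- the carry of 2ᵇ⁺¹. By `f-double` these two factors of f L add up to f(2ᵇ⁺¹).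
  f-submultiplicative : ∀ b L n → L ℕ.< 2 ^ b → f (L ℕ.+ 2 ^ b) n ≤ (f (2 ^ b) ⊛ f L) n
  f-submultiplicative zero    zero n _ = ℚ.≤-reflexive (sym (trans (⊛-congˡ (f 1) f-0 n) (⊛-identityʳ (f 1) n)))
  f-submultiplicative zero    (suc L) n (s≤s ())
  f-submultiplicative (suc b) L n L< = begin
    f (L ℕ.+ 2 ^ suc b) n
      ≡⟨ f-split b L n ⟩
    ad n (λ k j → a k * sh k (dil (λ q → f (q ℕ.+ M))) L j) + carry b L n
      ≲⟨ +-mono-≤ (ad-mono n λ k j _ → *-monoˡ-≤ (0≤a k) (sh-rel {0A = 𝟘} {0B = 𝟘} (λ s t → s j ≤ t j) ℚ.≤-refl k L λ m m≤L →
            dil-rel {0A = 𝟘} {0B = 𝟘} (λ s t → s j ≤ t j) ℚ.≤-refl {λ q → f (q ℕ.+ M)} {λ q → f M ⊛ f q} m λ q q+q≤m →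
              f-submultiplicative b q j (halve-< b (ℕ.≤-trans q+q≤m m≤L) L<)))
          (carry≤ b L n) ⟩
    ad n (λ k j → a k * sh k (dil (λ q → f M ⊛ f q)) L j) + (f L ⊛ carry b 0) n
      ≡⟨ cong₂ _+_ (f-⊛-ones (f M) L n) (⊛-comm (f L) (carry b 0) n) ⟩
    (f M ⊛ f L) n + (carry b 0 ⊛ f L) n
      ≡⟨ ⊛-distribʳ (f L) (f M) (carry b 0) n ⟨
    ((f M ⊕ carry b 0) ⊛ f L) n
      ≡⟨ ⊛-congʳ (f L) (λ m → sym (f-double b m)) n ⟩
    (f (2 ^ suc b) ⊛ f L) n ∎
    where
    open ≤-Reasoning
    M = 2 ^ b

  f-double-stable : ∀ b n → n ℕ.≤ suc b → f (2 ^ suc b) n ≡ f (2 ^ b) n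
  f-double-stable b n h = trans (f-double b n) (trans (cong (f (2 ^ b) n +_) (carry-vanish b 0 n h)) (ℚ.+-identityʳ _))

  -- The same induction with equalities: all carries vanish up to order n, and since halving lowers
  -- b and c together, their distance stays at least n.
  f-multiplicative : ∀ c b L n → L ℕ.< 2 ^ c → c ℕ.+ n ℕ.≤ b → f (L ℕ.+ 2 ^ b) n ≡ (f (2 ^ b) ⊛ f L) n
  f-multiplicative zero    b zero n _ _ =
    sym (trans (⊛-congˡ (f (2 ^ b)) f-0 n) (⊛-identityʳ (f (2 ^ b)) n))
  f-multiplicative zero    b (suc L) n (s≤s ())
  f-multiplicative (suc c) (suc b) L n L< (s≤s c+n≤b) = begin
    f (L ℕ.+ 2 ^ suc b) n
      ≡⟨ f-split b L n ⟩
    ad n (λ k j → a k * sh k (dil (λ q → f (q ℕ.+ M))) L j) + carry b L n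
      ≡⟨ cong₂ _+_ (ad-cong n λ k j e → cong (a k *_) (sh-rel {0A = 𝟘} {0B = 𝟘} (λ s t → s j ≡ t j) refl k L λ m m≤L →
            dil-rel {0A = 𝟘} {0B = 𝟘} (λ s t → s j ≡ t j) refl {λ q → f (q ℕ.+ M)} {λ q → f M ⊛ f q} m λ q q+q≤m →
              f-multiplicative c b q j (halve-< c (ℕ.≤-trans q+q≤m m≤L) L<)
                (ℕ.≤-trans (ℕ.+-monoʳ-≤ c (ℕ.≤-trans (ℕ.m≤n+m j k) (ℕ.≤-reflexive e))) c+n≤b)))
          (carry-vanish b L n n≤1+b) ⟩
    ad n (λ k j → a k * sh k (dil (λ q → f M ⊛ f q)) L j) + 0ℚ
      ≡⟨ trans (ℚ.+-identityʳ _) (f-⊛-ones (f M) L n) ⟩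
    (f M ⊛ f L) n
      ≡⟨ ad-cong n (λ i j e → cong (_* f L j) (sym (f-double-stable b i (ℕ.≤-trans (ℕ.≤-trans (ℕ.m≤m+n i j) (ℕ.≤-reflexive e)) n≤1+b)))) ⟩
    (f (2 ^ suc b) ⊛ f L) n ∎
    where
    open ≡-Reasoning
    M = 2 ^ b
    n≤1+b : n ℕ.≤ suc b
    n≤1+b = ℕ.m≤n⇒m≤1+n (ℕ.≤-trans (ℕ.m≤n+m n c) c+n≤b)

  -- The maximum

  abstract
    -- Coefficient n of f(2ᵇ) is the same for all b ≥ n, so the limit can be read off at b = n.
    w : Series
    w n = f (2 ^ n) n

    w-def : ∀ n → w n ≡ f (2 ^ n) n
    w-def n = refl

  w-stable : ∀ {b n} → n ℕ.≤ b → f (2 ^ b) n ≡ w n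
  w-stable {n = n} = go ∘ ℕ.≤⇒≤′
    where
    go : ∀ {b} → n ℕ.≤′ b → f (2 ^ b) n ≡ w n
    go ≤′-refl         = sym (w-def n)
    go (≤′-step {b} p) = trans (f-double-stable b n (ℕ.m≤n⇒m≤1+n (ℕ.≤′⇒≤ p))) (go p)

  0≤w : ∀ n → 0ℚ ≤ w n
  0≤w n = subst (0ℚ ≤_) (sym (w-def n)) (0≤f (2 ^ n) n)

  f≤w : ∀ b n → f (2 ^ b) n ≤ w n
  f≤w b n = ℚ.≤-trans (mono (ℕ.≤⇒≤′ (ℕ.m≤m⊔n b n))) (ℚ.≤-reflexive (w-stable (ℕ.m≤n⊔m b n)))
    where
    mono : ∀ {b c} → b ℕ.≤′ c → f (2 ^ b) n ≤ f (2 ^ c) n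
    mono ≤′-refl         = ℚ.≤-refl
    mono (≤′-step {c} p) = ℚ.≤-trans (mono p)
      (ℚ.≤-trans (x≤x+y (0≤carry c 0 n)) (ℚ.≤-reflexive (sym (f-double c n))))

  f≤w^ : ∀ {s ℓ} → PowerSum s ℓ → ∀ n → f ℓ n ≤ (w ⊛^ s) n
  f≤w^ []                     n = ℚ.≤-reflexive (f-0 n)
  f≤w^ (add {s} {ℓ} b ℓ< r) n = ℚ.≤-trans (f-submultiplicative b ℓ n ℓ<)
    (ad-mono n λ i j _ → *-mono-≤ (0≤w i) (0≤f ℓ j) (f≤w b i) (f≤w^ r j))

  -- The positions of the binary digits of optimal s n are at least n apart.
  width : ℕ → ℕ → ℕ
  width zero    n = 0
  width (suc s) n = suc (width s n ℕ.+ n)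

  optimal : ℕ → ℕ → ℕ
  optimal zero    n = 0
  optimal (suc s) n = optimal s n ℕ.+ 2 ^ (width s n ℕ.+ n)

  optimal<2^width : ∀ s n → optimal s n ℕ.< 2 ^ width s n
  optimal<2^width zero    n = z<s
  optimal<2^width (suc s) n = begin-strict
    optimal s n ℕ.+ 2 ^ b <⟨ ℕ.+-monoˡ-< (2 ^ b) (optimal<2^width s n) ⟩
    2 ^ width s n ℕ.+ 2 ^ b ≤⟨ ℕ.+-monoˡ-≤ (2 ^ b) (ℕ.^-monoʳ-≤ 2 (ℕ.m≤m+n (width s n) n)) ⟩
    2 ^ b ℕ.+ 2 ^ b       ≡⟨ 2^-suc b ⟨
    2 ^ suc b ∎
    where
    open ℕ.≤-Reasoning
    b = width s n ℕ.+ n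

  optimal-PowerSum : ∀ s n → PowerSum s (optimal s n)
  optimal-PowerSum zero    n = []
  optimal-PowerSum (suc s) n = add (width s n ℕ.+ n)
    (ℕ.<-≤-trans (optimal<2^width s n) (ℕ.^-monoʳ-≤ 2 (ℕ.m≤m+n (width s n) n))) (optimal-PowerSum s n)

  -- The digits are so far apart that `f-multiplicative` applies to each leading digit in turn.
  f-optimal : ∀ s n m → m ℕ.≤ n → f (optimal s n) m ≡ (w ⊛^ s) m
  f-optimal zero    n m _   = f-0 m
  f-optimal (suc s) n m m≤n = trans
    (f-multiplicative (width s n) _ (optimal s n) m (optimal<2^width s n) (ℕ.+-monoʳ-≤ (width s n) m≤n))
    (ad-cong m λ i j e → cong₂ _*_
      (w-stable (ℕ.≤-trans (ℕ.≤-trans (ℕ.m≤m+n i j) (ℕ.≤-reflexive e)) (ℕ.≤-trans m≤n (ℕ.m≤n+m n (width s n)))))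
      (f-optimal s n j (ℕ.≤-trans (ℕ.≤-trans (ℕ.m≤n+m j i) (ℕ.≤-reflexive e)) m≤n)))

  𝒲₂ : ℕ → ℕ → ℕ
  𝒲₂ s n = 𝒰₂ (optimal s n) n

  𝒲₂-w^ : ∀ s n → toℚ (𝒲₂ s n) * a n ≡ (w ⊛^ s) n
  𝒲₂-w^ s n = trans (cong (λ u → toℚ u * a n) (𝒰₂≡U (optimal s n) n)) (f-optimal s n n ℕ.≤-refl)

  0<a : ∀ n → 0ℚ ℚ.< a n
  0<a zero    = subst (0ℚ ℚ.<_) (sym a-0) (ℚ.positive⁻¹ 1ℚ)
  0<a (suc n) = subst (0ℚ ℚ.<_) (sym (a-suc n)) (ℚ.positive⁻¹ _
    {{ℚ.pos*pos⇒pos (a n) {{ℚ.positive (0<a n)}} _ {{ℚ.normalize-pos 3 (2 ℕ.* suc n)}}}})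

  𝒲₂-isMaximum : Is𝒲₂ 𝒲₂
  𝒲₂-isMaximum (suc s) n _ _ = record
    { attained   = optimal (suc s) n
                 , ℕ.≤-trans (ℕ.m^n>0 2 (width s n ℕ.+ n)) (ℕ.m≤n+m _ (optimal s n))
                 , binaryDigitSum≡ (optimal-PowerSum (suc s) n) , refl
    ; upperBound = λ ℓ _ e → toℚ-cancel (ℚ.*-cancelʳ-≤-pos (a n) {{ℚ.positive (0<a n)}} (begin
        toℚ (𝒰₂ ℓ n) * a n       ≡⟨ cong (λ u → toℚ u * a n) (𝒰₂≡U ℓ n) ⟩
        f ℓ n                    ≲⟨ f≤w^ (PowerSum-binaryDigitSum ℓ) n ⟩
        (w ⊛^ binaryDigitSum ℓ) n ≡⟨ cong (λ s → (w ⊛^ s) n) e ⟩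
        (w ⊛^ suc s) n           ≡⟨ 𝒲₂-w^ (suc s) n ⟨
        toℚ (𝒲₂ (suc s) n) * a n ∎))
    }
    where open ≤-Reasoning

-- A linear equation for w from an eigenvector of the transition operator

module Recursion where

  open import Data.Nat.Base using (_^_)
  open import Relation.Binary.PropositionalEquality
  open import Relation.Nullary.Negation using (contradiction)
  open NormedAlgebras
  open Representations
  open Weights
  open MaximalCount

  private module 𝔸 = NormedAlgebraProperties ℚ-normedAlgebra
  open 𝔸
  open Shift 𝟘

  private
    dil-congʲ : ∀ {x y : Family} s j → (∀ m → m ℕ.+ m ≡ s → x m j ≡ y m j) → dil x s j ≡ dil y s j
    dil-congʲ zero          j h = h 0 refl
    dil-congʲ (suc zero)    j h = refl
    dil-congʲ (suc (suc s)) j h =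
      dil-congʲ s j λ m e → h (suc m) (cong suc (trans (ℕ.+-suc m m) (cong suc e)))

  𝒜-cong : ∀ {x y : Family} t n → (∀ k m j → k ℕ.+ j ≡ n → m ℕ.+ m ≡ t ℕ.+ k → x m j ≡ y m j) →
           𝒜 x t n ≡ 𝒜 y t n
  𝒜-cong t n h = ad-cong n λ k j e → cong (a k *_) (dil-congʲ (t ℕ.+ k) j λ m e′ → h k m j e e′)

  𝒜-cong⁺ : ∀ {x y : Family} t n → 1 ℕ.≤ t → (∀ m j → x (suc m) j ≡ y (suc m) j) → 𝒜 x t n ≡ 𝒜 y t n
  𝒜-cong⁺ t n 1≤t h = 𝒜-cong t n λ where
    k zero    j e e′ → contradiction (ℕ.≤-trans 1≤t (ℕ.≤-trans (ℕ.m≤m+n t k) (ℕ.≤-reflexive (sym e′)))) λ ()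
    k (suc m) j e e′ → h m j

  dil-+ℚ : ∀ (x y : Family) s j → dil (λ m → x m ⊕ y m) s j ≡ dil x s j + dil y s j
  dil-+ℚ x y zero          j = refl
  dil-+ℚ x y (suc zero)    j = refl
  dil-+ℚ x y (suc (suc s)) j = dil-+ℚ (x ∘ suc) (y ∘ suc) s j

  𝒜-⊕ : ∀ (x y : Family) t n → 𝒜 (λ m → x m ⊕ y m) t n ≡ 𝒜 x t n + 𝒜 y t n
  𝒜-⊕ x y t n = trans
    (ad-cong n λ k j _ → trans (cong (a k *_) (dil-+ℚ x y (t ℕ.+ k) j)) (ℚ.*-distribˡ-+ (a k) _ _))
    (ad-+ n _ _)

  𝒜-⊛ : ∀ (g : Series) (x : Family) t n → 𝒜 (λ m → g ⊛ x m) t n ≡ (g ⊛ 𝒜 x t) n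
  𝒜-⊛ g x t n = trans
    (ad-cong n λ k j _ → cong (a k *_) (dil-rel P P-0 {y = x} (t ℕ.+ k) (λ _ _ _ → refl) j))
    (⊛-ad a g (λ k → dil x (t ℕ.+ k)) n)
    where
    P : Series → Series → Set
    P s u = ∀ j → s j ≡ (g ⊛ u) j
    P-0 : P 𝟘 𝟘
    P-0 j = sym (trans (⊛-comm g 𝟘 j) (⊛-zeroˡ g j))

  ⊝_ : Series → Series
  (⊝ g) n = - g n

  dil-⊝ : ∀ (x : Family) s j → dil (λ m → ⊝ x m) s j ≡ - dil x s j
  dil-⊝ x zero          j = refl
  dil-⊝ x (suc zero)    j = refl
  dil-⊝ x (suc (suc s)) j = dil-⊝ (x ∘ suc) s j

  𝒜-⊝ : ∀ (x : Family) t n → 𝒜 (λ m → ⊝ x m) t n ≡ - 𝒜 x t n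
  𝒜-⊝ x t n = trans
    (ad-cong n λ k j _ → trans (cong (a k *_) (dil-⊝ x (t ℕ.+ k) j)) (sym (ℚ.neg-distribʳ-* (a k) _)))
    (ad-neg n _)

  𝒜-zero : ∀ {x : Family} t n → (∀ k m j → k ℕ.+ j ≡ n → m ℕ.+ m ≡ t ℕ.+ k → x m j ≡ 0ℚ) → 𝒜 x t n ≡ 0ℚ
  𝒜-zero {x} t n h = ad-zero n λ k j e → trans
    (cong (a k *_) (dil-elim (λ s → s j ≡ 0ℚ) refl x (t ℕ.+ k) (λ m → h k m j e)))
    (ℚ.*-zeroʳ (a k))

  -- A series D with D ⊛ w explicit, from an eigenvector of 𝒜 away from index 1

  δ₁ : Family
  δ₁ (suc zero) = 𝟙
  δ₁ _          = 𝟘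

  -- below b without its entry at index 0
  pos : ℕ → Family
  pos b zero    = 𝟘
  pos b (suc t) = below b (suc t)

  -- Partial sums of Σ `pos i`. On positive indices `pos 0` is `δ₁` and `pos (i + 1)` is
  -- `𝒜 (pos i)`, so these are the partial sums of the Neumann series of (1 - 𝒜)⁻¹ δ₁.
  G : ℕ → Family
  G zero    t = 𝟘
  G (suc b) t = G b t ⊕ pos b t

  G-0 : ∀ b n → G b 0 n ≡ 0ℚ
  G-0 zero    n = refl
  G-0 (suc b) n = trans (ℚ.+-identityʳ _) (G-0 b n)

  𝒜-zeros : ∀ t n → 𝒜 (λ _ → 𝟘) t n ≡ 0ℚ
  𝒜-zeros t n = 𝒜-zero t n λ _ _ _ _ _ → refl

  G-step : ∀ b t n → 1 ℕ.≤ t → G (suc b) t n ≡ δ₁ t n + 𝒜 (G b) t n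
  G-step zero    (suc zero)    n _   = trans (ℚ.+-identityˡ _) (trans (f-0 n)
    (sym (trans (cong (𝟙 n +_) (𝒜-zeros 1 n)) (ℚ.+-identityʳ (𝟙 n)))))
  G-step zero    (suc (suc t)) n _   = sym (cong (0ℚ +_) (𝒜-zeros (suc (suc t)) n))
  G-step (suc b) t@(suc _)     n 1≤t = begin
    G (suc b) t n + below (suc b) t n
      ≡⟨ cong₂ _+_ (G-step b t n 1≤t) (trans (below-step b t n) (𝒜-cong⁺ t n 1≤t λ _ _ → refl)) ⟩
    δ₁ t n + 𝒜 (G b) t n + 𝒜 (pos b) t n
      ≡⟨ ℚ.+-assoc (δ₁ t n) _ _ ⟩
    δ₁ t n + (𝒜 (G b) t n + 𝒜 (pos b) t n)
      ≡⟨ cong (δ₁ t n +_) (𝒜-⊕ (G b) (pos b) t n) ⟨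
    δ₁ t n + 𝒜 (G (suc b)) t n ∎
    where open ≡-Reasoning

  carry-pos : ∀ b n → carry b 0 n ≡ 𝒜 (pos b) 0 n
  carry-pos b n = ad-cong n λ where
    zero    j _ → refl
    (suc k) j _ → cong (a (suc k) *_) (dil-congʲ {below b} {pos b} (suc k) j λ where
      (suc m) _ → refl)

  -- `f-double` telescopes, and row 0 of `𝒜` collects the carries.
  f-2^ : ∀ b n → f (2 ^ b) n ≡ f 1 n + 𝒜 (G b) 0 n
  f-2^ zero    n = sym (trans (cong (f 1 n +_) (𝒜-zeros 0 n)) (ℚ.+-identityʳ _))
  f-2^ (suc b) n = begin
    f (2 ^ suc b) n                        ≡⟨ f-double b n ⟩
    f (2 ^ b) n + carry b 0 n              ≡⟨ cong₂ _+_ (f-2^ b n) (carry-pos b n) ⟩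
    f 1 n + 𝒜 (G b) 0 n + 𝒜 (pos b) 0 n   ≡⟨ ℚ.+-assoc (f 1 n) _ _ ⟩
    f 1 n + (𝒜 (G b) 0 n + 𝒜 (pos b) 0 n) ≡⟨ cong (f 1 n +_) (𝒜-⊕ (G b) (pos b) 0 n) ⟨
    f 1 n + 𝒜 (G (suc b)) 0 n             ∎
    where open ≡-Reasoning

  -- If V = D δ₁ + 𝒜 V on positive indices, then V is D (1 - 𝒜)⁻¹ δ₁, that is, the limit of D `G b`:
  -- the difference is mapped by `𝒜` from b to b + 1, so by `𝒜-vanish` each of its coefficients is 0
  -- for large b. Inserting V for D G into `f-2^` expresses D w without w.
  module Eigenvector (V : Family) (D : Series) (V-0 : ∀ n → V 0 n ≡ 0ℚ)
    (V-eq : ∀ t n → 1 ℕ.≤ t → V t n ≡ (D ⊛ δ₁ t) n + 𝒜 V t n) where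

    private
      e : ℕ → Family
      e b t = V t ⊕ ⊝ (D ⊛ G b t)

      𝒜-e : ∀ b t n → 𝒜 (e b) t n ≡ 𝒜 V t n - (D ⊛ 𝒜 (G b) t) n
      𝒜-e b t n = trans (𝒜-⊕ V (λ t → ⊝ (D ⊛ G b t)) t n)
        (cong (𝒜 V t n +_) (trans (𝒜-⊝ (λ t → D ⊛ G b t) t n) (cong -_ (𝒜-⊛ D (G b) t n))))

      e-step : ∀ b t n → 1 ℕ.≤ t → e (suc b) t n ≡ 𝒜 (e b) t n
      e-step b t n 1≤t = begin
        V t n - (D ⊛ G (suc b) t) n
          ≡⟨ cong₂ _-_ (V-eq t n 1≤t) (trans (⊛-congˡ D (λ m → G-step b t m 1≤t) n) (⊛-distribˡ D (δ₁ t) (𝒜 (G b) t) n)) ⟩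
        (D ⊛ δ₁ t) n + 𝒜 V t n - ((D ⊛ δ₁ t) n + (D ⊛ 𝒜 (G b) t) n)
          ≡⟨ solve 3 (λ d v g → d :+ v :- (d :+ g) := v :- g) refl ((D ⊛ δ₁ t) n) (𝒜 V t n) _ ⟩
        𝒜 V t n - (D ⊛ 𝒜 (G b) t) n
          ≡⟨ 𝒜-e b t n ⟨
        𝒜 (e b) t n ∎
        where
        open ≡-Reasoning
        open Solver

      e-0 : ∀ b n → e b 0 n ≡ 0ℚ
      e-0 b n = cong₂ _-_ (V-0 n) (trans (⊛-congˡ D (G-0 b) n) (trans (⊛-comm D 𝟘 n) (⊛-zeroˡ D n)))

      𝒜-e-vanish : ∀ b n → n ℕ.≤ b → 𝒜 (e b) 0 n ≡ 0ℚ
      𝒜-e-vanish b n n≤b = 𝒜-zero 0 n go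
        where
        open ℕ.≤-Reasoning
        go : ∀ k m j → k ℕ.+ j ≡ n → m ℕ.+ m ≡ k → e b m j ≡ 0ℚ
        go k zero    j _ _ = e-0 b j
        go k (suc m) j p q = 𝒜-vanish e (λ b t n 1≤t → inj₁ (e-step b t n 1≤t)) b (suc m) j (s≤s z≤n) (begin
          j ℕ.+ suc m ≤⟨ ℕ.+-monoʳ-≤ j (ℕ.≤-trans (ℕ.m≤m+n (suc m) (suc m)) (ℕ.≤-reflexive q)) ⟩
          j ℕ.+ k     ≡⟨ trans (ℕ.+-comm j k) p ⟩
          n           ≤⟨ n≤b ⟩
          b           ∎)

    D⊛w : ∀ n → (D ⊛ w) n ≡ (D ⊛ f 1) n + 𝒜 V 0 n
    D⊛w n = begin
      (D ⊛ w) n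
        ≡⟨ ad-cong n (λ i j p → cong (D i *_) (sym (w-stable (ℕ.≤-trans (ℕ.m≤n+m j i) (ℕ.≤-reflexive p))))) ⟩
      (D ⊛ f (2 ^ n)) n
        ≡⟨ trans (⊛-congˡ D (f-2^ n) n) (⊛-distribˡ D (f 1) (𝒜 (G n) 0) n) ⟩
      (D ⊛ f 1) n + (D ⊛ 𝒜 (G n) 0) n
        ≡⟨ solve 3 (λ d v g → d :+ g := d :+ v :- (v :- g)) refl ((D ⊛ f 1) n) (𝒜 V 0 n) _ ⟩
      (D ⊛ f 1) n + 𝒜 V 0 n - (𝒜 V 0 n - (D ⊛ 𝒜 (G n) 0) n)
        ≡⟨ cong (λ x → (D ⊛ f 1) n + 𝒜 V 0 n - x) (trans (sym (𝒜-e n 0 n)) (𝒜-e-vanish n n ℕ.≤-refl)) ⟩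
      (D ⊛ f 1) n + 𝒜 V 0 n - 0ℚ
        ≡⟨ ℚ.+-identityʳ _ ⟩
      (D ⊛ f 1) n + 𝒜 V 0 n ∎
      where
      open ≡-Reasoning
      open Solver

  -- f 1 = (3/2) z, because 1 is a power of 2 and has no representation with several summands.
  ⊛-f1 : ∀ (g : Series) n → (g ⊛ f 1) (suc n) ≡ R * g n
  ⊛-f1 g n = trans (⊛-comm g (f 1) (suc n)) (begin
    f 1 0 * g (suc n) + ad n (λ i j → f 1 (suc i) * g j)
      ≡⟨ cong₂ _+_ (trans (cong (λ x → x * a 0 * g (suc n)) toℚ-0)
           (trans (cong (_* g (suc n)) (ℚ.*-zeroˡ (a 0))) (ℚ.*-zeroˡ (g (suc n)))))
           (ad-cong n λ i j _ → cong (_* g j) (f1 i)) ⟩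
    0ℚ + ((λ i → R * 𝟙 i) ⊛ g) n
      ≡⟨ trans (ℚ.+-identityˡ _) (⊛-scaleˡ R 𝟙 g n) ⟩
    R * (𝟙 ⊛ g) n
      ≡⟨ cong (R *_) (⊛-identityˡ g n) ⟩
    R * g n ∎)
    where
    open ≡-Reasoning
    f1 : ∀ i → f 1 (suc i) ≡ R * 𝟙 i
    f1 zero    = trans (cong (_* a 1) toℚ-1) (trans (ℚ.*-identityˡ (a 1))
      (trans (sym (ℚ.*-identityˡ (a 1))) (trans (cong (_* a 1) (sym toℚ-1)) (trans (suc*a 0) (cong (R *_) a-0)))))
    f1 (suc i) = trans (cong (λ u → toℚ u * a (suc (suc i))) (U-1 i))
      (trans (cong (_* a (suc (suc i))) toℚ-0) (trans (ℚ.*-zeroˡ (a (suc (suc i)))) (sym (ℚ.*-zeroʳ R))))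
      where
      U-1 : ∀ i → U (suc (suc i)) 1 ≡ 0
      U-1 i = refl

-- Integer polynomials and estimates for the weights

module Coefficients where

  open import Data.Integer.Base using (ℤ; -[1+_])
  open import Data.List.Base using (List; []; _∷_; applyUpTo)
  open import Data.Nat.Base using (_^_)
  open import Data.Rational.Base using (_/_)
  open import Data.Rational.Unnormalised.Base using (mkℚᵘ)
  open import Relation.Binary.PropositionalEquality
  open NormedAlgebras
  open Representations
  open Weights
  open MaximalCount

  private module 𝔸 = NormedAlgebraProperties ℚ-normedAlgebra
  open 𝔸
  open Shift

  abstract
    int : ℤ → ℚ
    int i = i / 1

    int-+ : ∀ i j → int (i ℤ.+ j) ≡ int i + int j
    int-+ i j = trans (/-≡ (i ℤ.+ j) 1 (i ℤ.* ℤ.+ 1 ℤ.+ j ℤ.* ℤ.+ 1) 1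
        (cong (ℤ._* ℤ.+ 1) (cong₂ ℤ._+_ (sym (ℤ.*-identityʳ i)) (sym (ℤ.*-identityʳ j)))))
      (fromℚᵘ-+ (mkℚᵘ i 0) (mkℚᵘ j 0))

    int-* : ∀ i j → int (i ℤ.* j) ≡ int i * int j
    int-* i j = fromℚᵘ-* (mkℚᵘ i 0) (mkℚᵘ j 0)

    int-0 : int (ℤ.+ 0) ≡ 0ℚ
    int-0 = refl

    int-pos : ∀ n → int (ℤ.+ n) ≡ toℚ n
    int-pos n = sym (toℚ-def n)

    int-neg : ∀ i → int (ℤ.- i) ≡ - int i
    int-neg i = trans (sym (solve 2 (λ x y → (x :+ y) :- y := x) refl (int (ℤ.- i)) (int i)))
      (trans (cong (_- int i) (trans (sym (int-+ (ℤ.- i) i)) (cong int (ℤ.+-inverseˡ i)))) (ℚ.+-identityˡ _))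
      where open Solver

  ∣int∣ : ∀ i → ∣ int i ∣ ≡ toℚ ℤ.∣ i ∣
  ∣int∣ (ℤ.+ n)   = trans (cong ∣_∣ (int-pos n)) (trans (ℚ.0≤p⇒∣p∣≡p (0≤toℚ n)) refl)
  ∣int∣ -[1+ n ] = trans (cong ∣_∣ (int-neg (ℤ.+ suc n)))
    (trans (ℚ.∣-p∣≡∣p∣ (int (ℤ.+ suc n))) (∣int∣ (ℤ.+ suc n)))

  Poly : Set
  Poly = List ℤ

  poly : Poly → Series
  poly []      n       = 0ℚ
  poly (c ∷ l) zero    = int c
  poly (c ∷ l) (suc n) = poly l n

  infixl 6 _⊞_
  infixr 7 _⊡_
  _⊞_ : Poly → Poly → Poly
  []      ⊞ m       = m
  (c ∷ l) ⊞ []      = c ∷ l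
  (c ∷ l) ⊞ (d ∷ m) = c ℤ.+ d ∷ l ⊞ m

  _⊡_ : ℤ → Poly → Poly
  c ⊡ []      = []
  c ⊡ (d ∷ l) = c ℤ.* d ∷ c ⊡ l

  -- The ℓ¹ norm, computed on integers.
  height : Poly → ℕ
  height []      = 0
  height (c ∷ l) = ℤ.∣ c ∣ ℕ.+ height l

  poly-⊞ : ∀ l m n → poly (l ⊞ m) n ≡ poly l n + poly m n
  poly-⊞ []      m       n       = sym (ℚ.+-identityˡ _)
  poly-⊞ (c ∷ l) []      n       = sym (ℚ.+-identityʳ _)
  poly-⊞ (c ∷ l) (d ∷ m) zero    = int-+ c d
  poly-⊞ (c ∷ l) (d ∷ m) (suc n) = poly-⊞ l m n

  poly-⊡ : ∀ c l n → poly (c ⊡ l) n ≡ int c * poly l n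
  poly-⊡ c []      n       = sym (ℚ.*-zeroʳ (int c))
  poly-⊡ c (d ∷ l) zero    = int-* c d
  poly-⊡ c (d ∷ l) (suc n) = poly-⊡ c l n

  ‖poly‖≤ : ∀ l n → ‖ poly l ‖ n ≤ toℚ (height l)
  ‖poly‖≤ l       zero    = 0≤toℚ (height l)
  ‖poly‖≤ []      (suc n) = ℚ.≤-trans (ℚ.≤-reflexive (ℚ.+-identityˡ _)) (‖poly‖≤ [] n)
  ‖poly‖≤ (c ∷ l) (suc n) = ℚ.≤-trans (+-mono-≤ (ℚ.≤-reflexive (∣int∣ c)) (‖poly‖≤ l n))
    (ℚ.≤-reflexive (sym (toℚ-+ ℤ.∣ c ∣ (height l))))

  -- The polynomial Σ zᵏ lₖ.
  comb : List Poly → Poly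
  comb []       = []
  comb (l ∷ ls) = l ⊞ (ℤ.+ 0 ∷ comb ls)

  comb-ad : ∀ K (h : ℕ → Poly) → (∀ k → K ℕ.≤ k → h k ≡ []) →
            ∀ n → ad n (λ k j → poly (h k) j) ≡ poly (comb (applyUpTo h K)) n
  comb-ad zero    h e n       = ad-zero n λ k j _ → cong (λ l → poly l j) (e k z≤n)
  comb-ad (suc K) h e zero    = sym (trans (poly-⊞ (h 0) _ 0)
    (trans (cong (poly (h 0) 0 +_) int-0) (ℚ.+-identityʳ _)))
  comb-ad (suc K) h e (suc n) = sym (trans (poly-⊞ (h 0) _ (suc n))
    (cong (poly (h 0) (suc n) +_) (sym (comb-ad K (h ∘ suc) (λ k p → e (suc k) (s≤s p)) n))))

  -- 2ᵏ k!, the denominator in a k = 3ᵏ / (2ᵏ k!).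
  den : ℕ → ℕ
  den zero    = 1
  den (suc k) = den k ℕ.* (2 ℕ.* suc k)

  0<den : ∀ k → 0 ℕ.< den k
  0<den zero    = ℕ.z<s
  0<den (suc k) = ℕ.*-mono-< (0<den k) ℕ.z<s

  toℚ-pos : ∀ {n} → 0 ℕ.< n → ℚ.Positive (toℚ n)
  toℚ-pos {suc n} _ = ℚ.positive (0<toℚ-suc n)

  cancel : ∀ {n x y} → 0 ℕ.< n → toℚ n * x ≡ toℚ n * y → x ≡ y
  cancel {n} 0<n e = ℚ.≤-antisym (ℚ.*-cancelˡ-≤-pos (toℚ n) {{toℚ-pos 0<n}} (ℚ.≤-reflexive e))
                                 (ℚ.*-cancelˡ-≤-pos (toℚ n) {{toℚ-pos 0<n}} (ℚ.≤-reflexive (sym e)))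

  cancel-≤ : ∀ {n x y} → 0 ℕ.< n → toℚ n * x ≤ toℚ n * y → x ≤ y
  cancel-≤ {n} 0<n = ℚ.*-cancelˡ-≤-pos (toℚ n) {{toℚ-pos 0<n}}

  den*a : ∀ k → toℚ (den k) * a k ≡ toℚ (3 ^ k)
  den*a zero    = trans (cong₂ _*_ toℚ-1 a-0) (sym toℚ-1)
  den*a (suc k) = begin
    toℚ (den k ℕ.* (2 ℕ.* suc k)) * a (suc k)
      ≡⟨ cong (_* a (suc k)) (trans (toℚ-* (den k) (2 ℕ.* suc k)) (cong (toℚ (den k) *_) (toℚ-* 2 (suc k)))) ⟩
    toℚ (den k) * (toℚ 2 * toℚ (suc k)) * a (suc k)
      ≡⟨ solve 4 (λ d t s a → d :* (t :* s) :* a := d :* t :* (s :* a)) refl (toℚ (den k)) (toℚ 2) (toℚ (suc k)) (a (suc k)) ⟩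
    toℚ (den k) * toℚ 2 * (toℚ (suc k) * a (suc k))
      ≡⟨ cong (toℚ (den k) * toℚ 2 *_) (suc*a k) ⟩
    toℚ (den k) * toℚ 2 * (R * a k)
      ≡⟨ solve 4 (λ d t r a → d :* t :* (r :* a) := t :* r :* (d :* a)) refl (toℚ (den k)) (toℚ 2) R (a k) ⟩
    toℚ 2 * R * (toℚ (den k) * a k)
      ≡⟨ cong₂ _*_ 2*R (den*a k) ⟩
    toℚ 3 * toℚ (3 ^ k)
      ≡⟨ toℚ-* 3 (3 ^ k) ⟨
    toℚ (3 ^ suc k) ∎
    where
    open ≡-Reasoning
    open Solver
    2*R : toℚ 2 * R ≡ toℚ 3
    2*R = trans (cong₂ _*_ (toℚ-def 2) R-def) (sym (toℚ-def 3))

  -- The hypothesis is an equation of natural numbers, which evaluation settles for concrete k.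
  scale-a : ∀ q k m → q ℕ.* 3 ^ k ≡ m ℕ.* den k → toℚ q * a k ≡ toℚ m
  scale-a q k m e = cancel (0<den k) (begin
    toℚ (den k) * (toℚ q * a k)   ≡⟨ solve 3 (λ d q a → d :* (q :* a) := q :* (d :* a)) refl (toℚ (den k)) (toℚ q) (a k) ⟩
    toℚ q * (toℚ (den k) * a k)   ≡⟨ cong (toℚ q *_) (den*a k) ⟩
    toℚ q * toℚ (3 ^ k)           ≡⟨ toℚ-* q (3 ^ k) ⟨
    toℚ (q ℕ.* 3 ^ k)             ≡⟨ cong toℚ (trans e (ℕ.*-comm m (den k))) ⟩
    toℚ (den k ℕ.* m)             ≡⟨ toℚ-* (den k) m ⟩
    toℚ (den k) * toℚ m           ∎)
    where
    open ≡-Reasoning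
    open Solver

  -- 3ᵏ / k!
  b : ℕ → ℚ
  b k = a k * toℚ (2 ^ k)

  0≤b : ∀ k → 0ℚ ≤ b k
  0≤b k = 0≤-* (0≤a k) (0≤toℚ (2 ^ k))

  -- The quotient of consecutive terms is 3/(k + 1), which is at most 1/2 from k = 5 on.
  b-halves : ∀ k → 5 ℕ.≤ k → b (suc k) + b (suc k) ≤ b k
  b-halves k 5≤k = cancel-≤ {suc k} ℕ.z<s (begin
    toℚ (suc k) * (b (suc k) + b (suc k))
      ≡⟨ cong (λ x → toℚ (suc k) * (a (suc k) * x + a (suc k) * x)) (toℚ-* 2 (2 ^ k)) ⟩
    toℚ (suc k) * (a (suc k) * (toℚ 2 * toℚ (2 ^ k)) + a (suc k) * (toℚ 2 * toℚ (2 ^ k)))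
      ≡⟨ solve 4 (λ s a t p → s :* (a :* (t :* p) :+ a :* (t :* p)) := (s :* a) :* (t :+ t) :* p) refl
           (toℚ (suc k)) (a (suc k)) (toℚ 2) (toℚ (2 ^ k)) ⟩
    (toℚ (suc k) * a (suc k)) * (toℚ 2 + toℚ 2) * toℚ (2 ^ k)
      ≡⟨ cong (λ x → x * (toℚ 2 + toℚ 2) * toℚ (2 ^ k)) (suc*a k) ⟩
    R * a k * (toℚ 2 + toℚ 2) * toℚ (2 ^ k)
      ≡⟨ solve 4 (λ r a t p → r :* a :* t :* p := (t :* r) :* (a :* p)) refl R (a k) (toℚ 2 + toℚ 2) (toℚ (2 ^ k)) ⟩
    (toℚ 2 + toℚ 2) * R * b k
      ≡⟨ cong (_* b k) (trans (cong₂ (λ x y → (x + x) * y) (toℚ-def 2) R-def) (sym (toℚ-def 6))) ⟩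
    toℚ 6 * b k
      ≲⟨ *-monoʳ-≤ (0≤b k) (toℚ-mono (s≤s 5≤k)) ⟩
    toℚ (suc k) * b k ∎)
    where
    open ≤-Reasoning
    open Solver

  -- By `b-halves` the tail is dominated by a geometric series of ratio 1/2.
  b-tail : ∀ m n → 5 ℕ.≤ m → sum n (λ i → b (m ℕ.+ i)) ≤ b m + b m
  b-tail m zero    5≤m = 0≤-+ (0≤b m) (0≤b m)
  b-tail m (suc n) 5≤m = +-mono-≤ (ℚ.≤-reflexive (cong b (ℕ.+-identityʳ m))) (begin
    sum n (λ i → b (m ℕ.+ suc i)) ≡⟨ sum-cong n (λ i _ → cong b (ℕ.+-suc m i)) ⟩
    sum n (λ i → b (suc m ℕ.+ i)) ≲⟨ b-tail (suc m) n (ℕ.m≤n⇒m≤1+n 5≤m) ⟩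
    b (suc m) + b (suc m)         ≲⟨ b-halves m 5≤m ⟩
    b m                           ∎)
    where open ≤-Reasoning

  sum-split≤ : ∀ m n {g : Series} → (∀ i → 0ℚ ≤ g i) → sum n g ≤ sum m g + sum n (λ i → g (m ℕ.+ i))
  sum-split≤ m n {g} p = ℚ.≤-trans (sum-mono-ℕ p (ℕ.m≤n+m n m)) (ℚ.≤-reflexive (sum-split m n g))

  -- An upper bound for e³ = 20.08.... The terms up to k = 5 are integers after multiplication by
  -- 40, and `b-tail` accounts for the others: 817/40 < 21.
  b-sum≤ : ∀ n → sum n b ≤ toℚ 21
  b-sum≤ n = cancel-≤ {40} ℕ.z<s (begin
    toℚ 40 * sum n b
      ≲⟨ *-monoˡ-≤ (0≤toℚ 40) (ℚ.≤-trans (sum-split≤ 5 n 0≤b) (+-monoʳ-≤ (sum 5 b) (b-tail 5 n ℕ.≤-refl))) ⟩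
    toℚ 40 * (b 0 + (b 1 + (b 2 + (b 3 + (b 4 + 0ℚ)))) + (b 5 + b 5))
      ≡⟨ solve 7 (λ t x y z u v w → t :* (x :+ (y :+ (z :+ (u :+ (v :+ con 0ℚ)))) :+ (w :+ w))
           := t :* x :+ t :* y :+ t :* z :+ t :* u :+ t :* v :+ (t :* w :+ t :* w)) refl
           (toℚ 40) (b 0) (b 1) (b 2) (b 3) (b 4) (b 5) ⟩
    toℚ 40 * b 0 + toℚ 40 * b 1 + toℚ 40 * b 2 + toℚ 40 * b 3 + toℚ 40 * b 4 + (toℚ 40 * b 5 + toℚ 40 * b 5)
      ≡⟨ cong₂ _+_ (cong₂ _+_ (cong₂ _+_ (cong₂ _+_ (cong₂ _+_
           (40b 0 40 refl) (40b 1 120 refl)) (40b 2 180 refl)) (40b 3 180 refl)) (40b 4 135 refl))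
           (cong₂ _+_ (40b 5 81 refl) (40b 5 81 refl)) ⟩
    toℚ 40 + toℚ 120 + toℚ 180 + toℚ 180 + toℚ 135 + (toℚ 81 + toℚ 81)
      ≡⟨ cong₂ _+_ (trans (cong (_+ toℚ 135) (trans (cong (_+ toℚ 180) (trans (cong (_+ toℚ 180) (sym (toℚ-+ 40 120))) (sym (toℚ-+ 160 180)))) (sym (toℚ-+ 340 180)))) (sym (toℚ-+ 520 135))) (sym (toℚ-+ 81 81)) ⟩
    toℚ 655 + toℚ 162
      ≡⟨ toℚ-+ 655 162 ⟨
    toℚ 817
      ≲⟨ toℚ-mono (ℕ.m≤m+n 817 23) ⟩
    toℚ 840
      ≡⟨ toℚ-* 40 21 ⟩
    toℚ 40 * toℚ 21 ∎)
    where
    open ≤-Reasoning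
    open Solver
    40b : ∀ k m → (40 ℕ.* 2 ^ k) ℕ.* 3 ^ k ≡ m ℕ.* den k → toℚ 40 * b k ≡ toℚ m
    40b k m e = trans (solve 3 (λ t a p → t :* (a :* p) := (t :* p) :* a) refl (toℚ 40) (a k) (toℚ (2 ^ k)))
      (trans (cong (_* a k) (sym (toℚ-* 40 (2 ^ k)))) (scale-a (40 ℕ.* 2 ^ k) k m e))

  -- Row t acts on norm bounds as the nonnegative matrix with the entries aₖ. It involves only the
  -- entries m with 2m ≥ t.
  ‖𝒜‖≤ : ∀ (x : Family) (E : ℕ → ℕ) N t → (∀ m → t ℕ.≤ m ℕ.+ m → ‖ x m ‖ N ≤ toℚ (E m)) →
         ‖ 𝒜 x t ‖ N ≤ sum N (λ k → a k * toℚ (dil 0 E (t ℕ.+ k)))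
  ‖𝒜‖≤ x E N t h = ℚ.≤-trans (‖ad‖≤ (λ k j → a k * dil 𝟘 x (t ℕ.+ k) j) N) (sum-mono N λ k _ → begin
    ‖ (λ j → a k * dil 𝟘 x (t ℕ.+ k) j) ‖ N ≡⟨ ‖scale‖ (a k) (dil 𝟘 x (t ℕ.+ k)) N ⟩
    ∣ a k ∣ * ‖ dil 𝟘 x (t ℕ.+ k) ‖ N       ≡⟨ cong (_* ‖ dil 𝟘 x (t ℕ.+ k) ‖ N) (ℚ.0≤p⇒∣p∣≡p (0≤a k)) ⟩
    a k * ‖ dil 𝟘 x (t ℕ.+ k) ‖ N           ≲⟨ *-monoˡ-≤ (0≤a k) (dil≤ (t ℕ.+ k) (ℕ.m≤m+n t k)) ⟩
    a k * toℚ (dil 0 E (t ℕ.+ k))           ∎)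
    where
    open ≤-Reasoning
    ‖𝟘‖ : ∀ N → ‖ 𝟘 ‖ N ≡ 0ℚ
    ‖𝟘‖ zero    = refl
    ‖𝟘‖ (suc N) = trans (ℚ.+-identityˡ _) (‖𝟘‖ N)
    dil≤ : ∀ s → t ℕ.≤ s → ‖ dil 𝟘 x s ‖ N ≤ toℚ (dil 0 E s)
    dil≤ s t≤s = go x E s λ m e → h m (subst (t ℕ.≤_) (sym e) t≤s)
      where
      go : ∀ (x : Family) (E : ℕ → ℕ) s → (∀ m → m ℕ.+ m ≡ s → ‖ x m ‖ N ≤ toℚ (E m)) →
           ‖ dil 𝟘 x s ‖ N ≤ toℚ (dil 0 E s)
      go x E zero          h = h 0 refl
      go x E (suc zero)    h = ℚ.≤-reflexive (trans (‖𝟘‖ N) (sym toℚ-0))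
      go x E (suc (suc s)) h = go (x ∘ suc) (E ∘ suc) s λ m e →
        h (suc m) (cong suc (trans (ℕ.+-suc m m) (cong suc e)))

-- The numerical certificate

module Certificate where

  open import Data.Integer.Base using (ℤ; +_; -_)
  open import Data.List.Base using (List; []; _∷_)
  open import Data.Nat.Base using (_+_; _^_; _*_)

  -- The numerical certificate: approximate eigenvector entries v̂ₜ = coefficients t
  -- for 2 ≤ t ≤ 7, in units of 10⁻⁵, as truncated power series. Entry 2 was chosen
  -- such that D is close to a product of two linear factors.
  coefficients : ℕ → List ℤ
  coefficients 2 =
      + 100000 ∷ - + 125401 ∷ + 97038 ∷ - + 108019 ∷ + 88215 ∷ - + 66727 ∷ + 44609 ∷ - + 33097 ∷
      + 26468 ∷ - + 22146 ∷ + 17252 ∷ - + 13133 ∷ + 9917 ∷ - + 7768 ∷ + 6095 ∷ - + 4788 ∷ + 3703 ∷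
      - + 2870 ∷ + 2223 ∷ - + 1734 ∷ + 1350 ∷ - + 1051 ∷ + 816 ∷ - + 634 ∷ + 493 ∷ - + 383 ∷ + 299 ∷
      - + 232 ∷ + 181 ∷ - + 140 ∷ + 109 ∷ []
  coefficients 3 =
      + 0 ∷ + 150000 ∷ - + 188102 ∷ + 145557 ∷ - + 77654 ∷ + 32844 ∷ - + 26150 ∷ + 29374 ∷ - + 27328 ∷
      + 19281 ∷ - + 12980 ∷ + 9589 ∷ - + 8008 ∷ + 6533 ∷ - + 5115 ∷ + 3859 ∷ - + 2949 ∷ + 2300 ∷
      - + 1809 ∷ + 1418 ∷ - + 1094 ∷ + 852 ∷ - + 656 ∷ + 517 ∷ - + 397 ∷ + 314 ∷ - + 238 ∷ + 191 ∷
      - + 144 ∷ + 117 ∷ - + 86 ∷ + 70 ∷ + 76 ∷ - + 55 ∷ + 46 ∷ + 38 ∷ - + 22 ∷ + 19 ∷ + 27 ∷ - + 7 ∷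
      + 9 ∷ []
  coefficients 4 =
      + 100000 ∷ - + 125401 ∷ + 97038 ∷ + 60731 ∷ - + 102305 ∷ + 70573 ∷ - + 22282 ∷ + 16662 ∷
      - + 20971 ∷ + 22308 ∷ - + 15902 ∷ + 11099 ∷ - + 7772 ∷ + 6486 ∷ - + 5220 ∷ + 4240 ∷ - + 3161 ∷
      + 2446 ∷ - + 1858 ∷ + 1493 ∷ - + 1147 ∷ + 910 ∷ - + 687 ∷ + 548 ∷ - + 414 ∷ + 335 ∷ - + 248 ∷
      + 203 ∷ - + 148 ∷ + 125 ∷ - + 89 ∷ + 162 ∷ - + 118 ∷ + 98 ∷ + 73 ∷ - + 33 ∷ + 30 ∷ + 61 ∷
      - + 7 ∷ + 16 ∷ + 37 ∷ []
  coefficients 5 =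
      + 0 ∷ + 0 ∷ + 225000 ∷ - + 225902 ∷ + 147797 ∷ - + 61896 ∷ + 83426 ∷ - + 82534 ∷ + 69972 ∷
      - + 44429 ∷ + 34409 ∷ - + 25900 ∷ + 22067 ∷ - + 16838 ∷ + 13444 ∷ - + 9944 ∷ + 7888 ∷ - + 6027 ∷
      + 4835 ∷ - + 3684 ∷ + 2911 ∷ - + 2211 ∷ + 1757 ∷ - + 1340 ∷ + 1067 ∷ - + 807 ∷ + 646 ∷ - + 485 ∷
      + 395 ∷ - + 292 ∷ + 241 ∷ - + 173 ∷ + 147 ∷ + 88 ∷ - + 9 ∷ + 17 ∷ + 102 ∷ + 17 ∷ + 16 ∷ + 58 ∷
      + 25 ∷ []
  coefficients 6 =
      + 0 ∷ + 150000 ∷ - + 75602 ∷ + 4481 ∷ + 31514 ∷ + 101166 ∷ - + 93783 ∷ + 63490 ∷ - + 22415 ∷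
      + 25136 ∷ - + 18595 ∷ + 18967 ∷ - + 12563 ∷ + 10636 ∷ - + 6961 ∷ + 6116 ∷ - + 4464 ∷ + 3828 ∷
      - + 2731 ∷ + 2247 ∷ - + 1633 ∷ + 1361 ∷ - + 1000 ∷ + 826 ∷ - + 600 ∷ + 500 ∷ - + 360 ∷ + 307 ∷
      - + 215 ∷ + 188 ∷ - + 125 ∷ + 117 ∷ + 53 ∷ + 71 ∷ - + 39 ∷ + 115 ∷ + 89 ∷ + 3 ∷ + 60 ∷ + 66 ∷
      + 22 ∷ []
  coefficients 7 =
      + 0 ∷ + 150000 ∷ - + 188102 ∷ + 145557 ∷ + 91096 ∷ - + 26896 ∷ - + 11719 ∷ + 44929 ∷ - + 9031 ∷
      + 16837 ∷ - + 6082 ∷ + 9891 ∷ - + 4410 ∷ + 6254 ∷ - + 3112 ∷ + 3388 ∷ - + 1859 ∷ + 2013 ∷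
      - + 1222 ∷ + 1198 ∷ - + 744 ∷ + 708 ∷ - + 455 ∷ + 430 ∷ - + 274 ∷ + 261 ∷ - + 162 ∷ + 163 ∷
      - + 96 ∷ + 103 ∷ - + 52 ∷ + 65 ∷ + 99 ∷ - + 55 ∷ + 62 ∷ + 183 ∷ + 8 ∷ + 44 ∷ + 106 ∷ + 45 ∷
      + 41 ∷ []
  coefficients _ = []

  -- Radii, in the same units, of a neighbourhood of v̂ that iteration does not leave: the residual
  -- of row t plus row t of `𝒜` applied to the radii is at most the radius of entry t. They are 0
  -- for t ≤ 2, where v̂ is kept. The growth 4ᵗ suits the infinitely many remaining rows, see
  -- `row-big`.
  errors : ℕ → ℕ
  errors 3 = 240
  errors 4 = 560
  errors 5 = 1700
  errors 6 = 7600
  errors 7 = 42500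
  errors (suc (suc (suc (suc (suc (suc (suc (suc m)))))))) = 2800 * 4 ^ (8 + m)
  errors _ = 0

  -- Q `a k` for k ≤ 14, an integer because Q = 2¹⁴ 14!.
  weights : ℕ → ℕ
  weights 0 = 1428329123020800
  weights 1 = 2142493684531200
  weights 2 = 1606870263398400
  weights 3 = 803435131699200
  weights 4 = 301288174387200
  weights 5 = 90386452316160
  weights 6 = 22596613079040
  weights 7 = 4842131374080
  weights 8 = 907899632640
  weights 9 = 151316605440
  weights 10 = 22697490816
  weights 11 = 3095112384
  weights 12 = 386889048
  weights 13 = 44641044
  weights 14 = 4782969
  weights _ = 0

  Q : ℕ
  Q = 1428329123020800

-- The eigenvector near its numerical approximation

module Verification where

  open import Data.Integer.Base using (ℤ)
  open import Data.List.Base using ([]; applyUpTo)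
  open import Data.Nat.Base using (_^_)
  open import Data.Nat.Solver using (module +-*-Solver)
  open import Relation.Binary.PropositionalEquality
  open import Relation.Nullary.Decidable using (toWitness; yes; no; _→-dec_)
  open NormedAlgebras
  open Representations
  open Weights
  open MaximalCount
  open Recursion
  open Coefficients
  open Certificate

  private module 𝔸 = NormedAlgebraProperties ℚ-normedAlgebra
  open 𝔸
  open Shift

  -- Row sums of 𝒜 against the certificate

  private
    weights-correct : ∀ {k} → k ℕ.< 15 → Q ℕ.* 3 ^ k ≡ weights k ℕ.* den k
    weights-correct = toWitness {a? = ℕ.allUpTo? (λ k → Q ℕ.* 3 ^ k ℕ.≟ weights k ℕ.* den k) 15} tt

    Q*a : ∀ k → k ℕ.< 15 → toℚ Q * a k ≡ toℚ (weights k)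
    Q*a k k<15 = scale-a Q k (weights k) (weights-correct k<15)

    0<Q : 0 ℕ.< Q
    0<Q = ℕ.z<s

  -- The first K terms of row t of Q`𝒜`, applied to norm bounds in place of series.
  rowSum : ℕ → (ℕ → ℕ) → ℕ → ℕ
  rowSum zero    F t = 0
  rowSum (suc K) F t = rowSum K F t ℕ.+ weights K ℕ.* dil 0 F (t ℕ.+ K)

  Growth : (ℕ → ℕ) → ℕ → Set
  Growth F m₀ = ∀ m → m₀ ℕ.≤ m → F m ℕ.≤ 2800 ℕ.* 4 ^ m

  private
    4^≡2^ : ∀ m → 4 ^ m ≡ 2 ^ (m ℕ.+ m)
    4^≡2^ m = trans (ℕ.^-*-assoc 2 2 m) (cong (2 ^_) (cong (m ℕ.+_) (ℕ.+-identityʳ m)))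

    dil-growth : ∀ F m₀ → Growth F m₀ → ∀ s → m₀ ℕ.+ m₀ ℕ.≤ s → dil 0 F s ℕ.≤ 2800 ℕ.* 2 ^ s
    dil-growth F m₀ g s m₀≤s = dil-elim 0 (ℕ._≤ 2800 ℕ.* 2 ^ s) z≤n F s λ m e →
      subst (λ p → F m ℕ.≤ 2800 ℕ.* p) (trans (4^≡2^ m) (cong (2 ^_) e))
        (g m (ℕ.≮⇒≥ λ m<m₀ → ℕ.<-irrefl refl (ℕ.<-≤-trans (ℕ.+-mono-< m<m₀ m<m₀)
          (ℕ.≤-trans m₀≤s (ℕ.≤-reflexive (sym e))))))

    growth-term : ∀ F m₀ → Growth F m₀ → ∀ t k → m₀ ℕ.+ m₀ ℕ.≤ t ℕ.+ k →
                  a k * toℚ (dil 0 F (t ℕ.+ k)) ≤ toℚ (2800 ℕ.* 2 ^ t) * b k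
    growth-term F m₀ g t k h = begin
      a k * toℚ (dil 0 F (t ℕ.+ k))
        ≲⟨ *-monoˡ-≤ (0≤a k) (toℚ-mono (dil-growth F m₀ g (t ℕ.+ k) h)) ⟩
      a k * toℚ (2800 ℕ.* 2 ^ (t ℕ.+ k))
        ≡⟨ cong (λ n → a k * toℚ n) (trans (cong (2800 ℕ.*_) (ℕ.^-distribˡ-+-* 2 t k)) (sym (ℕ.*-assoc 2800 (2 ^ t) (2 ^ k)))) ⟩
      a k * toℚ (2800 ℕ.* 2 ^ t ℕ.* 2 ^ k)
        ≡⟨ cong (a k *_) (toℚ-* (2800 ℕ.* 2 ^ t) (2 ^ k)) ⟩
      a k * (toℚ (2800 ℕ.* 2 ^ t) * toℚ (2 ^ k))
        ≡⟨ solve 3 (λ a x y → a :* (x :* y) := x :* (a :* y)) refl (a k) (toℚ (2800 ℕ.* 2 ^ t)) (toℚ (2 ^ k)) ⟩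
      toℚ (2800 ℕ.* 2 ^ t) * b k ∎
      where
      open ≤-Reasoning
      open Solver using (solve; _:=_; _:+_; _:*_; _:-_; :-_)

    Q-rowSum : ∀ K F t → K ℕ.≤ 15 →
               toℚ Q * sum K (λ k → a k * toℚ (dil 0 F (t ℕ.+ k))) ≡ toℚ (rowSum K F t)
    Q-rowSum zero    F t _ = trans (ℚ.*-zeroʳ (toℚ Q)) (sym toℚ-0)
    Q-rowSum (suc K) F t K<15 = begin
      toℚ Q * sum (suc K) g
        ≡⟨ cong (toℚ Q *_) (sum-last K g) ⟩
      toℚ Q * (sum K g + a K * toℚ (dil 0 F (t ℕ.+ K)))
        ≡⟨ solve 4 (λ q s a d → q :* (s :+ a :* d) := q :* s :+ (q :* a) :* d) refl (toℚ Q) (sum K g) (a K) _ ⟩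
      toℚ Q * sum K g + toℚ Q * a K * toℚ (dil 0 F (t ℕ.+ K))
        ≡⟨ cong₂ _+_ (Q-rowSum K F t (ℕ.<⇒≤ K<15)) (trans (cong (_* toℚ (dil 0 F (t ℕ.+ K))) (Q*a K K<15)) (sym (toℚ-* (weights K) _))) ⟩
      toℚ (rowSum K F t) + toℚ (weights K ℕ.* dil 0 F (t ℕ.+ K))
        ≡⟨ toℚ-+ (rowSum K F t) _ ⟨
      toℚ (rowSum (suc K) F t) ∎
      where
      open ≡-Reasoning
      open Solver using (solve; _:=_; _:+_; _:*_; _:-_; :-_)
      g : Series
      g k = a k * toℚ (dil 0 F (t ℕ.+ k))

    b15 : toℚ (2800 ℕ.* 2 ^ 7) * (b 15 + b 15) ≤ toℚ 8
    b15 = cancel-≤ {den 15} (0<den 15) (begin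
      toℚ (den 15) * (toℚ (2800 ℕ.* 2 ^ 7) * (b 15 + b 15))
        ≡⟨ solve 4 (λ d c a p → d :* (c :* (a :* p :+ a :* p)) := (c :+ c) :* p :* (d :* a)) refl
             (toℚ (den 15)) (toℚ (2800 ℕ.* 2 ^ 7)) (a 15) (toℚ (2 ^ 15)) ⟩
      (toℚ (2800 ℕ.* 2 ^ 7) + toℚ (2800 ℕ.* 2 ^ 7)) * toℚ (2 ^ 15) * (toℚ (den 15) * a 15)
        ≡⟨ cong₂ _*_ (trans (cong (_* toℚ (2 ^ 15)) (sym (toℚ-+ (2800 ℕ.* 2 ^ 7) (2800 ℕ.* 2 ^ 7)))) (sym (toℚ-* _ (2 ^ 15)))) (den*a 15) ⟩
      toℚ ((2800 ℕ.* 2 ^ 7 ℕ.+ 2800 ℕ.* 2 ^ 7) ℕ.* 2 ^ 15) * toℚ (3 ^ 15)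
        ≡⟨ toℚ-* ((2800 ℕ.* 2 ^ 7 ℕ.+ 2800 ℕ.* 2 ^ 7) ℕ.* 2 ^ 15) (3 ^ 15) ⟨
      toℚ ((2800 ℕ.* 2 ^ 7 ℕ.+ 2800 ℕ.* 2 ^ 7) ℕ.* 2 ^ 15 ℕ.* 3 ^ 15)
        ≲⟨ toℚ-mono (ℕ.≤ᵇ⇒≤ _ _ tt) ⟩
      toℚ (den 15 ℕ.* 8)
        ≡⟨ toℚ-* (den 15) 8 ⟩
      toℚ (den 15) * toℚ 8 ∎)
      where
      open ≤-Reasoning
      open Solver using (solve; _:=_; _:+_; _:*_; _:-_; :-_)

  -- The sum over k ≥ 15 is at most 2800 · 2ᵗ · 2b₁₅ ≤ 8.
  row≤ : ∀ F N t → Growth F 7 → t ℕ.≤ 7 →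
         toℚ Q * sum N (λ k → a k * toℚ (dil 0 F (t ℕ.+ k))) ≤ toℚ (rowSum 15 F t ℕ.+ Q ℕ.* 8)
  row≤ F N t g t≤7 = begin
    toℚ Q * sum N h
      ≲⟨ *-monoˡ-≤ (0≤toℚ Q) (sum-split≤ 15 N 0≤h) ⟩
    toℚ Q * (sum 15 h + sum N (λ i → h (15 ℕ.+ i)))
      ≡⟨ ℚ.*-distribˡ-+ (toℚ Q) (sum 15 h) _ ⟩
    toℚ Q * sum 15 h + toℚ Q * sum N (λ i → h (15 ℕ.+ i))
      ≲⟨ +-mono-≤ (ℚ.≤-reflexive (Q-rowSum 15 F t ℕ.≤-refl)) (*-monoˡ-≤ (0≤toℚ Q) tail≤) ⟩
    toℚ (rowSum 15 F t) + toℚ Q * toℚ 8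
      ≡⟨ trans (cong (toℚ (rowSum 15 F t) +_) (sym (toℚ-* Q 8))) (sym (toℚ-+ (rowSum 15 F t) (Q ℕ.* 8))) ⟩
    toℚ (rowSum 15 F t ℕ.+ Q ℕ.* 8) ∎
    where
    open ≤-Reasoning
    h : Series
    h k = a k * toℚ (dil 0 F (t ℕ.+ k))
    0≤h : ∀ k → 0ℚ ≤ h k
    0≤h k = 0≤-* (0≤a k) (0≤toℚ _)
    tail≤ : sum N (λ i → h (15 ℕ.+ i)) ≤ toℚ 8
    tail≤ = begin
      sum N (λ i → h (15 ℕ.+ i))
        ≲⟨ sum-mono N (λ i _ → growth-term F 7 g t (15 ℕ.+ i)
             (ℕ.≤-trans (ℕ.m≤m+n 14 (suc i)) (ℕ.≤-trans (ℕ.≤-reflexive (ℕ.+-suc 14 i)) (ℕ.m≤n+m (15 ℕ.+ i) t)))) ⟩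
      sum N (λ i → toℚ (2800 ℕ.* 2 ^ t) * b (15 ℕ.+ i))
        ≡⟨ sum-*ˡ N (toℚ (2800 ℕ.* 2 ^ t)) (λ i → b (15 ℕ.+ i)) ⟩
      toℚ (2800 ℕ.* 2 ^ t) * sum N (λ i → b (15 ℕ.+ i))
        ≲⟨ *-mono-≤ (0≤toℚ (2800 ℕ.* 2 ^ 7)) (sum-nonneg N (λ i → 0≤b (15 ℕ.+ i)))
             (toℚ-mono (ℕ.*-monoʳ-≤ 2800 (ℕ.^-monoʳ-≤ 2 t≤7))) (b-tail 15 N (ℕ.m≤m+n 5 10)) ⟩
      toℚ (2800 ℕ.* 2 ^ 7) * (b 15 + b 15)
        ≲⟨ b15 ⟩
      toℚ 8 ∎

  -- Since 4^((t + k)/2) = 2ᵗ2ᵏ, row t turns the bound 2800·4ᵐ into at most 2800·2ᵗ Σ 3ᵏ/k!, and e³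
  -- < 21 ≤ 2ᵗ for t ≥ 8.
  row-big : ∀ F N t → Growth F 4 → 8 ℕ.≤ t →
            sum N (λ k → a k * toℚ (dil 0 F (t ℕ.+ k))) ≤ toℚ (2800 ℕ.* 4 ^ t)
  row-big F N t g 8≤t = begin
    sum N (λ k → a k * toℚ (dil 0 F (t ℕ.+ k)))
      ≲⟨ sum-mono N (λ k _ → growth-term F 4 g t k (ℕ.≤-trans 8≤t (ℕ.m≤m+n t k))) ⟩
    sum N (λ k → toℚ (2800 ℕ.* 2 ^ t) * b k)
      ≡⟨ sum-*ˡ N (toℚ (2800 ℕ.* 2 ^ t)) b ⟩
    toℚ (2800 ℕ.* 2 ^ t) * sum N b
      ≲⟨ *-monoˡ-≤ (0≤toℚ (2800 ℕ.* 2 ^ t)) (ℚ.≤-trans (b-sum≤ N) (toℚ-mono (ℕ.≤-trans (ℕ.m≤m+n 21 235) (ℕ.^-monoʳ-≤ 2 8≤t)))) ⟩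
    toℚ (2800 ℕ.* 2 ^ t) * toℚ (2 ^ t)
      ≡⟨ toℚ-* (2800 ℕ.* 2 ^ t) (2 ^ t) ⟨
    toℚ (2800 ℕ.* 2 ^ t ℕ.* 2 ^ t)
      ≡⟨ cong toℚ (trans (ℕ.*-assoc 2800 (2 ^ t) (2 ^ t)) (cong (2800 ℕ.*_) (trans (sym (ℕ.^-distribˡ-+-* 2 t t)) (sym (4^≡2^ t))))) ⟩
    toℚ (2800 ℕ.* 4 ^ t) ∎
    where open ≤-Reasoning

  -- The residual of the approximate eigenvector

  v̂ : Family
  v̂ t = poly (coefficients t)

  -- Q times row t of 𝒜 applied to v̂.
  rowPoly : ℕ → Poly
  rowPoly t = comb (applyUpTo (λ k → (ℤ.+ weights k) ⊡ dil [] coefficients (t ℕ.+ k)) 15)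

  coefficients-≥8 : ∀ m → 8 ℕ.≤ m → coefficients m ≡ []
  coefficients-≥8 _ (s≤s (s≤s (s≤s (s≤s (s≤s (s≤s (s≤s (s≤s _)))))))) = refl

  Q𝒜v̂ : ∀ t n → toℚ Q * 𝒜 v̂ t n ≡ poly (rowPoly t) n
  Q𝒜v̂ t n = begin
    toℚ Q * 𝒜 v̂ t n
      ≡⟨ ad-*ˡ n (toℚ Q) _ ⟨
    ad n (λ k j → toℚ Q * (a k * dil 𝟘 v̂ (t ℕ.+ k) j))
      ≡⟨ ad-cong n (λ k j _ → trans (sym (ℚ.*-assoc (toℚ Q) (a k) _)) (trans (cong (toℚ Q * a k *_) (dil-poly (t ℕ.+ k) j)) (term k j))) ⟩
    ad n (λ k j → poly (row k) j)
      ≡⟨ comb-ad 15 row (λ k 15≤k → cong (ℤ.+ weights k ⊡_) (dil-[] (t ℕ.+ k) (ℕ.≤-trans 15≤k (ℕ.m≤n+m k t)))) n ⟩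
    poly (rowPoly t) n ∎
    where
    open ≡-Reasoning
    row : ℕ → Poly
    row k = (ℤ.+ weights k) ⊡ dil [] coefficients (t ℕ.+ k)
    P : Series → Poly → Set
    P s l = ∀ j → s j ≡ poly l j
    dil-poly : ∀ s j → dil 𝟘 v̂ s j ≡ poly (dil [] coefficients s) j
    dil-poly s = dil-rel {0A = 𝟘} {0B = []} P (λ _ → refl) {v̂} {coefficients} s (λ _ _ _ → refl)
    dil-[] : ∀ s → 15 ℕ.≤ s → dil [] coefficients s ≡ []
    dil-[] s 15≤s = dil-elim [] (_≡ []) refl coefficients s λ m e → coefficients-≥8 m
      (ℕ.≮⇒≥ λ m<8 → ℕ.<-irrefl refl (ℕ.<-≤-trans (s≤s (ℕ.+-mono-≤ (ℕ.≤-pred m<8) (ℕ.≤-pred m<8)))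
        (ℕ.≤-trans 15≤s (ℕ.≤-reflexive (sym e)))))
    term : ∀ k j → toℚ Q * a k * poly (dil [] coefficients (t ℕ.+ k)) j ≡ poly (row k) j
    term k j with k ℕ.<? 15
    ... | yes k<15 = trans (cong (_* poly (dil [] coefficients (t ℕ.+ k)) j) (trans (Q*a k k<15) (sym (int-pos (weights k)))))
                           (sym (poly-⊡ (ℤ.+ weights k) (dil [] coefficients (t ℕ.+ k)) j))
    ... | no k≮15 = trans (trans (cong (λ l → toℚ Q * a k * poly l j) empty) (ℚ.*-zeroʳ (toℚ Q * a k)))
                          (sym (cong (λ l → poly (ℤ.+ weights k ⊡ l) j) empty))
      where
      empty = dil-[] (t ℕ.+ k) (ℕ.≤-trans (ℕ.≮⇒≥ k≮15) (ℕ.m≤n+m k t))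

  -- Fixed point iteration in the rows t ≥ 3 only. Rows 1 and 2 would break it: their diagonal
  -- entries (3/2)z and (9/8)z² have norms above 1.
  iterate : ℕ → Family
  iterate (suc j) t@(suc (suc (suc _))) = 𝒜 (iterate j) t
  iterate _       t                     = v̂ t

  private
    small : ℕ → Set
    small t = height (rowPoly t ⊞ (ℤ.- ℤ.+ Q) ⊡ coefficients t) ℕ.+ (rowSum 15 errors t ℕ.+ Q ℕ.* 8) ℕ.≤ Q ℕ.* errors t

    small-3 : small 3
    small-3 = ℕ.≤ᵇ⇒≤ _ _ tt
    small-4 : small 4
    small-4 = ℕ.≤ᵇ⇒≤ _ _ tt
    small-5 : small 5
    small-5 = ℕ.≤ᵇ⇒≤ _ _ tt
    small-6 : small 6
    small-6 = ℕ.≤ᵇ⇒≤ _ _ tt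
    small-7 : small 7
    small-7 = ℕ.≤ᵇ⇒≤ _ _ tt

    growth : ∀ {F m₀} → (∀ m → 8 ℕ.≤ m → F m ≡ 2800 ℕ.* 4 ^ m) →
             (∀ {m} → m ℕ.< 8 → m₀ ℕ.≤ m → F m ℕ.≤ 2800 ℕ.* 4 ^ m) → Growth F m₀
    growth big few m m₀≤m with m ℕ.<? 8
    ... | yes m<8 = few m<8 m₀≤m
    ... | no  m≮8 = ℕ.≤-reflexive (big m (ℕ.≮⇒≥ m≮8))

    errors-≥8 : ∀ m → 8 ℕ.≤ m → errors m ≡ 2800 ℕ.* 4 ^ m
    errors-≥8 _ (s≤s (s≤s (s≤s (s≤s (s≤s (s≤s (s≤s (s≤s _)))))))) = refl

  errors-growth : Growth errors 7
  errors-growth = growth errors-≥8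
    (toWitness {a? = ℕ.allUpTo? (λ m → (7 ℕ.≤? m) →-dec (errors m ℕ.≤? 2800 ℕ.* 4 ^ m)) 8} tt)

  bounds : ℕ → ℕ
  bounds m = height (coefficients m) ℕ.+ errors m

  bounds-growth : Growth bounds 4
  bounds-growth = growth
    (λ m 8≤m → cong₂ (λ l e → height l ℕ.+ e) (coefficients-≥8 m 8≤m) (errors-≥8 m 8≤m))
    (toWitness {a? = ℕ.allUpTo? (λ m → (4 ℕ.≤? m) →-dec (bounds m ℕ.≤? 2800 ℕ.* 4 ^ m)) 8} tt)

  private
    -- The distance from the approximate eigenvector
    Δ : Family → Family
    Δ x t = x t ⊕ ⊝ v̂ t

    Δ-bounds : ∀ (x : Family) N t → ‖ Δ x t ‖ N ≤ toℚ (errors t) → ‖ x t ‖ N ≤ toℚ (bounds t)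
    Δ-bounds x N t h = begin
      ‖ x t ‖ N
        ≡⟨ ‖‖-cong N (λ n _ → solve 2 (λ x v → x := v :+ (x :- v)) refl (x t n) (v̂ t n)) ⟩
      ‖ v̂ t ⊕ Δ x t ‖ N
        ≲⟨ ‖⊕‖≤ (v̂ t) (Δ x t) N ⟩
      ‖ v̂ t ‖ N + ‖ Δ x t ‖ N
        ≲⟨ +-mono-≤ (‖poly‖≤ (coefficients t) N) h ⟩
      toℚ (height (coefficients t)) + toℚ (errors t)
        ≡⟨ toℚ-+ (height (coefficients t)) (errors t) ⟨
      toℚ (bounds t) ∎
      where
      open ≤-Reasoning
      open Solver using (solve; _:=_; _:+_; _:*_; _:-_; :-_)

    𝒜-Δ : ∀ (x : Family) t n → 𝒜 x t n ≡ 𝒜 v̂ t n + 𝒜 (Δ x) t n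
    𝒜-Δ x t n = trans (𝒜-cong t n λ k m j _ _ → solve 2 (λ x v → x := v :+ (x :- v)) refl (x m j) (v̂ m j))
      (𝒜-⊕ v̂ (Δ x) t n)
      where open Solver

    residual : ∀ t n → toℚ Q * (𝒜 v̂ t n - v̂ t n) ≡ poly (rowPoly t ⊞ (ℤ.- ℤ.+ Q) ⊡ coefficients t) n
    residual t n = sym (begin
      poly (rowPoly t ⊞ (ℤ.- ℤ.+ Q) ⊡ coefficients t) n
        ≡⟨ poly-⊞ (rowPoly t) _ n ⟩
      poly (rowPoly t) n + poly ((ℤ.- ℤ.+ Q) ⊡ coefficients t) n
        ≡⟨ cong₂ _+_ (sym (Q𝒜v̂ t n)) (trans (poly-⊡ (ℤ.- ℤ.+ Q) (coefficients t) n)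
             (cong (_* v̂ t n) (trans (int-neg (ℤ.+ Q)) (cong -_ (int-pos Q))))) ⟩
      toℚ Q * 𝒜 v̂ t n + (- toℚ Q) * v̂ t n
        ≡⟨ solve 3 (λ q a v → q :* a :+ (:- q) :* v := q :* (a :- v)) refl (toℚ Q) (𝒜 v̂ t n) (v̂ t n) ⟩
      toℚ Q * (𝒜 v̂ t n - v̂ t n) ∎)
      where
      open ≡-Reasoning
      open Solver using (solve; _:=_; _:+_; _:*_; _:-_; :-_)

    ‖Q‖ : ∀ (x : Series) N → toℚ Q * ‖ x ‖ N ≡ ‖ (λ n → toℚ Q * x n) ‖ N
    ‖Q‖ x N = sym (trans (‖scale‖ (toℚ Q) x N) (cong (_* ‖ x ‖ N) (ℚ.0≤p⇒∣p∣≡p (0≤toℚ Q))))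

    -- 𝒜 x - v̂ is the residual 𝒜 v̂ - v̂, an explicit polynomial over Q, plus 𝒜 (x - v̂), which the
    -- radii control. The inequality `small t` compares their sum with the radius.
    small-step : ∀ t → t ℕ.≤ 7 → small t → ∀ (x : Family) N → (∀ m → ‖ Δ x m ‖ N ≤ toℚ (errors m)) →
                 ‖ 𝒜 x t ⊕ ⊝ v̂ t ‖ N ≤ toℚ (errors t)
    small-step t t≤7 s x N h = cancel-≤ 0<Q (begin
      toℚ Q * ‖ 𝒜 x t ⊕ ⊝ v̂ t ‖ N
        ≡⟨ cong (toℚ Q *_) (‖‖-cong N λ n _ → trans (cong (_- v̂ t n) (𝒜-Δ x t n))
             (solve 3 (λ a b c → (a :+ b) :- c := (a :- c) :+ b) refl (𝒜 v̂ t n) (𝒜 (Δ x) t n) (v̂ t n))) ⟩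
      toℚ Q * ‖ (λ n → 𝒜 v̂ t n - v̂ t n) ⊕ 𝒜 (Δ x) t ‖ N
        ≲⟨ *-monoˡ-≤ (0≤toℚ Q) (ℚ.≤-trans (‖⊕‖≤ (λ n → 𝒜 v̂ t n - v̂ t n) (𝒜 (Δ x) t) N)
             (+-monoʳ-≤ (‖ (λ n → 𝒜 v̂ t n - v̂ t n) ‖ N) (‖𝒜‖≤ (Δ x) errors N t λ m _ → h m))) ⟩
      toℚ Q * (‖ (λ n → 𝒜 v̂ t n - v̂ t n) ‖ N + sum N (λ k → a k * toℚ (dil 0 errors (t ℕ.+ k))))
        ≡⟨ ℚ.*-distribˡ-+ (toℚ Q) _ _ ⟩
      toℚ Q * ‖ (λ n → 𝒜 v̂ t n - v̂ t n) ‖ N + toℚ Q * sum N (λ k → a k * toℚ (dil 0 errors (t ℕ.+ k)))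
        ≲⟨ +-mono-≤ (ℚ.≤-trans (ℚ.≤-reflexive (trans (‖Q‖ (λ n → 𝒜 v̂ t n - v̂ t n) N) (‖‖-cong N λ n _ → residual t n)))
                               (‖poly‖≤ (rowPoly t ⊞ (ℤ.- ℤ.+ Q) ⊡ coefficients t) N))
                    (row≤ errors N t errors-growth t≤7) ⟩
      toℚ (height (rowPoly t ⊞ (ℤ.- ℤ.+ Q) ⊡ coefficients t)) + toℚ (rowSum 15 errors t ℕ.+ Q ℕ.* 8)
        ≡⟨ toℚ-+ (height (rowPoly t ⊞ (ℤ.- ℤ.+ Q) ⊡ coefficients t)) _ ⟨
      toℚ (height (rowPoly t ⊞ (ℤ.- ℤ.+ Q) ⊡ coefficients t) ℕ.+ (rowSum 15 errors t ℕ.+ Q ℕ.* 8))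
        ≲⟨ toℚ-mono s ⟩
      toℚ (Q ℕ.* errors t)
        ≡⟨ toℚ-* Q (errors t) ⟩
      toℚ Q * toℚ (errors t) ∎)
      where
      open ≤-Reasoning
      open Solver using (solve; _:=_; _:+_; _:*_; _:-_; :-_)

    -- Here v̂ is 0, so all of 𝒜 x counts as error, and bounds for the entries themselves replace
    -- the radii.
    big-step : ∀ t → 8 ℕ.≤ t → ∀ (x : Family) N → (∀ m → ‖ Δ x m ‖ N ≤ toℚ (errors m)) →
               ‖ 𝒜 x t ⊕ ⊝ v̂ t ‖ N ≤ toℚ (errors t)
    big-step t 8≤t x N h = begin
      ‖ 𝒜 x t ⊕ ⊝ v̂ t ‖ N
        ≡⟨ ‖‖-cong N (λ n _ → trans (cong (λ l → 𝒜 x t n - poly l n) (coefficients-≥8 t 8≤t)) (ℚ.+-identityʳ (𝒜 x t n))) ⟩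
      ‖ 𝒜 x t ‖ N
        ≲⟨ ‖𝒜‖≤ x bounds N t (λ m _ → Δ-bounds x N m (h m)) ⟩
      sum N (λ k → a k * toℚ (dil 0 bounds (t ℕ.+ k)))
        ≲⟨ row-big bounds N t bounds-growth 8≤t ⟩
      toℚ (2800 ℕ.* 4 ^ t)
        ≡⟨ cong toℚ (errors-≥8 t 8≤t) ⟨
      toℚ (errors t) ∎
      where open ≤-Reasoning

    zero-step : ∀ t (x : Series) N → (∀ n → x n ≡ v̂ t n) → ‖ x ⊕ ⊝ v̂ t ‖ N ≤ toℚ (errors t)
    zero-step t x N e = ℚ.≤-trans (ℚ.≤-reflexive (trans
      (‖‖-cong N {g = poly []} λ n _ → trans (cong (_- v̂ t n) (e n)) (ℚ.+-inverseʳ (v̂ t n))) refl))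
      (ℚ.≤-trans (‖poly‖≤ [] N) (toℚ-mono z≤n))

    -- The neighbourhood given by the radii is mapped into itself. This bounds the limit without any
    -- contraction factor; convergence is a separate, coefficientwise matter.
    iterate-close : ∀ j N t → ‖ Δ (iterate j) t ‖ N ≤ toℚ (errors t)
    iterate-close zero    N t = zero-step t (v̂ t) N λ _ → refl
    iterate-close (suc j) N 0 = zero-step 0 (v̂ 0) N λ _ → refl
    iterate-close (suc j) N 1 = zero-step 1 (v̂ 1) N λ _ → refl
    iterate-close (suc j) N 2 = zero-step 2 (v̂ 2) N λ _ → refl
    iterate-close (suc j) N 3 = small-step 3 (ℕ.≤ᵇ⇒≤ _ _ tt) small-3 (iterate j) N (iterate-close j N)
    iterate-close (suc j) N 4 = small-step 4 (ℕ.≤ᵇ⇒≤ _ _ tt) small-4 (iterate j) N (iterate-close j N)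
    iterate-close (suc j) N 5 = small-step 5 (ℕ.≤ᵇ⇒≤ _ _ tt) small-5 (iterate j) N (iterate-close j N)
    iterate-close (suc j) N 6 = small-step 6 (ℕ.≤ᵇ⇒≤ _ _ tt) small-6 (iterate j) N (iterate-close j N)
    iterate-close (suc j) N 7 = small-step 7 (ℕ.≤ᵇ⇒≤ _ _ tt) small-7 (iterate j) N (iterate-close j N)
    iterate-close (suc j) N t@(suc (suc (suc (suc (suc (suc (suc (suc _)))))))) =
      big-step t (s≤s (s≤s (s≤s (s≤s (s≤s (s≤s (s≤s (s≤s z≤n)))))))) (iterate j) N (iterate-close j N)

    difference : ℕ → Family
    difference j t = iterate (suc j) t ⊕ ⊝ iterate j t

    -- Consecutive iterates agree in rows 1 and 2; this is why `𝒜-vanish` allows rows that are 0.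
    difference-step : ∀ j t n → 1 ℕ.≤ t → difference (suc j) t n ≡ 𝒜 (difference j) t n ⊎ difference (suc j) t n ≡ 0ℚ
    difference-step j 1 n _ = inj₂ (ℚ.+-inverseʳ (v̂ 1 n))
    difference-step j 2 n _ = inj₂ (ℚ.+-inverseʳ (v̂ 2 n))
    difference-step j t@(suc (suc (suc _))) n _ = inj₁ (sym (trans (𝒜-⊕ (iterate (suc j)) (λ m → ⊝ iterate j m) t n)
      (cong (𝒜 (iterate (suc j)) t n +_) (𝒜-⊝ (iterate j) t n))))

    iterate-suc : ∀ j t n → n ℕ.+ t ℕ.≤ j → iterate (suc j) t n ≡ iterate j t n
    iterate-suc j zero      n h = go j
      where
      go : ∀ j → iterate (suc j) 0 n ≡ iterate j 0 n
      go zero    = refl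
      go (suc j) = refl
    iterate-suc j t@(suc _) n h = trans
      (solve 2 (λ x y → x := y :+ (x :- y)) refl (iterate (suc j) t n) (iterate j t n))
      (trans (cong (iterate j t n +_) (𝒜-vanish difference difference-step j t n (s≤s z≤n) h)) (ℚ.+-identityʳ _))
      where open Solver

  -- The coefficientwise limit of the iterates: coefficient n of entry t no longer changes after n +
  -- t steps.
  v : Family
  v t n = iterate (n ℕ.+ t) t n

  private
    iterate-stable : ∀ {j} t n → n ℕ.+ t ℕ.≤ j → iterate j t n ≡ v t n
    iterate-stable t n = go ∘ ℕ.≤⇒≤′
      where
      go : ∀ {j} → n ℕ.+ t ℕ.≤′ j → iterate j t n ≡ v t n
      go ℕ.≤′-refl         = refl
      go (ℕ.≤′-step {j} p) = trans (iterate-suc j t n (ℕ.≤′⇒≤ p)) (go p)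

  v≈v̂ : ∀ t N → ‖ v t ⊕ ⊝ v̂ t ‖ N ≤ toℚ (errors t)
  v≈v̂ t N = ℚ.≤-trans (ℚ.≤-reflexive (‖‖-cong N λ n n<N → cong (_- v̂ t n)
    (sym (iterate-stable t n (ℕ.+-monoˡ-≤ t (ℕ.<⇒≤ n<N)))))) (iterate-close (N ℕ.+ t) N t)

  v≤bounds : ∀ t N → ‖ v t ‖ N ≤ toℚ (bounds t)
  v≤bounds t N = Δ-bounds v N t (v≈v̂ t N)

  v-0 : ∀ n → v 0 n ≡ 0ℚ
  v-0 n = trans (cong (λ j → iterate j 0 n) (ℕ.+-identityʳ n)) (go n)
    where
    go : ∀ j → iterate j 0 n ≡ 0ℚ
    go zero    = refl
    go (suc j) = refl

  v-1 : ∀ n → v 1 n ≡ 0ℚ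
  v-1 n = go (n ℕ.+ 1)
    where
    go : ∀ j → iterate j 1 n ≡ 0ℚ
    go zero    = refl
    go (suc j) = refl

  v-2 : ∀ n → v 2 n ≡ v̂ 2 n
  v-2 n = go (n ℕ.+ 2)
    where
    go : ∀ j → iterate j 2 n ≡ v̂ 2 n
    go zero    = refl
    go (suc j) = refl

  v-𝒜 : ∀ t n → v (3 ℕ.+ t) n ≡ 𝒜 v (3 ℕ.+ t) n
  v-𝒜 t n = trans (cong (λ j → iterate j (3 ℕ.+ t) n) (ℕ.+-suc n (2 ℕ.+ t)))
    (𝒜-cong (3 ℕ.+ t) n λ k m j e e′ → iterate-stable m j (begin
      j ℕ.+ m               ≤⟨ ℕ.+-monoʳ-≤ j (half≤ m k e′) ⟩
      j ℕ.+ (2 ℕ.+ t ℕ.+ k) ≡⟨ solve 3 (λ j t k → j :+ (t :+ k) := (k :+ j) :+ t) refl j (2 ℕ.+ t) k ⟩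
      (k ℕ.+ j) ℕ.+ (2 ℕ.+ t) ≡⟨ cong (ℕ._+ (2 ℕ.+ t)) e ⟩
      n ℕ.+ (2 ℕ.+ t)       ∎))
    where
    open ℕ.≤-Reasoning
    open +-*-Solver
    half≤ : ∀ m k → m ℕ.+ m ≡ 3 ℕ.+ t ℕ.+ k → m ℕ.≤ 2 ℕ.+ t ℕ.+ k
    half≤ zero    k e = z≤n
    half≤ (suc m) k e = ℕ.≤-trans (ℕ.m≤n+m (suc m) m) (ℕ.≤-reflexive (ℕ.suc-injective e))

-- The denominator D and its approximate factorisation

module PerturbedInverse where

  open import Data.Integer.Base using (ℤ)
  open import Data.List.Base using ([]; _∷_)
  open import Data.Rational.Base using (_/_)
  open import Relation.Binary.PropositionalEquality
  open NormedAlgebras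
  open Representations
  open Weights
  open MaximalCount
  open Recursion
  open Coefficients
  open Certificate
  open Verification

  private module 𝔸 = NormedAlgebraProperties ℚ-normedAlgebra
  open 𝔸
  open Shift
  open Solver using (solve; _:=_; _:+_; _:*_; _:-_; :-_; con)

  -- Entry 1 occurs in row 2 with coefficient a₀ = 1, so it is defined as what row 2 lacks. The rows
  -- t ≥ 3 refer to entries m with 2m ≥ 3 only and stay valid.
  V : Family
  V 0             = 𝟘
  V 1             = v 2 ⊕ ⊝ 𝒜 v 2
  V (suc (suc t)) = v (suc (suc t))

  -- The defect of row 1, the only row that is left.
  D : Series
  D = V 1 ⊕ ⊝ 𝒜 V 1

  private
    V₁ : Family
    V₁ 1 = V 1
    V₁ _ = 𝟘

    V-split : ∀ m n → V m n ≡ v m n + V₁ m n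
    V-split 0             n = sym (trans (ℚ.+-identityʳ (v 0 n)) (v-0 n))
    V-split 1             n = sym (trans (cong (_+ V 1 n) (v-1 n)) (ℚ.+-identityˡ (V 1 n)))
    V-split (suc (suc m)) n = sym (ℚ.+-identityʳ _)

    𝒜V : ∀ t n → 𝒜 V t n ≡ 𝒜 v t n + 𝒜 V₁ t n
    𝒜V t n = trans (𝒜-cong t n λ _ m j _ _ → V-split m j) (𝒜-⊕ v V₁ t n)

    zeros : ∀ k j → dil 𝟘 (λ _ → 𝟘) k j ≡ 0ℚ
    zeros zero          j = refl
    zeros (suc zero)    j = refl
    zeros (suc (suc k)) j = zeros k j

    dilV₁ : ∀ k j → dil 𝟘 V₁ (3 ℕ.+ k) j ≡ 0ℚ
    dilV₁ zero          j = refl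
    dilV₁ (suc zero)    j = refl
    dilV₁ (suc (suc k)) j = dilV₁-≥4 k j
      where
      dilV₁-≥4 : ∀ k j → dil 𝟘 (λ m → V₁ (suc (suc m))) (suc k) j ≡ 0ℚ
      dilV₁-≥4 zero          j = refl
      dilV₁-≥4 (suc zero)    j = refl
      dilV₁-≥4 (suc (suc k)) j = zeros (suc k) j

    𝒜V₁-2 : ∀ n → 𝒜 V₁ 2 n ≡ V 1 n
    𝒜V₁-2 n = trans (ad-first n _ λ k j → trans (cong (a (suc k) *_) (dilV₁ k j)) (ℚ.*-zeroʳ (a (suc k))))
      (trans (cong (_* V 1 n) a-0) (ℚ.*-identityˡ (V 1 n)))

    𝒜V₁-1 : ∀ n → V 1 n - 𝒜 V₁ 1 n ≡ (linear R ⊛ V 1) n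
    𝒜V₁-1 zero    = trans (cong (λ x → V 1 0 - x) (ℚ.*-zeroʳ (a 0)))
      (trans (ℚ.+-identityʳ (V 1 0)) (sym (linear-⊛-0 R (V 1))))
    𝒜V₁-1 (suc n) = trans (cong (λ x → V 1 (suc n) - x) (trans
        (cong₂ _+_ (ℚ.*-zeroʳ (a 0)) (trans
          (ad-first n _ λ k j → trans (cong (a (suc (suc k)) *_) (dilV₁ k j)) (ℚ.*-zeroʳ (a (suc (suc k)))))
          (cong (_* V 1 n) a-1)))
        (ℚ.+-identityˡ (R * V 1 n))))
      (sym (linear-⊛ R (V 1) n))
      where
      a-1 : a 1 ≡ R
      a-1 = trans (a-suc 0) (trans (cong (_* (ℤ.+ 3 / 2)) a-0) (trans (ℚ.*-identityˡ (ℤ.+ 3 / 2)) (sym R-def)))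

    V-eq : ∀ t n → 1 ℕ.≤ t → V t n ≡ (D ⊛ δ₁ t) n + 𝒜 V t n
    V-eq 1 n _ = sym (trans (cong (_+ 𝒜 V 1 n) (⊛-identityʳ D n))
      (solve 2 (λ x y → (x :- y) :+ y := x) refl (V 1 n) (𝒜 V 1 n)))
    V-eq 2 n _ = sym (trans (cong (_+ 𝒜 V 2 n) (trans (⊛-comm D 𝟘 n) (⊛-zeroˡ D n)))
      (trans (ℚ.+-identityˡ (𝒜 V 2 n)) (trans (𝒜V 2 n) (trans (cong (𝒜 v 2 n +_) (𝒜V₁-2 n))
        (solve 2 (λ x y → x :+ (y :- x) := y) refl (𝒜 v 2 n) (v 2 n))))))
    V-eq (suc (suc (suc t))) n _ = sym (trans (cong (_+ 𝒜 V (3 ℕ.+ t) n) (trans (⊛-comm D 𝟘 n) (⊛-zeroˡ D n)))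
      (trans (ℚ.+-identityˡ (𝒜 V (3 ℕ.+ t) n)) (trans (𝒜-cong (3 ℕ.+ t) n agree) (sym (v-𝒜 t n)))))
      where
      agree : ∀ k m j → k ℕ.+ j ≡ n → m ℕ.+ m ≡ 3 ℕ.+ t ℕ.+ k → V m j ≡ v m j
      agree k 1             j _ ()
      agree k (suc (suc m)) j _ _ = refl

  open Eigenvector V D (λ _ → refl) V-eq using (D⊛w)

  private
    ‖⊝‖ : ∀ (x : Series) N → ‖ ⊝ x ‖ N ≡ ‖ x ‖ N
    ‖⊝‖ x N = sum-cong N λ n _ → ℚ.∣-p∣≡∣p∣ (x n)

    V-bounds : ℕ → ℕ
    V-bounds 1 = 1850000
    V-bounds m = bounds m

    V₁-growth : Growth V-bounds 7
    V₁-growth m@(suc (suc _)) 7≤m = bounds-growth m (ℕ.≤-trans (ℕ.m≤m+n 4 3) 7≤m)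
    V₁-growth 1 (s≤s ())

    -- An inequality between numbers of units 10⁻⁵.
    row-≤ : ∀ F N t c → Growth F 7 → t ℕ.≤ 7 → rowSum 15 F t ℕ.+ Q ℕ.* 8 ℕ.≤ Q ℕ.* c →
            sum N (λ k → a k * toℚ (dil 0 F (t ℕ.+ k))) ≤ toℚ c
    row-≤ F N t c g t≤7 h = cancel-≤ {Q} ℕ.z<s
      (ℚ.≤-trans (row≤ F N t g t≤7) (ℚ.≤-trans (toℚ-mono h) (ℚ.≤-reflexive (toℚ-* Q c))))

    ‖V₁‖≤ : ∀ N → ‖ V 1 ‖ N ≤ toℚ 1850000
    ‖V₁‖≤ N = begin
      ‖ V 1 ‖ N
        ≲⟨ ‖⊕‖≤ (v 2) (⊝ 𝒜 v 2) N ⟩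
      ‖ v 2 ‖ N + ‖ ⊝ 𝒜 v 2 ‖ N
        ≲⟨ +-mono-≤ (v≤bounds 2 N) (ℚ.≤-trans (ℚ.≤-reflexive (‖⊝‖ (𝒜 v 2) N))
             (ℚ.≤-trans (‖𝒜‖≤ v bounds N 2 λ m _ → v≤bounds m N)
               (row-≤ bounds N 2 1060000 (λ m 7≤m → bounds-growth m (ℕ.≤-trans (ℕ.m≤m+n 4 3) 7≤m)) (ℕ.≤ᵇ⇒≤ _ _ tt) (ℕ.≤ᵇ⇒≤ _ _ tt)))) ⟩
      toℚ (bounds 2) + toℚ 1060000
        ≡⟨ toℚ-+ (bounds 2) 1060000 ⟨
      toℚ (bounds 2 ℕ.+ 1060000)
        ≲⟨ toℚ-mono (ℕ.≤ᵇ⇒≤ _ _ tt) ⟩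
      toℚ 1850000 ∎
      where open ≤-Reasoning

    V≤ : ∀ N m → ‖ V m ‖ N ≤ toℚ (V-bounds m)
    V≤ N 0             = ‖poly‖≤ [] N
    V≤ N 1             = ‖V₁‖≤ N
    V≤ N (suc (suc m)) = v≤bounds (suc (suc m)) N

    ‖D‖≤ : ∀ N → ‖ D ‖ N ≤ toℚ 5150000
    ‖D‖≤ N = begin
      ‖ D ‖ N
        ≲⟨ ‖⊕‖≤ (V 1) (⊝ 𝒜 V 1) N ⟩
      ‖ V 1 ‖ N + ‖ ⊝ 𝒜 V 1 ‖ N
        ≲⟨ +-mono-≤ (‖V₁‖≤ N) (ℚ.≤-trans (ℚ.≤-reflexive (‖⊝‖ (𝒜 V 1) N))
             (ℚ.≤-trans (‖𝒜‖≤ V V-bounds N 1 λ m _ → V≤ N m)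
               (row-≤ V-bounds N 1 3300000 V₁-growth (ℕ.≤ᵇ⇒≤ _ _ tt) (ℕ.≤ᵇ⇒≤ _ _ tt)))) ⟩
      toℚ 1850000 + toℚ 3300000
        ≡⟨ toℚ-+ 1850000 3300000 ⟨
      toℚ 5150000 ∎
      where open ≤-Reasoning

    Y : Series
    Y n = (D ⊛ f 1) n + 𝒜 V 0 n

    ‖Y‖≤ : ∀ N → ‖ Y ‖ N ≤ toℚ 10000000
    ‖Y‖≤ N = begin
      ‖ Y ‖ N
        ≲⟨ ‖⊕‖≤ (D ⊛ f 1) (𝒜 V 0) N ⟩
      ‖ D ⊛ f 1 ‖ N + ‖ 𝒜 V 0 ‖ N
        ≲⟨ +-mono-≤ (shifted N) (ℚ.≤-trans (‖𝒜‖≤ V V-bounds N 0 λ m _ → V≤ N m)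
             (row-≤ V-bounds N 0 2270000 V₁-growth z≤n (ℕ.≤ᵇ⇒≤ _ _ tt))) ⟩
      R * toℚ 5150000 + toℚ 2270000
        ≲⟨ subst₂ (λ x y → R * x + y ≤ toℚ 10000000) (sym (toℚ-def 5150000)) (sym (toℚ-def 2270000))
             (subst₂ (λ x y → x * (ℤ.+ 5150000 / 1) + (ℤ.+ 2270000 / 1) ≤ y) (sym R-def) (sym (toℚ-def 10000000))
               (ℚ.≤ᵇ⇒≤ tt)) ⟩
      toℚ 10000000 ∎
      where
      open ≤-Reasoning
      0≤R : 0ℚ ≤ R
      0≤R = subst (0ℚ ≤_) (sym R-def) (ℚ.≤ᵇ⇒≤ tt)
      f1-0 : (D ⊛ f 1) 0 ≡ 0ℚ
      f1-0 = trans (cong (λ u → D 0 * (u * a 0)) toℚ-0) (trans (cong (D 0 *_) (ℚ.*-zeroˡ (a 0))) (ℚ.*-zeroʳ (D 0)))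
      shifted : ∀ N → ‖ D ⊛ f 1 ‖ N ≤ R * toℚ 5150000
      shifted zero    = 0≤-* 0≤R (0≤toℚ 5150000)
      shifted (suc N) = begin
        ∣ (D ⊛ f 1) 0 ∣ + sum N (λ n → ∣ (D ⊛ f 1) (suc n) ∣)
          ≡⟨ cong₂ _+_ (cong ∣_∣ f1-0) (sum-cong N λ n _ → cong ∣_∣ (⊛-f1 D n)) ⟩
        0ℚ + ‖ (λ n → R * D n) ‖ N
          ≡⟨ trans (ℚ.+-identityˡ _) (trans (‖scale‖ R D N) (cong (_* ‖ D ‖ N) (ℚ.0≤p⇒∣p∣≡p 0≤R))) ⟩
        R * ‖ D ‖ N
          ≲⟨ *-monoˡ-≤ 0≤R (‖D‖≤ N) ⟩
        R * toℚ 5150000 ∎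

  -- D is close to 10⁵ (1 - g₀z)(1 - βz)

  β g₀ : ℚ
  β  = ℤ.+ 193 / 200
  g₀ = ℤ.+ 178901 / 100000

  private
    Δv : Family
    Δv t = v t ⊕ ⊝ v̂ t

    𝒜v : ∀ t n → 𝒜 v t n ≡ 𝒜 v̂ t n + 𝒜 Δv t n
    𝒜v t n = trans (𝒜-cong t n λ _ m j _ _ → solve 2 (λ x y → x := y :+ (x :- y)) refl (v m j) (v̂ m j))
      (𝒜-⊕ v̂ Δv t n)

    T : Series
    T = linear g₀ ⊛ linear β

    2Q : ℚ
    2Q = toℚ (2 ℕ.* Q)

    2Q-def : 2Q ≡ toℚ 2 * toℚ Q
    2Q-def = toℚ-* 2 Q

    abstract
      X : Poly
      X = ((ℤ.+ Q) ⊡ coefficients 2) ⊞ (ℤ.- ℤ.+ 1) ⊡ rowPoly 2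

      -- 2Q times the approximate value of D
      D̂ : Poly
      D̂ = ((ℤ.+ 2) ⊡ X) ⊞ (ℤ.+ 0 ∷ (ℤ.- ℤ.+ 3) ⊡ X) ⊞ (ℤ.- ℤ.+ 2) ⊡ rowPoly 1

      -- 2Q · 10⁵ (1 - g₀z)(1 - βz)
      target : Poly
      target = ℤ.+ 285665824604160000000 ∷ ℤ.- ℤ.+ 786726537618102681600 ∷ ℤ.+ 493171951284460191744 ∷ []

      int-neg-pos : ∀ n → int (ℤ.- ℤ.+ n) ≡ - toℚ n
      int-neg-pos n = trans (int-neg (ℤ.+ n)) (cong -_ (int-pos n))

      poly-X : ∀ n → poly X n ≡ toℚ Q * (v̂ 2 n - 𝒜 v̂ 2 n)
      poly-X n = begin
        poly X n
          ≡⟨ poly-⊞ ((ℤ.+ Q) ⊡ coefficients 2) ((ℤ.- ℤ.+ 1) ⊡ rowPoly 2) n ⟩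
        poly ((ℤ.+ Q) ⊡ coefficients 2) n + poly ((ℤ.- ℤ.+ 1) ⊡ rowPoly 2) n
          ≡⟨ cong₂ _+_ (trans (poly-⊡ (ℤ.+ Q) (coefficients 2) n) (cong (_* v̂ 2 n) (int-pos Q)))
               (trans (poly-⊡ (ℤ.- ℤ.+ 1) (rowPoly 2) n) (cong₂ _*_ (trans (int-neg-pos 1) (cong -_ toℚ-1)) (sym (Q𝒜v̂ 2 n)))) ⟩
        toℚ Q * v̂ 2 n + (- 1ℚ) * (toℚ Q * 𝒜 v̂ 2 n)
          ≡⟨ solve 3 (λ q x y → q :* x :+ (:- con 1ℚ) :* (q :* y) := q :* (x :- y)) refl (toℚ Q) (v̂ 2 n) (𝒜 v̂ 2 n) ⟩
        toℚ Q * (v̂ 2 n - 𝒜 v̂ 2 n) ∎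
        where open ≡-Reasoning

      2*R : toℚ 2 * R ≡ toℚ 3
      2*R = trans (cong₂ _*_ (toℚ-def 2) R-def) (sym (toℚ-def 3))

      linear-R : ∀ l n → poly (((ℤ.+ 2) ⊡ l) ⊞ (ℤ.+ 0 ∷ (ℤ.- ℤ.+ 3) ⊡ l)) n ≡ toℚ 2 * (linear R ⊛ poly l) n
      linear-R l n = trans (poly-⊞ ((ℤ.+ 2) ⊡ l) _ n) (trans
        (cong (_+ poly (ℤ.+ 0 ∷ (ℤ.- ℤ.+ 3) ⊡ l) n) (trans (poly-⊡ (ℤ.+ 2) l n) (cong (_* poly l n) (int-pos 2))))
        (go n))
        where
        go : ∀ n → toℚ 2 * poly l n + poly (ℤ.+ 0 ∷ (ℤ.- ℤ.+ 3) ⊡ l) n ≡ toℚ 2 * (linear R ⊛ poly l) n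
        go zero    = trans (cong (toℚ 2 * poly l 0 +_) int-0)
          (trans (ℚ.+-identityʳ _) (cong (toℚ 2 *_) (sym (linear-⊛-0 R (poly l)))))
        go (suc n) = trans (cong (toℚ 2 * poly l (suc n) +_) (trans (poly-⊡ (ℤ.- ℤ.+ 3) l n)
            (cong (_* poly l n) (trans (int-neg-pos 3) (cong -_ (sym 2*R))))))
          (trans (solve 4 (λ t x r y → t :* x :+ (:- (t :* r)) :* y := t :* (x :- r :* y)) refl (toℚ 2) (poly l (suc n)) R (poly l n))
            (cong (toℚ 2 *_) (sym (linear-⊛ R (poly l) n))))

      -- Entry 1 occurs in its own row as (3/2)z V 1, so D = (1 - (3/2)z) V 1 - 𝒜 v 1. Replacing v
      -- by v̂ leaves the errors of rows 2 and 1. The factor 2Q clears all denominators.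
      2Q*D : ∀ n → 2Q * D n ≡ poly D̂ n - (2Q * (linear R ⊛ 𝒜 Δv 2) n + 2Q * 𝒜 Δv 1 n)
      2Q*D n = begin
        2Q * (V 1 n - 𝒜 V 1 n)
          ≡⟨ cong (λ x → 2Q * x) (trans (cong (λ x → V 1 n - x) (𝒜V 1 n))
               (solve 3 (λ a b c → a :- (b :+ c) := (a :- c) :- b) refl (V 1 n) (𝒜 v 1 n) (𝒜 V₁ 1 n))) ⟩
        2Q * (V 1 n - 𝒜 V₁ 1 n - 𝒜 v 1 n)
          ≡⟨ cong (λ x → 2Q * x) (cong₂ _-_ (𝒜V₁-1 n) (𝒜v 1 n)) ⟩
        2Q * ((linear R ⊛ V 1) n - (𝒜 v̂ 1 n + 𝒜 Δv 1 n))
          ≡⟨ cong (λ x → 2Q * (x - (𝒜 v̂ 1 n + 𝒜 Δv 1 n))) (trans (⊛-congˡ (linear R) V₁≡ n) (trans (⊛-distribˡ (linear R) X̂ (⊝ 𝒜 Δv 2) n)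
               (cong ((linear R ⊛ X̂) n +_) (⊛-⊝ (linear R) (𝒜 Δv 2) n)))) ⟩
        2Q * ((linear R ⊛ X̂) n - (linear R ⊛ 𝒜 Δv 2) n - (𝒜 v̂ 1 n + 𝒜 Δv 1 n))
          ≡⟨ cong (_* ((linear R ⊛ X̂) n - (linear R ⊛ 𝒜 Δv 2) n - (𝒜 v̂ 1 n + 𝒜 Δv 1 n))) 2Q-def ⟩
        toℚ 2 * toℚ Q * ((linear R ⊛ X̂) n - (linear R ⊛ 𝒜 Δv 2) n - (𝒜 v̂ 1 n + 𝒜 Δv 1 n))
          ≡⟨ solve 6 (λ t q x y z w → t :* q :* (x :- y :- (z :+ w)) := t :* (q :* x) :+ (:- t) :* (q :* z) :- (t :* q :* y :+ t :* q :* w)) refl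
               (toℚ 2) (toℚ Q) ((linear R ⊛ X̂) n) ((linear R ⊛ 𝒜 Δv 2) n) (𝒜 v̂ 1 n) (𝒜 Δv 1 n) ⟩
        toℚ 2 * (toℚ Q * (linear R ⊛ X̂) n) + (- toℚ 2) * (toℚ Q * 𝒜 v̂ 1 n) - (toℚ 2 * toℚ Q * (linear R ⊛ 𝒜 Δv 2) n + toℚ 2 * toℚ Q * 𝒜 Δv 1 n)
          ≡⟨ cong₂ _-_ (sym poly-D̂) (cong₂ (λ x y → x * (linear R ⊛ 𝒜 Δv 2) n + y * 𝒜 Δv 1 n) (sym 2Q-def) (sym 2Q-def)) ⟩
        poly D̂ n - (2Q * (linear R ⊛ 𝒜 Δv 2) n + 2Q * 𝒜 Δv 1 n) ∎
        where
        open ≡-Reasoning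
        X̂ : Series
        X̂ = v̂ 2 ⊕ ⊝ 𝒜 v̂ 2
        V₁≡ : V 1 ≋ X̂ ⊕ ⊝ 𝒜 Δv 2
        V₁≡ n = trans (cong₂ _-_ (v-2 n) (𝒜v 2 n))
          (solve 3 (λ a b c → a :- (b :+ c) := (a :- b) :- c) refl (v̂ 2 n) (𝒜 v̂ 2 n) (𝒜 Δv 2 n))
        ⊛-⊝ : ∀ g h n → (g ⊛ ⊝ h) n ≡ - (g ⊛ h) n
        ⊛-⊝ g h n = trans (ad-cong n λ i j _ → sym (ℚ.neg-distribʳ-* (g i) (h j))) (ad-neg n _)
        poly-D̂ : poly D̂ n ≡ toℚ 2 * (toℚ Q * (linear R ⊛ X̂) n) + (- toℚ 2) * (toℚ Q * 𝒜 v̂ 1 n)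
        poly-D̂ = trans (poly-⊞ (((ℤ.+ 2) ⊡ X) ⊞ (ℤ.+ 0 ∷ (ℤ.- ℤ.+ 3) ⊡ X)) ((ℤ.- ℤ.+ 2) ⊡ rowPoly 1) n) (cong₂ _+_
          (trans (linear-R X n) (cong (toℚ 2 *_) (trans (⊛-congˡ (linear R) poly-X n)
            (trans (⊛-comm (linear R) _ n) (trans (⊛-scaleˡ (toℚ Q) X̂ (linear R) n) (cong (toℚ Q *_) (⊛-comm X̂ (linear R) n)))))))
          (trans (poly-⊡ (ℤ.- ℤ.+ 2) (rowPoly 1) n) (cong₂ _*_ (int-neg-pos 2) (sym (Q𝒜v̂ 1 n)))))

      poly-target : ∀ n → poly target n ≡ 2Q * (toℚ 100000 * T n)
      poly-target n = trans (go n) (cong₂ (λ x y → x * (y * T n)) (sym (toℚ-def (2 ℕ.* Q))) (sym (toℚ-def 100000)))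
        where
        go : ∀ n → poly target n ≡ (ℤ.+ (2 ℕ.* Q) / 1) * ((ℤ.+ 100000 / 1) * T n)
        go 0 = trans (trans (int-pos 285665824604160000000) (toℚ-def 285665824604160000000)) refl
        go 1 = trans (trans (int-neg-pos 786726537618102681600) (cong -_ (toℚ-def 786726537618102681600))) refl
        go 2 = trans (trans (int-pos 493171951284460191744) (toℚ-def 493171951284460191744)) refl
        go (suc (suc (suc n))) = sym (trans (cong (λ x → (ℤ.+ (2 ℕ.* Q) / 1) * ((ℤ.+ 100000 / 1) * x))
          (trans (linear-⊛ g₀ (linear β) (suc (suc n))) (cong (λ x → 0ℚ - x) (ℚ.*-zeroʳ g₀)))) refl)

      r₁ r₂ : ℕ
      r₁ = rowSum 15 errors 1 ℕ.+ Q ℕ.* 8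
      r₂ = rowSum 15 errors 2 ℕ.+ Q ℕ.* 8

      -- The coefficient 5 is 2(1 + 3/2), where 1 + 3/2 is the norm of 1 - (3/2)z, by which the
      -- error of row 2 gets multiplied. The bound 770 becomes 11/50 after division by 10⁵(1 - βz):
      -- 770·10⁻⁵·200/7 = 11/50.
      height-D̂ : height (D̂ ⊞ (ℤ.- ℤ.+ 1) ⊡ target) ℕ.+ (5 ℕ.* r₂ ℕ.+ 2 ℕ.* r₁) ℕ.≤ 2 ℕ.* Q ℕ.* 770
      height-D̂ = ℕ.≤ᵇ⇒≤ _ _ tt

      r₁-def : r₁ ≡ rowSum 15 errors 1 ℕ.+ Q ℕ.* 8
      r₁-def = refl

      r₂-def : r₂ ≡ rowSum 15 errors 2 ℕ.+ Q ℕ.* 8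
      r₂-def = refl

    ‖linear‖ : ∀ N → ‖ linear R ‖ N ≤ 1ℚ + R
    ‖linear‖ zero          = 0≤-+ 0≤1 0≤R
      where
      0≤R = subst (0ℚ ≤_) (sym R-def) (ℚ.≤ᵇ⇒≤ tt)
    ‖linear‖ (suc zero)    = +-monoʳ-≤ 1ℚ (subst (0ℚ ≤_) (sym R-def) (ℚ.≤ᵇ⇒≤ tt))
    ‖linear‖ (suc (suc N)) = +-monoʳ-≤ 1ℚ (ℚ.≤-reflexive (trans (cong₂ _+_
      (trans (ℚ.∣-p∣≡∣p∣ R) (ℚ.0≤p⇒∣p∣≡p (subst (0ℚ ≤_) (sym R-def) (ℚ.≤ᵇ⇒≤ tt)))) (zero-sum N)) (ℚ.+-identityʳ R)))
      where
      zero-sum : ∀ N → sum N (λ _ → 0ℚ) ≡ 0ℚ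
      zero-sum zero    = refl
      zero-sum (suc N) = trans (ℚ.+-identityˡ _) (zero-sum N)

    -- The excess of D over its approximation, in units 10⁻⁵
    ‖D-T‖≤ : ∀ N → ‖ D ⊕ ⊝ (λ n → toℚ 100000 * T n) ‖ N ≤ toℚ 770
    ‖D-T‖≤ N = cancel-≤ {2 ℕ.* Q} ℕ.z<s (begin
      2Q * ‖ D ⊕ ⊝ (λ n → toℚ 100000 * T n) ‖ N
        ≡⟨ trans (cong (_* ‖ D ⊕ ⊝ (λ n → toℚ 100000 * T n) ‖ N) (sym (ℚ.0≤p⇒∣p∣≡p (0≤toℚ (2 ℕ.* Q)))))
             (sym (‖scale‖ 2Q (D ⊕ ⊝ (λ n → toℚ 100000 * T n)) N)) ⟩
      ‖ (λ n → 2Q * (D n - toℚ 100000 * T n)) ‖ N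
        ≡⟨ ‖‖-cong N (λ n _ → split n) ⟩
      ‖ poly (D̂ ⊞ (ℤ.- ℤ.+ 1) ⊡ target) ⊕ (⊝ rest) ‖ N
        ≲⟨ ℚ.≤-trans (‖⊕‖≤ (poly (D̂ ⊞ (ℤ.- ℤ.+ 1) ⊡ target)) (⊝ rest) N)
             (+-mono-≤ (‖poly‖≤ (D̂ ⊞ (ℤ.- ℤ.+ 1) ⊡ target) N) (ℚ.≤-trans (ℚ.≤-reflexive (‖⊝‖ rest N)) rest≤)) ⟩
      toℚ (height (D̂ ⊞ (ℤ.- ℤ.+ 1) ⊡ target)) + toℚ (5 ℕ.* r₂ ℕ.+ 2 ℕ.* r₁)
        ≡⟨ toℚ-+ (height (D̂ ⊞ (ℤ.- ℤ.+ 1) ⊡ target)) _ ⟨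
      toℚ (height (D̂ ⊞ (ℤ.- ℤ.+ 1) ⊡ target) ℕ.+ (5 ℕ.* r₂ ℕ.+ 2 ℕ.* r₁))
        ≲⟨ toℚ-mono height-D̂ ⟩
      toℚ (2 ℕ.* Q ℕ.* 770)
        ≡⟨ toℚ-* (2 ℕ.* Q) 770 ⟩
      2Q * toℚ 770 ∎)
      where
      open ≤-Reasoning
      rest : Series
      rest n = 2Q * (linear R ⊛ 𝒜 Δv 2) n + 2Q * 𝒜 Δv 1 n
      split : ∀ n → 2Q * (D n - toℚ 100000 * T n) ≡ poly (D̂ ⊞ (ℤ.- ℤ.+ 1) ⊡ target) n - rest n
      split n = trans (solve 3 (λ q d t → q :* (d :- t) := q :* d :+ (:- con 1ℚ) :* (q :* t)) refl 2Q (D n) (toℚ 100000 * T n))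
        (trans (cong₂ _+_ (2Q*D n) (cong (λ x → (- 1ℚ) * x) (sym (poly-target n))))
        (trans (solve 3 (λ p r t → p :- r :+ t := p :+ t :- r) refl (poly D̂ n) (rest n) ((- 1ℚ) * poly target n))
          (cong (_- rest n) (sym (trans (poly-⊞ D̂ ((ℤ.- ℤ.+ 1) ⊡ target) n)
            (cong (poly D̂ n +_) (trans (poly-⊡ (ℤ.- ℤ.+ 1) target n) (cong (_* poly target n) (trans (int-neg-pos 1) (cong -_ toℚ-1))))))))))
      Q-row : ∀ t r → r ≡ rowSum 15 errors t ℕ.+ Q ℕ.* 8 → t ℕ.≤ 7 → toℚ Q * ‖ 𝒜 Δv t ‖ N ≤ toℚ r
      Q-row t r refl t≤7 = ℚ.≤-trans (*-monoˡ-≤ (0≤toℚ Q) (‖𝒜‖≤ Δv errors N t λ m _ → v≈v̂ m N)) (row≤ errors N t errors-growth t≤7)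
      scaled : ∀ x → 2Q * x ≡ toℚ 2 * (toℚ Q * x)
      scaled x = trans (cong (_* x) 2Q-def) (ℚ.*-assoc (toℚ 2) (toℚ Q) x)
      ‖2Q‖ : ∀ (x : Series) → ‖ (λ n → 2Q * x n) ‖ N ≡ toℚ 2 * (toℚ Q * ‖ x ‖ N)
      ‖2Q‖ x = trans (‖scale‖ 2Q x N) (trans (cong (_* ‖ x ‖ N) (ℚ.0≤p⇒∣p∣≡p (0≤toℚ (2 ℕ.* Q)))) (scaled (‖ x ‖ N)))
      rest≤ : ‖ rest ‖ N ≤ toℚ (5 ℕ.* r₂ ℕ.+ 2 ℕ.* r₁)
      rest≤ = begin
        ‖ rest ‖ N
          ≲⟨ ‖⊕‖≤ (λ n → 2Q * (linear R ⊛ 𝒜 Δv 2) n) (λ n → 2Q * 𝒜 Δv 1 n) N ⟩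
        ‖ (λ n → 2Q * (linear R ⊛ 𝒜 Δv 2) n) ‖ N + ‖ (λ n → 2Q * 𝒜 Δv 1 n) ‖ N
          ≡⟨ cong₂ _+_ (‖2Q‖ (linear R ⊛ 𝒜 Δv 2)) (‖2Q‖ (𝒜 Δv 1)) ⟩
        toℚ 2 * (toℚ Q * ‖ linear R ⊛ 𝒜 Δv 2 ‖ N) + toℚ 2 * (toℚ Q * ‖ 𝒜 Δv 1 ‖ N)
          ≲⟨ +-mono-≤ (*-monoˡ-≤ (0≤toℚ 2) (*-monoˡ-≤ (0≤toℚ Q) (ℚ.≤-trans (‖⊛‖≤ (linear R) (𝒜 Δv 2) N)
               (*-monoʳ-≤ (‖‖-nonneg (𝒜 Δv 2) N) (‖linear‖ N))))) (*-monoˡ-≤ (0≤toℚ 2) (Q-row 1 r₁ r₁-def (ℕ.≤ᵇ⇒≤ _ _ tt))) ⟩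
        toℚ 2 * (toℚ Q * ((1ℚ + R) * ‖ 𝒜 Δv 2 ‖ N)) + toℚ 2 * toℚ r₁
          ≡⟨ cong (_+ toℚ 2 * toℚ r₁) (solve 4 (λ t q r x → t :* (q :* ((con 1ℚ :+ r) :* x)) := (t :+ t :* r) :* (q :* x)) refl (toℚ 2) (toℚ Q) R (‖ 𝒜 Δv 2 ‖ N)) ⟩
        (toℚ 2 + toℚ 2 * R) * (toℚ Q * ‖ 𝒜 Δv 2 ‖ N) + toℚ 2 * toℚ r₁
          ≡⟨ cong (λ x → x * (toℚ Q * ‖ 𝒜 Δv 2 ‖ N) + toℚ 2 * toℚ r₁) (trans (cong (toℚ 2 +_) 2*R) (sym (toℚ-+ 2 3))) ⟩
        toℚ 5 * (toℚ Q * ‖ 𝒜 Δv 2 ‖ N) + toℚ 2 * toℚ r₁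
          ≲⟨ +-monoˡ-≤ (toℚ 2 * toℚ r₁) (*-monoˡ-≤ (0≤toℚ 5) (Q-row 2 r₂ r₂-def (ℕ.≤ᵇ⇒≤ _ _ tt))) ⟩
        toℚ 5 * toℚ r₂ + toℚ 2 * toℚ r₁
          ≡⟨ trans (cong₂ _+_ (sym (toℚ-* 5 r₂)) (sym (toℚ-* 2 r₁))) (sym (toℚ-+ (5 ℕ.* r₂) (2 ℕ.* r₁))) ⟩
        toℚ (5 ℕ.* r₂ ℕ.+ 2 ℕ.* r₁) ∎

  -- The normalised equation K ⊛ w = y

  private
    -- 10⁻⁵/(1 - βz), which cancels the second factor of D. Its zero 1/β lies just outside the unit
    -- disc, so the norm is finite, at most 10⁻⁵/(1 - β) with 1/(1 - β) = 200/7. The zero 1/g₀ of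
    -- the other factor is the pole that remains; g₀ has the first five decimals of Γ.
    B : Series
    B n = (ℤ.+ 1 / 100000) * geometric β n

    ‖B‖≤ : ∀ N → ‖ B ‖ N ≤ (ℤ.+ 1 / 100000) * (ℤ.+ 200 / 7)
    ‖B‖≤ N = ℚ.≤-trans (ℚ.≤-reflexive (‖scale‖ (ℤ.+ 1 / 100000) (geometric β) N))
      (*-monoˡ-≤ {ℤ.+ 1 / 100000} (ℚ.≤ᵇ⇒≤ tt) (‖geometric‖≤ N))
      where
      open ≤-Reasoning
      ‖geometric‖≤ : ∀ N → ‖ geometric β ‖ N ≤ ℤ.+ 200 / 7
      ‖geometric‖≤ zero    = ℚ.≤ᵇ⇒≤ tt
      ‖geometric‖≤ (suc N) = begin
        1ℚ + ‖ (λ n → β * geometric β n) ‖ N ≡⟨ cong (1ℚ +_) (‖scale‖ β (geometric β) N) ⟩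
        1ℚ + β * ‖ geometric β ‖ N           ≲⟨ +-monoʳ-≤ 1ℚ (*-monoˡ-≤ {β} (ℚ.≤ᵇ⇒≤ tt) (‖geometric‖≤ N)) ⟩
        1ℚ + β * (ℤ.+ 200 / 7)               ≡⟨⟩
        ℤ.+ 200 / 7                          ∎

  abstract
    K y : Series
    K = B ⊛ D
    y = B ⊛ Y

    K⊛w : K ⊛ w ≋ y
    K⊛w n = trans (⊛-assoc B D w n) (⊛-congˡ B D⊛w n)

    K-0 : K 0 ≡ 1ℚ
    K-0 = trans (cong (λ x → B 0 * x) D-0) refl
      where
      D-0 : D 0 ≡ ℤ.+ 100000 / 1
      D-0 = begin
        v 2 0 - a 0 * v 1 0 - a 0 * 0ℚ     ≡⟨ cong₂ _-_ (cong₂ _-_ (trans (v-2 0) (trans (int-pos 100000) (toℚ-def 100000)))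
                                                (trans (cong (a 0 *_) (v-1 0)) (ℚ.*-zeroʳ (a 0)))) (ℚ.*-zeroʳ (a 0)) ⟩
        (ℤ.+ 100000 / 1) - 0ℚ - 0ℚ         ≡⟨⟩
        ℤ.+ 100000 / 1                     ∎
        where open ≡-Reasoning

    ‖K-linear‖≤ : ∀ N → ‖ K ⊕ ⊝ linear g₀ ‖ N ≤ ℤ.+ 11 / 50
    ‖K-linear‖≤ N = begin
      ‖ K ⊕ ⊝ linear g₀ ‖ N
        ≡⟨ ‖‖-cong N (λ n _ → sym (difference n)) ⟩
      ‖ B ⊛ (D ⊕ ⊝ 10⁵T) ‖ N
        ≲⟨ ‖⊛‖≤ B (D ⊕ ⊝ 10⁵T) N ⟩
      ‖ B ‖ N * ‖ D ⊕ ⊝ 10⁵T ‖ N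
        ≲⟨ *-mono-≤ {y = (ℤ.+ 1 / 100000) * (ℤ.+ 200 / 7)} (ℚ.≤ᵇ⇒≤ tt) (‖‖-nonneg (D ⊕ ⊝ 10⁵T) N) (‖B‖≤ N) (ℚ.≤-trans (‖D-T‖≤ N) (ℚ.≤-reflexive (toℚ-def 770))) ⟩
      (ℤ.+ 1 / 100000) * (ℤ.+ 200 / 7) * (ℤ.+ 770 / 1)
        ≡⟨⟩
      ℤ.+ 11 / 50 ∎
      where
      open ≤-Reasoning
      10⁵T : Series
      10⁵T n = toℚ 100000 * T n
      B⊛10⁵T : ∀ n → (B ⊛ 10⁵T) n ≡ linear g₀ n
      B⊛10⁵T n = trans (⊛-scaleˡ (ℤ.+ 1 / 100000) (geometric β) 10⁵T n) (trans
        (cong ((ℤ.+ 1 / 100000) *_) (trans (⊛-comm (geometric β) 10⁵T n) (trans (⊛-scaleˡ (toℚ 100000) T (geometric β) n)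
          (cong₂ _*_ (toℚ-def 100000) (trans (⊛-assoc (linear g₀) (linear β) (geometric β) n)
            (trans (⊛-congˡ (linear g₀) (linear-⊛-geometric β) n) (⊛-identityʳ (linear g₀) n)))))))
        (trans (sym (ℚ.*-assoc (ℤ.+ 1 / 100000) (ℤ.+ 100000 / 1) (linear g₀ n))) (ℚ.*-identityˡ (linear g₀ n))))
      difference : ∀ n → (B ⊛ (D ⊕ ⊝ 10⁵T)) n ≡ K n - linear g₀ n
      difference n = trans (⊛-distribˡ B D (⊝ 10⁵T) n) (cong (K n +_)
        (trans (ad-cong n λ i j _ → sym (ℚ.neg-distribʳ-* (B i) (10⁵T j))) (trans (ad-neg n _) (cong -_ (B⊛10⁵T n)))))

    ‖y‖≤ : ∀ N → ‖ y ‖ N ≤ toℚ 2858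
    ‖y‖≤ N = begin
      ‖ B ⊛ Y ‖ N
        ≲⟨ ‖⊛‖≤ B Y N ⟩
      ‖ B ‖ N * ‖ Y ‖ N
        ≲⟨ *-mono-≤ {y = (ℤ.+ 1 / 100000) * (ℤ.+ 200 / 7)} (ℚ.≤ᵇ⇒≤ tt) (‖‖-nonneg Y N) (‖B‖≤ N) (ℚ.≤-trans (‖Y‖≤ N) (ℚ.≤-reflexive (toℚ-def 10000000))) ⟩
      (ℤ.+ 1 / 100000) * (ℤ.+ 200 / 7) * (ℤ.+ 10000000 / 1)
        ≲⟨ ℚ.≤ᵇ⇒≤ tt ⟩
      ℤ.+ 2858 / 1
        ≡⟨ toℚ-def 2858 ⟨
      toℚ 2858 ∎
      where open ≤-Reasoning

-- Locating the pole up to a given order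

module ApproximateGrowth where

  open import Data.Rational.Base using (½; _/_)
  open import Relation.Binary.PropositionalEquality
  open NormedAlgebras
  open Weights
  open MaximalCount hiding (width)
  open Recursion
  open PerturbedInverse

  private module 𝔸 = NormedAlgebraProperties ℚ-normedAlgebra
  open 𝔸
  open Solver using (solve; _:=_; _:+_; _:*_; _:-_; :-_; con)

  -- The sign change is kept between `left k` and `left k + gap k`. Only rational values are
  -- compared, so every step is decidable.
  module Bisection (F : ℚ → ℚ) (lo width : ℚ) (0≤width : 0ℚ ≤ width)
    (F-lo : F lo ≤ 0ℚ) (F-hi : 0ℚ ≤ F (lo + width)) where

    gap : ℕ → ℚ
    gap zero    = width
    gap (suc k) = gap k * ½

    left : ℕ → ℚ
    left zero    = lo
    left (suc k) with ℚ.≤-total (F (left k + gap (suc k))) 0ℚ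
    ... | inj₁ _ = left k + gap (suc k)
    ... | inj₂ _ = left k

    0≤gap : ∀ k → 0ℚ ≤ gap k
    0≤gap zero    = 0≤width
    0≤gap (suc k) = 0≤-* {y = ½} (0≤gap k) (ℚ.≤ᵇ⇒≤ tt)

    gap-half : ∀ k → gap (suc k) + gap (suc k) ≡ gap k
    gap-half k = trans (solve 1 (λ x → x :* con ½ :+ x :* con ½ := x) refl (gap k)) refl

    F-left : ∀ k → F (left k) ≤ 0ℚ
    F-left zero    = F-lo
    F-left (suc k) with ℚ.≤-total (F (left k + gap (suc k))) 0ℚ
    ... | inj₁ p = p
    ... | inj₂ _ = F-left k

    F-right : ∀ k → 0ℚ ≤ F (left k + gap k)
    F-right zero    = F-hi
    F-right (suc k) with ℚ.≤-total (F (left k + gap (suc k))) 0ℚ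
    ... | inj₁ _ = subst (λ x → 0ℚ ≤ F x) (trans (cong (left k +_) (sym (gap-half k))) (sym (ℚ.+-assoc (left k) _ _))) (F-right k)
    ... | inj₂ p = p

    left-mono : ∀ k → left k ≤ left (suc k)
    left-mono k with ℚ.≤-total (F (left k + gap (suc k))) 0ℚ
    ... | inj₁ _ = x≤x+y (0≤gap (suc k))
    ... | inj₂ _ = ℚ.≤-refl

    right-anti : ∀ k → left (suc k) + gap (suc k) ≤ left k + gap k
    right-anti k with ℚ.≤-total (F (left k + gap (suc k))) 0ℚ
    ... | inj₁ _ = ℚ.≤-reflexive (trans (ℚ.+-assoc (left k) _ _) (cong (left k +_) (gap-half k)))
    ... | inj₂ _ = +-monoʳ-≤ (left k) (ℚ.≤-trans (x≤x+y (0≤gap (suc k))) (ℚ.≤-reflexive (gap-half k)))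

    left-mono* : ∀ {j k} → j ℕ.≤ k → left j ≤ left k
    left-mono* = go ∘ ℕ.≤⇒≤′
      where
      go : ∀ {j k} → j ℕ.≤′ k → left j ≤ left k
      go ℕ.≤′-refl         = ℚ.≤-refl
      go (ℕ.≤′-step {k} p) = ℚ.≤-trans (go p) (left-mono k)

    right-anti* : ∀ {j k} → j ℕ.≤ k → left k + gap k ≤ left j + gap j
    right-anti* = go ∘ ℕ.≤⇒≤′
      where
      go : ∀ {j k} → j ℕ.≤′ k → left k + gap k ≤ left j + gap j
      go ℕ.≤′-refl         = ℚ.≤-refl
      go (ℕ.≤′-step {k} p) = ℚ.≤-trans (right-anti k) (go p)

    lo≤left : ∀ k → lo ≤ left k
    lo≤left k = left-mono* {0} {k} z≤n

    right≤hi : ∀ k → left k + gap k ≤ lo + width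
    right≤hi k = right-anti* {0} {k} z≤n

    left≤right : ∀ k → left k ≤ left k + gap k
    left≤right k = x≤x+y (0≤gap k)

    -- k + 1 ≤ 2ᵏ, in the form that combines with the Archimedean property.
    suc*gap : ∀ k → toℚ (suc k) * gap k ≤ width
    suc*gap zero    = ℚ.≤-reflexive (trans (cong (_* width) toℚ-1) (ℚ.*-identityˡ width))
    suc*gap (suc k) = begin
      toℚ (suc (suc k)) * gap (suc k)
        ≲⟨ *-monoʳ-≤ (0≤gap (suc k)) (toℚ-mono (s≤s (s≤s (ℕ.m≤n+m k k)))) ⟩
      toℚ (suc (suc (k ℕ.+ k))) * gap (suc k)
        ≡⟨ cong (λ m → toℚ (suc m) * gap (suc k)) (sym (ℕ.+-suc k k)) ⟩
      toℚ (suc k ℕ.+ suc k) * gap (suc k)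
        ≡⟨ cong (_* gap (suc k)) (toℚ-+ (suc k) (suc k)) ⟩
      (toℚ (suc k) + toℚ (suc k)) * (gap k * ½)
        ≡⟨ solve 2 (λ s x → (s :+ s) :* (x :* con ½) := s :* x) refl (toℚ (suc k)) (gap k) ⟩
      toℚ (suc k) * gap k
        ≲⟨ suc*gap k ⟩
      width ∎
      where open ≤-Reasoning

  archimedean-* : ∀ p ε → 0ℚ ℚ.< ε → ∃[ n ] p ≤ toℚ n * ε
  archimedean-* p ε 0<ε = n , (begin
    p               ≡⟨ ℚ.*-identityʳ p ⟨
    p * 1ℚ          ≡⟨ cong (p *_) (ℚ.*-inverseˡ ε) ⟨
    p * (1/ε * ε)   ≡⟨ ℚ.*-assoc p 1/ε ε ⟨
    p * 1/ε * ε     ≲⟨ *-monoʳ-≤ (ℚ.<⇒≤ 0<ε) (proj₂ (archimedean (p * 1/ε))) ⟩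
    toℚ n * ε       ∎)
    where
    open ≤-Reasoning
    instance
      ε≢0 = ℚ.pos⇒nonZero ε {{ℚ.positive 0<ε}}
    1/ε = ℚ.1/ ε
    n = proj₁ (archimedean (p * 1/ε))

  -- A rational zero need not exist, but a small value suffices: at the left end of a short interval
  -- with a sign change, the Lipschitz condition bounds F.
  approximate-zero : ∀ (F : ℚ → ℚ) lo width L ε → 0ℚ ≤ width → 0ℚ ≤ L → 0ℚ ℚ.< ε →
    F lo ≤ 0ℚ → 0ℚ ≤ F (lo + width) →
    (∀ x h → lo ≤ x → 0ℚ ≤ h → x + h ≤ lo + width → ∣ F (x + h) - F x ∣ ≤ L * h) →
    ∃[ x ] lo ≤ x × x ≤ lo + width × ∣ F x ∣ ≤ ε
  approximate-zero F lo width L ε 0≤width 0≤L 0<ε F-lo F-hi lip = left n , lo≤left n ,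
    ℚ.≤-trans (left≤right n) (right≤hi n) , ∣∣-least (ℚ.≤-trans (F-left n) (ℚ.<⇒≤ 0<ε)) (begin
      - F (left n)                             ≲⟨ x≤y+x (F-right n) ⟩
      F (left n + gap n) - F (left n)          ≲⟨ ≤∣∣ _ ⟩
      ∣ F (left n + gap n) - F (left n) ∣      ≲⟨ lip (left n) (gap n) (lo≤left n) (0≤gap n) (right≤hi n) ⟩
      L * gap n                                ≲⟨ ℚ.*-cancelˡ-≤-pos (toℚ (suc n)) {{ℚ.positive (0<toℚ-suc n)}} scaled ⟩
      ε                                        ∎)
    where
    open ≤-Reasoning
    open Bisection F lo width 0≤width F-lo F-hi
    n = proj₁ (archimedean-* (L * width) ε 0<ε)
    scaled : toℚ (suc n) * (L * gap n) ≤ toℚ (suc n) * ε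
    scaled = begin
      toℚ (suc n) * (L * gap n) ≡⟨ solve 3 (λ s l g → s :* (l :* g) := l :* (s :* g)) refl (toℚ (suc n)) L (gap n) ⟩
      L * (toℚ (suc n) * gap n) ≲⟨ *-monoˡ-≤ 0≤L (suc*gap n) ⟩
      L * width                 ≲⟨ proj₂ (archimedean-* (L * width) ε 0<ε) ⟩
      toℚ n * ε                 ≲⟨ *-monoʳ-≤ (ℚ.<⇒≤ 0<ε) (toℚ-mono (ℕ.n≤1+n n)) ⟩
      toℚ (suc n) * ε           ∎

  -- Splitting off the factor 1 - g z

  private
    κ : Series
    κ = K ⊕ ⊝ linear g₀

    -- The interval is g₀ ± d. At its ends the main term g - g₀ of `E-close` has absolute value d
    -- and outweighs the error, which fixes the two signs.
    d lo range : ℚ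
    d     = ℤ.+ 11 / 50
    lo    = ℤ.+ 156901 / 100000
    range = d + d

    -- K/(1 - gz). Coefficient n is gⁿ times the partial sum of K(1/g) up to order n, so it is small
    -- when 1/g is nearly a zero of the truncated K.
    E : ℚ → Series
    E g = geometric g ⊛ K

    E-suc : ∀ g n → E g (suc n) ≡ K (suc n) + g * E g n
    E-suc g n = geometric-⊛ g K n

    E-0 : ∀ g → E g 0 ≡ 1ℚ
    E-0 g = trans (cong (1ℚ *_) K-0) refl

    E-1 : ∀ g → E g 1 ≡ (g - g₀) + κ 1
    E-1 g = trans (E-suc g 0) (trans (cong (λ x → K 1 + g * x) (E-0 g))
      (solve 3 (λ k g h → k :+ g :* con 1ℚ := (g :- h) :+ (k :- (:- h))) refl (K 1) g g₀))

    E-2+ : ∀ g n → E g (suc (suc n)) ≡ g * E g (suc n) + κ (suc (suc n))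
    E-2+ g n = trans (E-suc g (suc n)) (trans (ℚ.+-comm (K (suc (suc n))) _)
      (cong (g * E g (suc n) +_) (sym (ℚ.+-identityʳ (K (suc (suc n)))))))

    -- The partial norms of κ without its (vanishing) constant term
    σ : ℕ → ℚ
    σ n = sum n (λ i → ∣ κ (suc i) ∣)

    σ≤d : ∀ n → σ n ≤ d
    σ≤d n = ℚ.≤-trans (x≤y+x (0≤∣∣ (κ 0))) (‖K-linear‖≤ (suc n))

    power : ℚ → ℕ → ℚ
    power g zero    = 1ℚ
    power g (suc n) = g * power g n

    module _ {g : ℚ} (1≤g : 1ℚ ≤ g) where

      0≤g : 0ℚ ≤ g
      0≤g = ℚ.≤-trans 0≤1 1≤g

      1≤power : ∀ n → 1ℚ ≤ power g n
      1≤power zero    = ℚ.≤-refl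
      1≤power (suc n) = ℚ.≤-trans (1≤power n) (ℚ.≤-trans (ℚ.≤-reflexive (sym (ℚ.*-identityˡ (power g n))))
        (*-monoʳ-≤ (ℚ.≤-trans 0≤1 (1≤power n)) 1≤g))

      -- For K = 1 - g₀z the coefficient would be exactly gⁿ(g - g₀). The coefficient of index i + 1
      -- of κ enters with the factor gⁿ⁻ⁱ, at most gⁿ because g ≥ 1.
      E-close : ∀ n → ∣ E g (suc n) - power g n * (g - g₀) ∣ ≤ power g n * σ (suc n)
      E-close zero    = ℚ.≤-reflexive (trans (cong (λ x → ∣ x - 1ℚ * (g - g₀) ∣) (E-1 g))
        (trans (cong ∣_∣ (solve 2 (λ x k → (x :+ k) :- con 1ℚ :* x := k) refl (g - g₀) (κ 1)))
          (solve 1 (λ x → x := con 1ℚ :* (x :+ con 0ℚ)) refl ∣ κ 1 ∣)))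
      E-close (suc n) = begin
        ∣ E g (suc (suc n)) - power g (suc n) * (g - g₀) ∣
          ≡⟨ cong ∣_∣ (trans (cong (_- power g (suc n) * (g - g₀)) (E-2+ g n))
               (solve 5 (λ g e k p x → g :* e :+ k :- g :* p :* x := g :* (e :- p :* x) :+ k) refl g (E g (suc n)) (κ (suc (suc n))) (power g n) (g - g₀))) ⟩
        ∣ g * (E g (suc n) - power g n * (g - g₀)) + κ (suc (suc n)) ∣
          ≲⟨ ∣+∣≤ (g * (E g (suc n) - power g n * (g - g₀))) (κ (suc (suc n))) ⟩
        ∣ g * (E g (suc n) - power g n * (g - g₀)) ∣ + ∣ κ (suc (suc n)) ∣
          ≲⟨ +-mono-≤ (∣*∣≤ (0≤x⇒∣x∣≈x 0≤g) (E-close n)) (ℚ.≤-trans (ℚ.≤-reflexive (sym (ℚ.*-identityˡ ∣ κ (suc (suc n)) ∣)))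
               (*-monoʳ-≤ (0≤∣∣ (κ (suc (suc n)))) (1≤power (suc n)))) ⟩
        g * (power g n * σ (suc n)) + power g (suc n) * ∣ κ (suc (suc n)) ∣
          ≡⟨ solve 4 (λ g p s k → g :* (p :* s) :+ g :* p :* k := g :* p :* (s :+ k)) refl g (power g n) (σ (suc n)) ∣ κ (suc (suc n)) ∣ ⟩
        power g (suc n) * (σ (suc n) + ∣ κ (suc (suc n)) ∣)
          ≡⟨ cong (power g (suc n) *_) (sum-last (suc n) (λ i → ∣ κ (suc i) ∣)) ⟨
        power g (suc n) * σ (suc (suc n)) ∎
        where open ≤-Reasoning

    E-lo : ∀ n → E lo (suc n) ≤ 0ℚ
    E-lo n = begin
      E lo (suc n)
        ≡⟨ solve 2 (λ e p → e := (e :- p) :+ p) refl (E lo (suc n)) (power lo n * (lo - g₀)) ⟩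
      (E lo (suc n) - power lo n * (lo - g₀)) + power lo n * (lo - g₀)
        ≲⟨ +-monoˡ-≤ (power lo n * (lo - g₀)) (ℚ.≤-trans (≤∣∣ _) (ℚ.≤-trans (E-close 1≤lo n) (*-monoˡ-≤ (ℚ.≤-trans 0≤1 (1≤power 1≤lo n)) (σ≤d (suc n))))) ⟩
      power lo n * d + power lo n * (lo - g₀)
        ≡⟨ solve 1 (λ p → p :* con d :+ p :* con (lo - g₀) := con 0ℚ) refl (power lo n) ⟩
      0ℚ ∎
      where
      open ≤-Reasoning
      1≤lo : 1ℚ ≤ lo
      1≤lo = ℚ.≤ᵇ⇒≤ tt

    E-hi : ∀ n → 0ℚ ≤ E (lo + range) (suc n)
    E-hi n = begin
      0ℚ
        ≡⟨ solve 1 (λ p → con 0ℚ := p :* con (hi - g₀) :- p :* con d) refl (power hi n) ⟩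
      power hi n * (hi - g₀) - power hi n * d
        ≲⟨ +-monoʳ-≤ (power hi n * (hi - g₀)) (-‿anti-≤ (ℚ.≤-trans (E-close 1≤hi n) (*-monoˡ-≤ (ℚ.≤-trans 0≤1 (1≤power 1≤hi n)) (σ≤d (suc n))))) ⟩
      power hi n * (hi - g₀) - ∣ E hi (suc n) - power hi n * (hi - g₀) ∣
        ≲⟨ +-monoʳ-≤ (power hi n * (hi - g₀)) (-‿anti-≤ (ℚ.≤-trans (≤∣∣ _) (ℚ.≤-reflexive (∣-∣ _)))) ⟩
      power hi n * (hi - g₀) - - (E hi (suc n) - power hi n * (hi - g₀))
        ≡⟨ solve 2 (λ e p → p :- (:- (e :- p)) := e) refl (E hi (suc n)) (power hi n * (hi - g₀)) ⟩
      E hi (suc n) ∎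
      where
      open ≤-Reasoning
      hi : ℚ
      hi = lo + range
      1≤hi : 1ℚ ≤ hi
      1≤hi = ℚ.≤ᵇ⇒≤ tt

    E-bound : ∀ n → ∃[ B ] 0ℚ ≤ B × (∀ g → 0ℚ ≤ g → g ≤ toℚ 3 → ∣ E g n ∣ ≤ B)
    E-bound zero    = 1ℚ , 0≤1 , λ g _ _ → ℚ.≤-reflexive (cong ∣_∣ (E-0 g))
    E-bound (suc n) with E-bound n
    ... | B , 0≤B , h = ∣ K (suc n) ∣ + toℚ 3 * B , 0≤-+ (0≤∣∣ (K (suc n))) (0≤-* (0≤toℚ 3) 0≤B) , λ g 0≤g g≤3 → begin
      ∣ E g (suc n) ∣                 ≡⟨ cong ∣_∣ (E-suc g n) ⟩
      ∣ K (suc n) + g * E g n ∣       ≲⟨ ∣+∣≤ (K (suc n)) (g * E g n) ⟩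
      ∣ K (suc n) ∣ + ∣ g * E g n ∣   ≲⟨ +-monoʳ-≤ ∣ K (suc n) ∣ (∣*∣≤ (ℚ.≤-trans (0≤x⇒∣x∣≈x 0≤g) g≤3) (h g 0≤g g≤3)) ⟩
      ∣ K (suc n) ∣ + toℚ 3 * B       ∎
      where open ≤-Reasoning

    -- Each coefficient is a polynomial in g. The constant may depend on n in any way, as it only
    -- influences the number of bisection steps.
    E-Lipschitz : ∀ n → ∃[ L ] 0ℚ ≤ L × (∀ g h → 0ℚ ≤ g → 0ℚ ≤ h → g + h ≤ toℚ 3 → ∣ E (g + h) n - E g n ∣ ≤ L * h)
    E-Lipschitz zero    = 0ℚ , ℚ.≤-refl , λ g h _ _ _ → ℚ.≤-reflexive
      (trans (cong₂ (λ x y → ∣ x - y ∣) (E-0 (g + h)) (E-0 g)) (sym (ℚ.*-zeroˡ h)))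
    E-Lipschitz (suc n) with E-Lipschitz n | E-bound n
    ... | L , 0≤L , lip | B , 0≤B , bound = toℚ 3 * L + B , 0≤-+ (0≤-* (0≤toℚ 3) 0≤L) 0≤B , λ g h 0≤g 0≤h g+h≤3 → begin
      ∣ E (g + h) (suc n) - E g (suc n) ∣
        ≡⟨ cong ∣_∣ (trans (cong₂ _-_ (E-suc (g + h) n) (E-suc g n))
             (solve 5 (λ k g h x y → (k :+ (g :+ h) :* x) :- (k :+ g :* y) := (g :+ h) :* (x :- y) :+ h :* y) refl (K (suc n)) g h (E (g + h) n) (E g n))) ⟩
      ∣ (g + h) * (E (g + h) n - E g n) + h * E g n ∣
        ≲⟨ ∣+∣≤ ((g + h) * (E (g + h) n - E g n)) (h * E g n) ⟩
      ∣ (g + h) * (E (g + h) n - E g n) ∣ + ∣ h * E g n ∣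
        ≲⟨ +-mono-≤ (∣*∣≤ (ℚ.≤-trans (0≤x⇒∣x∣≈x (0≤-+ 0≤g 0≤h)) g+h≤3) (lip g h 0≤g 0≤h g+h≤3))
             (∣*∣≤ (0≤x⇒∣x∣≈x 0≤h) (bound g 0≤g (ℚ.≤-trans (x≤x+y 0≤h) g+h≤3))) ⟩
      toℚ 3 * (L * h) + h * B
        ≡⟨ solve 4 (λ t l h b → t :* (l :* h) :+ h :* b := (t :* l :+ b) :* h) refl (toℚ 3) L h B ⟩
      (toℚ 3 * L + B) * h ∎
      where open ≤-Reasoning

    hi≤3 : lo + range ≤ toℚ 3
    hi≤3 = ℚ.≤-trans (ℚ.≤ᵇ⇒≤ tt) (ℚ.≤-reflexive (sym (toℚ-def 3)))

    0≤lo : 0ℚ ≤ lo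
    0≤lo = ℚ.≤ᵇ⇒≤ tt

    zero-of-E : ∀ n → ∃[ g ] lo ≤ g × g ≤ lo + range × ∣ E g (suc n) ∣ ≤ ℤ.+ 1 / 100
    zero-of-E n = from (E-Lipschitz (suc n))
      where
      from : ∃[ L ] 0ℚ ≤ L × (∀ g h → 0ℚ ≤ g → 0ℚ ≤ h → g + h ≤ toℚ 3 → ∣ E (g + h) (suc n) - E g (suc n) ∣ ≤ L * h) →
             ∃[ g ] lo ≤ g × g ≤ lo + range × ∣ E g (suc n) ∣ ≤ ℤ.+ 1 / 100
      from (L , 0≤L , lip) = approximate-zero (λ g → E g (suc n)) lo range L (ℤ.+ 1 / 100)
        (ℚ.≤ᵇ⇒≤ tt) 0≤L (ℚ.positive⁻¹ (ℤ.+ 1 / 100)) (E-lo n) (E-hi n)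
        λ x h lo≤x 0≤h x+h≤hi → lip x h (ℚ.≤-trans 0≤lo lo≤x) 0≤h (ℚ.≤-trans x+h≤hi hi≤3)

    -- If 1 - g z nearly divides K up to order n, the quotient is close to 1.
    ‖E-1‖≤ : ∀ g n → lo ≤ g → ∣ E g (suc n) ∣ ≤ ℤ.+ 1 / 100 → ‖ E g ∘ suc ‖ (suc n) ≤ ℤ.+ 21 / 50
    ‖E-1‖≤ g n lo≤g small = begin
      ‖ e ‖ (suc n)                     ≡⟨ sum-last n (λ i → ∣ e i ∣) ⟩
      ‖ e ‖ n + ∣ e n ∣                 ≲⟨ +-mono-≤ ‖e‖≤ small ⟩
      (ℤ.+ 41 / 100) + (ℤ.+ 1 / 100)    ≡⟨⟩
      ℤ.+ 21 / 50                       ∎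
      where
      open ≤-Reasoning
      e : Series
      e = E g ∘ suc
      ‖κ‖≤ : ‖ (λ i → κ (suc (suc i))) ‖ n ≤ d
      ‖κ‖≤ = ℚ.≤-trans (x≤y+x (0≤∣∣ (κ 1))) (σ≤d (suc n))
      ‖e‖≤ : ‖ e ‖ n ≤ ℤ.+ 41 / 100
      ‖e‖≤ = ℚ.*-cancelˡ-≤-pos (lo - 1ℚ) (begin
        (lo - 1ℚ) * ‖ e ‖ n
          ≲⟨ *-monoʳ-≤ (‖‖-nonneg e n) (+-monoˡ-≤ (- 1ℚ) lo≤g) ⟩
        (g - 1ℚ) * ‖ e ‖ n
          ≡⟨ solve 2 (λ g x → (g :- con 1ℚ) :* x := g :* x :- x) refl g (‖ e ‖ n) ⟩
        g * ‖ e ‖ n - ‖ e ‖ n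
          ≲⟨ +-monoˡ-≤ (- ‖ e ‖ n) (backward e (λ i → κ (suc (suc i))) (ℚ.≤-trans 0≤lo lo≤g) (E-2+ g) n) ⟩
        ‖ e ‖ n + (∣ e n ∣ + ‖ (λ i → κ (suc (suc i))) ‖ n) - ‖ e ‖ n
          ≡⟨ solve 2 (λ x y → x :+ y :- x := y) refl (‖ e ‖ n) (∣ e n ∣ + ‖ (λ i → κ (suc (suc i))) ‖ n) ⟩
        ∣ e n ∣ + ‖ (λ i → κ (suc (suc i))) ‖ n
          ≲⟨ +-mono-≤ small ‖κ‖≤ ⟩
        (ℤ.+ 1 / 100) + d
          ≲⟨ ℚ.≤ᵇ⇒≤ tt ⟩
        (lo - 1ℚ) * (ℤ.+ 41 / 100) ∎)

    -- The factors 1/(1 - gz) and 1 - gz cancel, which leaves K w.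
    E⊛u : ∀ g → E g ⊛ (linear g ⊛ w) ≋ y
    E⊛u g n = begin
      ((geometric g ⊛ K) ⊛ (linear g ⊛ w)) n ≡⟨ ⊛-congʳ (linear g ⊛ w) (⊛-comm (geometric g) K) n ⟩
      ((K ⊛ geometric g) ⊛ (linear g ⊛ w)) n ≡⟨ ⊛-assoc K (geometric g) (linear g ⊛ w) n ⟩
      (K ⊛ (geometric g ⊛ (linear g ⊛ w))) n ≡⟨ ⊛-congˡ K (geometric-linear-cancel g w) n ⟩
      (K ⊛ w) n                              ≡⟨ K⊛w n ⟩
      y n                                    ∎
      where open ≡-Reasoning

  g-low g-high : ℚ
  g-low  = lo
  g-high = lo + range

  -- Up to any order n, w is a solution of w (i + 1) = g w i + u i with a
  -- bounded u: the factor 1 - g z removes the dominant singularity.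
  approximate-ratio : ∀ n → ∃[ g ] g-low ≤ g × g ≤ g-high × ‖ linear g ⊛ w ‖ (suc (suc n)) ≤ toℚ 5000
  approximate-ratio n = g , lo≤g , g≤hi , ℚ.*-cancelˡ-≤-pos (ℤ.+ 29 / 50) (begin
      (ℤ.+ 29 / 50) * ‖ u ‖ N
        ≡⟨ solve 1 (λ x → con (ℤ.+ 29 / 50) :* x := x :- con (ℤ.+ 21 / 50) :* x) refl (‖ u ‖ N) ⟩
      ‖ u ‖ N - (ℤ.+ 21 / 50) * ‖ u ‖ N
        ≲⟨ +-monoˡ-≤ (- ((ℤ.+ 21 / 50) * ‖ u ‖ N)) ‖u‖≤ ⟩
      ‖ y ‖ N + (ℤ.+ 21 / 50) * ‖ u ‖ N - (ℤ.+ 21 / 50) * ‖ u ‖ N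
        ≡⟨ solve 2 (λ x y → x :+ y :- y := x) refl (‖ y ‖ N) ((ℤ.+ 21 / 50) * ‖ u ‖ N) ⟩
      ‖ y ‖ N
        ≲⟨ ‖y‖≤ N ⟩
      toℚ 2858
        ≲⟨ subst₂ (λ x y → x ≤ (ℤ.+ 29 / 50) * y) (sym (toℚ-def 2858)) (sym (toℚ-def 5000)) (ℚ.≤ᵇ⇒≤ tt) ⟩
      (ℤ.+ 29 / 50) * toℚ 5000 ∎)
    where
    open ≤-Reasoning
    g     = proj₁ (zero-of-E n)
    lo≤g  = proj₁ (proj₂ (zero-of-E n))
    g≤hi  = proj₁ (proj₂ (proj₂ (zero-of-E n)))
    small = proj₂ (proj₂ (proj₂ (zero-of-E n)))
    N = suc (suc n)
    u e⁺ : Series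
    u = linear g ⊛ w
    e⁺ zero    = 0ℚ
    e⁺ (suc i) = E g (suc i)
    E-split : E g ≋ 𝟙 ⊕ e⁺
    E-split zero    = trans (E-0 g) (sym (ℚ.+-identityʳ 1ℚ))
    E-split (suc i) = sym (ℚ.+-identityˡ (E g (suc i)))
    u-eq : ∀ i → u i ≡ y i + (⊝ (e⁺ ⊛ u)) i
    u-eq i = trans (solve 2 (λ u e → u := (u :+ e) :- e) refl (u i) ((e⁺ ⊛ u) i)) (cong (_- (e⁺ ⊛ u) i)
      (trans (cong (_+ (e⁺ ⊛ u) i) (sym (⊛-identityˡ u i)))
        (trans (sym (⊛-distribʳ u 𝟙 e⁺ i)) (trans (sym (⊛-congʳ u E-split i)) (E⊛u g i)))))
    -- From u = y - (E - 1)u with E - 1 of norm at most 21/50 up to this order; the bound is 2858/(1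
    -- - 21/50) < 5000.
    ‖u‖≤ : ‖ u ‖ N ≤ ‖ y ‖ N + (ℤ.+ 21 / 50) * ‖ u ‖ N
    ‖u‖≤ = begin
      ‖ u ‖ N                             ≡⟨ ‖‖-cong N (λ i _ → u-eq i) ⟩
      ‖ y ⊕ ⊝ (e⁺ ⊛ u) ‖ N                ≲⟨ ‖⊕‖≤ y (⊝ (e⁺ ⊛ u)) N ⟩
      ‖ y ‖ N + ‖ ⊝ (e⁺ ⊛ u) ‖ N          ≡⟨ cong (‖ y ‖ N +_) (sum-cong N λ i _ → ℚ.∣-p∣≡∣p∣ ((e⁺ ⊛ u) i)) ⟩
      ‖ y ‖ N + ‖ e⁺ ⊛ u ‖ N              ≲⟨ +-monoʳ-≤ (‖ y ‖ N) (ℚ.≤-trans (‖⊛‖≤ e⁺ u N) (*-monoʳ-≤ (‖‖-nonneg u N)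
                                               (ℚ.≤-trans (ℚ.≤-reflexive (ℚ.+-identityˡ (‖ E g ∘ suc ‖ (suc n)))) (‖E-1‖≤ g n lo≤g small)))) ⟩
      ‖ y ‖ N + (ℤ.+ 21 / 50) * ‖ u ‖ N   ∎

-- Exact computation of two coefficients of w

module ExactValues where

  open import Data.List.Base using (List; []; _∷_; zipWith; map; replicate)
  open import Data.Nat.Base
  open import Data.Nat.Properties
  open import Data.Nat.Solver using (module +-*-Solver)
  open import Relation.Binary.PropositionalEquality
  open NormedAlgebras
  open Representations
  open Weights
  open MaximalCount using (w; w-def; 𝒜)
  open Recursion using (G; G-0; G-step; f-2^; δ₁)
  open Shift 0

  -- The integers behind G

  δ : ℕ → ℕ → ℕ
  δ zero zero = 1
  δ _    _    = 0

  tree : ℕ → ℕ → ℕ → ℕ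
  tree zero    t       n = 0
  tree (suc b) zero    n = 0
  tree (suc b) (suc t) n = δ t n + binomialSum n (λ k j → dil (λ m → tree b m j) (suc t + k))

  binomialSum-cong′ : ∀ n {g h} → (∀ k j → k + j ≡ n → g k j ≡ h k j) → binomialSum n g ≡ binomialSum n h
  binomialSum-cong′ zero    e = e 0 0 refl
  binomialSum-cong′ (suc n) e = cong₂ _+_ (binomialSum-cong′ n λ k j p → e (suc k) j (cong suc p))
                                          (binomialSum-cong′ n λ k j p → e k (suc j) (trans (+-suc k j) (cong suc p)))

  dil-cong⁼ : ∀ {x y : ℕ → ℕ} s → (∀ m → m + m ≡ s → x m ≡ y m) → dil x s ≡ dil y s
  dil-cong⁼ zero          h = h 0 refl
  dil-cong⁼ (suc zero)    h = refl
  dil-cong⁼ (suc (suc s)) h = dil-cong⁼ s λ m e → h (suc m) (cong suc (trans (+-suc m m) (cong suc e)))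

  -- The integer counterpart of `𝒜-vanish`: passing from (t, n) to (m, j) lowers n + t, so depth n +
  -- t is enough.
  tree-suc : ∀ b t n → n + t ≤ b → tree (suc b) t n ≡ tree b t n
  tree-suc zero    zero    n h = refl
  tree-suc zero    (suc t) n h with () ← ≤-trans (m≤n+m (suc t) n) h
  tree-suc (suc b) zero    n h = refl
  tree-suc (suc b) (suc t) n h = cong (δ t n +_) (binomialSum-cong′ n λ k j e → dil-cong⁼ (suc t + k) λ m e′ →
    tree-suc b m j (≤-pred (≤-trans (descend k j m e e′) h)))
    where
    open ≤-Reasoning
    open +-*-Solver
    descend : ∀ k j m → k + j ≡ n → m + m ≡ suc t + k → suc (j + m) ≤ n + suc t
    descend k j (suc m) e e′ = begin
      suc (j + suc m)       ≤⟨ s≤s (+-monoʳ-≤ j (m≤n+m (suc m) m)) ⟩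
      suc (j + (m + suc m)) ≡⟨ +-suc j (m + suc m) ⟨
      j + (suc m + suc m)   ≡⟨ cong (j +_) e′ ⟩
      j + (suc t + k)       ≡⟨ solve 3 (λ j t k → j :+ (t :+ k) := (k :+ j) :+ t) refl j (suc t) k ⟩
      k + j + suc t         ≡⟨ cong (_+ suc t) e ⟩
      n + suc t             ∎

  trees : ℕ → ℕ → ℕ
  trees n t = tree (n + t) t n

  tree-stable : ∀ {b} t n → n + t ≤ b → tree b t n ≡ trees n t
  tree-stable t n = go ∘ ≤⇒≤′
    where
    go : ∀ {b} → n + t ≤′ b → tree b t n ≡ trees n t
    go ≤′-refl         = refl
    go (≤′-step {b} p) = trans (tree-suc b t n (≤′⇒≤ p)) (go p)

  -- Σ C(i, k) dil (trees (j + i - k)) (s + k), arranged as a Pascal triangle whose entries are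
  -- whole sequences in s, so that they can be shared.
  pascal : ℕ → ℕ → ℕ → ℕ
  pascal zero    j s = dil (trees j) s
  pascal (suc i) j s = pascal i j (suc s) + pascal i (suc j) s

  pascal-binomialSum : ∀ n j s → pascal n j s ≡ binomialSum n (λ k i → dil (trees (j + i)) (s + k))
  pascal-binomialSum zero    j s = sym (cong₂ (λ i k → dil (trees i) k) (+-identityʳ j) (+-identityʳ s))
  pascal-binomialSum (suc n) j s = cong₂ _+_
    (trans (pascal-binomialSum n j (suc s)) (binomialSum-cong n λ k i → cong (dil (trees (j + i))) (sym (+-suc s k))))
    (trans (pascal-binomialSum n (suc j) s) (binomialSum-cong n λ k i → cong (λ m → dil (trees m) (s + k)) (sym (+-suc j i))))

  trees-pascal : ∀ n t → trees n (suc t) ≡ δ t n + pascal n 0 (suc t)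
  trees-pascal n t = trans (cong (λ b → tree b (suc t) n) (+-suc n t)) (cong (δ t n +_) (trans
    (binomialSum-cong′ n λ k j e → dil-cong⁼ (suc t + k) λ m e′ → tree-stable m j (bound k j m e e′))
    (sym (pascal-binomialSum n 0 (suc t)))))
    where
    open ≤-Reasoning
    open +-*-Solver
    half : ∀ k m → m + m ≡ suc t + k → m ≤ t + k
    half k zero    _  = z≤n
    half k (suc m) e′ = ≤-trans (m≤n+m (suc m) m) (≤-reflexive (suc-injective e′))
    bound : ∀ k j m → k + j ≡ n → m + m ≡ suc t + k → j + m ≤ n + t
    bound k j m e e′ = begin
      j + m       ≤⟨ +-monoʳ-≤ j (half k m e′) ⟩
      j + (t + k) ≡⟨ solve 3 (λ j t k → j :+ (t :+ k) := (k :+ j) :+ t) refl j t k ⟩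
      k + j + t   ≡⟨ cong (_+ t) e ⟩
      n + t       ∎

  -- Memoised computation

  -- Verified initial terms of a sequence. The length is not recorded: combining lists of different
  -- lengths yields a shorter but still correct prefix.
  data Prefix : List ℕ → (ℕ → ℕ) → Set where
    []  : ∀ {x} → Prefix [] x
    _∷_ : ∀ {x c l} → c ≡ x 0 → Prefix l (x ∘ suc) → Prefix (c ∷ l) x

  dilate : List ℕ → List ℕ
  dilate []      = []
  dilate (c ∷ l) = c ∷ 0 ∷ dilate l

  drop₁ : List ℕ → List ℕ
  drop₁ []      = []
  drop₁ (_ ∷ l) = l

  zero-first : List ℕ → List ℕ
  zero-first []      = []
  zero-first (_ ∷ l) = 0 ∷ l

  add-lists : List ℕ → List ℕ → List ℕ
  add-lists = zipWith _+_

  Prefix-+ : ∀ {l m x y} → Prefix l x → Prefix m y → Prefix (add-lists l m) (λ s → x s + y s)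
  Prefix-+ []      _       = []
  Prefix-+ (_ ∷ _) []      = []
  Prefix-+ (e ∷ p) (f ∷ q) = cong₂ _+_ e f ∷ Prefix-+ p q

  Prefix-≡ : ∀ {l x y} → (∀ s → x s ≡ y s) → Prefix l x → Prefix l y
  Prefix-≡ h []      = []
  Prefix-≡ h (e ∷ p) = trans e (h 0) ∷ Prefix-≡ (h ∘ suc) p

  Prefix-drop₁ : ∀ {l x} → Prefix l x → Prefix (drop₁ l) (x ∘ suc)
  Prefix-drop₁ []      = []
  Prefix-drop₁ (_ ∷ p) = p

  Prefix-dilate : ∀ {l x} → Prefix l x → Prefix (dilate l) (dil x)
  Prefix-dilate []      = []
  Prefix-dilate (e ∷ p) = e ∷ refl ∷ Prefix-dilate p

  Prefix-zeros : ∀ n → Prefix (replicate n 0) (λ _ → 0)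
  Prefix-zeros zero    = []
  Prefix-zeros (suc n) = refl ∷ Prefix-zeros n

  -- The solution of x = r + dil x: each pass doubles the number of known terms.
  resolve : ℕ → List ℕ → List ℕ
  resolve zero    r = 0 ∷ []
  resolve (suc i) r = add-lists r (dilate (resolve i r))

  Prefix-resolve : ∀ {r x ρ} i → x 0 ≡ 0 → (∀ s → ρ s + dil x s ≡ x s) → Prefix r ρ → Prefix (resolve i r) x
  Prefix-resolve zero    e h p = sym e ∷ []
  Prefix-resolve (suc i) e h p = Prefix-≡ h (Prefix-+ p (Prefix-dilate (Prefix-resolve i e h p)))

  -- Prefixes of pascal i j, pascal (i + 1) (j - 1), …, pascal (i + j) 0
  data Diagonal : ℕ → ℕ → List (List ℕ) → Set where
    [_] : ∀ {i l} → Prefix l (pascal i 0) → Diagonal i 0 (l ∷ [])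
    _∷_ : ∀ {i j l ls} → Prefix l (pascal i (suc j)) → Diagonal (suc i) j ls → Diagonal i (suc j) (l ∷ ls)

  -- pascal i j without the contribution of trees (i + j)
  lower : ℕ → ℕ → ℕ → ℕ
  lower zero    j s = 0
  lower (suc i) j s = pascal i j (suc s) + lower i (suc j) s

  pascal-lower : ∀ i j s → pascal i j s ≡ lower i j s + dil (trees (i + j)) s
  pascal-lower zero    j s = refl
  pascal-lower (suc i) j s = trans (cong (pascal i j (suc s) +_) (trans (pascal-lower i (suc j) s)
    (cong (λ m → lower i (suc j) s + dil (trees m) s) (+-suc i j))))
    (sym (+-assoc (pascal i j (suc s)) _ _))

  data Lower : ℕ → ℕ → List (List ℕ) → Set where
    [_] : ∀ {i l} → Prefix l (lower i 0) → Lower i 0 (l ∷ [])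
    _∷_ : ∀ {i j l ls} → Prefix l (lower i (suc j)) → Lower (suc i) j ls → Lower i (suc j) (l ∷ ls)

  scan : List ℕ → List (List ℕ) → List (List ℕ)
  scan acc []       = acc ∷ []
  scan acc (l ∷ ls) = acc ∷ scan (add-lists (drop₁ l) acc) ls

  -- The recursion for `lower` moves along an antidiagonal and needs, besides its predecessor there,
  -- only the previous antidiagonal of `pascal`.
  Lower-scan : ∀ {i j acc ls} → Prefix acc (lower i (suc j)) → Diagonal i j ls → Lower i (suc j) (scan acc ls)
  Lower-scan p [ q ]   = p ∷ [ Prefix-+ (Prefix-drop₁ q) p ]
  Lower-scan p (q ∷ d) = p ∷ Lower-scan (Prefix-+ (Prefix-drop₁ q) p) d

  last-list : List (List ℕ) → List ℕ
  last-list []             = []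
  last-list (l ∷ [])       = l
  last-list (_ ∷ l ∷ ls) = last-list (l ∷ ls)

  private
    reindex : ∀ (x : ℕ → ℕ → ℕ) {l m n} → m ≡ n → Prefix l (x m) → Prefix l (x n)
    reindex x refl p = p

  Lower-last : ∀ {i j ls} → Lower i j ls → Prefix (last-list ls) (lower (i + j) 0)
  Lower-last {i}         [ p ]              = reindex (λ m → lower m 0) (sym (+-identityʳ i)) p
  Lower-last {i} {suc j} (_ ∷ d@([ _ ]))    = reindex (λ m → lower m 0) (sym (+-suc i j)) (Lower-last d)
  Lower-last {i} {suc j} (_ ∷ d@(_ ∷ _))    = reindex (λ m → lower m 0) (sym (+-suc i j)) (Lower-last d)

  Diagonal-last : ∀ {i j ls} → Diagonal i j ls → Prefix (last-list ls) (pascal (i + j) 0)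
  Diagonal-last {i}         [ p ]           = reindex (λ m → pascal m 0) (sym (+-identityʳ i)) p
  Diagonal-last {i} {suc j} (_ ∷ d@([ _ ])) = reindex (λ m → pascal m 0) (sym (+-suc i j)) (Diagonal-last d)
  Diagonal-last {i} {suc j} (_ ∷ d@(_ ∷ _)) = reindex (λ m → pascal m 0) (sym (+-suc i j)) (Diagonal-last d)

  Diagonal-map : ∀ {i j t ls} → Prefix t (trees (i + j)) → Lower i j ls → Diagonal i j (map (λ l → add-lists l (dilate t)) ls)
  Diagonal-map {i} {zero} p [ q ]   = [ Prefix-≡ (λ s → sym (pascal-lower i 0 s)) (Prefix-+ q (Prefix-dilate p)) ]
  Diagonal-map {i} {suc j} {t} p (q ∷ d) =
    Prefix-≡ (λ s → sym (pascal-lower i (suc j) s)) (Prefix-+ q (Prefix-dilate p))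
    ∷ Diagonal-map (subst (λ m → Prefix t (trees m)) (+-suc i j) p) d

  -- The next antidiagonal. All but the contribution of the new sequence `trees (n + 1)` comes from
  -- the previous one; the last entry then states an equation x = r + dil x for that sequence, and
  -- its dilation is added to every entry.
  step : List (List ℕ) → List (List ℕ)
  step ls = map (λ l → add-lists l (dilate t)) ms
    where
    -- Long enough not to shorten any prefix that occurs; likewise the seven passes of `resolve`
    -- provide up to 128 terms.
    ms = scan (replicate 200 0) ls
    t  = resolve 7 (zero-first (last-list ms))

  trees-0 : ∀ n → trees n 0 ≡ 0
  trees-0 n with n + 0
  ... | zero  = refl
  ... | suc _ = refl

  Diagonal-step : ∀ {n ls} → Diagonal 0 n ls → Diagonal 0 (suc n) (step ls)
  Diagonal-step {n} {ls} d = Diagonal-map t-prefix ms-lower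
    where
    ms-lower : Lower 0 (suc n) (scan (replicate 200 0) ls)
    ms-lower = Lower-scan (Prefix-zeros 200) d
    ρ : ℕ → ℕ
    ρ zero    = 0
    ρ (suc s) = lower (suc n) 0 (suc s)
    zeroed : ∀ {l} → Prefix l (lower (suc n) 0) → Prefix (zero-first l) ρ
    zeroed []      = []
    zeroed (_ ∷ p) = refl ∷ p
    equation : ∀ s → ρ s + dil (trees (suc n)) s ≡ trees (suc n) s
    equation zero    = refl
    equation (suc s) = sym (trans (trees-pascal (suc n) s) (trans (cong (_+ pascal (suc n) 0 (suc s)) (δ-suc s))
      (trans (pascal-lower (suc n) 0 (suc s)) (cong (λ m → lower (suc n) 0 (suc s) + dil (trees m) (suc s)) (+-identityʳ (suc n))))))
      where
      δ-suc : ∀ s → δ s (suc n) ≡ 0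
      δ-suc zero    = refl
      δ-suc (suc s) = refl
    t-prefix : Prefix (resolve 7 (zero-first (last-list (scan (replicate 200 0) ls)))) (trees (suc n))
    t-prefix = Prefix-resolve 7 (trees-0 (suc n)) equation (zeroed (Lower-last ms-lower))

  -- Every step loses one term at the end of the antidiagonal, so the initial prefix has to be
  -- longer than the order that is aimed at.
  start : ℕ → List (List ℕ)
  start n = dilate (resolve 7 (0 ∷ 1 ∷ replicate n 0)) ∷ []

  Diagonal-start : ∀ n → Diagonal 0 0 (start n)
  Diagonal-start n = [ Prefix-dilate (Prefix-resolve {r = 0 ∷ 1 ∷ replicate n 0} {trees 0} {ρ} 7 (trees-0 0) equation (refl ∷ refl ∷ Prefix-zeros n)) ]
    where
    ρ : ℕ → ℕ
    ρ (suc zero) = 1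
    ρ _          = 0
    equation : ∀ s → ρ s + dil (trees 0) s ≡ trees 0 s
    equation zero          = refl
    equation (suc zero)    = refl
    equation (suc (suc s)) = sym (trees-pascal 0 (suc s))

  diagonal : ℕ → List (List ℕ)
  diagonal zero    = start 40
  diagonal (suc n) = step (diagonal n)

  Diagonal-diagonal : ∀ n → Diagonal 0 n (diagonal n)
  Diagonal-diagonal zero    = Diagonal-start 40
  Diagonal-diagonal (suc n) = Diagonal-step (Diagonal-diagonal n)

  head₀ : List ℕ → ℕ
  head₀ []      = 0
  head₀ (c ∷ _) = c

  private
    module 𝔸 = NormedAlgebraProperties ℚ-normedAlgebra

  toℚ-tree : ∀ b t n → toℚ (tree b t n) ℚ.* a n ≡ G b t n

  toℚ-row : ∀ b t n → toℚ (binomialSum n (λ k j → dil (λ m → tree b m j) (t + k))) ℚ.* a n ≡ 𝒜 (G b) t n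
  toℚ-row b t n = trans (binomialSum-ad n _) (𝔸.ad-cong n λ k j _ → trans
    (solve 3 (λ x y z → x :* y :* z := x :* (z :* y)) refl (a k) (a j) (toℚ (dil (λ m → tree b m j) (t + k))))
    (cong (a k ℚ.*_) (dil-rel P (trans (cong (ℚ._* a j) toℚ-0) (ℚ.*-zeroˡ (a j))) (t + k) λ m _ → toℚ-tree b m j)))
    where
    open 𝔸.Solver using (solve; _:=_; _:*_)
    P : ∀ {j} → ℕ → 𝔸.Series → Set
    P {j} u s = toℚ u ℚ.* a j ≡ s j

  toℚ-tree zero    t       n = trans (cong (ℚ._* a n) toℚ-0) (ℚ.*-zeroˡ (a n))
  toℚ-tree (suc b) zero    n = trans (trans (cong (ℚ._* a n) toℚ-0) (ℚ.*-zeroˡ (a n))) (sym (G-0 (suc b) n))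
  toℚ-tree (suc b) (suc t) n = begin
    toℚ (δ t n + row) ℚ.* a n
      ≡⟨ trans (cong (ℚ._* a n) (toℚ-+ (δ t n) row)) (ℚ.*-distribʳ-+ (a n) (toℚ (δ t n)) (toℚ row)) ⟩
    toℚ (δ t n) ℚ.* a n ℚ.+ toℚ row ℚ.* a n
      ≡⟨ cong₂ ℚ._+_ (δ-δ₁ t n) (toℚ-row b (suc t) n) ⟩
    δ₁ (suc t) n ℚ.+ 𝒜 (G b) (suc t) n
      ≡⟨ G-step b (suc t) n (s≤s z≤n) ⟨
    G (suc b) (suc t) n ∎
    where
    open ≡-Reasoning
    row = binomialSum n (λ k j → dil (λ m → tree b m j) (suc t + k))
    δ-δ₁ : ∀ t n → toℚ (δ t n) ℚ.* a n ≡ δ₁ (suc t) n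
    δ-δ₁ zero    zero    = trans (cong₂ ℚ._*_ toℚ-1 a-0) (ℚ.*-identityˡ 1ℚ)
    δ-δ₁ zero    (suc n) = trans (cong (ℚ._* a (suc n)) toℚ-0) (ℚ.*-zeroˡ (a (suc n)))
    δ-δ₁ (suc t) n       = trans (cong (ℚ._* a n) toℚ-0) (ℚ.*-zeroˡ (a n))

  -- From order 2 on f 1 contributes nothing, and row 0 of the transition operator remains.
  w-pascal : ∀ n → w (2 + n) ≡ toℚ (pascal (2 + n) 0 0) ℚ.* a (2 + n)
  w-pascal n = begin
    w N
      ≡⟨ trans (w-def N) (f-2^ N N) ⟩
    f 1 N ℚ.+ 𝒜 (G N) 0 N
      ≡⟨ cong (ℚ._+ 𝒜 (G N) 0 N) (trans (cong (ℚ._* a N) toℚ-0) (ℚ.*-zeroˡ (a N))) ⟩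
    0ℚ ℚ.+ 𝒜 (G N) 0 N
      ≡⟨ trans (ℚ.+-identityˡ _) (sym (toℚ-row N 0 N)) ⟩
    toℚ (binomialSum N (λ k j → dil (λ m → tree N m j) k)) ℚ.* a N
      ≡⟨ cong (λ u → toℚ u ℚ.* a N) (trans (binomialSum-cong′ N λ k j e → dil-cong⁼ k λ m e′ → tree-stable m j (bound k j m e e′))
           (sym (pascal-binomialSum N 0 0))) ⟩
    toℚ (pascal N 0 0) ℚ.* a N ∎
    where
    open ≡-Reasoning
    N = 2 + n
    bound : ∀ k j m → k + j ≡ N → m + m ≡ k → j + m ≤ N
    bound k j m e e′ = ≤-trans (+-monoʳ-≤ j (≤-trans (m≤m+n m m) (≤-reflexive e′))) (≤-reflexive (trans (+-comm j k) e))

  w-value : ∀ n c → 2 ≤ n → head₀ (last-list (diagonal n)) ≡ suc c → w n ≡ toℚ (suc c) ℚ.* a n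
  w-value (suc (suc n)) c _ e =
    trans (w-pascal n) (cong (λ u → toℚ u ℚ.* a (2 + n)) (sym (from-head (Diagonal-last (Diagonal-diagonal (2 + n))) e)))
    where
    from-head : ∀ {l x} → Prefix l x → head₀ l ≡ suc c → suc c ≡ x 0
    from-head (e ∷ _) refl = e
  w-value (suc zero) c (s≤s ()) e

  abstract
    count-63 : head₀ (last-list (diagonal 63)) ≡ suc 32615983882179874452751082939496979281114881141381620494671860940303288774108538178523618618
    count-63 = refl

    count-64 : head₀ (last-list (diagonal 64)) ≡ suc 2489615813741306105475580472314955991397530382032808850791073040050523134963780581909313595612
    count-64 = refl

    w-63 : w 63 ≡ toℚ 32615983882179874452751082939496979281114881141381620494671860940303288774108538178523618619 ℚ.* a 63
    w-63 = w-value 63 _ (s≤s (s≤s z≤n)) count-63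

    w-64 : w 64 ≡ toℚ 2489615813741306105475580472314955991397530382032808850791073040050523134963780581909313595613 ℚ.* a 64
    w-64 = w-value 64 _ (s≤s (s≤s z≤n)) count-64

-- The real numbers as a complete normed algebra

module Reals where

  open ℝ using (ℝ; mkℝ; seq; cauchy)
  open import Algebra.Structures using (IsCommutativeRing)
  open import Data.Rational.Base using (½)
  open import Relation.Binary.Structures using (IsEquivalence)
  open NormedAlgebras
  open Weights
  open ApproximateGrowth using (archimedean-*)

  private module 𝔸 = NormedAlgebraProperties ℚ-normedAlgebra
  open 𝔸.Solver using (solve; _:=_; _:+_; _:*_; _:-_; :-_; con)
  open 𝔸.≤-Reasoning

  private
    variable
      x y z u : ℝ

    0<half : ∀ {ε} → 0ℚ ℚ.< ε → 0ℚ ℚ.< ε ℚ.* ½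
    0<half {ε} 0<ε = ℚ.positive⁻¹ (ε ℚ.* ½) {{ℚ.pos*pos⇒pos ε {{ℚ.positive 0<ε}} ½}}

    half+half : ∀ ε → ε ℚ.* ½ ℚ.+ ε ℚ.* ½ ≡ ε
    half+half ε = ≡.trans (solve 1 (λ x → x :* con ½ :+ x :* con ½ := x) refl ε) refl

    ∣p-p∣≤ : ∀ {p q ε} → p ≡ q → 0ℚ ℚ.< ε → ℚ.∣ p ℚ.- q ∣ ℚ.≤ ε
    ∣p-p∣≤ {p} refl 0<ε = ℚ.≤-trans (ℚ.≤-reflexive (≡.cong ℚ.∣_∣ (ℚ.+-inverseʳ p))) (ℚ.<⇒≤ 0<ε)

    ⊔-left : ∀ M N {n} → M ℕ.⊔ N ℕ.≤ n → M ℕ.≤ n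
    ⊔-left M N h = ℕ.m⊔n≤o⇒m≤o M N h

    ⊔-right : ∀ M N {n} → M ℕ.⊔ N ℕ.≤ n → N ℕ.≤ n
    ⊔-right M N h = ℕ.m⊔n≤o⇒n≤o M N h

    both : {P Q S : ℚ → ℕ → Set} →
      (∀ ε → 0ℚ ℚ.< ε → ∃[ N ] ∀ n → N ℕ.≤ n → P ε n) →
      (∀ ε → 0ℚ ℚ.< ε → ∃[ N ] ∀ n → N ℕ.≤ n → Q ε n) →
      (∀ ε n → P (ε ℚ.* ½) n → Q (ε ℚ.* ½) n → S ε n) →
      ∀ ε → 0ℚ ℚ.< ε → ∃[ N ] ∀ n → N ℕ.≤ n → S ε n
    both p q f ε 0<ε =
      let M , p′ = p (ε ℚ.* ½) (0<half 0<ε)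
          N , q′ = q (ε ℚ.* ½) (0<half 0<ε)
      in M ℕ.⊔ N , λ n h → f ε n (p′ n (⊔-left M N h)) (q′ n (⊔-right M N h))

    add-halves : ∀ {p q} ε → p ℚ.≤ ε ℚ.* ½ → q ℚ.≤ ε ℚ.* ½ → p ℚ.+ q ℚ.≤ ε
    add-halves ε p q = ℚ.≤-trans (ℚ.+-mono-≤ p q) (ℚ.≤-reflexive (half+half ε))

  -- The relations of Defs are functions; wrapped in records, they no longer
  -- unfold during the inference of implicit arguments.
  infix 4 _≃_ _≤_
  record _≃_ (x y : ℝ) : Set where
    constructor wrap
    field unwrap : x ℝ.≃ y
  open _≃_ public

  record _≤_ (x y : ℝ) : Set where
    constructor wrap
    field unwrap : x ℝ.≤ y
  open _≤_ public

  -- Opaque copies of the operations, for the same reason.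
  infixl 6 _+_
  infixl 7 _*_
  abstract
    _+_ _*_ : ℝ → ℝ → ℝ
    _+_ = ℝ._+_
    _*_ = ℝ._*_

    neg abs : ℝ → ℝ
    neg x = ℝ.- x
    abs x = ℝ.∣ x ∣

    ι : ℚ → ℝ
    ι = ℝ.fromℚ

    0ᴿ 1ᴿ : ℝ
    0ᴿ = ℝ.0ℝ
    1ᴿ = ℝ.1ℝ

    +-def : ∀ x y → x + y ≡ x ℝ.+ y
    +-def _ _ = refl

    *-def : ∀ x y → x * y ≡ x ℝ.* y
    *-def _ _ = refl

    ι-def : ∀ p → ι p ≡ ℝ.fromℚ p
    ι-def _ = refl

    0ᴿ-def : 0ᴿ ≡ ℝ.0ℝ
    0ᴿ-def = refl

    1ᴿ-def : 1ᴿ ≡ ℝ.1ℝ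
    1ᴿ-def = refl

  abstract
    seq-+ : ∀ x y n → seq (x + y) n ≡ seq x n ℚ.+ seq y n
    seq-+ _ _ _ = refl

    seq-* : ∀ x y n → seq (x * y) n ≡ seq x n ℚ.* seq y n
    seq-* _ _ _ = refl

    seq-neg : ∀ x n → seq (neg x) n ≡ ℚ.- seq x n
    seq-neg _ _ = refl

    seq-abs : ∀ x n → seq (abs x) n ≡ ℚ.∣ seq x n ∣
    seq-abs _ _ = refl

    seq-ι : ∀ p n → seq (ι p) n ≡ p
    seq-ι _ _ = refl

  pointwise-≃ : (∀ n → seq x n ≡ seq y n) → x ≃ y
  pointwise-≃ e = wrap λ ε 0<ε → 0 , λ n _ → ∣p-p∣≤ (e n) 0<ε

  eventually-≤ : ∀ N → (∀ n → N ℕ.≤ n → seq x n ℚ.≤ seq y n) → x ≤ y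
  eventually-≤ N e = wrap λ ε 0<ε → N , λ n h → ℚ.≤-trans (e n h) (𝔸.x≤x+y (ℚ.<⇒≤ 0<ε))

  pointwise-≤ : (∀ n → seq x n ℚ.≤ seq y n) → x ≤ y
  pointwise-≤ e = eventually-≤ 0 λ n _ → e n

  shrink : ∀ M ε → 0ℚ ℚ.≤ M → 0ℚ ℚ.< ε → ∃[ η ] 0ℚ ℚ.< η × η ℚ.≤ 1ℚ × η ℚ.* M ℚ.≤ ε
  shrink M ε 0≤M 0<ε = η , 0<η , η≤1 , (begin
    η ℚ.* M                       ≲⟨ 𝔸.*-monoˡ-≤ (ℚ.<⇒≤ 0<η) (proj₂ (archimedean-* M ε 0<ε)) ⟩
    η ℚ.* (toℚ n ℚ.* ε)           ≲⟨ 𝔸.*-monoˡ-≤ (ℚ.<⇒≤ 0<η) (𝔸.*-monoʳ-≤ (ℚ.<⇒≤ 0<ε) (toℚ-mono (ℕ.n≤1+n n))) ⟩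
    η ℚ.* (toℚ (suc n) ℚ.* ε)     ≡⟨ solve 3 (λ h s e → h :* (s :* e) := (s :* h) :* e) refl η (toℚ (suc n)) ε ⟩
    toℚ (suc n) ℚ.* η ℚ.* ε       ≡⟨ ≡.cong (ℚ._* ε) (ℚ.*-inverseʳ (toℚ (suc n))) ⟩
    1ℚ ℚ.* ε                      ≡⟨ ℚ.*-identityˡ ε ⟩
    ε                             ∎)
    where
    n = proj₁ (archimedean-* M ε 0<ε)
    instance
      suc-pos : ℚ.Positive (toℚ (suc n))
      suc-pos = ℚ.positive (0<toℚ-suc n)
      suc≢0 : ℚ.NonZero (toℚ (suc n))
      suc≢0 = ℚ.pos⇒nonZero (toℚ (suc n))
    η : ℚ
    η = ℚ.1/ toℚ (suc n)
    0<η : 0ℚ ℚ.< η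
    0<η = ℚ.positive⁻¹ η {{ℚ.1/pos⇒pos (toℚ (suc n))}}
    η≤1 : η ℚ.≤ 1ℚ
    η≤1 = begin
      η                   ≡⟨ ℚ.*-identityˡ η ⟨
      1ℚ ℚ.* η            ≲⟨ 𝔸.*-monoʳ-≤ (ℚ.<⇒≤ 0<η) (≡.subst (ℚ._≤ toℚ (suc n)) toℚ-1 (toℚ-mono (ℕ.s≤s ℕ.z≤n))) ⟩
      toℚ (suc n) ℚ.* η   ≡⟨ ℚ.*-inverseʳ (toℚ (suc n)) ⟩
      1ℚ                  ∎

  bounded : ∀ x → ∃[ B ] 0ℚ ℚ.≤ B × ∃[ N ] ∀ n → N ℕ.≤ n → ℚ.∣ seq x n ∣ ℚ.≤ B
  bounded x =
    let N , close = cauchy x 1ℚ (ℚ.positive⁻¹ 1ℚ)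
    in ℚ.∣ seq x N ∣ ℚ.+ 1ℚ , 𝔸.0≤-+ (ℚ.0≤∣p∣ (seq x N)) (ℚ.≤ᵇ⇒≤ tt) , N , λ n N≤n → begin
      ℚ.∣ seq x n ∣
        ≡⟨ ≡.cong ℚ.∣_∣ (solve 2 (λ a b → a := b :+ (a :- b)) refl (seq x n) (seq x N)) ⟩
      ℚ.∣ seq x N ℚ.+ (seq x n ℚ.- seq x N) ∣
        ≲⟨ ℚ.≤-trans (ℚ.∣p+q∣≤∣p∣+∣q∣ (seq x N) _) (ℚ.+-monoʳ-≤ ℚ.∣ seq x N ∣ (close n N N≤n ℕ.≤-refl)) ⟩
      ℚ.∣ seq x N ∣ ℚ.+ 1ℚ ∎

  private
    abstract
      ≃-sym : x ≃ y → y ≃ x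
      ≃-sym {x} {y} (wrap e) = wrap λ ε 0<ε → let N , h = e ε 0<ε in N , λ n N≤n → ℚ.≤-trans
        (ℚ.≤-reflexive (≡.trans (≡.sym (ℚ.∣-p∣≡∣p∣ (seq y n ℚ.- seq x n)))
          (≡.cong ℚ.∣_∣ (solve 2 (λ a b → :- (a :- b) := b :- a) refl (seq y n) (seq x n))))) (h n N≤n)

      ≃-trans : x ≃ y → y ≃ z → x ≃ z
      ≃-trans {x} {y} {z} (wrap e) (wrap f) = wrap (both e f λ ε n p q → begin
        ℚ.∣ seq x n ℚ.- seq z n ∣
          ≡⟨ ≡.cong ℚ.∣_∣ (solve 3 (λ a b c → a :- c := (a :- b) :+ (b :- c)) refl (seq x n) (seq y n) (seq z n)) ⟩
        ℚ.∣ (seq x n ℚ.- seq y n) ℚ.+ (seq y n ℚ.- seq z n) ∣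
          ≲⟨ ℚ.≤-trans (ℚ.∣p+q∣≤∣p∣+∣q∣ (seq x n ℚ.- seq y n) _) (add-halves ε p q) ⟩
        ε ∎)

      +-cong : x ≃ y → u ≃ z → (x + u) ≃ (y + z)
      +-cong {x} {y} {u} {z} (wrap e) (wrap f) = wrap (both e f λ ε n p q → begin
        ℚ.∣ (seq x n ℚ.+ seq u n) ℚ.- (seq y n ℚ.+ seq z n) ∣
          ≡⟨ ≡.cong ℚ.∣_∣ (solve 4 (λ a b c d → (a :+ b) :- (c :+ d) := (a :- c) :+ (b :- d)) refl (seq x n) (seq u n) (seq y n) (seq z n)) ⟩
        ℚ.∣ (seq x n ℚ.- seq y n) ℚ.+ (seq u n ℚ.- seq z n) ∣
          ≲⟨ ℚ.≤-trans (ℚ.∣p+q∣≤∣p∣+∣q∣ (seq x n ℚ.- seq y n) _) (add-halves ε p q) ⟩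
        ε ∎)

      -‿cong : x ≃ y → neg x ≃ neg y
      -‿cong {x} {y} (wrap e) = wrap λ ε 0<ε → let N , h = e ε 0<ε in N , λ n N≤n → ℚ.≤-trans
        (ℚ.≤-reflexive (≡.trans (≡.cong ℚ.∣_∣ (solve 2 (λ a b → (:- a) :- (:- b) := :- (a :- b)) refl (seq x n) (seq y n)))
          (ℚ.∣-p∣≡∣p∣ (seq x n ℚ.- seq y n)))) (h n N≤n)

      *-congˡ : ∀ z → x ≃ y → (z * x) ≃ (z * y)
      *-congˡ {x} {y} z (wrap e) = wrap λ ε 0<ε →
        let B , 0≤B , M , b = bounded z
            η , 0<η , _ , ηB = shrink B ε 0≤B 0<ε
            N , h = e η 0<η
        in M ℕ.⊔ N , λ n k → begin
          ℚ.∣ seq z n ℚ.* seq x n ℚ.- seq z n ℚ.* seq y n ∣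
            ≡⟨ ≡.cong ℚ.∣_∣ (solve 3 (λ a b c → a :* b :- a :* c := a :* (b :- c)) refl (seq z n) (seq x n) (seq y n)) ⟩
          ℚ.∣ seq z n ℚ.* (seq x n ℚ.- seq y n) ∣
            ≲⟨ 𝔸.∣*∣≤ (b n (⊔-left M N k)) (h n (⊔-right M N k)) ⟩
          B ℚ.* η
            ≡⟨ ℚ.*-comm B η ⟩
          η ℚ.* B
            ≲⟨ ηB ⟩
          ε ∎

      *-comm : ∀ x y → (x * y) ≃ (y * x)
      *-comm x y = pointwise-≃ λ n → ℚ.*-comm (seq x n) (seq y n)

      *-cong : x ≃ y → u ≃ z → (x * u) ≃ (y * z)
      *-cong {x} {y} {u} {z} e f = ≃-trans {x * u} {x * z} {y * z} (*-congˡ {u} {z} x f)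
        (≃-trans {x * z} {z * x} {y * z} (*-comm x z)
          (≃-trans {z * x} {z * y} {y * z} (*-congˡ {x} {y} z e) (*-comm z y)))

      +-assoc : ∀ x y z → (x + y) + z ≃ x + (y + z)
      +-assoc x y z = pointwise-≃ λ n → ℚ.+-assoc (seq x n) (seq y n) (seq z n)
      *-assoc : ∀ x y z → (x * y) * z ≃ x * (y * z)
      *-assoc x y z = pointwise-≃ λ n → ℚ.*-assoc (seq x n) (seq y n) (seq z n)
      distribˡ : ∀ x y z → x * (y + z) ≃ x * y + x * z
      distribˡ x y z = pointwise-≃ λ n → ℚ.*-distribˡ-+ (seq x n) (seq y n) (seq z n)
      distribʳ : ∀ x y z → (y + z) * x ≃ y * x + z * x
      distribʳ x y z = pointwise-≃ λ n → ℚ.*-distribʳ-+ (seq x n) (seq y n) (seq z n)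
      *-identityˡ : ∀ x → 1ᴿ * x ≃ x
      *-identityˡ x = pointwise-≃ λ n → ℚ.*-identityˡ (seq x n)
      *-identityʳ : ∀ x → x * 1ᴿ ≃ x
      *-identityʳ x = pointwise-≃ λ n → ℚ.*-identityʳ (seq x n)
      +-identityˡ : ∀ x → 0ᴿ + x ≃ x
      +-identityˡ x = pointwise-≃ λ n → ℚ.+-identityˡ (seq x n)
      +-identityʳ : ∀ x → x + 0ᴿ ≃ x
      +-identityʳ x = pointwise-≃ λ n → ℚ.+-identityʳ (seq x n)
      -‿inverseˡ : ∀ x → neg x + x ≃ 0ᴿ
      -‿inverseˡ x = pointwise-≃ λ n → ℚ.+-inverseˡ (seq x n)
      -‿inverseʳ : ∀ x → x + neg x ≃ 0ᴿ
      -‿inverseʳ x = pointwise-≃ λ n → ℚ.+-inverseʳ (seq x n)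
      +-comm : ∀ x y → x + y ≃ y + x
      +-comm x y = pointwise-≃ λ n → ℚ.+-comm (seq x n) (seq y n)

      ≤-reflexive : x ≃ y → x ≤ y
      ≤-reflexive {x} {y} (wrap e) = wrap λ ε 0<ε → let N , h = e ε 0<ε in N , λ n N≤n → begin
        seq x n                           ≡⟨ solve 2 (λ a b → a := b :+ (a :- b)) refl (seq x n) (seq y n) ⟩
        seq y n ℚ.+ (seq x n ℚ.- seq y n) ≲⟨ ℚ.+-monoʳ-≤ (seq y n) (ℚ.≤-trans (𝔸.≤∣∣ (seq x n ℚ.- seq y n)) (h n N≤n)) ⟩
        seq y n ℚ.+ ε                     ∎

      ≤-trans : x ≤ y → y ≤ z → x ≤ z
      ≤-trans {x} {y} {z} (wrap p) (wrap q) = wrap (both p q λ ε n h k → begin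
        seq x n                               ≲⟨ h ⟩
        seq y n ℚ.+ ε ℚ.* ½                   ≲⟨ ℚ.+-monoˡ-≤ (ε ℚ.* ½) k ⟩
        seq z n ℚ.+ ε ℚ.* ½ ℚ.+ ε ℚ.* ½       ≡⟨ ≡.trans (ℚ.+-assoc (seq z n) _ _) (≡.cong (seq z n ℚ.+_) (half+half ε)) ⟩
        seq z n ℚ.+ ε                         ∎)

      +-mono-≤ : x ≤ y → u ≤ z → (x + u) ≤ (y + z)
      +-mono-≤ {x} {y} {u} {z} (wrap p) (wrap q) = wrap (both p q λ ε n h k → begin
        seq x n ℚ.+ seq u n                               ≲⟨ ℚ.+-mono-≤ h k ⟩
        (seq y n ℚ.+ ε ℚ.* ½) ℚ.+ (seq z n ℚ.+ ε ℚ.* ½)   ≡⟨ 𝔸.+-interchange (seq y n) (ε ℚ.* ½) (seq z n) (ε ℚ.* ½) ⟩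
        seq y n ℚ.+ seq z n ℚ.+ (ε ℚ.* ½ ℚ.+ ε ℚ.* ½)     ≡⟨ ≡.cong (seq y n ℚ.+ seq z n ℚ.+_) (half+half ε) ⟩
        seq y n ℚ.+ seq z n ℚ.+ ε                         ∎)

      -- The hypotheses hold only up to η, so the product that is nonnegative is (x + η)(z + η - y).
      -- It differs from x(z - y) by η times an eventually bounded quantity.
      *-monoˡ-≤ : 0ᴿ ≤ x → y ≤ z → (x * y) ≤ (x * z)
      *-monoˡ-≤ {x} {y} {z} (wrap 0≤x) (wrap y≤z) = wrap λ ε 0<ε →
        let B , 0≤B , N₁ , b = bounded x
            C , 0≤C , N₂ , c = bounded (z ℝ.- y)
            η , 0<η , η≤1 , small = shrink (B ℚ.+ C ℚ.+ 1ℚ) ε (𝔸.0≤-+ (𝔸.0≤-+ 0≤B 0≤C) (ℚ.≤ᵇ⇒≤ tt)) 0<ε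
            N₃ , p = 0≤x η 0<η
            N₄ , q = y≤z η 0<η
        in (N₁ ℕ.⊔ N₂) ℕ.⊔ (N₃ ℕ.⊔ N₄) , λ n h →
          let h₁₂ = ⊔-left (N₁ ℕ.⊔ N₂) (N₃ ℕ.⊔ N₄) h
              h₃₄ = ⊔-right (N₁ ℕ.⊔ N₂) (N₃ ℕ.⊔ N₄) h
              X = seq x n ; Y = seq y n ; Z = seq z n
          in 𝔸.≤-by (solve 4 (λ x y z η → x :* z :+ η :* (x :+ (z :- y) :+ η) := x :* y :+ (x :+ η) :* (z :+ η :- y)) refl X Y Z η)
               (𝔸.0≤-* (p n (⊔-left N₃ N₄ h₃₄)) (𝔸.0≤y-x (q n (⊔-right N₃ N₄ h₃₄))))
             then-≤ 𝔸.+-monoʳ-≤ (X ℚ.* Z) (begin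
          η ℚ.* (X ℚ.+ (Z ℚ.- Y) ℚ.+ η)
            ≲⟨ 𝔸.*-monoˡ-≤ (ℚ.<⇒≤ 0<η) (ℚ.+-mono-≤ (ℚ.+-mono-≤ (ℚ.≤-trans (𝔸.≤∣∣ X) (b n (⊔-left N₁ N₂ h₁₂)))
                 (ℚ.≤-trans (𝔸.≤∣∣ (Z ℚ.- Y)) (c n (⊔-right N₁ N₂ h₁₂)))) η≤1) ⟩
          η ℚ.* (B ℚ.+ C ℚ.+ 1ℚ)
            ≲⟨ small ⟩
          ε ∎)
        where
        _then-≤_ : ∀ {p q r} → p ℚ.≤ q → q ℚ.≤ r → p ℚ.≤ r
        _then-≤_ = ℚ.≤-trans

      ∣∣-cong : x ≃ y → abs x ≃ abs y
      ∣∣-cong {x} {y} (wrap e) = wrap λ ε 0<ε → let N , h = e ε 0<ε in N , λ n N≤n →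
        ℚ.≤-trans (𝔸.∣∣-least (lemma (seq x n) (seq y n))
          (ℚ.≤-trans (ℚ.≤-reflexive (solve 2 (λ a b → :- (a :- b) := b :- a) refl ℚ.∣ seq x n ∣ ℚ.∣ seq y n ∣))
            (ℚ.≤-trans (lemma (seq y n) (seq x n)) (ℚ.≤-reflexive (≡.trans (≡.sym (ℚ.∣-p∣≡∣p∣ (seq y n ℚ.- seq x n)))
              (≡.cong ℚ.∣_∣ (solve 2 (λ a b → :- (a :- b) := b :- a) refl (seq y n) (seq x n)))))))) (h n N≤n)
        where
        lemma : ∀ p q → ℚ.∣ p ∣ ℚ.- ℚ.∣ q ∣ ℚ.≤ ℚ.∣ p ℚ.- q ∣
        lemma p q = begin
          ℚ.∣ p ∣ ℚ.- ℚ.∣ q ∣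
            ≡⟨ ≡.cong (λ r → ℚ.∣ r ∣ ℚ.- ℚ.∣ q ∣) (solve 2 (λ a b → a := (a :- b) :+ b) refl p q) ⟩
          ℚ.∣ (p ℚ.- q) ℚ.+ q ∣ ℚ.- ℚ.∣ q ∣
            ≲⟨ ℚ.+-monoˡ-≤ (ℚ.- ℚ.∣ q ∣) (ℚ.∣p+q∣≤∣p∣+∣q∣ (p ℚ.- q) q) ⟩
          ℚ.∣ p ℚ.- q ∣ ℚ.+ ℚ.∣ q ∣ ℚ.- ℚ.∣ q ∣
            ≡⟨ solve 2 (λ a b → a :+ b :- b := a) refl ℚ.∣ p ℚ.- q ∣ ℚ.∣ q ∣ ⟩
          ℚ.∣ p ℚ.- q ∣ ∎

      ∣∣-least : ∀ {b} → x ≤ b → neg x ≤ b → abs x ≤ b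
      ∣∣-least (wrap p) (wrap q) = wrap λ ε 0<ε →
        let M , p′ = p ε 0<ε
            N , q′ = q ε 0<ε
        in M ℕ.⊔ N , λ n h → 𝔸.∣∣-least (p′ n (⊔-left M N h)) (q′ n (⊔-right M N h))

      ∣+∣≤ : ∀ x y → abs (x + y) ≤ abs x + abs y
      ∣+∣≤ x y = pointwise-≤ λ n → ℚ.∣p+q∣≤∣p∣+∣q∣ (seq x n) (seq y n)
      ∣*∣ : ∀ x y → abs (x * y) ≃ abs x * abs y
      ∣*∣ x y = pointwise-≃ λ n → ℚ.∣p*q∣≡∣p∣*∣q∣ (seq x n) (seq y n)
      ∣-∣ : ∀ x → abs (neg x) ≃ abs x
      ∣-∣ x = pointwise-≃ λ n → ℚ.∣-p∣≡∣p∣ (seq x n)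
      ≤∣∣ : ∀ x → x ≤ abs x
      ≤∣∣ x = pointwise-≤ λ n → 𝔸.≤∣∣ (seq x n)
      0≤∣∣ : ∀ x → 0ᴿ ≤ abs x
      0≤∣∣ x = pointwise-≤ λ n → ℚ.0≤∣p∣ (seq x n)
      ι-+ : ∀ p q → ι (p ℚ.+ q) ≃ ι p + ι q
      ι-+ p q = pointwise-≃ λ _ → refl
      ι-* : ∀ p q → ι (p ℚ.* q) ≃ ι p * ι q
      ι-* p q = pointwise-≃ λ _ → refl
      ι-neg : ∀ p → ι (ℚ.- p) ≃ neg (ι p)
      ι-neg p = pointwise-≃ λ _ → refl
      ι-0 : ι 0ℚ ≃ 0ᴿ
      ι-0 = pointwise-≃ λ _ → refl
      ι-1 : ι 1ℚ ≃ 1ᴿ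
      ι-1 = pointwise-≃ λ _ → refl
      ι-mono : ∀ {p q} → p ℚ.≤ q → ι p ≤ ι q
      ι-mono p≤q = pointwise-≤ λ _ → p≤q

  private
    isEquivalence : IsEquivalence _≃_
    isEquivalence = record
      { refl  = λ {x} → pointwise-≃ {x} {x} λ _ → refl
      ; sym   = λ {x} {y} → ≃-sym {x} {y}
      ; trans = λ {x} {y} {z} → ≃-trans {x} {y} {z}
      }

    isCommutativeRing : IsCommutativeRing _≃_ _+_ _*_ neg 0ᴿ 1ᴿ
    isCommutativeRing = record
      { isRing = record
        { +-isAbelianGroup = record
          { isGroup = record
            { isMonoid = record
              { isSemigroup = record
                { isMagma = record { isEquivalence = isEquivalence ; ∙-cong = +-cong }
                ; assoc = +-assoc }
              ; identity = +-identityˡ , +-identityʳ }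
            ; inverse = -‿inverseˡ , -‿inverseʳ
            ; ⁻¹-cong = -‿cong }
          ; comm = +-comm }
        ; *-cong = *-cong
        ; *-assoc = *-assoc
        ; *-identity = *-identityˡ , *-identityʳ
        ; distrib = distribˡ , distribʳ }
      ; *-comm = *-comm
      }

  ℝ-normedAlgebra : NormedAlgebra
  ℝ-normedAlgebra = record
    { Carrier = ℝ ; _≈_ = _≃_ ; _≤_ = _≤_ ; _+_ = _+_ ; _*_ = _*_ ; -_ = neg ; ∣_∣ = abs
    ; 0# = 0ᴿ ; 1# = 1ᴿ ; ι = ι
    ; isCommutativeRing = isCommutativeRing
    ; ≤-reflexive = ≤-reflexive ; ≤-trans = ≤-trans ; +-mono-≤ = +-mono-≤ ; *-monoˡ-≤ = *-monoˡ-≤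
    ; ∣∣-cong = ∣∣-cong ; ∣+∣≤ = ∣+∣≤ ; ∣*∣ = ∣*∣ ; ∣-∣ = ∣-∣ ; ≤∣∣ = ≤∣∣ ; 0≤∣∣ = 0≤∣∣ ; ∣∣-least = ∣∣-least
    ; ι-+ = ι-+ ; ι-* = ι-* ; ι-neg = ι-neg ; ι-0 = ι-0 ; ι-1 = ι-1 ; ι-mono = ι-mono
    }

  private module ℝᵃ = NormedAlgebraProperties ℝ-normedAlgebra

  ℝ-bounded : ∀ x → ∃[ B ] 0ℚ ℚ.≤ B × abs x ≤ ι B
  ℝ-bounded x =
    let B , 0≤B , N , h = bounded x
    in B , 0≤B , to-ℝ B N h
    where
    abstract
      to-ℝ : ∀ B N → (∀ n → N ℕ.≤ n → ℚ.∣ seq x n ∣ ℚ.≤ B) → abs x ≤ ι B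
      to-ℝ B N h = eventually-≤ N h

  private
    η : ℕ → ℚ
    η n = (ℚ.1/ toℚ (suc n)) {{ℚ.pos⇒nonZero (toℚ (suc n)) {{ℚ.positive (0<toℚ-suc n)}}}}

    0<η : ∀ n → 0ℚ ℚ.< η n
    0<η n = ℚ.positive⁻¹ (η n) {{ℚ.1/pos⇒pos (toℚ (suc n)) {{ℚ.positive (0<toℚ-suc n)}}}}

    η-small : ∀ ε → 0ℚ ℚ.< ε → ∃[ N ] ∀ n → N ℕ.≤ n → η n ℚ.≤ ε
    η-small ε 0<ε = N , λ n N≤n → begin
      η n                            ≡⟨ ℚ.*-identityʳ (η n) ⟨
      η n ℚ.* 1ℚ                     ≲⟨ 𝔸.*-monoˡ-≤ (ℚ.<⇒≤ (0<η n)) (proj₂ (archimedean-* 1ℚ ε 0<ε)) ⟩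
      η n ℚ.* (toℚ N ℚ.* ε)          ≲⟨ 𝔸.*-monoˡ-≤ (ℚ.<⇒≤ (0<η n)) (𝔸.*-monoʳ-≤ (ℚ.<⇒≤ 0<ε) (toℚ-mono (ℕ.m≤n⇒m≤1+n N≤n))) ⟩
      η n ℚ.* (toℚ (suc n) ℚ.* ε)    ≡⟨ solve 3 (λ h s e → h :* (s :* e) := (s :* h) :* e) refl (η n) (toℚ (suc n)) ε ⟩
      toℚ (suc n) ℚ.* η n ℚ.* ε      ≡⟨ ≡.cong (ℚ._* ε) (ℚ.*-inverseʳ (toℚ (suc n)) {{ℚ.pos⇒nonZero (toℚ (suc n)) {{ℚ.positive (0<toℚ-suc n)}}}}) ⟩
      1ℚ ℚ.* ε                       ≡⟨ ℚ.*-identityˡ ε ⟩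
      ε                              ∎
      where N = proj₁ (archimedean-* 1ℚ ε 0<ε)

    ∣-∣-via : ∀ {p q s α β} → ℚ.∣ p ℚ.- q ∣ ℚ.≤ α → ℚ.∣ q ℚ.- s ∣ ℚ.≤ β → ℚ.∣ p ℚ.- s ∣ ℚ.≤ α ℚ.+ β
    ∣-∣-via {p} {q} {s} h k = ℚ.≤-trans (ℚ.≤-reflexive (≡.cong ℚ.∣_∣
      (solve 3 (λ p q s → p :- s := (p :- q) :+ (q :- s)) refl p q s)))
      (ℚ.≤-trans (ℚ.∣p+q∣≤∣p∣+∣q∣ (p ℚ.- q) (q ℚ.- s)) (ℚ.+-mono-≤ h k))

    ∣-∣-sym : ∀ p q → ℚ.∣ p ℚ.- q ∣ ≡ ℚ.∣ q ℚ.- p ∣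
    ∣-∣-sym p q = ≡.trans (≡.sym (ℚ.∣-p∣≡∣p∣ (p ℚ.- q))) (≡.cong ℚ.∣_∣ (solve 2 (λ p q → :- (p :- q) := q :- p) refl p q))

  module _ (x r : ℕ → ℝ) (b : ℕ → ℚ) (b→0 : ∀ ε → 0ℚ ℚ.< ε → ∃[ n ] b n ℚ.≤ ε)
    (r≤b : ∀ m → r m ≤ ι (b m)) (close : ∀ m n → m ℕ.≤ n → abs (x n + neg (x m)) ≤ r m) where

    private
      -- The diagonal sequence evaluates x n at an index where it has settled up to η n.
      settle : ℕ → ℕ
      settle n = proj₁ (cauchy (x n) (η n) (0<η n))

      settled : ∀ n j → settle n ℕ.≤ j → ℚ.∣ seq (x n) (settle n) ℚ.- seq (x n) j ∣ ℚ.≤ η n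
      settled n j h = proj₂ (cauchy (x n) (η n) (0<η n)) (settle n) j ℕ.≤-refl h

      diag : ℕ → ℚ
      diag n = seq (x n) (settle n)

      abstract
        close′ : ∀ m n → m ℕ.≤ n → ∀ ε → 0ℚ ℚ.< ε →
                 ∃[ N ] ∀ j → N ℕ.≤ j → ℚ.∣ seq (x n) j ℚ.- seq (x m) j ∣ ℚ.≤ seq (r m) j ℚ.+ ε
        close′ m n m≤n = unwrap (close m n m≤n)

        r≤b′ : ∀ m ε → 0ℚ ℚ.< ε → ∃[ N ] ∀ j → N ℕ.≤ j → seq (r m) j ℚ.≤ b m ℚ.+ ε
        r≤b′ m = unwrap (r≤b m)

      near : ∀ M m ε → M ℕ.≤ m → 0ℚ ℚ.< ε →
             ∃[ N ] ∀ j → N ℕ.≤ j → ℚ.∣ diag m ℚ.- seq (x M) j ∣ ℚ.≤ η m ℚ.+ (b M ℚ.+ ε ℚ.+ ε)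
      near M m ε M≤m 0<ε =
        let N₁ , h₁ = close′ M m M≤m ε 0<ε
            N₂ , h₂ = r≤b′ M ε 0<ε
        in settle m ℕ.⊔ (N₁ ℕ.⊔ N₂) , λ j h →
          let h′ = ⊔-right (settle m) (N₁ ℕ.⊔ N₂) h
          in ∣-∣-via {p = diag m} {q = seq (x m) j} (settled m j (⊔-left (settle m) (N₁ ℕ.⊔ N₂) h))
               (ℚ.≤-trans (h₁ j (⊔-left N₁ N₂ h′)) (ℚ.+-monoˡ-≤ ε (h₂ j (⊔-right N₁ N₂ h′))))

      diag-cauchy : ∀ ε → 0ℚ ℚ.< ε → ∃[ N ] ∀ m n → N ℕ.≤ m → N ℕ.≤ n → ℚ.∣ diag m ℚ.- diag n ∣ ℚ.≤ ε
      diag-cauchy ε 0<ε =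
        let δ = ε ℚ.* ½ ℚ.* ½ ℚ.* ½
            0<δ = 0<half (0<half (0<half 0<ε))
            M , bM≤δ = b→0 δ 0<δ
            N , ηN≤δ = η-small δ 0<δ
        in M ℕ.⊔ N , λ m n hm hn →
          let N₁ , p = near M m δ (⊔-left M N hm) 0<δ
              N₂ , q = near M n δ (⊔-left M N hn) 0<δ
              j = N₁ ℕ.⊔ N₂
              bound : ∀ k → N ℕ.≤ k → η k ℚ.+ (b M ℚ.+ δ ℚ.+ δ) ℚ.≤ ε ℚ.* ½
              bound k N≤k = ℚ.≤-trans (ℚ.+-mono-≤ (ηN≤δ k N≤k) (ℚ.+-monoˡ-≤ δ (ℚ.+-monoˡ-≤ δ bM≤δ)))
                (ℚ.≤-reflexive (solve 1 (λ e → e :* con ½ :* con ½ :* con ½ :+ (e :* con ½ :* con ½ :* con ½ :+ e :* con ½ :* con ½ :* con ½ :+ e :* con ½ :* con ½ :* con ½) := e :* con ½) refl ε))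
          in ℚ.≤-trans (∣-∣-via {p = diag m} {q = seq (x M) j} {s = diag n} (p j (ℕ.m≤m⊔n N₁ N₂))
               (ℚ.≤-trans (ℚ.≤-reflexive (∣-∣-sym (seq (x M) j) (diag n))) (q j (ℕ.m≤n⊔m N₁ N₂))))
               (add-halves ε (bound m (⊔-right M N hm)) (bound n (⊔-right M N hn)))

    -- The estimate survives with r m itself, because the order of ℝ tolerates every positive ε
    -- anyway.
    ℝ-limit : ∃[ L ] (∀ m → abs (L + neg (x m)) ≤ r m)
    ℝ-limit = L , close-L
      where
      L : ℝ
      L = mkℝ diag diag-cauchy
      abstract
        close-L : ∀ m → abs (L + neg (x m)) ≤ r m
        close-L m = wrap λ ε 0<ε →
          let δ = ε ℚ.* ½ ℚ.* ½
              0<δ = 0<half (0<half 0<ε)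
              N₁ , p₁ = cauchy (x m) δ 0<δ
              N₂ , p₂ = cauchy (r m) δ 0<δ
              N₃ , p₃ = η-small δ 0<δ
              N = m ℕ.⊔ (N₁ ℕ.⊔ (N₂ ℕ.⊔ N₃))
          in N , λ i h →
            let hm = ⊔-left m (N₁ ℕ.⊔ (N₂ ℕ.⊔ N₃)) h
                h′ = ⊔-right m (N₁ ℕ.⊔ (N₂ ℕ.⊔ N₃)) h
                h₁ = ⊔-left N₁ (N₂ ℕ.⊔ N₃) h′
                h″ = ⊔-right N₁ (N₂ ℕ.⊔ N₃) h′
                h₂ = ⊔-left N₂ N₃ h″
                h₃ = ⊔-right N₂ N₃ h″
                N₄ , p₄ = close′ m i hm δ 0<δ
                j = i ℕ.⊔ (settle i ℕ.⊔ N₄)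
                i≤j = ℕ.m≤m⊔n i (settle i ℕ.⊔ N₄)
                k≤j = ℕ.≤-trans (ℕ.m≤m⊔n (settle i) N₄) (ℕ.m≤n⊔m i (settle i ℕ.⊔ N₄))
                l≤j = ℕ.≤-trans (ℕ.m≤n⊔m (settle i) N₄) (ℕ.m≤n⊔m i (settle i ℕ.⊔ N₄))
            in begin
              ℚ.∣ diag i ℚ.- seq (x m) i ∣
                ≲⟨ ∣-∣-via {p = diag i} {q = seq (x m) j} (∣-∣-via {p = diag i} {q = seq (x i) j} (ℚ.≤-trans (settled i j k≤j) (p₃ i h₃)) (p₄ j l≤j))
                     (p₁ j i (ℕ.≤-trans h₁ i≤j) h₁) ⟩
              δ ℚ.+ (seq (r m) j ℚ.+ δ) ℚ.+ δ
                ≡⟨ solve 3 (λ d r s → d :+ (r :+ d) :+ d := s :+ (r :- s) :+ (d :+ d :+ d)) refl δ (seq (r m) j) (seq (r m) i) ⟩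
              seq (r m) i ℚ.+ (seq (r m) j ℚ.- seq (r m) i) ℚ.+ (δ ℚ.+ δ ℚ.+ δ)
                ≲⟨ ℚ.+-monoˡ-≤ (δ ℚ.+ δ ℚ.+ δ) (ℚ.+-monoʳ-≤ (seq (r m) i) (ℚ.≤-trans (𝔸.≤∣∣ _) (p₂ j i (ℕ.≤-trans h₂ i≤j) h₂))) ⟩
              seq (r m) i ℚ.+ δ ℚ.+ (δ ℚ.+ δ ℚ.+ δ)
                ≡⟨ solve 2 (λ r e → r :+ e :* con ½ :* con ½ :+ (e :* con ½ :* con ½ :+ e :* con ½ :* con ½ :+ e :* con ½ :* con ½) := r :+ e) refl (seq (r m) i) ε ⟩
              seq (r m) i ℚ.+ ε ∎

  ℝ-completeAlgebra : CompleteAlgebra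
  ℝ-completeAlgebra = record
    { normedAlgebra = ℝ-normedAlgebra
    ; bounded = ℝ-bounded
    ; limit = ℝ-limit
    }

  ι-reflects-≤ : ∀ {p q} → ι p ≤ ι q → p ℚ.≤ q
  ι-reflects-≤ {p} {q} (wrap h) = ℚ.≮⇒≥ λ q<p → ℚ.<-irrefl refl (ℚ.<-≤-trans (half< q<p) (begin
    ε ℚ.+ ε                      ≡⟨ half+half (p ℚ.- q) ⟩
    p ℚ.- q                      ≲⟨ ℚ.+-monoˡ-≤ (ℚ.- q) (≡.subst₂ (λ a b → a ℚ.≤ b ℚ.+ ε) (seq-ι p _) (seq-ι q _)
                                      (proj₂ (h ε (0<half (0<p-q q<p))) _ ℕ.≤-refl)) ⟩
    q ℚ.+ ε ℚ.- q                ≡⟨ solve 2 (λ q e → q :+ e :- q := e) refl q ε ⟩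
    ε                            ∎))
    where
    ε : ℚ
    ε = (p ℚ.- q) ℚ.* ½
    0<p-q : q ℚ.< p → 0ℚ ℚ.< p ℚ.- q
    0<p-q q<p = ≡.subst (ℚ._< p ℚ.- q) (ℚ.+-inverseʳ q) (ℚ.+-monoˡ-< (ℚ.- q) q<p)
    half< : q ℚ.< p → ε ℚ.< ε ℚ.+ ε
    half< q<p = ≡.subst (ℚ._< ε ℚ.+ ε) (ℚ.+-identityˡ ε) (ℚ.+-monoˡ-< ε (0<half (0<p-q q<p)))

  module Inverse (y : ℝ) (0<y : ℝ.0ℝ ℝ.< y) where

    abstract
      reciprocal-of : ℝ
      reciprocal-of = ℝ.inverse y 0<y

      reciprocal-def : reciprocal-of ≡ ℝ.inverse y 0<y
      reciprocal-def = refl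

    private
      δ : ℚ
      δ = proj₁ 0<y
      0<δ : 0ℚ ℚ.< δ
      0<δ = proj₁ (proj₂ 0<y)
      cut : ℚ → ℚ
      cut p = p ℚ.⊔ δ
      cut>0 : ∀ p → ℚ.Positive (cut p)
      cut>0 p = ℚ.positive (ℚ.<-≤-trans 0<δ (ℚ.p≤q⊔p p δ))

    abstract
      *-reciprocal : y * reciprocal-of ≃ 1ᴿ
      *-reciprocal = wrap λ ε 0<ε → proj₁ (proj₂ (proj₂ 0<y)) , λ n N≤n →
        let p = seq y n
            cut≡p = ℚ.p≥q⇒p⊔q≡p (≡.subst (ℚ._≤ p) (ℚ.+-identityˡ δ) (proj₂ (proj₂ (proj₂ 0<y)) n N≤n))
        in ∣p-p∣≤ (≡.trans (≡.cong (ℚ._* seq reciprocal-of n) (≡.sym cut≡p))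
             (ℚ.*-inverseʳ (cut p) {{ℚ.pos⇒nonZero (cut p) {{cut>0 p}}}})) 0<ε

      0≤reciprocal : 0ᴿ ≤ reciprocal-of
      0≤reciprocal = pointwise-≤ λ n → ℚ.<⇒≤ (ℚ.positive⁻¹ _ {{ℚ.1/pos⇒pos (cut (seq y n)) {{cut>0 (seq y n)}}}})

  abstract
    unwrap-∣∣≤ : abs x ≤ y * abs z → ℝ.∣ x ∣ ℝ.≤ y ℝ.* ℝ.∣ z ∣
    unwrap-∣∣≤ = unwrap

    unwrap-∣-∣≤ : abs (x + neg y) ≤ z → ℝ.∣ x ℝ.- y ∣ ℝ.≤ z
    unwrap-∣-∣≤ = unwrap

    unwrap-1+ : x ≃ y * (1ᴿ + z) → x ℝ.≃ y ℝ.* (ℝ.1ℝ ℝ.+ z)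
    unwrap-1+ = unwrap

  abstract
    -- Half of p is the witness, the other half being spent on the tolerance in the hypothesis.
    ι≤⇒0< : ∀ {p x} → 0ℚ ℚ.< p → ι p ≤ x → ℝ.0ℝ ℝ.< x
    ι≤⇒0< {p} {x} 0<p (wrap h) =
      let N , k = h (p ℚ.* ½) (0<half 0<p)
      in p ℚ.* ½ , 0<half 0<p , N , λ n N≤n → begin
        0ℚ ℚ.+ p ℚ.* ½                  ≡⟨ solve 1 (λ p → con 0ℚ :+ p :* con ½ := p :- p :* con ½) refl p ⟩
        p ℚ.- p ℚ.* ½                   ≲⟨ ℚ.+-monoˡ-≤ (ℚ.- (p ℚ.* ½)) (k n N≤n) ⟩
        seq x n ℚ.+ p ℚ.* ½ ℚ.- p ℚ.* ½ ≡⟨ solve 2 (λ x e → x :+ e :- e := x) refl (seq x n) (p ℚ.* ½) ⟩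
        seq x n                         ∎

-- Coefficient asymptotics of powers of a series with a simple pole

module PoleExpansions where

  open import Data.Rational.Base using (_/_)
  open import Data.Vec.Base using (Vec; []; _∷_; last; map)
  open NormedAlgebras
  open Weights using (toℚ; toℚ-+; toℚ-*; toℚ-mono; toℚ-1; 0≤toℚ; 0<toℚ-suc)
  open ApproximateGrowth using (archimedean-*)

  private
    module ℚᵃ = NormedAlgebraProperties ℚ-normedAlgebra

  ⅔ : ℚ
  ⅔ = ℤ.+ 2 / 3

  0≤⅔^ : ∀ n → 0ℚ ℚ.≤ ℚᵃ.geometric ⅔ n
  0≤⅔^ zero    = ℚ.≤ᵇ⇒≤ tt
  0≤⅔^ (suc n) = ℚᵃ.0≤-* {⅔} (ℚ.≤ᵇ⇒≤ tt) (0≤⅔^ n)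

  private
    -- The weight n + 2 makes the induction close, since 2(n + 3) ≤ 3(n + 2).
    ⅔^-bound : ∀ n → toℚ (2 ℕ.+ n) ℚ.* ℚᵃ.geometric ⅔ n ℚ.≤ toℚ 2
    ⅔^-bound zero    = ℚ.≤-reflexive (ℚ.*-identityʳ (toℚ 2))
    ⅔^-bound (suc n) = begin
      toℚ (3 ℕ.+ n) ℚ.* (⅔ ℚ.* ℚᵃ.geometric ⅔ n)
        ≡⟨ solve 2 (λ s x → s :* (con ⅔ :* x) := (s :+ s) :* con (ℤ.+ 1 / 3) :* x) refl (toℚ (3 ℕ.+ n)) (ℚᵃ.geometric ⅔ n) ⟩
      (toℚ (3 ℕ.+ n) ℚ.+ toℚ (3 ℕ.+ n)) ℚ.* (ℤ.+ 1 / 3) ℚ.* ℚᵃ.geometric ⅔ n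
        ≲⟨ ℚᵃ.*-monoʳ-≤ (0≤⅔^ n) (ℚᵃ.*-monoʳ-≤ {ℤ.+ 1 / 3} (ℚ.≤ᵇ⇒≤ tt) bound) ⟩
      (toℚ (2 ℕ.+ n) ℚ.+ toℚ (2 ℕ.+ n) ℚ.+ toℚ (2 ℕ.+ n)) ℚ.* (ℤ.+ 1 / 3) ℚ.* ℚᵃ.geometric ⅔ n
        ≡⟨ solve 2 (λ s x → (s :+ s :+ s) :* con (ℤ.+ 1 / 3) :* x := s :* x) refl (toℚ (2 ℕ.+ n)) (ℚᵃ.geometric ⅔ n) ⟩
      toℚ (2 ℕ.+ n) ℚ.* ℚᵃ.geometric ⅔ n
        ≲⟨ ⅔^-bound n ⟩
      toℚ 2 ∎
      where
      open ℚᵃ.≤-Reasoning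
      open ℚᵃ.Solver using (solve; _:=_; _:+_; _:*_; con)
      bound : toℚ (3 ℕ.+ n) ℚ.+ toℚ (3 ℕ.+ n) ℚ.≤ toℚ (2 ℕ.+ n) ℚ.+ toℚ (2 ℕ.+ n) ℚ.+ toℚ (2 ℕ.+ n)
      bound = ≡.subst₂ ℚ._≤_ (toℚ-+ (3 ℕ.+ n) (3 ℕ.+ n))
        (≡.trans (toℚ-+ (2 ℕ.+ n ℕ.+ (2 ℕ.+ n)) (2 ℕ.+ n)) (≡.cong (ℚ._+ toℚ (2 ℕ.+ n)) (toℚ-+ (2 ℕ.+ n) (2 ℕ.+ n))))
        (toℚ-mono (ℕ.≤-trans (ℕ.m≤m+n (3 ℕ.+ n ℕ.+ (3 ℕ.+ n)) n) (ℕ.≤-reflexive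
          (ℕsolve 1 (λ n → (ncon 3 ⊹ n ⊹ (ncon 3 ⊹ n)) ⊹ n ≔ (ncon 2 ⊹ n ⊹ (ncon 2 ⊹ n)) ⊹ (ncon 2 ⊹ n)) refl n))))
        where
        open Data.Nat.Solver.+-*-Solver using () renaming (solve to ℕsolve; con to ncon; _:+_ to _⊹_; _:=_ to _≔_)

  ⅔^-small : ∀ B ε → 0ℚ ℚ.< ε → ∃[ n ] B ℚ.* ℚᵃ.geometric ⅔ n ℚ.≤ ε
  ⅔^-small B ε 0<ε with ℚ.≤-total 0ℚ B
  ... | inj₂ B≤0 = 0 , ℚ.≤-trans (ℚ.≤-reflexive (ℚ.*-identityʳ B)) (ℚ.≤-trans B≤0 (ℚ.<⇒≤ 0<ε))
  ... | inj₁ 0≤B = n , ℚ.*-cancelˡ-≤-pos (toℚ (2 ℕ.+ n)) {{ℚ.positive (0<toℚ-suc (suc n))}} (begin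
      toℚ (2 ℕ.+ n) ℚ.* (B ℚ.* ℚᵃ.geometric ⅔ n)
        ≡⟨ solve 3 (λ s b x → s :* (b :* x) := b :* (s :* x)) refl (toℚ (2 ℕ.+ n)) B (ℚᵃ.geometric ⅔ n) ⟩
      B ℚ.* (toℚ (2 ℕ.+ n) ℚ.* ℚᵃ.geometric ⅔ n)
        ≲⟨ ℚᵃ.*-monoˡ-≤ 0≤B (⅔^-bound n) ⟩
      B ℚ.* toℚ 2
        ≲⟨ proj₂ (archimedean-* (B ℚ.* toℚ 2) ε 0<ε) ⟩
      toℚ n ℚ.* ε
        ≲⟨ ℚᵃ.*-monoʳ-≤ (ℚ.<⇒≤ 0<ε) (toℚ-mono (ℕ.m≤n+m n 2)) ⟩
      toℚ (2 ℕ.+ n) ℚ.* ε ∎)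
      where
      open ℚᵃ.≤-Reasoning
      open ℚᵃ.Solver using (solve; _:=_; _:*_)
      n = proj₁ (archimedean-* (B ℚ.* toℚ 2) ε 0<ε)

  -- The numbers C(n + j, j)

  figurate : ℕ → ℕ → ℕ
  figurate zero    n       = 1
  figurate (suc j) zero    = 1
  figurate (suc j) (suc n) = figurate (suc j) n ℕ.+ figurate j (suc n)

  figurate-0 : ∀ j → figurate j 0 ≡ 1
  figurate-0 zero    = refl
  figurate-0 (suc j) = refl

  private
    open Data.Nat.Solver.+-*-Solver using () renaming (solve to ℕsolve; con to ncon; _:+_ to _⊹_; _:*_ to _⊠_; _:=_ to _≔_)

    -- The absorption identities of C(n + j, j) in the two directions. Each serves in the induction
    -- step of the other.
    figurate-step-j : ∀ j n → suc j ℕ.* figurate (suc j) n ≡ suc (n ℕ.+ j) ℕ.* figurate j n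
    figurate-step-n : ∀ j n → suc n ℕ.* figurate j (suc n) ≡ suc (n ℕ.+ j) ℕ.* figurate j n

    figurate-step-j j zero    = ≡.cong (suc j ℕ.*_) (≡.sym (figurate-0 j))
    figurate-step-j j (suc n) = begin
      suc j ℕ.* (F ℕ.+ G)                             ≡⟨ ℕ.*-distribˡ-+ (suc j) F G ⟩
      suc j ℕ.* F ℕ.+ suc j ℕ.* G                     ≡⟨ ≡.cong (ℕ._+ suc j ℕ.* G) (≡.trans (figurate-step-j j n) (≡.sym (figurate-step-n j n))) ⟩
      suc n ℕ.* G ℕ.+ suc j ℕ.* G                     ≡⟨ ℕsolve 3 (λ j n g → (ncon 1 ⊹ n) ⊠ g ⊹ (ncon 1 ⊹ j) ⊠ g ≔ (ncon 1 ⊹ (ncon 1 ⊹ n) ⊹ j) ⊠ g) refl j n G ⟩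
      suc (suc n ℕ.+ j) ℕ.* G                         ∎
      where
      open ≡.≡-Reasoning
      F = figurate (suc j) n
      G = figurate j (suc n)

    figurate-step-n zero    n = ≡.cong (λ m → suc m ℕ.* 1) (≡.sym (ℕ.+-identityʳ n))
    figurate-step-n (suc j) n = begin
      suc n ℕ.* (F ℕ.+ G)                             ≡⟨ ℕ.*-distribˡ-+ (suc n) F G ⟩
      suc n ℕ.* F ℕ.+ suc n ℕ.* G                     ≡⟨ ≡.cong (suc n ℕ.* F ℕ.+_) (≡.trans (figurate-step-n j n) (≡.sym (figurate-step-j j n))) ⟩
      suc n ℕ.* F ℕ.+ suc j ℕ.* F                     ≡⟨ ℕsolve 3 (λ j n g → (ncon 1 ⊹ n) ⊠ g ⊹ (ncon 1 ⊹ j) ⊠ g ≔ (ncon 1 ⊹ (n ⊹ (ncon 1 ⊹ j))) ⊠ g) refl j n F ⟩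
      suc (n ℕ.+ suc j) ℕ.* F                         ∎
      where
      open ≡.≡-Reasoning
      F = figurate (suc j) n
      G = figurate j (suc n)

  reciprocal : ℕ → ℚ
  reciprocal j = (ℚ.1/ toℚ (suc j)) {{ℚ.pos⇒nonZero (toℚ (suc j)) {{ℚ.positive (0<toℚ-suc j)}}}}

  suc*reciprocal : ∀ j → toℚ (suc j) ℚ.* reciprocal j ≡ 1ℚ
  suc*reciprocal j = ℚ.*-inverseʳ (toℚ (suc j)) {{ℚ.pos⇒nonZero (toℚ (suc j)) {{ℚ.positive (0<toℚ-suc j)}}}}

  figurate-suc : ∀ j n → toℚ (figurate (suc j) n) ≡ toℚ (figurate j n) ℚ.* (1ℚ ℚ.+ reciprocal j ℚ.* toℚ n)
  figurate-suc j n = begin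
    G                                         ≡⟨ ℚ.*-identityˡ G ⟨
    1ℚ ℚ.* G                                  ≡⟨ ≡.cong (ℚ._* G) (suc*reciprocal j) ⟨
    s ℚ.* q ℚ.* G                             ≡⟨ solve 3 (λ s q g → s :* q :* g := q :* (s :* g)) refl s q G ⟩
    q ℚ.* (s ℚ.* G)                           ≡⟨ ≡.cong (q ℚ.*_) (≡.trans (≡.sym (toℚ-* (suc j) (figurate (suc j) n))) (≡.trans (≡.cong toℚ (figurate-step-j j n)) (toℚ-* (suc (n ℕ.+ j)) (figurate j n)))) ⟩
    q ℚ.* (toℚ (suc (n ℕ.+ j)) ℚ.* F)         ≡⟨ ≡.cong (λ x → q ℚ.* (x ℚ.* F)) (≡.trans (≡.cong toℚ (≡.sym (ℕ.+-suc n j))) (toℚ-+ n (suc j))) ⟩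
    q ℚ.* ((toℚ n ℚ.+ s) ℚ.* F)               ≡⟨ solve 4 (λ q n s f → q :* ((n :+ s) :* f) := f :* (s :* q :+ q :* n)) refl q (toℚ n) s F ⟩
    F ℚ.* (s ℚ.* q ℚ.+ q ℚ.* toℚ n)           ≡⟨ ≡.cong (λ x → F ℚ.* (x ℚ.+ q ℚ.* toℚ n)) (suc*reciprocal j) ⟩
    F ℚ.* (1ℚ ℚ.+ q ℚ.* toℚ n)                ∎
    where
    open ≡.≡-Reasoning
    open ℚᵃ.Solver using (solve; _:=_; _:+_; _:*_)
    F = toℚ (figurate j n)
    G = toℚ (figurate (suc j) n)
    s = toℚ (suc j)
    q = reciprocal j

  -- 1 / ((j + 1) ⋯ (j + r))
  reciprocals : ℕ → ℕ → ℚ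
  reciprocals j zero    = 1ℚ
  reciprocals j (suc r) = reciprocal j ℚ.* reciprocals (suc j) r

  reciprocals-! : ∀ j r → toℚ ((j ℕ.+ r) ℕ.!) ℚ.* reciprocals j r ≡ toℚ (j ℕ.!)
  reciprocals-! j zero    = ≡.trans (ℚ.*-identityʳ _) (≡.cong (λ m → toℚ (m ℕ.!)) (ℕ.+-identityʳ j))
  reciprocals-! j (suc r) = begin
    toℚ ((j ℕ.+ suc r) ℕ.!) ℚ.* (q ℚ.* p)      ≡⟨ ≡.cong (λ m → toℚ (m ℕ.!) ℚ.* (q ℚ.* p)) (ℕ.+-suc j r) ⟩
    toℚ ((suc j ℕ.+ r) ℕ.!) ℚ.* (q ℚ.* p)      ≡⟨ solve 3 (λ x q p → x :* (q :* p) := q :* (x :* p)) refl (toℚ ((suc j ℕ.+ r) ℕ.!)) q p ⟩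
    q ℚ.* (toℚ ((suc j ℕ.+ r) ℕ.!) ℚ.* p)      ≡⟨ ≡.cong (q ℚ.*_) (≡.trans (reciprocals-! (suc j) r) (toℚ-* (suc j) (j ℕ.!))) ⟩
    q ℚ.* (toℚ (suc j) ℚ.* toℚ (j ℕ.!))        ≡⟨ solve 3 (λ q s x → q :* (s :* x) := (s :* q) :* x) refl q (toℚ (suc j)) (toℚ (j ℕ.!)) ⟩
    toℚ (suc j) ℚ.* q ℚ.* toℚ (j ℕ.!)          ≡⟨ ≡.trans (≡.cong (ℚ._* toℚ (j ℕ.!)) (suc*reciprocal j)) (ℚ.*-identityˡ _) ⟩
    toℚ (j ℕ.!)                                ∎
    where
    open ≡.≡-Reasoning
    open ℚᵃ.Solver using (solve; _:=_; _:*_)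
    q = reciprocal j
    p = reciprocals (suc j) r

  -- Singularity analysis at a simple pole

  module PoleExpansion (ℂ : CompleteAlgebra) where
    open CompleteAlgebra ℂ
    open NormedAlgebraProperties normedAlgebra
    open Solver using (solve; _:=_; _:+_; _:*_; _:-_; :-_; con)
    open ≤-Reasoning

    -- A common rational bound for the initial segments; the norm itself need not exist as a
    -- constructive real number.
    Summable : Series → Set
    Summable f = ∃[ B ] 0ℚ ℚ.≤ B × (∀ n → ‖ f ‖ n ≤ ι B)

    Summable-⊕ : ∀ {f g} → Summable f → Summable g → Summable (f ⊕ g)
    Summable-⊕ {f} {g} (B , 0≤B , p) (C , 0≤C , q) = B ℚ.+ C , ℚᵃ.0≤-+ 0≤B 0≤C , λ n → begin
      ‖ f ⊕ g ‖ n         ≲⟨ ‖⊕‖≤ f g n ⟩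
      ‖ f ‖ n + ‖ g ‖ n   ≲⟨ +-mono-≤ (p n) (q n) ⟩
      ι B + ι C           ≈⟨ ι-+ B C ⟨
      ι (B ℚ.+ C)         ∎

    Summable-⊛ : ∀ {f g} → Summable f → Summable g → Summable (f ⊛ g)
    Summable-⊛ {f} {g} (B , 0≤B , p) (C , 0≤C , q) = B ℚ.* C , ℚᵃ.0≤-* 0≤B 0≤C , λ n → begin
      ‖ f ⊛ g ‖ n         ≲⟨ ‖⊛‖≤ f g n ⟩
      ‖ f ‖ n * ‖ g ‖ n   ≲⟨ *-mono-≤ (0≤ι 0≤B) (‖‖-nonneg g n) (p n) (q n) ⟩
      ι B * ι C           ≈⟨ ι-* B C ⟨
      ι (B ℚ.* C)         ∎

    Summable-scale : ∀ x {f} → Summable f → Summable (λ n → x * f n)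
    Summable-scale x {f} (B , 0≤B , p) = let C , 0≤C , q = bounded x in C ℚ.* B , ℚᵃ.0≤-* 0≤C 0≤B , λ n → begin
      ‖ (λ n → x * f n) ‖ n ≈⟨ ‖scale‖ x f n ⟩
      ∣ x ∣ * ‖ f ‖ n       ≲⟨ *-mono-≤ (0≤ι 0≤C) (‖‖-nonneg f n) q (p n) ⟩
      ι C * ι B             ≈⟨ ι-* C B ⟨
      ι (C ℚ.* B)           ∎

    Summable-𝟙 : Summable 𝟙
    Summable-𝟙 = 1ℚ , ℚ.≤ᵇ⇒≤ tt , λ n → ≤-trans (‖𝟙‖ n) (≤-reflexive (≈-sym ι-1))
      where
      0≤1 : 0# ≤ 1#
      0≤1 = ≤-trans (0≤ι {1ℚ} (ℚ.≤ᵇ⇒≤ tt)) (≤-reflexive ι-1)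
      zeros : ∀ n → ‖ 𝟘 ‖ n ≤ 0#
      zeros zero    = ≤-refl
      zeros (suc n) = ≤-trans (+-mono-≤ ∣0∣≤0 (zeros n)) (≤-reflexive (+-identityˡ 0#))
      ‖𝟙‖ : ∀ n → ‖ 𝟙 ‖ n ≤ 1#
      ‖𝟙‖ zero    = 0≤1
      ‖𝟙‖ (suc n) = ≤-trans (+-mono-≤ (0≤x⇒∣x∣≈x 0≤1) (zeros n)) (≤-reflexive (+-identityʳ 1#))

    Summable-𝟘 : Summable 𝟘
    Summable-𝟘 = 0ℚ , ℚ.≤-refl , λ n → ≤-trans (zeros n) (≤-reflexive (≈-sym ι-0))
      where
      zeros : ∀ n → ‖ 𝟘 ‖ n ≤ 0#
      zeros zero    = ≤-refl
      zeros (suc n) = ≤-trans (+-mono-≤ ∣0∣≤0 (zeros n)) (≤-reflexive (+-identityˡ 0#))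

    term≤ : ∀ {f B} → (∀ n → ‖ f ‖ n ≤ ι B) → ∀ n → ∣ f n ∣ ≤ ι B
    term≤ {f} p n = ≤-trans (sum-term {suc n} n (λ i → 0≤∣∣ (f i)) (ℕ.n<1+n n)) (p (suc n))

    -- Polynomials in the basis C(n + j, j)

    newton : ∀ {s} → ℕ → Vec Carrier s → Series
    newton j []       n = 0#
    newton j (b ∷ bs) n = b * ι (toℚ (figurate j n)) + newton (suc j) bs n

    newton-0 : ∀ {s} j (bs : Vec Carrier s) → newton (suc j) bs 0 ≈ newton j bs 0
    newton-0 j []       = ≈-refl
    newton-0 j (b ∷ bs) = +-cong (*-congˡ (≈-reflexive (≡.cong (ι ∘ toℚ) (≡.sym (figurate-0 j))))) (newton-0 (suc j) bs)

    -- Pascal's rule for the basis. It is what makes multiplication by 1/(1 - γz) raise the index j.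
    newton-suc : ∀ {s} j (bs : Vec Carrier s) n → newton (suc j) bs (suc n) ≈ newton (suc j) bs n + newton j bs (suc n)
    newton-suc j []       n = ≈-sym (+-identityˡ 0#)
    newton-suc j (b ∷ bs) n = begin-equality
      b * ι (toℚ (figurate (suc j) n ℕ.+ figurate j (suc n))) + newton (suc (suc j)) bs (suc n)
        ≈⟨ +-cong (≈-trans (*-congˡ (≈-trans (≈-reflexive (≡.cong ι (toℚ-+ (figurate (suc j) n) _))) (ι-+ _ _))) (distribˡ b _ _))
                  (newton-suc (suc j) bs n) ⟩
      (b * ι (toℚ (figurate (suc j) n)) + b * ι (toℚ (figurate j (suc n)))) + (newton (suc (suc j)) bs n + newton (suc j) bs (suc n))
        ≈⟨ +-interchange _ _ _ _ ⟩
      newton (suc j) (b ∷ bs) n + newton j (b ∷ bs) (suc n) ∎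

    newton-scale : ∀ {s} j c (bs : Vec Carrier s) n → newton j (map (c *_) bs) n ≈ c * newton j bs n
    newton-scale j c []       n = ≈-sym (zeroʳ c)
    newton-scale j c (b ∷ bs) n = ≈-trans (+-cong (*-assoc c b _) (newton-scale (suc j) c bs n)) (≈-sym (distribˡ c _ _))

    -- The second polynomial has smaller degree, so the leading coefficient is untouched.
    addLow : ∀ {s} → Vec Carrier (suc s) → Vec Carrier s → Vec Carrier (suc s)
    addLow (a ∷ [])     []       = a ∷ []
    addLow (a ∷ a′ ∷ as) (b ∷ bs) = a + b ∷ addLow (a′ ∷ as) bs

    newton-addLow : ∀ {s} j (as : Vec Carrier (suc s)) bs n → newton j (addLow as bs) n ≈ newton j as n + newton j bs n
    newton-addLow j (a ∷ [])      []       n = ≈-sym (+-identityʳ _)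
    newton-addLow j (a ∷ a′ ∷ as) (b ∷ bs) n = ≈-trans
      (+-cong (distribʳ (ι (toℚ (figurate j n))) a b) (newton-addLow (suc j) (a′ ∷ as) bs n)) (+-interchange _ _ _ _)

    last-addLow : ∀ {s} (as : Vec Carrier (suc s)) bs → last (addLow as bs) ≈ last as
    last-addLow (a ∷ [])           []       = ≈-refl
    last-addLow (a ∷ a′ ∷ [])      (b ∷ []) = ≈-refl
    last-addLow (a ∷ a′ ∷ a″ ∷ as) (b ∷ bs@(_ ∷ _)) = last-addLow (a′ ∷ a″ ∷ as) bs

    last-scale : ∀ {s} c (bs : Vec Carrier (suc s)) → last (map (c *_) bs) ≈ c * last bs
    last-scale c (b ∷ [])      = ≈-refl
    last-scale c (b ∷ b′ ∷ bs) = last-scale c (b′ ∷ bs)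

    eval : ∀ {d} → Vec Carrier d → Carrier → Carrier
    eval []      x = 0#
    eval (c ∷ P) x = c + x * eval P x

    addHead : ∀ {d} → Carrier → Vec Carrier (suc d) → Vec Carrier (suc d)
    addHead b (c ∷ P) = b + c ∷ P

    eval-addHead : ∀ {d} b (P : Vec Carrier (suc d)) x → eval (addHead b P) x ≈ b + eval P x
    eval-addHead b (c ∷ P) x = +-assoc b c _

    -- Multiplication by 1 + v x
    mulLinear : ∀ {d} → Carrier → Vec Carrier d → Vec Carrier (suc d)
    mulLinear v []      = 0# ∷ []
    mulLinear v (q ∷ Q) = q ∷ addHead (v * q) (mulLinear v Q)

    eval-mulLinear : ∀ {d} v (Q : Vec Carrier d) x → eval (mulLinear v Q) x ≈ (1# + v * x) * eval Q x
    eval-mulLinear v []      x = ≈-trans (+-identityˡ _) (≈-trans (zeroʳ x) (≈-sym (zeroʳ _)))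
    eval-mulLinear v (q ∷ Q) x = begin-equality
      q + x * eval (addHead (v * q) (mulLinear v Q)) x
        ≈⟨ +-congˡ (*-congˡ (≈-trans (eval-addHead (v * q) (mulLinear v Q) x) (+-congˡ (eval-mulLinear v Q x)))) ⟩
      q + x * (v * q + (1# + v * x) * eval Q x)
        ≈⟨ +-congˡ (*-congˡ (+-congˡ (*-congʳ (+-congʳ (≈-sym ι-1))))) ⟩
      q + x * (v * q + (ι 1ℚ + v * x) * eval Q x)
        ≈⟨ solve 4 (λ q x v e → q :+ x :* (v :* q :+ (con 1ℚ :+ v :* x) :* e) := (con 1ℚ :+ v :* x) :* (q :+ x :* e)) ≈-refl q x v (eval Q x) ⟩
      (ι 1ℚ + v * x) * (q + x * eval Q x)
        ≈⟨ *-congʳ (+-congʳ ι-1) ⟩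
      (1# + v * x) * (q + x * eval Q x) ∎

    last-addHead : ∀ {d} b (P : Vec Carrier (suc (suc d))) → last (addHead b P) ≈ last P
    last-addHead b (c ∷ _ ∷ _) = ≈-refl

    last-mulLinear : ∀ {d} v (Q : Vec Carrier (suc d)) → last (mulLinear v Q) ≈ v * last Q
    last-mulLinear v (q ∷ [])     = +-identityʳ (v * q)
    last-mulLinear v (q ∷ q′ ∷ Q) =
      ≈-trans (last-addHead (v * q) (mulLinear v (q′ ∷ Q))) (last-mulLinear v (q′ ∷ Q))

    -- Conversion to powers of n after the factor C(n + j, j) has been taken out. By `figurate-suc`
    -- the next basis element has the additional factor 1 + n/(j + 1), which gives a Horner scheme.
    monomials : ∀ {s} → ℕ → Vec Carrier s → Vec Carrier s
    monomials j []       = []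
    monomials j (b ∷ bs) = addHead b (mulLinear (ι (reciprocal j)) (monomials (suc j) bs))

    newton-monomials : ∀ {s} j (bs : Vec Carrier s) n →
                       newton j bs n ≈ ι (toℚ (figurate j n)) * eval (monomials j bs) (ι (toℚ n))
    newton-monomials j []       n = ≈-sym (zeroʳ _)
    newton-monomials j (b ∷ bs) n = begin-equality
      b * ι F + newton (suc j) bs n
        ≈⟨ +-cong (*-comm b (ι F)) (newton-monomials (suc j) bs n) ⟩
      ι F * b + ι (toℚ (figurate (suc j) n)) * e
        ≈⟨ +-congˡ (*-congʳ (≈-trans (≈-reflexive (≡.cong ι (figurate-suc j n))) (≈-trans (ι-* F _) (*-congˡ (≈-trans (ι-+ 1ℚ _) (+-cong ι-1 (ι-* _ _))))))) ⟩
      ι F * b + ι F * (1# + ι (reciprocal j) * ι (toℚ n)) * e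
        ≈⟨ ≈-trans (+-congˡ (*-assoc _ _ _)) (≈-sym (distribˡ (ι F) b _)) ⟩
      ι F * (b + (1# + ι (reciprocal j) * ι (toℚ n)) * e)
        ≈⟨ *-congˡ (+-congˡ (eval-mulLinear (ι (reciprocal j)) (monomials (suc j) bs) (ι (toℚ n)))) ⟨
      ι F * (b + eval (mulLinear (ι (reciprocal j)) (monomials (suc j) bs)) (ι (toℚ n)))
        ≈⟨ *-congˡ (eval-addHead b (mulLinear (ι (reciprocal j)) (monomials (suc j) bs)) (ι (toℚ n))) ⟨
      ι F * eval (monomials j (b ∷ bs)) (ι (toℚ n)) ∎
      where
      F : ℚ
      F = toℚ (figurate j n)
      e : Carrier
      e = eval (monomials (suc j) bs) (ι (toℚ n))

    last-monomials : ∀ {r} j (bs : Vec Carrier (suc r)) → last (monomials j bs) ≈ last bs * ι (reciprocals j r)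
    last-monomials j (b ∷ [])      = ≈-trans (+-identityʳ b) (≈-sym (≈-trans (*-congˡ ι-1) (*-identityʳ b)))
    last-monomials {suc r} j (b ∷ b′ ∷ bs) = begin-equality
      last (addHead b (mulLinear (ι (reciprocal j)) Q))     ≈⟨ last-addHead b (mulLinear (ι (reciprocal j)) Q) ⟩
      last (mulLinear (ι (reciprocal j)) Q)                 ≈⟨ last-mulLinear (ι (reciprocal j)) Q ⟩
      ι (reciprocal j) * last Q                             ≈⟨ *-congˡ (last-monomials (suc j) (b′ ∷ bs)) ⟩
      ι (reciprocal j) * (last (b′ ∷ bs) * ι (reciprocals (suc j) r))
        ≈⟨ solve 3 (λ x y z → x :* (y :* z) := y :* (x :* z)) ≈-refl (ι (reciprocal j)) (last (b′ ∷ bs)) _ ⟩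
      last (b′ ∷ bs) * (ι (reciprocal j) * ι (reciprocals (suc j) r))
        ≈⟨ *-congˡ (ι-* (reciprocal j) _) ⟨
      last (b′ ∷ bs) * ι (reciprocals j (suc r)) ∎
      where
      Q : Vec Carrier (suc r)
      Q = monomials (suc j) (b′ ∷ bs)

    -- The error terms are relative, so the polynomial will have to be divided by, with an explicit
    -- positive bound. In c + n P′(n) with P′(n) ≥ δ, the second term exceeds a bound of c by 1 as
    -- soon as n δ does.
    eventually-positive : ∀ {r} (P : Vec Carrier (suc r)) ε → 0ℚ ℚ.< ε → ι ε ≤ last P →
      ∃[ δ ] 0ℚ ℚ.< δ × ∃[ N ] ∀ n → N ℕ.≤ n → ι δ ≤ eval P (ι (toℚ n))
    eventually-positive (c ∷ [])     ε 0<ε h = ε , 0<ε , 0 , λ n _ → ≤-trans h (≤-reflexive (≈-sym (≈-trans (+-congˡ (zeroʳ _)) (+-identityʳ c))))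
    eventually-positive (c ∷ c′ ∷ P) ε 0<ε h =
      let δ , 0<δ , N , p = eventually-positive (c′ ∷ P) ε 0<ε h
          C , 0≤C , ∣c∣≤C = bounded c
          M , C+1≤Mδ = archimedean-* (C ℚ.+ 1ℚ) δ 0<δ
      in 1ℚ , ℚ.positive⁻¹ 1ℚ , N ℕ.⊔ M , λ n N⊔M≤n → begin
        ι 1ℚ
          ≈⟨ solve 1 (λ x → con 1ℚ := :- x :+ (x :+ con 1ℚ)) ≈-refl (ι C) ⟩
        - ι C + (ι C + ι 1ℚ)
          ≲⟨ +-mono-≤ (≤-trans (-‿anti-≤ (≤-trans (≤∣∣ (- c)) (≤-trans (≤-reflexive (∣-∣ c)) ∣c∣≤C))) (≤-reflexive (-‿involutive c)))
               (≤-trans (≤-reflexive (≈-sym (ι-+ C 1ℚ))) (≤-trans (ι-mono (ℚ.≤-trans C+1≤Mδ (ℚᵃ.*-monoʳ-≤ (ℚ.<⇒≤ 0<δ) (toℚ-mono (ℕ.m⊔n≤o⇒n≤o N M N⊔M≤n)))))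
                 (≤-reflexive (ι-* (toℚ n) δ)))) ⟩
        c + ι (toℚ n) * ι δ
          ≲⟨ +-monoʳ-≤ c (*-monoˡ-≤ (0≤ι (0≤toℚ n)) (p n (ℕ.m⊔n≤o⇒m≤o N M N⊔M≤n))) ⟩
        c + ι (toℚ n) * eval (c′ ∷ P) (ι (toℚ n)) ∎

    module Pole (γ x : Carrier) (γx≈1 : γ * x ≈ 1#) (3/2≤γ : ι (ℤ.+ 3 / 2) ≤ γ) (0≤x : 0# ≤ x) (x≤⅔ : x ≤ ι ⅔) where

      γ^_ x^_ : ℕ → Carrier
      γ^_ = geometric γ
      x^_ = geometric x

      0≤γ : 0# ≤ γ
      0≤γ = ≤-trans (0≤ι (ℚ.≤ᵇ⇒≤ tt)) 3/2≤γ

      0≤1# : 0# ≤ 1#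
      0≤1# = ≤-trans (0≤ι {1ℚ} (ℚ.≤ᵇ⇒≤ tt)) (≤-reflexive ι-1)

      0≤γ^ : ∀ n → 0# ≤ γ^ n
      0≤γ^ zero    = 0≤1#
      0≤γ^ (suc n) = 0≤-* 0≤γ (0≤γ^ n)

      0≤x^ : ∀ n → 0# ≤ x^ n
      0≤x^ zero    = 0≤1#
      0≤x^ (suc n) = 0≤-* 0≤x (0≤x^ n)

      γ^x^ : ∀ n → γ^ n * x^ n ≈ 1#
      γ^x^ zero    = *-identityˡ 1#
      γ^x^ (suc n) = begin-equality
        γ * γ^ n * (x * x^ n)   ≈⟨ solve 4 (λ g p x q → g :* p :* (x :* q) := (g :* x) :* (p :* q)) ≈-refl γ (γ^ n) x (x^ n) ⟩
        γ * x * (γ^ n * x^ n)   ≈⟨ *-cong γx≈1 (γ^x^ n) ⟩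
        1# * 1#                 ≈⟨ *-identityˡ 1# ⟩
        1#                      ∎

      x^≤⅔^ : ∀ n → x^ n ≤ ι (ℚᵃ.geometric ⅔ n)
      x^≤⅔^ zero    = ≤-reflexive (≈-sym ι-1)
      x^≤⅔^ (suc n) = ≤-trans (*-mono-≤ (0≤ι {⅔} (ℚ.≤ᵇ⇒≤ tt)) (0≤x^ n) x≤⅔ (x^≤⅔^ n)) (≤-reflexive (≈-sym (ι-* ⅔ _)))

      x^-suc≤ : ∀ n → x^ (suc n) ≤ x^ n
      x^-suc≤ n = ≤-trans (*-monoʳ-≤ (0≤x^ n) (≤-trans x≤⅔ (≤-trans (ι-mono (ℚ.≤ᵇ⇒≤ tt)) (≤-reflexive ι-1))))
        (≤-reflexive (*-identityˡ (x^ n)))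

      x^-mono : ∀ m i → x^ (m ℕ.+ i) ≤ x^ m
      x^-mono m zero    = ≤-reflexive (≈-reflexive (≡.cong x^_ (ℕ.+-identityʳ m)))
      x^-mono m (suc i) = ≤-trans (≤-reflexive (≈-reflexive (≡.cong x^_ (ℕ.+-suc m i)))) (≤-trans (x^-suc≤ (m ℕ.+ i)) (x^-mono m i))

      record SimplePole (f : Series) : Set where
        constructor simplePole
        field
          residue   : Carrier
          remainder : Series
          summable  : Summable remainder
          expansion : ∀ n → f n ≈ residue * γ^ n + remainder n

      -- With f = K/(1 - γz), the numbers f n xⁿ are the partial sums of K(x), so the residue is
      -- K(x) and f n - K(x)γⁿ is bounded. This remainder satisfies h (n + 1) = γ h n + K (n + 1);
      -- solved backwards, the recursion contracts and makes a bounded h summable.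
      geometric-pole : ∀ {K} → Summable K → SimplePole (γ^_ ⊛ K)
      geometric-pole {K} (B , 0≤B , ‖K‖≤) = simplePole L h (ℤ.+ 4 / 1 ℚ.* B , ℚᵃ.0≤-* {ℤ.+ 4 / 1} (ℚ.≤ᵇ⇒≤ tt) 0≤B , ‖h‖≤)
        λ n → solve 2 (λ a b → a := b :+ (a :- b)) ≈-refl (f n) (L * γ^ n)
        where
        f X : Series
        f = γ^_ ⊛ K
        X n = f n * x^ n
        X-suc : ∀ n → X (suc n) ≈ X n + K (suc n) * x^ (suc n)
        X-suc n = begin-equality
          f (suc n) * x^ (suc n)
            ≈⟨ *-congʳ (geometric-⊛ γ K n) ⟩
          (K (suc n) + γ * f n) * (x * x^ n)
            ≈⟨ solve 5 (λ k g f x p → (k :+ g :* f) :* (x :* p) := (g :* x) :* (f :* p) :+ k :* (x :* p)) ≈-refl (K (suc n)) γ (f n) x (x^ n) ⟩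
          γ * x * X n + K (suc n) * x^ (suc n)
            ≈⟨ +-congʳ (≈-trans (*-congʳ γx≈1) (*-identityˡ (X n))) ⟩
          X n + K (suc n) * x^ (suc n) ∎
        X-close : ∀ m i → ∣ X (m ℕ.+ i) - X m ∣ ≤ x^ m * sum i (λ k → ∣ K (suc m ℕ.+ k) ∣)
        X-close m zero    = ≤-trans (≤-reflexive (∣∣-cong (≈-trans (+-congʳ (≈-reflexive (≡.cong X (ℕ.+-identityʳ m)))) (-‿inverseʳ (X m)))))
          (≤-trans ∣0∣≤0 (≤-reflexive (≈-sym (zeroʳ (x^ m)))))
        X-close m (suc i) = begin
          ∣ X (m ℕ.+ suc i) - X m ∣
            ≈⟨ ∣∣-cong (≈-trans (+-congʳ (≈-trans (≈-reflexive (≡.cong X (ℕ.+-suc m i))) (X-suc (m ℕ.+ i))))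
                 (solve 3 (λ a b c → (a :+ b) :- c := (a :- c) :+ b) ≈-refl (X (m ℕ.+ i)) (K (suc m ℕ.+ i) * x^ (suc m ℕ.+ i)) (X m))) ⟩
          ∣ (X (m ℕ.+ i) - X m) + K (suc m ℕ.+ i) * x^ (suc m ℕ.+ i) ∣
            ≲⟨ ≤-trans (∣+∣≤ _ _) (+-mono-≤ (X-close m i) (∣*∣≤ ≤-refl (≤-trans (0≤x⇒∣x∣≈x (0≤x^ (suc m ℕ.+ i)))
                 (≤-trans (x^-suc≤ (m ℕ.+ i)) (x^-mono m i))))) ⟩
          x^ m * sum i (λ k → ∣ K (suc m ℕ.+ k) ∣) + ∣ K (suc m ℕ.+ i) ∣ * x^ m
            ≈⟨ solve 3 (λ p s k → p :* s :+ k :* p := p :* (s :+ k)) ≈-refl (x^ m) _ ∣ K (suc m ℕ.+ i) ∣ ⟩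
          x^ m * (sum i (λ k → ∣ K (suc m ℕ.+ k) ∣) + ∣ K (suc m ℕ.+ i) ∣)
            ≈⟨ *-congˡ (sum-last i (λ k → ∣ K (suc m ℕ.+ k) ∣)) ⟨
          x^ m * sum (suc i) (λ k → ∣ K (suc m ℕ.+ k) ∣) ∎
        r : Series
        r m = ι B * x^ m
        X-cauchy : ∀ m n → m ℕ.≤ n → ∣ X n - X m ∣ ≤ r m
        X-cauchy m n m≤n = begin
          ∣ X n - X m ∣
            ≈⟨ ∣∣-cong (+-congʳ (≈-reflexive (≡.cong X (≡.sym (ℕ.m+[n∸m]≡n m≤n))))) ⟩
          ∣ X (m ℕ.+ (n ℕ.∸ m)) - X m ∣
            ≲⟨ X-close m (n ℕ.∸ m) ⟩
          x^ m * sum (n ℕ.∸ m) (λ k → ∣ K (suc m ℕ.+ k) ∣)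
            ≲⟨ *-monoˡ-≤ (0≤x^ m) (≤-trans (x≤y+x (sum-nonneg (suc m) λ i → 0≤∣∣ (K i)))
                 (≤-trans (≤-reflexive (≈-sym (sum-split (suc m) (n ℕ.∸ m) (λ i → ∣ K i ∣)))) (‖K‖≤ (suc m ℕ.+ (n ℕ.∸ m))))) ⟩
          x^ m * ι B
            ≈⟨ *-comm (x^ m) (ι B) ⟩
          r m ∎
        the-limit : ∃[ L ] (∀ m → ∣ L - X m ∣ ≤ r m)
        the-limit = limit X r (λ m → B ℚ.* ℚᵃ.geometric ⅔ m) (⅔^-small B)
          (λ m → ≤-trans (*-monoˡ-≤ (0≤ι 0≤B) (x^≤⅔^ m)) (≤-reflexive (≈-sym (ι-* B _)))) X-cauchy
        L : Carrier
        L = proj₁ the-limit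
        h : Series
        h n = f n - L * γ^ n
        h-suc : ∀ n → h (suc n) ≈ γ * h n + K (suc n)
        h-suc n = ≈-trans (+-congʳ (geometric-⊛ γ K n))
          (solve 5 (λ k g f l p → (k :+ g :* f) :- l :* (g :* p) := g :* (f :- l :* p) :+ k) ≈-refl (K (suc n)) γ (f n) L (γ^ n))
        ∣h∣≤ : ∀ n → ∣ h n ∣ ≤ ι B
        ∣h∣≤ n = begin
          ∣ f n - L * γ^ n ∣
            ≈⟨ ∣∣-cong (+-congʳ (≈-trans (≈-sym (*-identityʳ (f n))) (*-congˡ (≈-sym (γ^x^ n))))) ⟩
          ∣ f n * (γ^ n * x^ n) - L * γ^ n ∣
            ≈⟨ ∣∣-cong (solve 4 (λ f p q l → f :* (p :* q) :- l :* p := (:- p) :* (l :- f :* q)) ≈-refl (f n) (γ^ n) (x^ n) L) ⟩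
          ∣ - γ^ n * (L - X n) ∣
            ≲⟨ ∣*∣≤ (≤-trans (≤-reflexive (∣-∣ (γ^ n))) (0≤x⇒∣x∣≈x (0≤γ^ n))) (proj₂ the-limit n) ⟩
          γ^ n * (ι B * x^ n)
            ≈⟨ solve 3 (λ p b q → p :* (b :* q) := b :* (p :* q)) ≈-refl (γ^ n) (ι B) (x^ n) ⟩
          ι B * (γ^ n * x^ n)
            ≈⟨ ≈-trans (*-congˡ (γ^x^ n)) (*-identityʳ (ι B)) ⟩
          ι B ∎
        ‖h‖≤ : ∀ n → ‖ h ‖ n ≤ ι (ℤ.+ 4 / 1 ℚ.* B)
        ‖h‖≤ n = begin
          ‖ h ‖ n
            ≈⟨ solve 1 (λ s → s := con (ℤ.+ 2 / 1) :* (con (ℤ.+ 3 / 2) :* s :- s)) ≈-refl (‖ h ‖ n) ⟩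
          ι (ℤ.+ 2 / 1) * (ι (ℤ.+ 3 / 2) * ‖ h ‖ n - ‖ h ‖ n)
            ≲⟨ *-monoˡ-≤ (0≤ι {ℤ.+ 2 / 1} (ℚ.≤ᵇ⇒≤ tt)) (+-monoˡ-≤ (- ‖ h ‖ n) (≤-trans (*-monoʳ-≤ (‖‖-nonneg h n) 3/2≤γ)
                 (≤-trans (backward h (K ∘ suc) 0≤γ h-suc n) (+-monoʳ-≤ (‖ h ‖ n) (+-mono-≤ (∣h∣≤ n)
                   (≤-trans (x≤y+x (0≤∣∣ (K 0))) (‖K‖≤ (suc n)))))))) ⟩
          ι (ℤ.+ 2 / 1) * (‖ h ‖ n + (ι B + ι B) - ‖ h ‖ n)
            ≈⟨ solve 2 (λ s b → con (ℤ.+ 2 / 1) :* (s :+ (b :+ b) :- s) := con (ℤ.+ 4 / 1) :* b) ≈-refl (‖ h ‖ n) (ι B) ⟩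
          ι (ℤ.+ 4 / 1) * ι B
            ≈⟨ ι-* (ℤ.+ 4 / 1) B ⟨
          ι (ℤ.+ 4 / 1 ℚ.* B) ∎

      -- Powers of a series with a simple pole

      record Expansion (r : ℕ) (lead : Carrier) (f : Series) : Set where
        constructor expand
        field
          coefficients : Vec Carrier (suc r)
          remainder    : Series
          summable     : Summable remainder
          expansion    : ∀ n → f n ≈ newton 0 coefficients n * γ^ n + remainder n
          leading      : last coefficients ≈ lead

      -- Multiplication by 1/(1 - γz) raises the order of the pole by one: C(n + j, j)γⁿ becomes C(n
      -- + j + 1, j + 1)γⁿ.
      geometric-newton : ∀ {s} j (bs : Vec Carrier s) n →
                         (γ^_ ⊛ (λ n → newton j bs n * γ^ n)) n ≈ newton (suc j) bs n * γ^ n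
      geometric-newton j bs zero    = ≈-trans (*-identityˡ _) (*-congʳ (≈-sym (newton-0 j bs)))
      geometric-newton j bs (suc n) = begin-equality
        (γ^_ ⊛ (λ n → newton j bs n * γ^ n)) (suc n)
          ≈⟨ geometric-⊛ γ _ n ⟩
        newton j bs (suc n) * γ^ (suc n) + γ * (γ^_ ⊛ (λ n → newton j bs n * γ^ n)) n
          ≈⟨ +-congˡ (*-congˡ (geometric-newton j bs n)) ⟩
        newton j bs (suc n) * (γ * γ^ n) + γ * (newton (suc j) bs n * γ^ n)
          ≈⟨ solve 4 (λ a g p b → a :* (g :* p) :+ g :* (b :* p) := (b :+ a) :* (g :* p)) ≈-refl (newton j bs (suc n)) γ (γ^ n) (newton (suc j) bs n) ⟩
        (newton (suc j) bs n + newton j bs (suc n)) * γ^ (suc n)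
          ≈⟨ *-congʳ (newton-suc j bs n) ⟨
        newton (suc j) bs (suc n) * γ^ (suc n) ∎

      module _ {W : Series} (W-pole : SimplePole W) where
        open SimplePole W-pole renaming (residue to c; remainder to h₀; summable to h₀-summable; expansion to W-expansion)

        private
          W-⊛ : ∀ f n → (W ⊛ f) n ≈ c * (γ^_ ⊛ f) n + (h₀ ⊛ f) n
          W-⊛ f n = begin-equality
            (W ⊛ f) n                              ≈⟨ ⊛-congʳ f W-expansion n ⟩
            (((λ n → c * γ^ n) ⊕ h₀) ⊛ f) n        ≈⟨ ⊛-distribʳ f (λ n → c * γ^ n) h₀ n ⟩
            ((λ n → c * γ^ n) ⊛ f) n + (h₀ ⊛ f) n  ≈⟨ +-congʳ (⊛-scaleˡ c γ^_ f n) ⟩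
            c * (γ^_ ⊛ f) n + (h₀ ⊛ f) n           ∎

        -- The induction goes through for all products with a summable K: the part of
        -- W without pole is absorbed in K.
        power-expansion : ∀ r {K} → Summable K → (K-pole : SimplePole (γ^_ ⊛ K)) →
                          Expansion r (geometric c (suc r) * SimplePole.residue K-pole) (W ⊛^ suc r ⊛ K)
        power-expansion zero {K} K-summable (simplePole k h h-summable K-expansion) =
          expand (c * k ∷ []) (λ n → c * h n + (h₀ ⊛ K) n)
            (Summable-⊕ (Summable-scale c h-summable) (Summable-⊛ h₀-summable K-summable))
            (λ n → begin-equality
              ((W ⊛ 𝟙) ⊛ K) n
                ≈⟨ ⊛-congʳ K (⊛-identityʳ W) n ⟩
              (W ⊛ K) n
                ≈⟨ W-⊛ K n ⟩
              c * (γ^_ ⊛ K) n + (h₀ ⊛ K) n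
                ≈⟨ +-congʳ (*-congˡ (K-expansion n)) ⟩
              c * (k * γ^ n + h n) + (h₀ ⊛ K) n
                ≈⟨ solve 5 (λ c k g h x → c :* (k :* g :+ h) :+ x := (c :* k :* con 1ℚ :+ con 0ℚ) :* g :+ (c :* h :+ x)) ≈-refl c k (γ^ n) (h n) ((h₀ ⊛ K) n) ⟩
              (c * k * ι 1ℚ + ι 0ℚ) * γ^ n + (c * h n + (h₀ ⊛ K) n)
                ≈⟨ +-congʳ (*-congʳ (+-cong (*-congˡ (≈-reflexive (≡.cong ι (≡.sym toℚ-1)))) ι-0)) ⟩
              newton 0 (c * k ∷ []) n * γ^ n + (c * h n + (h₀ ⊛ K) n) ∎)
            (*-congʳ (≈-sym (*-identityʳ c)))
        power-expansion (suc r) {K} K-summable K-pole = expand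
          (addLow (c * k ∷ map (c *_) bs) bs′) (λ n → c * h n + h₂ n)
          (Summable-⊕ (Summable-scale c (SimplePole.summable h₁-pole)) h₂-summable)
          (λ n → begin-equality
            ((W ⊛ W ⊛^ suc r) ⊛ K) n
              ≈⟨ ⊛-assoc W (W ⊛^ suc r) K n ⟩
            (W ⊛ (W ⊛^ suc r ⊛ K)) n
              ≈⟨ W-⊛ (W ⊛^ suc r ⊛ K) n ⟩
            c * (γ^_ ⊛ (W ⊛^ suc r ⊛ K)) n + (h₀ ⊛ (W ⊛^ suc r ⊛ K)) n
              ≈⟨ +-cong (*-congˡ (first n)) (second n) ⟩
            c * (newton 1 bs n * γ^ n + (k * γ^ n + h n)) + (newton 0 bs′ n * γ^ n + h₂ n)
              ≈⟨ solve 7 (λ c w g k h v x → c :* (w :* g :+ (k :* g :+ h)) :+ (v :* g :+ x) := (c :* k :* con 1ℚ :+ c :* w :+ v) :* g :+ (c :* h :+ x)) ≈-refl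
                   c (newton 1 bs n) (γ^ n) k (h n) (newton 0 bs′ n) (h₂ n) ⟩
            (c * k * ι 1ℚ + c * newton 1 bs n + newton 0 bs′ n) * γ^ n + (c * h n + h₂ n)
              ≈⟨ +-congʳ (*-congʳ (≈-trans (+-congʳ (+-cong (*-congˡ (≈-reflexive (≡.cong ι (≡.sym toℚ-1)))) (≈-sym (newton-scale 1 c bs n))))
                   (≈-sym (newton-addLow 0 (c * k ∷ map (c *_) bs) bs′ n)))) ⟩
            newton 0 (addLow (c * k ∷ map (c *_) bs) bs′) n * γ^ n + (c * h n + h₂ n) ∎)
          (begin-equality
            last (addLow (c * k ∷ map (c *_) bs) bs′)      ≈⟨ last-addLow (c * k ∷ map (c *_) bs) bs′ ⟩
            last (map (c *_) bs)                           ≈⟨ last-scale c bs ⟩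
            c * last bs                                    ≈⟨ *-congˡ leading₁ ⟩
            c * (geometric c (suc r) * SimplePole.residue K-pole) ≈⟨ *-assoc _ _ _ ⟨
            geometric c (suc (suc r)) * SimplePole.residue K-pole ∎)
          where
          open Expansion (power-expansion r K-summable K-pole) using () renaming
            (coefficients to bs; remainder to h₁; summable to h₁-summable; expansion to expansion₁; leading to leading₁)
          -- The summable remainder, divided by 1 - γz, has only a simple pole; its residue k goes
          -- into the constant coefficient.
          h₁-pole : SimplePole (γ^_ ⊛ h₁)
          h₁-pole = geometric-pole h₁-summable
          k : Carrier
          k = SimplePole.residue h₁-pole
          h : Series
          h = SimplePole.remainder h₁-pole
          h₀K-summable : Summable (h₀ ⊛ K)
          h₀K-summable = Summable-⊛ h₀-summable K-summable
          open Expansion (power-expansion r h₀K-summable (geometric-pole h₀K-summable)) using () renaming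
            (coefficients to bs′; remainder to h₂; summable to h₂-summable; expansion to expansion₂)
          first : ∀ n → (γ^_ ⊛ (W ⊛^ suc r ⊛ K)) n ≈ newton 1 bs n * γ^ n + (k * γ^ n + h n)
          first n = begin-equality
            (γ^_ ⊛ (W ⊛^ suc r ⊛ K)) n
              ≈⟨ ⊛-congˡ γ^_ expansion₁ n ⟩
            (γ^_ ⊛ ((λ n → newton 0 bs n * γ^ n) ⊕ h₁)) n
              ≈⟨ ⊛-distribˡ γ^_ (λ n → newton 0 bs n * γ^ n) h₁ n ⟩
            (γ^_ ⊛ (λ n → newton 0 bs n * γ^ n)) n + (γ^_ ⊛ h₁) n
              ≈⟨ +-cong (geometric-newton 0 bs n) (SimplePole.expansion h₁-pole n) ⟩
            newton 1 bs n * γ^ n + (k * γ^ n + h n) ∎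
          second : ∀ n → (h₀ ⊛ (W ⊛^ suc r ⊛ K)) n ≈ newton 0 bs′ n * γ^ n + h₂ n
          second n = begin-equality
            (h₀ ⊛ (W ⊛^ suc r ⊛ K)) n   ≈⟨ ⊛-assoc h₀ (W ⊛^ suc r) K n ⟨
            ((h₀ ⊛ W ⊛^ suc r) ⊛ K) n   ≈⟨ ⊛-congʳ K (⊛-comm h₀ (W ⊛^ suc r)) n ⟩
            ((W ⊛^ suc r ⊛ h₀) ⊛ K) n   ≈⟨ ⊛-assoc (W ⊛^ suc r) h₀ K n ⟩
            (W ⊛^ suc r ⊛ (h₀ ⊛ K)) n   ≈⟨ expansion₂ n ⟩
            newton 0 bs′ n * γ^ n + h₂ n ∎

-- The growth rate Γ and the expansion of w

module Growth where

  open ℝ using (ℝ; mkℝ; seq)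
  open import Data.Nat.Base using (_^_)
  open import Data.Rational.Base using (½; _/_)
  open NormedAlgebras
  open Weights hiding (f)
  open MaximalCount using (w; 0≤w)
  open Coefficients using (den; 0<den; den*a)
  open ApproximateGrowth
  open ExactValues using (w-63; w-64)
  open Reals using (ι; abs; 0ᴿ; eventually-≤; pointwise-≤; seq-+; seq-*; seq-neg; seq-abs; seq-ι; module Inverse; ι≤⇒0<; ℝ-normedAlgebra; ℝ-completeAlgebra; 0ᴿ-def; 1ᴿ-def)
  open PoleExpansions

  private module ℚᵃ = NormedAlgebraProperties ℚ-normedAlgebra
  open NormedAlgebraProperties ℝ-normedAlgebra hiding (ι; ∣_∣)
  open PoleExpansion ℝ-completeAlgebra

  abstract
    ratio : ℕ → ℚ
    ratio n = proj₁ (approximate-ratio n)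

    low≤ratio : ∀ n → g-low ℚ.≤ ratio n
    low≤ratio n = proj₁ (proj₂ (approximate-ratio n))

    ratio-norm : ∀ n → ℚᵃ.‖_‖ (ℚᵃ._⊛_ (ℚᵃ.linear (ratio n)) w) (suc (suc n)) ℚ.≤ toℚ 5000
    ratio-norm n = proj₂ (proj₂ (proj₂ (approximate-ratio n)))

  ratio-close : ∀ m k → k ℕ.≤ m → ℚ.∣ w (suc k) ℚ.- ratio m ℚ.* w k ∣ ℚ.≤ toℚ 5000
  ratio-close m k k≤m = ℚ.≤-trans (ℚ.≤-reflexive (≡.cong ℚ.∣_∣ (≡.sym (ℚᵃ.linear-⊛ (ratio m) w k))))
    (ℚ.≤-trans (ℚᵃ.sum-term {f = λ i → ℚ.∣ ℚᵃ._⊛_ (ℚᵃ.linear (ratio m)) w i ∣} (suc k) (λ i → ℚ.0≤∣p∣ (ℚᵃ._⊛_ (ℚᵃ.linear (ratio m)) w i)) (s≤s (s≤s k≤m))) (ratio-norm m))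

  C₆₃ C₆₄ : ℕ
  C₆₃ = 32615983882179874452751082939496979281114881141381620494671860940303288774108538178523618619
  C₆₄ = 2489615813741306105475580472314955991397530382032808850791073040050523134963780581909313595613

  den-positive : ∀ k → ℚ.Positive (toℚ (den k))
  den-positive k = ℚ.positive (ℚ.<-≤-trans (0<toℚ-suc 0) (toℚ-mono (0<den k)))

  den*w : ∀ k C → w k ≡ toℚ C ℚ.* a k → toℚ (den k) ℚ.* w k ≡ toℚ (C ℕ.* 3 ^ k)
  den*w k C e = begin
    toℚ (den k) ℚ.* w k               ≡⟨ ≡.cong (toℚ (den k) ℚ.*_) e ⟩
    toℚ (den k) ℚ.* (toℚ C ℚ.* a k)   ≡⟨ solve 3 (λ d c a → d :* (c :* a) := c :* (d :* a)) refl (toℚ (den k)) (toℚ C) (a k) ⟩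
    toℚ C ℚ.* (toℚ (den k) ℚ.* a k)   ≡⟨ ≡.cong (toℚ C ℚ.*_) (den*a k) ⟩
    toℚ C ℚ.* toℚ (3 ^ k)             ≡⟨ toℚ-* C (3 ^ k) ⟨
    toℚ (C ℕ.* 3 ^ k)                 ∎
    where
    open ≡.≡-Reasoning
    open ℚᵃ.Solver using (solve; _:=_; _:*_)

  den*w₆₃ : toℚ (den 63) ℚ.* w 63 ≡ toℚ (C₆₃ ℕ.* 3 ^ 63)
  den*w₆₃ = den*w 63 C₆₃ w-63

  den*w₆₄ : toℚ (den 64) ℚ.* w 64 ≡ toℚ (C₆₄ ℕ.* 3 ^ 64)
  den*w₆₄ = den*w 64 C₆₄ w-64

  w-large : toℚ 100000 ℚ.≤ w 64
  w-large = ℚ.*-cancelˡ-≤-pos (toℚ (den 64)) {{den-positive 64}} (begin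
    toℚ (den 64) ℚ.* toℚ 100000       ≡⟨ toℚ-* (den 64) 100000 ⟨
    toℚ (den 64 ℕ.* 100000)           ≲⟨ toℚ-mono (ℕ.≤ᵇ⇒≤ (den 64 ℕ.* 100000) (C₆₄ ℕ.* 3 ^ 64) tt) ⟩
    toℚ (C₆₄ ℕ.* 3 ^ 64)              ≡⟨ den*w₆₄ ⟨
    toℚ (den 64) ℚ.* w 64             ∎)
    where open ℚᵃ.≤-Reasoning

  -- Above 10⁵ the growth by a factor of at least 3/2 outweighs the error 5000. So w is unbounded,
  -- which makes the approximate ratios converge.
  w-step : ∀ k → toℚ 100000 ℚ.≤ w k → 1ℚ ℚ.+ w k ℚ.≤ w (suc k)
  w-step k large = begin
    1ℚ ℚ.+ v
      ≲⟨ ℚᵃ.≤-by (solve 1 (λ v → con (ℤ.+ 3 / 2) :* v :- con (ℤ.+ 5000 / 1) := (con 1ℚ :+ v) :+ (con ½ :* (v :- con (ℤ.+ 100000 / 1)) :+ con (ℤ.+ 44999 / 1))) refl v)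
           (ℚᵃ.0≤-+ {½ ℚ.* (v ℚ.- (ℤ.+ 100000 / 1))} {ℤ.+ 44999 / 1} (ℚᵃ.0≤-* {½} {v ℚ.- (ℤ.+ 100000 / 1)} (ℚ.≤ᵇ⇒≤ tt) (ℚᵃ.0≤y-x (ℚ.≤-trans (ℚ.≤-reflexive (≡.sym (toℚ-def 100000))) large)))
             (ℚ.≤ᵇ⇒≤ {0ℚ} {ℤ.+ 44999 / 1} tt)) ⟩
    (ℤ.+ 3 / 2) ℚ.* v ℚ.- (ℤ.+ 5000 / 1)
      ≲⟨ ℚ.+-mono-≤ {(ℤ.+ 3 / 2) ℚ.* v} {ratio k ℚ.* v} { ℚ.- (ℤ.+ 5000 / 1)} { ℚ.- ℚ.∣ d ∣} main error ⟩
    ratio k ℚ.* v ℚ.- ℚ.∣ w (suc k) ℚ.- ratio k ℚ.* v ∣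
      ≲⟨ ℚ.+-monoʳ-≤ (ratio k ℚ.* v) (ℚᵃ.-‿anti-≤ (ℚ.≤-trans (ℚᵃ.≤∣∣ (ℚ.- d)) (ℚ.≤-reflexive (ℚ.∣-p∣≡∣p∣ d)))) ⟩
    ratio k ℚ.* v ℚ.- ℚ.- (w (suc k) ℚ.- ratio k ℚ.* v)
      ≡⟨ solve 2 (λ x y → y :- (:- (x :- y)) := x) refl (w (suc k)) (ratio k ℚ.* v) ⟩
    w (suc k) ∎
    where
    open ℚᵃ.≤-Reasoning
    open ℚᵃ.Solver using (solve; _:=_; _:+_; _:*_; _:-_; :-_; con)
    v = w k
    d = w (suc k) ℚ.- ratio k ℚ.* v
    3/2≤ratio : (ℤ.+ 3 / 2) ℚ.≤ ratio k
    3/2≤ratio = ℚ.≤-trans (ℚ.≤ᵇ⇒≤ {ℤ.+ 3 / 2} {g-low} tt) (low≤ratio k)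
    main : (ℤ.+ 3 / 2) ℚ.* v ℚ.≤ ratio k ℚ.* v
    main = ℚᵃ.*-monoʳ-≤ (0≤w k) 3/2≤ratio
    error : ℚ.- (ℤ.+ 5000 / 1) ℚ.≤ ℚ.- ℚ.∣ d ∣
    error = ℚᵃ.-‿anti-≤ (≡.subst (ℚ.∣ d ∣ ℚ.≤_) (toℚ-def 5000) (ratio-close k k ℕ.≤-refl))

  w-grows : ∀ {b k} → toℚ 100000 ℚ.≤ toℚ b → toℚ b ℚ.≤ w k → ∀ j → toℚ (j ℕ.+ b) ℚ.≤ w (j ℕ.+ k)
  w-grows         large b≤w zero    = b≤w
  w-grows {b} {k} large b≤w (suc j) = begin
    toℚ (suc (j ℕ.+ b))       ≡⟨ toℚ-suc (j ℕ.+ b) ⟩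
    1ℚ ℚ.+ toℚ (j ℕ.+ b)      ≲⟨ ℚ.+-monoʳ-≤ 1ℚ ih ⟩
    1ℚ ℚ.+ w (j ℕ.+ k)        ≲⟨ w-step (j ℕ.+ k) (ℚ.≤-trans large (ℚ.≤-trans (toℚ-mono (ℕ.m≤n+m b j)) ih)) ⟩
    w (suc (j ℕ.+ k))         ∎
    where
    open ℚᵃ.≤-Reasoning
    ih = w-grows {b} {k} large b≤w j

  -- Both ratios predict w (k + 1) from w k with an error of at most 5000, hence they differ by at
  -- most 10000/w k, where k may be any index up to m and n.
  ratio-cauchy : ∀ ε → 0ℚ ℚ.< ε → ∃[ N ] ∀ m n → N ℕ.≤ m → N ℕ.≤ n → ℚ.∣ ratio m ℚ.- ratio n ∣ ℚ.≤ ε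
  ratio-cauchy ε 0<ε = k , λ m n hm hn → ℚ.*-cancelˡ-≤-pos (w k) {{w-positive}} (begin
    w k ℚ.* ℚ.∣ ratio m ℚ.- ratio n ∣
      ≡⟨ ≡.trans (≡.cong (ℚ._* ℚ.∣ ratio m ℚ.- ratio n ∣) (≡.sym (ℚ.0≤p⇒∣p∣≡p (0≤w k)))) (≡.sym (ℚ.∣p*q∣≡∣p∣*∣q∣ (w k) (ratio m ℚ.- ratio n))) ⟩
    ℚ.∣ w k ℚ.* (ratio m ℚ.- ratio n) ∣
      ≡⟨ ≡.cong ℚ.∣_∣ (solve 4 (λ v x y z → v :* (x :- y) := (z :- y :* v) :- (z :- x :* v)) refl (w k) (ratio m) (ratio n) (w (suc k))) ⟩
    ℚ.∣ (w (suc k) ℚ.- ratio n ℚ.* w k) ℚ.- (w (suc k) ℚ.- ratio m ℚ.* w k) ∣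
      ≲⟨ ℚ.≤-trans (ℚᵃ.∣-∣≤ (w (suc k) ℚ.- ratio n ℚ.* w k) (w (suc k) ℚ.- ratio m ℚ.* w k)) (ℚ.+-mono-≤ (ratio-close n k hn) (ratio-close m k hm)) ⟩
    toℚ 5000 ℚ.+ toℚ 5000
      ≲⟨ proj₂ (archimedean-* (toℚ 5000 ℚ.+ toℚ 5000) ε 0<ε) ⟩
    toℚ j ℚ.* ε
      ≲⟨ ℚᵃ.*-monoʳ-≤ (ℚ.<⇒≤ 0<ε) (ℚ.≤-trans (toℚ-mono (ℕ.m≤m+n j 100000)) (w-grows {100000} {64} ℚ.≤-refl w-large j)) ⟩
    w k ℚ.* ε ∎)
    where
    open ℚᵃ.≤-Reasoning
    open ℚᵃ.Solver using (solve; _:=_; _:*_; _:-_)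
    j = proj₁ (archimedean-* (toℚ 5000 ℚ.+ toℚ 5000) ε 0<ε)
    k = j ℕ.+ 64
    w-positive : ℚ.Positive (w k)
    w-positive = ℚ.positive (ℚ.<-≤-trans (0<toℚ-suc 99999) (ℚ.≤-trans (toℚ-mono (ℕ.m≤n+m 100000 j)) (w-grows {100000} {64} ℚ.≤-refl w-large j)))

  abstract
    -- Γ = (3/2)γ
    Γ : ℝ
    Γ = mkℝ ratio ratio-cauchy

    seq-Γ : ∀ n → seq Γ n ≡ ratio n
    seq-Γ n = refl

    low≤Γ : ι g-low ≤ Γ
    low≤Γ = pointwise-≤ λ n → ≡.subst (ℚ._≤ ratio n) (≡.sym (seq-ι g-low n)) (low≤ratio n)

  3/2≤Γ : ι (ℤ.+ 3 / 2) ≤ Γ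
  3/2≤Γ = ≤-trans (ι-mono (ℚ.≤ᵇ⇒≤ tt)) low≤Γ

  0<Γ : ℝ.0ℝ ℝ.< Γ
  0<Γ = ι≤⇒0< {ℤ.+ 3 / 2} (ℚ.positive⁻¹ (ℤ.+ 3 / 2)) 3/2≤Γ

  module Γ⁻¹ = Inverse Γ 0<Γ

  Γ⁻¹ : ℝ
  Γ⁻¹ = Γ⁻¹.reciprocal-of

  Γ⁻¹≤⅔ : Γ⁻¹ ≤ ι ⅔
  Γ⁻¹≤⅔ = begin
    Γ⁻¹                           ≈⟨ solve 1 (λ x → x := con ⅔ :* (con (ℤ.+ 3 / 2) :* x)) ≈-refl Γ⁻¹ ⟩
    ι ⅔ * (ι (ℤ.+ 3 / 2) * Γ⁻¹)   ≲⟨ *-monoˡ-≤ (0≤ι {⅔} (ℚ.≤ᵇ⇒≤ tt)) (*-monoʳ-≤ Γ⁻¹.0≤reciprocal 3/2≤Γ) ⟩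
    ι ⅔ * (Γ * Γ⁻¹)               ≈⟨ ≈-trans (*-congˡ Γ⁻¹.*-reciprocal) (*-identityʳ (ι ⅔)) ⟩
    ι ⅔                           ∎
    where
    open ≤-Reasoning
    open Solver using (solve; _:=_; _:*_; con)

  open Pole Γ Γ⁻¹ Γ⁻¹.*-reciprocal 3/2≤Γ Γ⁻¹.0≤reciprocal Γ⁻¹≤⅔ public
    renaming (γ^_ to Γ^_; x^_ to Γ⁻^_; 0≤γ to 0≤Γ; 0≤γ^ to 0≤Γ^; 0≤x^ to 0≤Γ⁻^; γ^x^ to Γ^Γ⁻^; x^≤⅔^ to Γ⁻^≤⅔^; x^-mono to Γ⁻^-mono)

  W u : Series
  W n = ι (w n)
  u = linear Γ ⊛ W

  seq-sum : ∀ n (f : Series) m → seq (sum n f) m ≡ ℚᵃ.sum n (λ i → seq (f i) m)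
  seq-sum zero    f m = seq-0
    where
    seq-0 : seq 0ᴿ m ≡ 0ℚ
    seq-0 = ≡.cong (λ x → seq x m) 0ᴿ-def
  seq-sum (suc n) f m = ≡.trans (seq-+ (f 0) _ m) (≡.cong (seq (f 0) m ℚ.+_) (seq-sum n (f ∘ suc) m))

  seq-ad : ∀ n (g : ℕ → ℕ → ℝ) m → seq (ad n g) m ≡ ℚᵃ.ad n (λ i j → seq (g i j) m)
  seq-ad zero    g m = refl
  seq-ad (suc n) g m = ≡.trans (seq-+ (g 0 (suc n)) _ m) (≡.cong (seq (g 0 (suc n)) m ℚ.+_) (seq-ad n (λ i j → g (suc i) j) m))

  seq-linear : ∀ n m → seq (linear Γ n) m ≡ ℚᵃ.linear (ratio m) n
  seq-linear zero          m = ≡.cong (λ x → seq x m) 1ᴿ-def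
  seq-linear (suc zero)    m = ≡.trans (seq-neg Γ m) (≡.cong ℚ.-_ (seq-Γ m))
  seq-linear (suc (suc n)) m = ≡.cong (λ x → seq x m) 0ᴿ-def

  seq-u : ∀ n m → seq (u n) m ≡ ℚᵃ._⊛_ (ℚᵃ.linear (ratio m)) w n
  seq-u n m = ≡.trans (seq-ad n (λ i j → linear Γ i * W j) m) (ℚᵃ.ad-cong n λ i j _ →
    ≡.trans (seq-* (linear Γ i) (W j) m) (≡.cong₂ ℚ._*_ (seq-linear i m) (seq-ι (w j) m)))

  -- At index m ≥ n of the Cauchy sequences, this is the bound for the rational ratio m, which is
  -- valid up to order m + 1.
  ‖u‖≤ : ∀ n → ‖ u ‖ n ≤ ι (toℚ 5000)
  ‖u‖≤ n = eventually-≤ n λ m n≤m → begin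
    seq (‖ u ‖ n) m
      ≡⟨ ≡.trans (seq-sum n (λ i → abs (u i)) m) (ℚᵃ.sum-cong n λ i _ → ≡.trans (seq-abs (u i) m) (≡.cong ℚ.∣_∣ (seq-u i m))) ⟩
    ℚᵃ.‖_‖ (ℚᵃ._⊛_ (ℚᵃ.linear (ratio m)) w) n
      ≲⟨ ℚᵃ.‖‖-mono-ℕ (ℚᵃ._⊛_ (ℚᵃ.linear (ratio m)) w) (ℕ.m≤n⇒m≤1+n (ℕ.m≤n⇒m≤1+n n≤m)) ⟩
    ℚᵃ.‖_‖ (ℚᵃ._⊛_ (ℚᵃ.linear (ratio m)) w) (suc (suc m))
      ≲⟨ ratio-norm m ⟩
    toℚ 5000
      ≡⟨ seq-ι (toℚ 5000) m ⟨
    seq (ι (toℚ 5000)) m ∎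
    where open ℚᵃ.≤-Reasoning

  u-summable : Summable u
  u-summable = toℚ 5000 , 0≤toℚ 5000 , ‖u‖≤

  u-pole : SimplePole (geometric Γ ⊛ u)
  u-pole = geometric-pole u-summable

  -- w n = c Γⁿ + h n
  abstract
    c : ℝ
    c = SimplePole.residue u-pole

    h : Series
    h = SimplePole.remainder u-pole

    h-summable : Summable h
    h-summable = SimplePole.summable u-pole

    W-expansion : ∀ n → W n ≈ c * geometric Γ n + h n
    W-expansion n = ≈-trans (≈-sym (geometric-linear-cancel Γ W n)) (SimplePole.expansion u-pole n)

    -- 20000 = 4·5000, with the factor 4 of `geometric-pole`.
    ∣h∣≤ : ∀ n → abs (h n) ≤ ι (toℚ 20000)
    ∣h∣≤ n = ≤-trans (term≤ (proj₂ (proj₂ h-summable)) n)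
      (≤-reflexive (≈-reflexive (≡.cong ι (≡.trans (≡.cong (ℚ._* toℚ 5000) (≡.sym (toℚ-def 4))) (≡.sym (toℚ-* 4 5000))))))

  W-pole : SimplePole W
  W-pole = simplePole c h h-summable W-expansion

-- Undoing the scaling by 3/2 and the factorials

module Quotients where

  open import Data.Nat.Base using (_!)
  open import Data.Rational.Base using (_/_)
  open NormedAlgebras
  open Weights hiding (f)
  open MaximalCount using (w; 𝒲₂; 𝒲₂-w^)
  open PoleExpansions using (⅔)

  private module ℚᵃ = NormedAlgebraProperties ℚ-normedAlgebra

  toℚ-/ : ∀ l d .{{_ : ℕ.NonZero d}} → toℚ d ℚ.* (ℤ.+ l / d) ≡ toℚ l
  toℚ-/ l d = begin
    toℚ d ℚ.* (ℤ.+ l / d)               ≡⟨ ≡.cong (ℚ._* (ℤ.+ l / d)) (toℚ-def d) ⟩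
    (ℤ.+ d / 1) ℚ.* (ℤ.+ l / d)         ≡⟨ /-* (ℤ.+ d) 1 (ℤ.+ l) d ⟩
    (ℤ.+ d ℤ.* ℤ.+ l) / (1 ℕ.* d)       ≡⟨ /-≡ (ℤ.+ d ℤ.* ℤ.+ l) (1 ℕ.* d) (ℤ.+ l) 1
                                             (≡.trans (ℤ.*-identityʳ (ℤ.+ d ℤ.* ℤ.+ l)) (≡.trans (ℤ.*-comm (ℤ.+ d) (ℤ.+ l))
                                               (≡.cong (λ d → ℤ.+ l ℤ.* ℤ.+ d) (≡.sym (ℕ.*-identityˡ d))))) ⟩
    ℤ.+ l / 1                           ≡⟨ toℚ-def l ⟨
    toℚ l                               ∎
    where
    open ≡.≡-Reasoning
    instance
      1*d≢0 : ℕ.NonZero (1 ℕ.* d)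
      1*d≢0 = ℕ.m*n≢0 1 d

  -- a n = (3/2)ⁿ/n!, expressed without division.
  !*a : ∀ n → toℚ (n !) ℚ.* (a n ℚ.* ℚᵃ.geometric ⅔ n) ≡ 1ℚ
  !*a zero    = ≡.trans (≡.cong₂ (λ x y → x ℚ.* (y ℚ.* 1ℚ)) toℚ-1 a-0) refl
  !*a (suc n) = begin
    toℚ (suc n ℕ.* n !) ℚ.* (a (suc n) ℚ.* (⅔ ℚ.* g))
      ≡⟨ ≡.cong (ℚ._* (a (suc n) ℚ.* (⅔ ℚ.* g))) (toℚ-* (suc n) (n !)) ⟩
    toℚ (suc n) ℚ.* toℚ (n !) ℚ.* (a (suc n) ℚ.* (⅔ ℚ.* g))
      ≡⟨ solve 4 (λ s f a g → s :* f :* (a :* (con ⅔ :* g)) := f :* (s :* a :* con ⅔ :* g)) refl (toℚ (suc n)) (toℚ (n !)) (a (suc n)) g ⟩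
    toℚ (n !) ℚ.* (toℚ (suc n) ℚ.* a (suc n) ℚ.* ⅔ ℚ.* g)
      ≡⟨ ≡.cong (λ z → toℚ (n !) ℚ.* (z ℚ.* ⅔ ℚ.* g)) (≡.trans (suc*a n) (≡.cong (ℚ._* a n) R-def)) ⟩
    toℚ (n !) ℚ.* ((ℤ.+ 3 / 2) ℚ.* a n ℚ.* ⅔ ℚ.* g)
      ≡⟨ solve 3 (λ f a g → f :* (con (ℤ.+ 3 / 2) :* a :* con ⅔ :* g) := f :* (a :* g)) refl (toℚ (n !)) (a n) g ⟩
    toℚ (n !) ℚ.* (a n ℚ.* g)
      ≡⟨ !*a n ⟩
    1ℚ ∎
    where
    open ≡.≡-Reasoning
    open ℚᵃ.Solver using (solve; _:*_; _:=_; con)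
    g : ℚ
    g = ℚᵃ.geometric ⅔ n

  quotient : ℕ → ℕ → ℚ
  quotient u n = (ℤ.+ u / n !) {{n ℕ.!≢0}}

  /!-def : ∀ s n → ℚᵃ._⊛^_ w s n ℚ.* ℚᵃ.geometric ⅔ n ≡ quotient (𝒲₂ s n) n
  /!-def s n = begin
    ℚᵃ._⊛^_ w s n ℚ.* g
      ≡⟨ ≡.cong (ℚ._* g) (𝒲₂-w^ s n) ⟨
    toℚ (𝒲₂ s n) ℚ.* a n ℚ.* g
      ≡⟨ ≡.cong (λ z → z ℚ.* a n ℚ.* g) (toℚ-/ (𝒲₂ s n) (n !) {{n ℕ.!≢0}}) ⟨
    toℚ (n !) ℚ.* q ℚ.* a n ℚ.* g
      ≡⟨ solve 4 (λ f q a g → f :* q :* a :* g := q :* (f :* (a :* g))) refl (toℚ (n !)) q (a n) g ⟩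
    q ℚ.* (toℚ (n !) ℚ.* (a n ℚ.* g))
      ≡⟨ ≡.trans (≡.cong (q ℚ.*_) (!*a n)) (ℚ.*-identityʳ q) ⟩
    q ∎
    where
    open ≡.≡-Reasoning
    open ℚᵃ.Solver using (solve; _:*_; _:=_)
    g q : ℚ
    g = ℚᵃ.geometric ⅔ n
    q = quotient (𝒲₂ s n) n

-- Decimals of γ and α

module Decimals where

  open ℝ using (ℝ)
  open import Data.Nat.Base using (_^_)
  open import Data.Rational.Base using (_/_)
  open NormedAlgebras
  open Weights hiding (f)
  open MaximalCount using (w)
  open Coefficients using (den)
  open Reals using (ι; abs; 0ᴿ; ℝ-normedAlgebra; ℝ-completeAlgebra)
  open PoleExpansions
  open Quotients using (toℚ-/)
  open Growth

  open NormedAlgebraProperties ℝ-normedAlgebra hiding (ι; ∣_∣)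
  open PoleExpansion ℝ-completeAlgebra
  open Solver using (solve; _:=_; _:+_; _:*_; _:-_; :-_)

  open ≤-Reasoning

  ⟦_⟧ : ℕ → ℝ
  ⟦ n ⟧ = ι (toℚ n)

  0≤⟦_⟧ : ∀ n → 0ᴿ ≤ ⟦ n ⟧
  0≤⟦ n ⟧ = 0≤ι (0≤toℚ n)

  ⟦⟧-+ : ∀ m n → ⟦ m ℕ.+ n ⟧ ≈ ⟦ m ⟧ + ⟦ n ⟧
  ⟦⟧-+ m n = ≈-trans (≈-reflexive (≡.cong ι (toℚ-+ m n))) (ι-+ (toℚ m) (toℚ n))

  ⟦⟧-* : ∀ m n → ⟦ m ℕ.* n ⟧ ≈ ⟦ m ⟧ * ⟦ n ⟧
  ⟦⟧-* m n = ≈-trans (≈-reflexive (≡.cong ι (toℚ-* m n))) (ι-* (toℚ m) (toℚ n))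

  ⟦⟧-mono : ∀ {m n} → m ℕ.≤ n → ⟦ m ⟧ ≤ ⟦ n ⟧
  ⟦⟧-mono m≤n = ι-mono (toℚ-mono m≤n)

  ι-cancel : ∀ {p x y} → 0ℚ ℚ.< p → ι p * x ≤ ι p * y → x ≤ y
  ι-cancel {p} {x} {y} 0<p h = begin
    x                 ≈⟨ undo x ⟩
    ι q * (ι p * x)   ≲⟨ *-monoˡ-≤ (0≤ι (ℚ.<⇒≤ (ℚ.positive⁻¹ q {{ℚ.1/pos⇒pos p {{ℚ.positive 0<p}}}}))) h ⟩
    ι q * (ι p * y)   ≈⟨ undo y ⟨
    y                 ∎
    where
    instance
      p≢0 : ℚ.NonZero p
      p≢0 = ℚ.pos⇒nonZero p {{ℚ.positive 0<p}}
    q : ℚ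
    q = ℚ.1/ p
    undo : ∀ z → z ≈ ι q * (ι p * z)
    undo z = ≈-sym (≈-trans (≈-sym (*-assoc (ι q) (ι p) z)) (≈-trans (*-congʳ (≈-trans (≈-sym (ι-* q p))
      (≈-trans (≈-reflexive (≡.cong ι (ℚ.*-inverseˡ p))) ι-1))) (*-identityˡ z)))

  ⟦⟧-cancel : ∀ {n x y} → 0 ℕ.< n → ⟦ n ⟧ * x ≤ ⟦ n ⟧ * y → x ≤ y
  ⟦⟧-cancel {suc n} _ = ι-cancel (0<toℚ-suc n)

  +-cancelʳ-≤ : ∀ {x y} z → x + z ≤ y + z → x ≤ y
  +-cancelʳ-≤ {x} {y} z h = begin
    x          ≈⟨ solve 2 (λ x z → x := x :+ z :- z) ≈-refl x z ⟩
    x + z - z  ≲⟨ +-monoˡ-≤ (- z) h ⟩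
    y + z - z  ≈⟨ solve 2 (λ x z → x := x :+ z :- z) ≈-refl y z ⟨
    y          ∎

  -- An enclosure of z from y ≈ z x, where x lies between A/D and B/D and y = E/D.
  module Enclosure {x y z : ℝ} (A B D E e : ℕ) (0≤z : 0ᴿ ≤ z)
    (A≤Dx : ⟦ A ⟧ ≤ ⟦ D ⟧ * x) (Dx≤B : ⟦ D ⟧ * x ≤ ⟦ B ⟧) (Dy≈E : ⟦ D ⟧ * y ≈ ⟦ E ⟧)
    (close : abs (y - z * x) ≤ ⟦ e ⟧) where

    upper : ∀ T n → 0 ℕ.< A → T ℕ.* (E ℕ.+ D ℕ.* e) ℕ.≤ A ℕ.* n → ⟦ T ⟧ * z ≤ ⟦ n ⟧
    upper T n 0<A h = ⟦⟧-cancel 0<A (begin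
      ⟦ A ⟧ * (⟦ T ⟧ * z)
        ≈⟨ solve 3 (λ a t z → a :* (t :* z) := t :* (z :* a)) ≈-refl ⟦ A ⟧ ⟦ T ⟧ z ⟩
      ⟦ T ⟧ * (z * ⟦ A ⟧)
        ≲⟨ *-monoˡ-≤ 0≤⟦ T ⟧ (*-monoˡ-≤ 0≤z A≤Dx) ⟩
      ⟦ T ⟧ * (z * (⟦ D ⟧ * x))
        ≈⟨ solve 5 (λ t z d x y → t :* (z :* (d :* x)) := t :* (d :* (y :+ (:- (y :- z :* x))))) ≈-refl ⟦ T ⟧ z ⟦ D ⟧ x y ⟩
      ⟦ T ⟧ * (⟦ D ⟧ * (y + - (y - z * x)))
        ≲⟨ *-monoˡ-≤ 0≤⟦ T ⟧ (*-monoˡ-≤ 0≤⟦ D ⟧ (+-monoʳ-≤ y (≤-trans (≤∣∣ _) (≤-trans (≤-reflexive (∣-∣ _)) close)))) ⟩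
      ⟦ T ⟧ * (⟦ D ⟧ * (y + ⟦ e ⟧))
        ≈⟨ *-congˡ (≈-trans (distribˡ ⟦ D ⟧ y ⟦ e ⟧) (+-cong Dy≈E (≈-sym (⟦⟧-* D e)))) ⟩
      ⟦ T ⟧ * (⟦ E ⟧ + ⟦ D ℕ.* e ⟧)
        ≈⟨ ≈-trans (⟦⟧-* T (E ℕ.+ D ℕ.* e)) (*-congˡ (⟦⟧-+ E (D ℕ.* e))) ⟨
      ⟦ T ℕ.* (E ℕ.+ D ℕ.* e) ⟧
        ≲⟨ ⟦⟧-mono h ⟩
      ⟦ A ℕ.* n ⟧
        ≈⟨ ⟦⟧-* A n ⟩
      ⟦ A ⟧ * ⟦ n ⟧ ∎)

    lower : ∀ T n → 0 ℕ.< B → B ℕ.* n ℕ.+ T ℕ.* (D ℕ.* e) ℕ.≤ T ℕ.* E → ⟦ n ⟧ ≤ ⟦ T ⟧ * z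
    lower T n 0<B h = ⟦⟧-cancel 0<B (+-cancelʳ-≤ ⟦ T ℕ.* (D ℕ.* e) ⟧ (begin
      ⟦ B ⟧ * ⟦ n ⟧ + ⟦ T ℕ.* (D ℕ.* e) ⟧
        ≈⟨ ≈-trans (⟦⟧-+ (B ℕ.* n) (T ℕ.* (D ℕ.* e))) (+-congʳ (⟦⟧-* B n)) ⟨
      ⟦ B ℕ.* n ℕ.+ T ℕ.* (D ℕ.* e) ⟧
        ≲⟨ ⟦⟧-mono h ⟩
      ⟦ T ℕ.* E ⟧
        ≈⟨ ≈-trans (⟦⟧-* T E) (*-congˡ (≈-sym Dy≈E)) ⟩
      ⟦ T ⟧ * (⟦ D ⟧ * y)
        ≈⟨ *-congˡ (*-congˡ (solve 3 (λ y z x → y := z :* x :+ (y :- z :* x)) ≈-refl y z x)) ⟩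
      ⟦ T ⟧ * (⟦ D ⟧ * (z * x + (y - z * x)))
        ≲⟨ *-monoˡ-≤ 0≤⟦ T ⟧ (*-monoˡ-≤ 0≤⟦ D ⟧ (+-monoʳ-≤ (z * x) (≤-trans (≤∣∣ _) close))) ⟩
      ⟦ T ⟧ * (⟦ D ⟧ * (z * x + ⟦ e ⟧))
        ≈⟨ solve 5 (λ t d z x e → t :* (d :* (z :* x :+ e)) := t :* (z :* (d :* x)) :+ t :* (d :* e)) ≈-refl ⟦ T ⟧ ⟦ D ⟧ z x ⟦ e ⟧ ⟩
      ⟦ T ⟧ * (z * (⟦ D ⟧ * x)) + ⟦ T ⟧ * (⟦ D ⟧ * ⟦ e ⟧)
        ≲⟨ +-mono-≤ (*-monoˡ-≤ 0≤⟦ T ⟧ (*-monoˡ-≤ 0≤z Dx≤B))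
             (≤-reflexive (≈-sym (≈-trans (⟦⟧-* T (D ℕ.* e)) (*-congˡ (⟦⟧-* D e))))) ⟩
      ⟦ T ⟧ * (z * ⟦ B ⟧) + ⟦ T ℕ.* (D ℕ.* e) ⟧
        ≈⟨ +-congʳ (solve 3 (λ a t z → t :* (z :* a) := a :* (t :* z)) ≈-refl ⟦ B ⟧ ⟦ T ⟧ z) ⟩
      ⟦ B ⟧ * (⟦ T ⟧ * z) + ⟦ T ℕ.* (D ℕ.* e) ⟧ ∎))

  ⅔*-upper : ∀ {z} l d .{{_ : ℕ.NonZero d}} → ⟦ 2 ℕ.* d ⟧ * z ≤ ⟦ 3 ℕ.* l ⟧ → ι ⅔ * z ≤ ι (ℤ.+ l / d)
  ⅔*-lower : ∀ {z} l d .{{_ : ℕ.NonZero d}} → ⟦ 3 ℕ.* l ⟧ ≤ ⟦ 2 ℕ.* d ⟧ * z → ι (ℤ.+ l / d) ≤ ι ⅔ * z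
  private
    ⅔*-scale : ∀ z d → ⟦ 3 ℕ.* d ⟧ * (ι ⅔ * z) ≈ ⟦ 2 ℕ.* d ⟧ * z
    ⅔*-scale z d = begin-equality
      ⟦ 3 ℕ.* d ⟧ * (ι ⅔ * z)
        ≈⟨ *-congʳ (⟦⟧-* 3 d) ⟩
      ⟦ 3 ⟧ * ⟦ d ⟧ * (ι ⅔ * z)
        ≈⟨ solve 4 (λ t d q z → t :* d :* (q :* z) := t :* q :* d :* z) ≈-refl ⟦ 3 ⟧ ⟦ d ⟧ (ι ⅔) z ⟩
      ⟦ 3 ⟧ * ι ⅔ * ⟦ d ⟧ * z
        ≈⟨ *-congʳ (*-congʳ (≈-trans (≈-sym (ι-* (toℚ 3) ⅔)) (≈-reflexive (≡.cong ι (toℚ-/ 2 3))))) ⟩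
      ⟦ 2 ⟧ * ⟦ d ⟧ * z
        ≈⟨ *-congʳ (⟦⟧-* 2 d) ⟨
      ⟦ 2 ℕ.* d ⟧ * z ∎

    /-scale : ∀ l d .{{_ : ℕ.NonZero d}} → ⟦ 3 ℕ.* d ⟧ * ι (ℤ.+ l / d) ≈ ⟦ 3 ℕ.* l ⟧
    /-scale l d = ≈-trans (*-congʳ (⟦⟧-* 3 d)) (≈-trans (*-assoc ⟦ 3 ⟧ ⟦ d ⟧ _) (≈-trans (*-congˡ (≈-trans (≈-sym (ι-* (toℚ d) _))
      (≈-reflexive (≡.cong ι (toℚ-/ l d))))) (≈-sym (⟦⟧-* 3 l))))

    0<3* : ∀ d .{{_ : ℕ.NonZero d}} → 0 ℕ.< 3 ℕ.* d
    0<3* (suc d) = s≤s z≤n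

  ⅔*-upper {z} l d h = ⟦⟧-cancel (0<3* d) (≤-trans (≤-reflexive (⅔*-scale z d)) (≤-trans h (≤-reflexive (≈-sym (/-scale l d)))))
  ⅔*-lower {z} l d h = ⟦⟧-cancel (0<3* d) (≤-trans (≤-reflexive (/-scale l d)) (≤-trans h (≤-reflexive (≈-sym (⅔*-scale z d)))))

  ^-upper : ∀ {T n} → ⟦ T ⟧ * Γ ≤ ⟦ n ⟧ → ∀ k → ⟦ T ^ k ⟧ * (Γ^ k) ≤ ⟦ n ^ k ⟧
  ^-upper {T} {n} h zero    = ≤-reflexive (*-identityʳ _)
  ^-upper {T} {n} h (suc k) = begin
    ⟦ T ℕ.* T ^ k ⟧ * (Γ * (Γ^ k))         ≈⟨ *-congʳ (⟦⟧-* T (T ^ k)) ⟩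
    ⟦ T ⟧ * ⟦ T ^ k ⟧ * (Γ * (Γ^ k))       ≈⟨ solve 4 (λ t p g q → t :* p :* (g :* q) := (t :* g) :* (p :* q)) ≈-refl ⟦ T ⟧ ⟦ T ^ k ⟧ Γ (Γ^ k) ⟩
    (⟦ T ⟧ * Γ) * (⟦ T ^ k ⟧ * (Γ^ k))     ≲⟨ *-mono-≤ 0≤⟦ n ⟧ (0≤-* 0≤⟦ T ^ k ⟧ (0≤Γ^ k)) h (^-upper h k) ⟩
    ⟦ n ⟧ * ⟦ n ^ k ⟧                      ≈⟨ ⟦⟧-* n (n ^ k) ⟨
    ⟦ n ℕ.* n ^ k ⟧                        ∎

  ^-lower : ∀ {T n} → ⟦ n ⟧ ≤ ⟦ T ⟧ * Γ → ∀ k → ⟦ n ^ k ⟧ ≤ ⟦ T ^ k ⟧ * (Γ^ k)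
  ^-lower {T} {n} h zero    = ≤-reflexive (≈-sym (*-identityʳ _))
  ^-lower {T} {n} h (suc k) = begin
    ⟦ n ℕ.* n ^ k ⟧                        ≈⟨ ⟦⟧-* n (n ^ k) ⟩
    ⟦ n ⟧ * ⟦ n ^ k ⟧                      ≲⟨ *-mono-≤ (0≤-* 0≤⟦ T ⟧ 0≤Γ) 0≤⟦ n ^ k ⟧ h (^-lower h k) ⟩
    (⟦ T ⟧ * Γ) * (⟦ T ^ k ⟧ * (Γ^ k))     ≈⟨ solve 4 (λ t p g q → t :* p :* (g :* q) := (t :* g) :* (p :* q)) ≈-refl ⟦ T ⟧ ⟦ T ^ k ⟧ Γ (Γ^ k) ⟨
    ⟦ T ⟧ * ⟦ T ^ k ⟧ * (Γ * (Γ^ k))       ≈⟨ *-congʳ (⟦⟧-* T (T ^ k)) ⟨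
    ⟦ T ℕ.* T ^ k ⟧ * (Γ * (Γ^ k))         ∎

  private
    -- Γ lies within 5000/w 63 of w 64/w 63, an interval of length about 5·10⁻¹². This precision is
    -- needed for α, where Γ is raised to the 63rd power.
    T Γ⁻ Γ⁺ : ℕ
    T  = 10000000000000
    Γ⁻ = 17890115118177
    Γ⁺ = 17890115118227

    den*W : ∀ k C → toℚ (den k) ℚ.* w k ≡ toℚ C → ⟦ den k ⟧ * W k ≈ ⟦ C ⟧
    den*W k C e = ≈-trans (≈-sym (ι-* (toℚ (den k)) (w k))) (≈-reflexive (≡.cong ι e))

    -- `den 64` = 128 `den 63` serves as a common denominator.
    e₆₃ : ⟦ den 64 ⟧ * W 63 ≈ ⟦ 128 ℕ.* (C₆₃ ℕ.* 3 ^ 63) ⟧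
    e₆₃ = ≈-trans (*-congʳ (≈-trans (⟦⟧-* (den 63) 128) (*-comm ⟦ den 63 ⟧ ⟦ 128 ⟧))) (≈-trans (*-assoc ⟦ 128 ⟧ ⟦ den 63 ⟧ (W 63))
      (≈-trans (*-congˡ (den*W 63 _ den*w₆₃)) (≈-sym (⟦⟧-* 128 (C₆₃ ℕ.* 3 ^ 63)))))

    module Γ-enclosure = Enclosure {W 63} {W 64} {Γ} (128 ℕ.* (C₆₃ ℕ.* 3 ^ 63)) (128 ℕ.* (C₆₃ ℕ.* 3 ^ 63)) (den 64) (C₆₄ ℕ.* 3 ^ 64) 5000
      0≤Γ (≤-reflexive (≈-sym e₆₃)) (≤-reflexive e₆₃) (den*W 64 _ den*w₆₄)
      (≤-trans (≤-reflexive (∣∣-cong (≈-sym (linear-⊛ Γ W 63)))) (term≤ ‖u‖≤ 64))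

    TΓ≤Γ⁺ : ⟦ T ⟧ * Γ ≤ ⟦ Γ⁺ ⟧
    TΓ≤Γ⁺ = Γ-enclosure.upper T Γ⁺ (ℕ.<ᵇ⇒< 0 _ tt) (ℕ.≤ᵇ⇒≤ _ _ tt)

    Γ⁻≤TΓ : ⟦ Γ⁻ ⟧ ≤ ⟦ T ⟧ * Γ
    Γ⁻≤TΓ = Γ-enclosure.lower T Γ⁻ (ℕ.<ᵇ⇒< 0 _ tt) (ℕ.≤ᵇ⇒≤ _ _ tt)

  γ-lower : ι (ℤ.+ 11926743412 / 10000000000) ≤ ι ⅔ * Γ
  γ-lower = ⅔*-lower 11926743412 10000000000 (Γ-enclosure.lower (2 ℕ.* 10000000000) (3 ℕ.* 11926743412) (ℕ.<ᵇ⇒< 0 _ tt) (ℕ.≤ᵇ⇒≤ _ _ tt))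

  γ-upper : ι ⅔ * Γ ≤ ι (ℤ.+ 119267434125 / 100000000000)
  γ-upper = ⅔*-upper 119267434125 100000000000 (Γ-enclosure.upper (2 ℕ.* 100000000000) (3 ℕ.* 119267434125) (ℕ.<ᵇ⇒< 0 _ tt) (ℕ.≤ᵇ⇒≤ _ _ tt))

  -- At n = 64 the remainder, at most 20000, is already smaller than w, so c Γ⁶⁴ is nonnegative.
  0≤c : 0ᴿ ≤ c
  0≤c = begin
    0ᴿ                               ≲⟨ 0≤-* (0≤y-x h≤W) (0≤Γ⁻^ 64) ⟩
    (W 64 - h 64) * (Γ⁻^ 64)          ≈⟨ *-congʳ (≈-trans (+-congʳ (W-expansion 64)) (solve 2 (λ a b → a :+ b :- b := a) ≈-refl (c * (Γ^ 64)) (h 64))) ⟩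
    c * (Γ^ 64) * (Γ⁻^ 64)            ≈⟨ ≈-trans (*-assoc c _ _) (≈-trans (*-congˡ (Γ^Γ⁻^ 64)) (*-identityʳ c)) ⟩
    c                                ∎
    where
    h≤W : h 64 ≤ W 64
    h≤W = ≤-trans (≤∣∣ _) (≤-trans (∣h∣≤ 64) (≤-trans (⟦⟧-mono (ℕ.≤ᵇ⇒≤ 20000 100000 tt)) (ι-mono w-large)))

  private
    assoc : ⟦ den 64 ℕ.* T ^ 63 ⟧ * (Γ^ 63) ≈ ⟦ den 64 ⟧ * (⟦ T ^ 63 ⟧ * (Γ^ 63))
    assoc = ≈-trans (*-congʳ (⟦⟧-* (den 64) (T ^ 63))) (*-assoc ⟦ den 64 ⟧ ⟦ T ^ 63 ⟧ (Γ^ 63))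

    -- w 64 = (c Γ)Γ⁶³ + h 64 determines c Γ up to 20000/Γ⁶³, and α = (2/3) c Γ.
    module α-enclosure = Enclosure {Γ^ 63} {W 64} {c * Γ} (den 64 ℕ.* Γ⁻ ^ 63) (den 64 ℕ.* Γ⁺ ^ 63) (den 64 ℕ.* T ^ 63) (T ^ 63 ℕ.* (C₆₄ ℕ.* 3 ^ 64)) 20000
      (0≤-* 0≤c 0≤Γ)
      (≤-trans (≤-reflexive (⟦⟧-* (den 64) (Γ⁻ ^ 63))) (≤-trans (*-monoˡ-≤ 0≤⟦ den 64 ⟧ (^-lower Γ⁻≤TΓ 63)) (≤-reflexive (≈-sym assoc))))
      (≤-trans (≤-reflexive assoc) (≤-trans (*-monoˡ-≤ 0≤⟦ den 64 ⟧ (^-upper TΓ≤Γ⁺ 63)) (≤-reflexive (≈-sym (⟦⟧-* (den 64) (Γ⁺ ^ 63))))))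
      (≈-trans (*-congʳ (≈-trans (⟦⟧-* (den 64) (T ^ 63)) (*-comm ⟦ den 64 ⟧ ⟦ T ^ 63 ⟧))) (≈-trans (*-assoc ⟦ T ^ 63 ⟧ ⟦ den 64 ⟧ (W 64))
        (≈-trans (*-congˡ (den*W 64 _ den*w₆₄)) (≈-sym (⟦⟧-* (T ^ 63) (C₆₄ ℕ.* 3 ^ 64))))))
      (≤-trans (≤-reflexive (∣∣-cong (≈-trans (+-cong (W-expansion 64) (-‿cong (*-assoc c Γ (Γ^ 63))))
        (solve 2 (λ a b → a :+ b :- a := b) ≈-refl (c * (Γ^ 64)) (h 64))))) (∣h∣≤ 64))

  α-lower : ι (ℤ.+ 2963720490 / 10000000000) ≤ ι ⅔ * (c * Γ)
  α-lower = ⅔*-lower 2963720490 10000000000 (α-enclosure.lower (2 ℕ.* 10000000000) (3 ℕ.* 2963720490) (ℕ.<ᵇ⇒< 0 _ tt) (ℕ.≤ᵇ⇒≤ _ _ tt))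

  α-upper : ι ⅔ * (c * Γ) ≤ ι (ℤ.+ 29637204909 / 100000000000)
  α-upper = ⅔*-upper 29637204909 100000000000 (α-enclosure.upper (2 ℕ.* 100000000000) (3 ℕ.* 29637204909) (ℕ.<ᵇ⇒< 0 _ tt) (ℕ.≤ᵇ⇒≤ _ _ tt))

-- Real roots and the limit of the n-th roots

module Roots where

  open ℝ using (ℝ; mkℝ; seq; cauchy)
  open import Data.Empty using (⊥; ⊥-elim)
  open import Data.Rational.Base using (½; _/_)
  open NormedAlgebras
  open Weights using (toℚ; toℚ-mono; toℚ-suc; toℚ-0; 0≤toℚ; 0<toℚ-suc)
  open ApproximateGrowth
  open Reals

  private module ℚᵃ = NormedAlgebraProperties ℚ-normedAlgebra
  open NormedAlgebraProperties ℝ-normedAlgebra hiding (ι; ∣_∣; _≈_; _≤_; _+_; _*_)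
  private
    variable
      x y : ℝ

  ≤-antisym : x ≤ y → y ≤ x → x ≃ y
  ≤-antisym {x} {y} (wrap p) (wrap q) = wrap λ ε 0<ε →
    let M , p′ = p ε 0<ε
        N , q′ = q ε 0<ε
    in M ℕ.⊔ N , λ n h → ℚᵃ.∣∣-least (difference≤ (p′ n (ℕ.m⊔n≤o⇒m≤o M N h)))
         (ℚ.≤-trans (ℚ.≤-reflexive (solve 2 (λ a b → :- (a :- b) := b :- a) refl (seq x n) (seq y n))) (difference≤ (q′ n (ℕ.m⊔n≤o⇒n≤o M N h))))
    where
    open ℚᵃ.Solver using (solve; _:=_; _:+_; _:-_; :-_)
    difference≤ : ∀ {a b e} → a ℚ.≤ b ℚ.+ e → a ℚ.- b ℚ.≤ e
    difference≤ {a} {b} {e} h = ℚ.≤-trans (ℚ.+-monoˡ-≤ (ℚ.- b) h) (ℚ.≤-reflexive (solve 2 (λ b e → b :+ e :- b := e) refl b e))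

  0<⇒ι≤ : (0<x : ℝ.0ℝ ℝ.< x) → ι (proj₁ 0<x) ≤ x
  0<⇒ι≤ {x} (δ , _ , N , h) = eventually-≤ N λ n N≤n → ≡.subst (ℚ._≤ seq x n) (≡.trans (ℚ.+-identityˡ δ) (≡.sym (seq-ι δ n))) (h n N≤n)

  -- The order of ℝ is not decidable, but overlapping alternatives are: one approximation of x with
  -- error at most ε/4 is compared with 3ε/4.
  locate : ∀ x {ε} → 0ℚ ℚ.< ε → x ≤ ι ε ⊎ ι (ε ℚ.* ½) ≤ x
  locate x {ε} 0<ε with cauchy x (ε ℚ.* (ℤ.+ 1 / 4)) (ℚ.positive⁻¹ _ {{ℚ.pos*pos⇒pos ε {{ℚ.positive 0<ε}} (ℤ.+ 1 / 4)}})
  ... | N , close with ℚ.≤-total (seq x N) (ε ℚ.* (ℤ.+ 3 / 4))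
  ...   | inj₁ h = inj₁ (eventually-≤ N λ n N≤n → begin
      seq x n                                      ≡⟨ solve 2 (λ a b → a := b :+ (a :- b)) refl (seq x n) (seq x N) ⟩
      seq x N ℚ.+ (seq x n ℚ.- seq x N)            ≲⟨ ℚ.+-mono-≤ h (ℚ.≤-trans (ℚᵃ.≤∣∣ _) (close n N N≤n ℕ.≤-refl)) ⟩
      ε ℚ.* (ℤ.+ 3 / 4) ℚ.+ ε ℚ.* (ℤ.+ 1 / 4)      ≡⟨ solve 1 (λ e → e :* con (ℤ.+ 3 / 4) :+ e :* con (ℤ.+ 1 / 4) := e) refl ε ⟩
      ε                                            ≡⟨ seq-ι ε n ⟨
      seq (ι ε) n                                  ∎)
    where
    open ℚᵃ.≤-Reasoning
    open ℚᵃ.Solver using (solve; _:=_; _:+_; _:*_; _:-_; con)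
  ...   | inj₂ h = inj₂ (eventually-≤ N λ n N≤n → begin
      seq (ι (ε ℚ.* ½)) n                          ≡⟨ seq-ι (ε ℚ.* ½) n ⟩
      ε ℚ.* ½                                      ≡⟨ solve 1 (λ e → e :* con ½ := e :* con (ℤ.+ 3 / 4) :- e :* con (ℤ.+ 1 / 4)) refl ε ⟩
      ε ℚ.* (ℤ.+ 3 / 4) ℚ.- ε ℚ.* (ℤ.+ 1 / 4)      ≲⟨ ℚ.+-mono-≤ h (ℚᵃ.-‿anti-≤ (ℚ.≤-trans (ℚᵃ.≤∣∣ _) (close N n ℕ.≤-refl N≤n))) ⟩
      seq x N ℚ.- (seq x N ℚ.- seq x n)            ≡⟨ solve 2 (λ a b → b :- (b :- a) := a) refl (seq x n) (seq x N) ⟩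
      seq x n                                      ∎)
    where
    open ℚᵃ.≤-Reasoning
    open ℚᵃ.Solver using (solve; _:=_; _:+_; _:*_; _:-_; con)

  geometric-mono : ∀ {x y} → 0ᴿ ≤ x → x ≤ y → ∀ n → 0ᴿ ≤ geometric x n × geometric x n ≤ geometric y n
  geometric-mono 0≤x x≤y zero    = ≤-trans (0≤ι {1ℚ} (ℚ.≤ᵇ⇒≤ tt)) (≤-reflexive ι-1) , ≤-refl
  geometric-mono 0≤x x≤y (suc n) =
    let 0≤xⁿ , xⁿ≤yⁿ = geometric-mono 0≤x x≤y n
    in 0≤-* 0≤x 0≤xⁿ , *-mono-≤ (≤-trans 0≤x x≤y) 0≤xⁿ x≤y xⁿ≤yⁿ

  geometric-cong : ∀ {x y} → x ≃ y → ∀ n → geometric x n ≃ geometric y n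
  geometric-cong e zero    = ≈-refl
  geometric-cong e (suc n) = *-cong e (geometric-cong e n)

  geometric-* : ∀ x y n → geometric (x * y) n ≃ geometric x n * geometric y n
  geometric-* x y zero    = ≈-sym (*-identityˡ _)
  geometric-* x y (suc n) = ≈-trans (*-congˡ (geometric-* x y n))
    (solve 4 (λ x y p q → (x :* y) :* (p :* q) := (x :* p) :* (y :* q)) ≈-refl x y (geometric x n) (geometric y n))
    where open Solver using (solve; _:=_; _:*_)

  ι-geometric : ∀ p n → ι (ℚᵃ.geometric p n) ≃ geometric (ι p) n
  ι-geometric p zero    = ι-1
  ι-geometric p (suc n) = ≈-trans (ι-* p _) (*-congˡ (ι-geometric p n))

  seq-geometric : ∀ x n k → seq (geometric x n) k ≡ ℚᵃ.geometric (seq x k) n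
  seq-geometric x zero    k = ≡.cong (λ x → seq x k) 1ᴿ-def
  seq-geometric x (suc n) k = ≡.trans (seq-* x _ k) (≡.cong (seq x k ℚ.*_) (seq-geometric x n k))

  -- Bisection between 0 and 1 + q, where (1 + q)ⁿ⁺¹ ≥ 1 + q ≥ q.
  module Root (n : ℕ) (q : ℚ) (0≤q : 0ℚ ℚ.≤ q) where
    private
      F : ℚ → ℚ
      F p = ℚᵃ.geometric p (suc n) ℚ.- q

      1≤geometric : ∀ {p} → 1ℚ ℚ.≤ p → ∀ n → 1ℚ ℚ.≤ ℚᵃ.geometric p n
      1≤geometric 1≤p zero    = ℚ.≤-refl
      1≤geometric {p} 1≤p (suc n) = ℚᵃ.*-mono-≤ {1ℚ} {p} {1ℚ} (ℚ.≤-trans (ℚ.≤ᵇ⇒≤ tt) 1≤p) (ℚ.≤ᵇ⇒≤ tt) 1≤p (1≤geometric 1≤p n)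

      0≤1+q : 0ℚ ℚ.≤ 1ℚ ℚ.+ q
      0≤1+q = ℚᵃ.0≤-+ {1ℚ} (ℚ.≤ᵇ⇒≤ tt) 0≤q

      F-lo : F 0ℚ ℚ.≤ 0ℚ
      F-lo = ≡.subst (λ z → z ℚ.- q ℚ.≤ 0ℚ) (≡.sym (ℚ.*-zeroˡ (ℚᵃ.geometric 0ℚ n))) (≡.subst (ℚ._≤ 0ℚ) (≡.sym (ℚ.+-identityˡ (ℚ.- q))) (ℚᵃ.-‿anti-≤ 0≤q))

      F-hi : 0ℚ ℚ.≤ F (0ℚ ℚ.+ (1ℚ ℚ.+ q))
      F-hi = ≡.subst (λ z → 0ℚ ℚ.≤ F z) (≡.sym (ℚ.+-identityˡ (1ℚ ℚ.+ q))) (ℚᵃ.0≤y-x (begin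
        q                                                       ≲⟨ ℚᵃ.x≤y+x {q} {1ℚ} (ℚ.≤ᵇ⇒≤ tt) ⟩
        1ℚ ℚ.+ q                                                ≡⟨ ℚ.*-identityʳ _ ⟨
        (1ℚ ℚ.+ q) ℚ.* 1ℚ                                       ≲⟨ ℚᵃ.*-monoˡ-≤ 0≤1+q (1≤geometric (ℚᵃ.x≤x+y {1ℚ} 0≤q) n) ⟩
        (1ℚ ℚ.+ q) ℚ.* ℚᵃ.geometric (1ℚ ℚ.+ q) n                ∎))
        where open ℚᵃ.≤-Reasoning

      open Bisection F 0ℚ (1ℚ ℚ.+ q) 0≤1+q F-lo F-hi

      gap-small : ∀ ε → 0ℚ ℚ.< ε → ∃[ N ] gap N ℚ.≤ ε
      gap-small ε 0<ε = N , ℚ.*-cancelˡ-≤-pos (toℚ (suc N)) {{ℚ.positive (0<toℚ-suc N)}} (ℚ.≤-trans (suc*gap N)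
        (ℚ.≤-trans (proj₂ (archimedean-* (1ℚ ℚ.+ q) ε 0<ε)) (ℚᵃ.*-monoʳ-≤ (ℚ.<⇒≤ 0<ε) (toℚ-mono (ℕ.n≤1+n N)))))
        where N = proj₁ (archimedean-* (1ℚ ℚ.+ q) ε 0<ε)

      near : ∀ N m k → N ℕ.≤ m → N ℕ.≤ k → left m ℚ.- left k ℚ.≤ gap N
      near N m k N≤m N≤k = ℚ.≤-trans (ℚ.+-mono-≤ (ℚ.≤-trans (left≤right m) (right-anti* N≤m)) (ℚᵃ.-‿anti-≤ (left-mono* N≤k)))
        (ℚ.≤-reflexive (solve 2 (λ l g → l :+ g :- l := g) refl (left N) (gap N)))
        where open ℚᵃ.Solver using (solve; _:=_; _:+_; _:-_)

      left-cauchy : ∀ ε → 0ℚ ℚ.< ε → ∃[ N ] ∀ m k → N ℕ.≤ m → N ℕ.≤ k → ℚ.∣ left m ℚ.- left k ∣ ℚ.≤ ε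
      left-cauchy ε 0<ε = N , λ m k N≤m N≤k → ℚ.≤-trans (ℚᵃ.∣∣-least (near N m k N≤m N≤k)
        (ℚ.≤-trans (ℚ.≤-reflexive (solve 2 (λ a b → :- (a :- b) := b :- a) refl (left m) (left k))) (near N k m N≤k N≤m))) (proj₂ (gap-small ε 0<ε))
        where
        open ℚᵃ.Solver using (solve; _:=_; _:-_; :-_)
        N = proj₁ (gap-small ε 0<ε)

      gap-anti : ∀ {m k} → m ℕ.≤ k → gap k ℚ.≤ gap m
      gap-anti {m} {k} m≤k = begin
        gap k                         ≡⟨ solve 2 (λ l g → g := l :+ g :- l) refl (left k) (gap k) ⟩
        left k ℚ.+ gap k ℚ.- left k   ≲⟨ ℚ.+-mono-≤ (right-anti* m≤k) (ℚᵃ.-‿anti-≤ (left-mono* m≤k)) ⟩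
        left m ℚ.+ gap m ℚ.- left m   ≡⟨ solve 2 (λ l g → g := l :+ g :- l) refl (left m) (gap m) ⟨
        gap m                         ∎
        where
        open ℚᵃ.≤-Reasoning
        open ℚᵃ.Solver using (solve; _:=_; _:+_; _:-_)

      gap-cauchy : ∀ ε → 0ℚ ℚ.< ε → ∃[ N ] ∀ m k → N ℕ.≤ m → N ℕ.≤ k → ℚ.∣ gap m ℚ.- gap k ∣ ℚ.≤ ε
      gap-cauchy ε 0<ε = N , λ m k N≤m N≤k → ℚᵃ.∣∣-least (bound m k N≤m)
        (ℚ.≤-trans (ℚ.≤-reflexive (solve 2 (λ a b → :- (a :- b) := b :- a) refl (gap m) (gap k))) (bound k m N≤k))
        where
        open ℚᵃ.Solver using (solve; _:=_; _:-_; :-_)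
        N = proj₁ (gap-small ε 0<ε)
        bound : ∀ m k → N ℕ.≤ m → gap m ℚ.- gap k ℚ.≤ ε
        bound m k N≤m = ℚ.≤-trans (ℚ.+-mono-≤ (ℚ.≤-trans (gap-anti N≤m) (proj₂ (gap-small ε 0<ε))) (ℚᵃ.-‿anti-≤ (0≤gap k)))
          (ℚ.≤-reflexive (ℚ.+-identityʳ ε))

      g : ℝ
      g = mkℝ gap gap-cauchy

      g≃0 : g ≃ 0ᴿ
      g≃0 = wrap λ ε 0<ε → proj₁ (gap-small ε 0<ε) , λ k N≤k → ℚᵃ.∣∣-least
        (ℚ.≤-trans (ℚ.≤-reflexive (g-0 k)) (ℚ.≤-trans (gap-anti N≤k) (proj₂ (gap-small ε 0<ε))))
        (ℚ.≤-trans (ℚᵃ.-‿anti-≤ (ℚ.≤-trans (0≤gap k) (ℚ.≤-reflexive (≡.sym (g-0 k))))) (ℚ.<⇒≤ 0<ε))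
        where
        g-0 : ∀ k → gap k ℚ.- seq 0ᴿ k ≡ gap k
        g-0 k = ≡.trans (≡.cong (λ z → gap k ℚ.- seq z k) 0ᴿ-def) (ℚ.+-identityʳ (gap k))

    root : ℝ
    root = mkℝ left left-cauchy

    0≤root : 0ᴿ ≤ root
    0≤root = pointwise-≤ λ k → ≡.subst (ℚ._≤ left k) (≡.sym (≡.cong (λ z → seq z k) 0ᴿ-def)) (lo≤left k)

    -- The left ends have powers at most q, the right ends at least q; the two differ by the gap,
    -- which is equal to 0 as a real number.
    root^ : geometric root (suc n) ≃ ι q
    root^ = ≤-antisym
      (pointwise-≤ λ k → ≡.subst₂ ℚ._≤_ (≡.sym (seq-geometric root (suc n) k)) (≡.sym (seq-ι q k)) (from-≤0 (F-left k)))
      (≤-trans (pointwise-≤ λ k → ≡.subst₂ ℚ._≤_ (≡.sym (seq-ι q k))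
          (≡.sym (≡.trans (seq-geometric (root + g) (suc n) k) (≡.cong (λ z → ℚᵃ.geometric z (suc n)) (seq-+ root g k)))) (from-0≤ (F-right k)))
        (≤-reflexive (geometric-cong (≈-trans (+-congˡ g≃0) (+-identityʳ root)) (suc n))))
      where
      open ℚᵃ.Solver using (solve; _:=_; _:+_; _:-_)
      from-≤0 : ∀ {p} → p ℚ.- q ℚ.≤ 0ℚ → p ℚ.≤ q
      from-≤0 {p} h = ≡.subst₂ ℚ._≤_ (solve 2 (λ p q → p :- q :+ q := p) refl p q) (ℚ.+-identityˡ q) (ℚ.+-monoˡ-≤ q h)
      from-0≤ : ∀ {p} → 0ℚ ℚ.≤ p ℚ.- q → q ℚ.≤ p
      from-0≤ {p} h = ≡.subst₂ ℚ._≤_ (ℚ.+-identityˡ q) (solve 2 (λ p q → p :- q :+ q := p) refl p q) (ℚ.+-monoˡ-≤ q h)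

  bernoulli : ∀ {t} → 0ℚ ℚ.≤ t → ∀ n → 1ℚ ℚ.+ toℚ n ℚ.* t ℚ.≤ ℚᵃ.geometric (1ℚ ℚ.+ t) n
  bernoulli {t} 0≤t zero    = ℚ.≤-reflexive (≡.trans (≡.cong (λ z → 1ℚ ℚ.+ z ℚ.* t) toℚ-0) (≡.trans (≡.cong (1ℚ ℚ.+_) (ℚ.*-zeroˡ t)) refl))
  bernoulli {t} 0≤t (suc n) = begin
    1ℚ ℚ.+ toℚ (suc n) ℚ.* t
      ≡⟨ ≡.cong (λ z → 1ℚ ℚ.+ z ℚ.* t) (toℚ-suc n) ⟩
    1ℚ ℚ.+ (1ℚ ℚ.+ toℚ n) ℚ.* t
      ≲⟨ ℚᵃ.≤-by (solve 2 (λ n t → (con 1ℚ :+ t) :* (con 1ℚ :+ n :* t) := con 1ℚ :+ (con 1ℚ :+ n) :* t :+ n :* (t :* t)) refl (toℚ n) t)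
           (ℚᵃ.0≤-* (0≤toℚ n) (ℚᵃ.0≤-* 0≤t 0≤t)) ⟩
    (1ℚ ℚ.+ t) ℚ.* (1ℚ ℚ.+ toℚ n ℚ.* t)
      ≲⟨ ℚᵃ.*-monoˡ-≤ (ℚᵃ.0≤-+ {1ℚ} (ℚ.≤ᵇ⇒≤ tt) 0≤t) (bernoulli 0≤t n) ⟩
    (1ℚ ℚ.+ t) ℚ.* ℚᵃ.geometric (1ℚ ℚ.+ t) n ∎
    where
    open ℚᵃ.≤-Reasoning
    open ℚᵃ.Solver using (solve; _:=_; _:+_; _:*_; con)

  -- As x ≤ 2, adding 2t amounts to at least multiplying by 1 + t. Bernoulli's inequality turns this
  -- into a factor that is linear in n.
  power-gap : ∀ {x y t} → 0ᴿ ≤ x → x ≤ ι (ℤ.+ 2 / 1) → 0ℚ ℚ.≤ t → x + ι (t ℚ.+ t) ≤ y → ∀ n →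
              geometric x n * ι (1ℚ ℚ.+ toℚ n ℚ.* t) ≤ geometric y n
  power-gap {x} {y} {t} 0≤x x≤2 0≤t x+2t≤y n = begin
    geometric x n * ι (1ℚ ℚ.+ toℚ n ℚ.* t)
      ≲⟨ *-monoˡ-≤ (proj₁ (geometric-mono 0≤x ≤-refl n)) (≤-trans (ι-mono (bernoulli 0≤t n)) (≤-reflexive (ι-geometric (1ℚ ℚ.+ t) n))) ⟩
    geometric x n * geometric (ι (1ℚ ℚ.+ t)) n
      ≈⟨ geometric-* x (ι (1ℚ ℚ.+ t)) n ⟨
    geometric (x * ι (1ℚ ℚ.+ t)) n
      ≲⟨ proj₂ (geometric-mono (0≤-* 0≤x (0≤ι (ℚᵃ.0≤-+ {1ℚ} (ℚ.≤ᵇ⇒≤ tt) 0≤t))) step n) ⟩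
    geometric y n ∎
    where
    open ≤-Reasoning
    step : x * ι (1ℚ ℚ.+ t) ≤ y
    step = begin
      x * ι (1ℚ ℚ.+ t)              ≈⟨ *-congˡ (ι-+ 1ℚ t) ⟩
      x * (ι 1ℚ + ι t)              ≈⟨ solve 2 (λ x t → x :* (con 1ℚ :+ t) := x :+ x :* t) ≈-refl x (ι t) ⟩
      x + x * ι t                   ≲⟨ +-monoʳ-≤ x (*-monoʳ-≤ (0≤ι 0≤t) x≤2) ⟩
      x + ι (ℤ.+ 2 / 1) * ι t       ≈⟨ +-congˡ (≈-trans (solve 1 (λ t → con (ℤ.+ 2 / 1) :* t := t :+ t) ≈-refl (ι t)) (≈-sym (ι-+ t t))) ⟩
      x + ι (t ℚ.+ t)               ≲⟨ x+2t≤y ⟩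
      y                             ∎
      where open Solver using (solve; _:=_; _:+_; _:*_; con)

  -- If rⁿ lies between Aγⁿ and Bγⁿ, then r is close to γ for large n. Instead of logarithms or
  -- roots of A and B, a distance of ε/2 is refuted: by `power-gap` it would force a factor growing
  -- with n between the powers.
  module RootLimit {γ γ⁻¹ : ℝ} (0≤γ : 0ᴿ ≤ γ) (γ≤2 : γ ≤ ι (ℤ.+ 2 / 1)) (0≤γ⁻¹ : 0ᴿ ≤ γ⁻¹) (γγ⁻¹ : γ * γ⁻¹ ≃ 1ᴿ)
    (A B : ℚ) (0<A : 0ℚ ℚ.< A) (ε : ℚ) (0<ε : 0ℚ ℚ.< ε) where

    private
      -- A quarter of ε, so that 2t is the lower alternative ε/2 of `locate`.
      t : ℚ
      t = ε ℚ.* (ℤ.+ 1 / 4)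

      0<t : 0ℚ ℚ.< t
      0<t = ℚ.positive⁻¹ t {{ℚ.pos*pos⇒pos ε {{ℚ.positive 0<ε}} (ℤ.+ 1 / 4)}}

      0<tA : 0ℚ ℚ.< t ℚ.* A
      0<tA = ℚ.positive⁻¹ _ {{ℚ.pos*pos⇒pos t {{ℚ.positive 0<t}} A {{ℚ.positive 0<A}}}}

      t+t : ε ℚ.* ½ ≡ t ℚ.+ t
      t+t = solve 1 (λ e → e :* con ½ := e :* con (ℤ.+ 1 / 4) :+ e :* con (ℤ.+ 1 / 4)) refl ε
        where open ℚᵃ.Solver using (solve; _:=_; _:+_; _:*_; con)

      N₁ N₂ : ℕ
      N₁ = proj₁ (archimedean-* B t 0<t)
      N₂ = proj₁ (archimedean-* 1ℚ (t ℚ.* A) 0<tA)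

      cancel : ∀ n p q → geometric γ n * ι p ≤ geometric γ n * ι q → p ℚ.≤ q
      cancel n p q h = ι-reflects-≤ (≤-trans (≤-reflexive (undo p)) (≤-trans (*-monoˡ-≤ (proj₁ (geometric-mono 0≤γ⁻¹ ≤-refl n)) h) (≤-reflexive (≈-sym (undo q)))))
        where
        inverses : ∀ n → geometric γ⁻¹ n * geometric γ n ≃ 1ᴿ
        inverses n = ≈-trans (≈-sym (geometric-* γ⁻¹ γ n)) (≈-trans (geometric-cong (≈-trans (*-comm γ⁻¹ γ) γγ⁻¹) n) (geometric-1 n))
          where
          geometric-1 : ∀ n → geometric 1ᴿ n ≃ 1ᴿ
          geometric-1 zero    = ≈-refl
          geometric-1 (suc n) = ≈-trans (*-identityˡ _) (geometric-1 n)
        undo : ∀ p → ι p ≃ geometric γ⁻¹ n * (geometric γ n * ι p)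
        undo p = ≈-sym (≈-trans (≈-sym (*-assoc _ _ _)) (≈-trans (*-congʳ (inverses n)) (*-identityˡ (ι p))))

      difference : ∀ x y δ → ι δ ≤ x + neg y → y + ι δ ≤ x
      difference x y δ h = ≤-trans (+-monoʳ-≤ y h) (≤-reflexive (solve 2 (λ x y → y :+ (x :- y) := x) ≈-refl x y))
        where open Solver using (solve; _:=_; _:+_; _:-_)

      contra : ∀ {a} p → 0ℚ ℚ.< a → a ℚ.+ p ℚ.≤ p → ⊥
      contra {a} p 0<a h = ℚ.<-irrefl refl (ℚ.<-≤-trans (≡.subst (ℚ._< a ℚ.+ p) (ℚ.+-identityˡ p) (ℚ.+-monoˡ-< p 0<a)) h)

    N : ℕ
    N = N₁ ℕ.⊔ N₂

    close : ∀ {n r} → N ℕ.≤ n → 0ᴿ ≤ r → ι A * geometric γ n ≤ geometric r n → geometric r n ≤ ι B * geometric γ n →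
            abs (r + neg γ) ≤ ι ε
    close {n} {r} N≤n 0≤r low high = ∣∣-least above (≤-trans (≤-reflexive flip) below)
      where
      open ≤-Reasoning
      open Solver using (solve; _:=_; _:+_; _:*_; _:-_; :-_)

      flip : neg (r + neg γ) ≃ γ + neg r
      flip = solve 2 (λ r g → :- (r :- g) := g :- r) ≈-refl r γ

      above : r + neg γ ≤ ι ε
      above with locate (r + neg γ) 0<ε
      ... | inj₁ h = h
      ... | inj₂ h = ⊥-elim (contra (toℚ n ℚ.* t) (ℚ.positive⁻¹ 1ℚ) (ℚ.≤-trans (cancel n (1ℚ ℚ.+ toℚ n ℚ.* t) B (begin
          geometric γ n * ι (1ℚ ℚ.+ toℚ n ℚ.* t)
            ≲⟨ power-gap 0≤γ γ≤2 (ℚ.<⇒≤ 0<t) (difference r γ (t ℚ.+ t) (≡.subst (λ z → ι z ≤ r + neg γ) t+t h)) n ⟩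
          geometric r n
            ≲⟨ high ⟩
          ι B * geometric γ n
            ≈⟨ *-comm (ι B) (geometric γ n) ⟩
          geometric γ n * ι B ∎))
        (ℚ.≤-trans (proj₂ (archimedean-* B t 0<t)) (ℚᵃ.*-monoʳ-≤ (ℚ.<⇒≤ 0<t) (toℚ-mono (ℕ.m⊔n≤o⇒m≤o N₁ N₂ N≤n))))))

      below : γ + neg r ≤ ι ε
      below with locate (γ + neg r) 0<ε
      ... | inj₁ h = h
      ... | inj₂ h = ⊥-elim (contra (A ℚ.* (toℚ n ℚ.* t)) 0<A (ℚ.≤-trans (ℚ.≤-reflexive (expand A (toℚ n ℚ.* t))) (ℚ.≤-trans (cancel n (A ℚ.* (1ℚ ℚ.+ toℚ n ℚ.* t)) 1ℚ (begin
          geometric γ n * ι (A ℚ.* (1ℚ ℚ.+ toℚ n ℚ.* t))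
            ≈⟨ *-congˡ (ι-* A _) ⟩
          geometric γ n * (ι A * ι (1ℚ ℚ.+ toℚ n ℚ.* t))
            ≈⟨ solve 3 (λ g a s → g :* (a :* s) := (a :* g) :* s) ≈-refl (geometric γ n) (ι A) _ ⟩
          ι A * geometric γ n * ι (1ℚ ℚ.+ toℚ n ℚ.* t)
            ≲⟨ *-monoʳ-≤ (0≤ι (ℚᵃ.0≤-+ {1ℚ} (ℚ.≤ᵇ⇒≤ tt) (ℚᵃ.0≤-* (0≤toℚ n) (ℚ.<⇒≤ 0<t)))) low ⟩
          geometric r n * ι (1ℚ ℚ.+ toℚ n ℚ.* t)
            ≲⟨ power-gap 0≤r r≤2 (ℚ.<⇒≤ 0<t) r+2t≤γ n ⟩
          geometric γ n
            ≈⟨ ≈-trans (*-congˡ ι-1) (*-identityʳ _) ⟨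
          geometric γ n * ι 1ℚ ∎))
        (ℚ.≤-trans (proj₂ (archimedean-* 1ℚ (t ℚ.* A) 0<tA)) (ℚ.≤-trans (ℚᵃ.*-monoʳ-≤ (ℚ.<⇒≤ 0<tA) (toℚ-mono (ℕ.m⊔n≤o⇒n≤o N₁ N₂ N≤n)))
          (ℚ.≤-reflexive (rotate (toℚ n) t A)))))))
        where
        r+2t≤γ : r + ι (t ℚ.+ t) ≤ γ
        r+2t≤γ = difference γ r (t ℚ.+ t) (≡.subst (λ z → ι z ≤ γ + neg r) t+t h)
        r≤2 : r ≤ ι (ℤ.+ 2 / 1)
        r≤2 = ≤-trans (x≤x+y (0≤ι (ℚᵃ.0≤-+ (ℚ.<⇒≤ 0<t) (ℚ.<⇒≤ 0<t)))) (≤-trans r+2t≤γ γ≤2)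
        expand : ∀ a s → a ℚ.+ a ℚ.* s ≡ a ℚ.* (1ℚ ℚ.+ s)
        expand a s = ℚ-solve 2 (λ a s → a ℚ:+ a ℚ:* s ℚ:= a ℚ:* (ℚcon 1ℚ ℚ:+ s)) refl a s
          where open ℚᵃ.Solver using () renaming (solve to ℚ-solve; _:+_ to _ℚ:+_; _:*_ to _ℚ:*_; _:=_ to _ℚ:=_; con to ℚcon)
        rotate : ∀ n t a → n ℚ.* (t ℚ.* a) ≡ a ℚ.* (n ℚ.* t)
        rotate n t a = ≡.trans (≡.sym (ℚ.*-assoc n t a)) (ℚ.*-comm (n ℚ.* t) a)

-- The constants γ, α, κ and relative error terms

module Constants where

  open ℝ using (ℝ; seq)
  open import Data.Empty using (⊥-elim)
  open import Data.Nat.Base using (_!)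
  open import Data.Rational.Base using (½; _/_)
  open import Data.Vec.Base using (Vec; []; _∷_)
  open import Relation.Nullary.Decidable using (Dec; yes; no; toWitness)
  open NormedAlgebras
  open Weights hiding (f)
  open MaximalCount using (w; 𝒲₂)
  open Reals
  open PoleExpansions
  open Quotients
  open Growth
  open Decimals
  open Roots

  private module ℚᵃ = NormedAlgebraProperties ℚ-normedAlgebra
  open NormedAlgebraProperties ℝ-normedAlgebra hiding (ι; ∣_∣; _≈_; _≤_; _+_; _*_)
  open PoleExpansion ℝ-completeAlgebra
  open ≤-Reasoning
  open Solver using (solve; _:=_; _:+_; _:*_; _:-_; con)

  private
    variable
      x y : ℝ

  -- Strict inequality of reals carries a rational witness; half of q - p is free for it.
  ≤ι⇒< : ∀ {p q} → p ℚ.< q → x ≤ ι p → x ℝ.< ℝ.fromℚ q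
  ≤ι⇒< {x} {p} {q} p<q (wrap h) = ε , 0<ε , proj₁ (h ε 0<ε) , λ n N≤n → ℚ.≤-trans
    (ℚ.+-monoˡ-≤ ε (≡.subst (λ z → seq x n ℚ.≤ z ℚ.+ ε) (seq-ι p n) (proj₂ (h ε 0<ε) n N≤n)))
    (ℚ.≤-reflexive (ℚ-solve 2 (λ p q → p ⊹ (q ⊟ p) ⊠ ℚcon ½ ⊹ (q ⊟ p) ⊠ ℚcon ½ ≔ q) refl p q))
    where
    open ℚᵃ.Solver using () renaming (solve to ℚ-solve; _:+_ to _⊹_; _:*_ to _⊠_; _:-_ to _⊟_; _:=_ to _≔_; con to ℚcon)
    ε : ℚ
    ε = (q ℚ.- p) ℚ.* ½
    0<q-p : 0ℚ ℚ.< q ℚ.- p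
    0<q-p = ≡.subst (ℚ._< q ℚ.- p) (ℚ.+-inverseʳ p) (ℚ.+-monoˡ-< (ℚ.- p) p<q)
    0<ε : 0ℚ ℚ.< ε
    0<ε = ℚ.positive⁻¹ ε {{ℚ.pos*pos⇒pos (q ℚ.- p) {{ℚ.positive 0<q-p}} ½}}

  fromℕ-def : ∀ n → ⟦ n ⟧ ≡ ℝ.fromℕ n
  fromℕ-def n = ≡.trans (ι-def (toℚ n)) (≡.cong ℝ.fromℚ {toℚ n} {ℤ.+ n / 1} (toℚ-def n))

  ÷-def : ∀ x y 0<y → x * Inverse.reciprocal-of y 0<y ≡ x ℝ.÷ y [ 0<y ]
  ÷-def x y 0<y = ≡.trans (*-def x (Inverse.reciprocal-of y 0<y))
    (≡.cong (x ℝ.*_) {Inverse.reciprocal-of y 0<y} {ℝ.inverse y 0<y} (Inverse.reciprocal-def y 0<y))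

  ^-def : ∀ x n → geometric x n ≡ x ℝ.^ n
  ^-def x zero    = 1ᴿ-def
  ^-def x (suc n) = ≡.trans (*-def x (geometric x n)) (≡.cong (x ℝ.*_) {geometric x n} {x ℝ.^ n} (^-def x n))

  evaluate-def : ∀ {d} (P : Vec ℝ d) x → eval P x ≡ ℝ.evaluate P x
  evaluate-def []      x = 0ᴿ-def
  evaluate-def (p ∷ P) x = ≡.trans (+-def p (x * eval P x)) (≡.cong (p ℝ.+_) {x * eval P x} {x ℝ.* ℝ.evaluate P x}
    (≡.trans (*-def x (eval P x)) (≡.cong (x ℝ.*_) {eval P x} {ℝ.evaluate P x} (evaluate-def P x))))

  γ α : ℝ
  γ = ι ⅔ * Γ
  α = ι ⅔ * (c * Γ)

  0<γ : ℝ.0ℝ ℝ.< γ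
  0<γ = ι≤⇒0< {ℤ.+ 11926743412 / 10000000000} (ℚ.positive⁻¹ (ℤ.+ 11926743412 / 10000000000)) γ-lower

  module γ⁻¹ = Inverse γ 0<γ

  0≤γ : 0ᴿ ≤ γ
  0≤γ = ≤-trans (0≤ι {ℤ.+ 11926743412 / 10000000000} (ℚ.≤ᵇ⇒≤ tt)) γ-lower

  γ≤2 : γ ≤ ι (ℤ.+ 2 / 1)
  γ≤2 = ≤-trans γ-upper (ι-mono (ℚ.≤ᵇ⇒≤ tt))

  γ-decimals : γ ℝ.≐ 11926743412 ·10⁻¹⁰…
  γ-decimals = ≡.subst (ℝ._≤ γ) (ι-def _) (unwrap γ-lower) , ≤ι⇒< (toWitness {a? = (ℤ.+ 119267434125 / 100000000000) ℚ.<? (ℤ.+ 11926743413 / 10000000000)} tt) γ-upper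

  α-decimals : α ℝ.≐ 2963720490 ·10⁻¹⁰…
  α-decimals = ≡.subst (ℝ._≤ α) (ι-def _) (unwrap α-lower) , ≤ι⇒< (toWitness {a? = (ℤ.+ 29637204909 / 100000000000) ℚ.<? (ℤ.+ 2963720491 / 10000000000)} tt) α-upper

  3γ-def : ⟦ 3 ⟧ * γ ≡ ℝ.fromℕ 3 ℝ.* γ
  3γ-def = ≡.trans (≡.cong (_* γ) (fromℕ-def 3)) (*-def (ℝ.fromℕ 3) γ)

  0<3γ : ℝ.0ℝ ℝ.< ℝ.fromℕ 3 ℝ.* γ
  0<3γ = ≡.subst (ℝ.0ℝ ℝ.<_) 3γ-def (ι≤⇒0< {1ℚ} (ℚ.positive⁻¹ 1ℚ) (begin
    ι 1ℚ           ≲⟨ ≤-trans (ι-mono (ℚ.≤ᵇ⇒≤ tt)) γ-lower ⟩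
    γ              ≈⟨ solve 1 (λ g → g := con 1ℚ :* g) ≈-refl γ ⟩
    ι 1ℚ * γ       ≲⟨ *-monoʳ-≤ 0≤γ (ι-mono (≡.subst (ℚ._≤ toℚ 3) toℚ-1 (toℚ-mono (s≤s z≤n)))) ⟩
    ⟦ 3 ⟧ * γ      ∎))

  κ : ℝ
  κ = ℝ.fromℕ 2 ℝ.÷ (ℝ.fromℕ 3 ℝ.* γ) [ 0<3γ ]

  private
    k : ℝ
    k = Inverse.reciprocal-of (ℝ.fromℕ 3 ℝ.* γ) 0<3γ

    κ-def : ⟦ 2 ⟧ * k ≡ κ
    κ-def = ≡.trans (≡.cong (λ z → z * k) {⟦ 2 ⟧} {ℝ.fromℕ 2} (fromℕ-def 2)) (÷-def (ℝ.fromℕ 2) (ℝ.fromℕ 3 ℝ.* γ) 0<3γ)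

    3γk≃1 : ⟦ 3 ⟧ * γ * k ≃ 1ᴿ
    3γk≃1 = ≡.subst (λ z → z * k ≃ 1ᴿ) {ℝ.fromℕ 3 ℝ.* γ} {⟦ 3 ⟧ * γ} (≡.sym 3γ-def) (Inverse.*-reciprocal (ℝ.fromℕ 3 ℝ.* γ) 0<3γ)

    2k≃Γ⁻¹ : ∀ k → ⟦ 3 ⟧ * γ * k ≃ 1ᴿ → ⟦ 2 ⟧ * k ≃ Γ⁻¹
    2k≃Γ⁻¹ k e = begin-equality
      ⟦ 2 ⟧ * k                           ≈⟨ *-congʳ (≈-trans (≈-sym (ι-* (toℚ 3) ⅔)) (≈-reflexive (≡.cong ι (toℚ-/ 2 3)))) ⟨
      ⟦ 3 ⟧ * ι ⅔ * k                     ≈⟨ ≈-trans (*-congˡ Γ⁻¹.*-reciprocal) (*-identityʳ _) ⟨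
      ⟦ 3 ⟧ * ι ⅔ * k * (Γ * Γ⁻¹)         ≈⟨ solve 5 (λ t q k g i → t :* q :* k :* (g :* i) := i :* (t :* (q :* g) :* k)) ≈-refl ⟦ 3 ⟧ (ι ⅔) k Γ Γ⁻¹ ⟩
      Γ⁻¹ * (⟦ 3 ⟧ * γ * k)               ≈⟨ ≈-trans (*-congˡ e) (*-identityʳ _) ⟩
      Γ⁻¹                                 ∎

  κ≃Γ⁻¹ : κ ≃ Γ⁻¹
  κ≃Γ⁻¹ = ≡.subst (_≃ Γ⁻¹) κ-def (2k≃Γ⁻¹ k 3γk≃1)

  κ<1 : κ ℝ.< ℝ.1ℝ
  κ<1 = ≤ι⇒< (toWitness {a? = ⅔ ℚ.<? 1ℚ} tt) (≤-trans (≤-reflexive κ≃Γ⁻¹) Γ⁻¹≤⅔)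

  private
    γⁿ κⁿ ⅔ⁿ : Series
    γⁿ = geometric γ
    κⁿ = geometric κ
    ⅔ⁿ n = ι (ℚᵃ.geometric ⅔ n)

    γ-power : ∀ n → γⁿ n ≃ (Γ^ n) * ⅔ⁿ n
    γ-power n = ≈-trans (geometric-* (ι ⅔) Γ n) (≈-trans (*-congʳ (≈-sym (ι-geometric ⅔ n))) (*-comm _ _))

    γκ-power : ∀ n → γⁿ n * κⁿ n ≃ ⅔ⁿ n
    γκ-power n = ≈-trans (≈-sym (geometric-* γ κ n)) (≈-trans (geometric-cong γκ≃⅔ n) (≈-sym (ι-geometric ⅔ n)))
      where
      γκ≃⅔ : γ * κ ≃ ι ⅔
      γκ≃⅔ = ≈-trans (*-congˡ κ≃Γ⁻¹) (≈-trans (*-assoc (ι ⅔) Γ Γ⁻¹) (≈-trans (*-congˡ Γ⁻¹.*-reciprocal) (*-identityʳ (ι ⅔))))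

  ι-ad : ∀ n g → ι (ℚᵃ.ad n g) ≃ ad n (λ i j → ι (g i j))
  ι-ad zero    g = ≈-refl
  ι-ad (suc n) g = ≈-trans (ι-+ (g 0 (suc n)) _) (+-congˡ (ι-ad n (λ i j → g (suc i) j)))

  ι-⊛^ : ∀ s n → ι (ℚᵃ._⊛^_ w s n) ≃ (W ⊛^ s) n
  ι-⊛^ zero    zero    = ι-1
  ι-⊛^ zero    (suc n) = ι-0
  ι-⊛^ (suc s) n       = ≈-trans (ι-ad n (λ i j → w i ℚ.* ℚᵃ._⊛^_ w s j))
    (ad-cong n λ i j _ → ≈-trans (ι-* (w i) _) (*-congˡ (ι-⊛^ s j)))

  -- Undoing the scaling multiplies by (2/3)ⁿ. This turns Γⁿ into γⁿ, and the remainder r gets the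
  -- factor (2/3)ⁿ = γⁿκⁿ.
  /!-expansion : ∀ s n {p r} → (W ⊛^ s) n ≃ p * (Γ^ n) + r → 𝒲₂ s n ℝ./ n ! ≃ p * γⁿ n + r * (γⁿ n * κⁿ n)
  /!-expansion s n {p} {r} e = begin-equality
    𝒲₂ s n ℝ./ n !
      ≡⟨ ≡.trans (≡.cong ι (/!-def s n)) (ι-def _) ⟨
    ι (ℚᵃ._⊛^_ w s n ℚ.* ℚᵃ.geometric ⅔ n)
      ≈⟨ ≈-trans (ι-* _ _) (*-congʳ (≈-trans (ι-⊛^ s n) e)) ⟩
    (p * (Γ^ n) + r) * ⅔ⁿ n
      ≈⟨ solve 4 (λ p g r t → (p :* g :+ r) :* t := p :* (g :* t) :+ r :* t) ≈-refl p (Γ^ n) r (⅔ⁿ n) ⟩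
    p * ((Γ^ n) * ⅔ⁿ n) + r * ⅔ⁿ n
      ≈⟨ +-cong (*-congˡ (≈-sym (γ-power n))) (*-congˡ (≈-sym (γκ-power n))) ⟩
    p * γⁿ n + r * (γⁿ n * κⁿ n) ∎

  W-expansion′ : ∀ n → 𝒲₂ 1 n ℝ./ n ! ≃ c * γⁿ n + h n * (γⁿ n * κⁿ n)
  W-expansion′ n = /!-expansion 1 n (≈-trans (⊛-identityʳ W n) (W-expansion n))

  module _ (f v q r : Series) (δ B : ℚ) (N : ℕ) (0<δ : 0ℚ ℚ.< δ) (0≤B : 0ℚ ℚ.≤ B)
    (δ≤q : ∀ n → N ℕ.≤ n → ι δ ≤ q n) (∣r∣≤B : ∀ n → abs (r n) ≤ ι B)
    (v-def : ∀ n → N ℕ.≤ n → q n * γⁿ n ≃ v n)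
    (f-expansion : ∀ n → N ℕ.≤ n → f n ≃ q n * γⁿ n + r n * (γⁿ n * κⁿ n)) where

    private
      instance
        δ≢0 : ℚ.NonZero δ
        δ≢0 = ℚ.pos⇒nonZero δ {{ℚ.positive 0<δ}}

      module q⁻¹ n (N≤n : N ℕ.≤ n) = Inverse (q n) (ι≤⇒0< 0<δ (δ≤q n N≤n))

      q⁻¹≤ : ∀ n N≤n → q⁻¹.reciprocal-of n N≤n ≤ ι (ℚ.1/ δ)
      q⁻¹≤ n N≤n = ι-cancel 0<δ (begin
        ι δ * q⁻¹.reciprocal-of n N≤n     ≲⟨ *-monoʳ-≤ (q⁻¹.0≤reciprocal n N≤n) (δ≤q n N≤n) ⟩
        q n * q⁻¹.reciprocal-of n N≤n     ≈⟨ ≈-trans (q⁻¹.*-reciprocal n N≤n) (≈-sym ι-1) ⟩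
        ι 1ℚ                              ≡⟨ ≡.cong ι (ℚ.*-inverseʳ δ) ⟨
        ι (δ ℚ.* ℚ.1/ δ)                  ≈⟨ ι-* δ (ℚ.1/ δ) ⟩
        ι δ * ι (ℚ.1/ δ)                  ∎)

      -- The inverse of q n requires a proof that q n is positive, which is available from N on;
      -- before that, 0 is a default.
      error : ∀ n → Dec (N ℕ.≤ n) → ℝ
      error n (yes N≤n) = r n * q⁻¹.reciprocal-of n N≤n * κⁿ n
      error n (no _)    = 0ᴿ

      C : ℝ
      C = ι B * ι (ℚ.1/ δ)

      error≤ : ∀ n d → N ℕ.≤ n → abs (error n d) ≤ C * abs (κⁿ n)
      error≤ n (no N≰n)  N≤n = ⊥-elim (N≰n N≤n)
      error≤ n (yes N≤n) _   = ∣*∣≤ (∣*∣≤ (∣r∣≤B n) (≤-trans (0≤x⇒∣x∣≈x (q⁻¹.0≤reciprocal n N≤n)) (q⁻¹≤ n N≤n))) ≤-refl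

      f≃v : ∀ n d → N ℕ.≤ n → f n ≃ v n * (1ᴿ + error n d)
      f≃v n (no N≰n)  N≤n = ⊥-elim (N≰n N≤n)
      f≃v n (yes N≤n) _   = begin-equality
        f n
          ≈⟨ f-expansion n N≤n ⟩
        q n * γⁿ n + r n * (γⁿ n * κⁿ n)
          ≈⟨ +-congˡ (≈-trans (*-congʳ (q⁻¹.*-reciprocal n N≤n)) (*-identityˡ _)) ⟨
        q n * γⁿ n + q n * i * (r n * (γⁿ n * κⁿ n))
          ≈⟨ solve 5 (λ q g i r k → q :* g :+ q :* i :* (r :* (g :* k)) := (q :* g) :* (con 1ℚ :+ r :* i :* k)) ≈-refl (q n) (γⁿ n) i (r n) (κⁿ n) ⟩
        q n * γⁿ n * (ι 1ℚ + r n * i * κⁿ n)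
          ≈⟨ *-cong (v-def n N≤n) (+-congʳ ι-1) ⟩
        v n * (1ᴿ + r n * i * κⁿ n) ∎
        where
        i : ℝ
        i = q⁻¹.reciprocal-of n N≤n

    -- The relative error is (r n/q n)κⁿ, and r n/q n is bounded by B/δ.
    asymptotic : f ℝ.≈ v [1+O (λ n → κ ℝ.^ n) ]
    asymptotic = e ,
      (C , N , λ n N≤n → unwrap-∣∣≤ {e n} {C} (≡.subst (λ z → abs (e n) ≤ C * abs z) (^-def κ n) (error≤ n (N ℕ.≤? n) N≤n))) ,
      N , λ n N≤n → unwrap-1+ {f n} {v n} {e n} (f≃v n (N ℕ.≤? n) N≤n)
      where
      e : Series
      e n = error n (N ℕ.≤? n)

-- The asymptotic formulas

module Asymptotics where

  open ℝ using (ℝ)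
  open import Data.Nat.Base using (_!; _∸_)
  open import Data.Rational.Base using (½; _/_)
  open import Data.Vec.Base using (Vec; last)
  open NormedAlgebras
  open Weights hiding (f)
  open MaximalCount using (w; 0≤w; 𝒲₂; 𝒲₂-isMaximum)
  open Reals
  open PoleExpansions
  open Growth hiding (u)
  open Decimals
  open Roots
  open Quotients
  open Constants

  private module ℚᵃ = NormedAlgebraProperties ℚ-normedAlgebra
  open NormedAlgebraProperties ℝ-normedAlgebra hiding (ι; ∣_∣; _≈_; _≤_; _+_; _*_)
  open PoleExpansion ℝ-completeAlgebra
  open ≤-Reasoning
  open Solver using (solve; _:=_; _:+_; _:*_; _:-_; :-_; con)

  *^-def : ∀ x y n → x * geometric y n ≡ x ℝ.* y ℝ.^ n
  *^-def x y n = ≡.trans (*-def x (geometric y n)) (≡.cong (x ℝ.*_) {geometric y n} {y ℝ.^ n} (^-def y n))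

  ^*-def : ∀ y n q → geometric y n * ι q ≡ y ℝ.^ n ℝ.* ℝ.fromℚ q
  ^*-def y n q = ≡.trans (*-def (geometric y n) (ι q))
    (≡.cong₂ ℝ._*_ {geometric y n} {y ℝ.^ n} {ι q} {ℝ.fromℚ q} (^-def y n) (ι-def q))

  evaluate*^-def : ∀ {d} (P : Vec ℝ d) n y → eval P ⟦ n ⟧ * geometric y n ≡ ℝ.evaluate P (ℝ.fromℕ n) ℝ.* y ℝ.^ n
  evaluate*^-def P n y = ≡.trans (≡.cong (_* geometric y n) {eval P ⟦ n ⟧} {ℝ.evaluate P (ℝ.fromℕ n)}
    (≡.trans (evaluate-def P ⟦ n ⟧) (≡.cong (ℝ.evaluate P) {⟦ n ⟧} {ℝ.fromℕ n} (fromℕ-def n)))) (*^-def (ℝ.evaluate P (ℝ.fromℕ n)) y n)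

  private
    cmin : ℚ
    cmin = ℤ.+ 1 / 10

    0<cmin : 0ℚ ℚ.< cmin
    0<cmin = ℚ.positive⁻¹ cmin

  -- From c γ = α ≥ 0.29... and γ ≤ 2.
  cmin≤c : ι cmin ≤ c
  cmin≤c = ι-cancel {ℤ.+ 2 / 1} (ℚ.positive⁻¹ (ℤ.+ 2 / 1)) (begin
    ι (ℤ.+ 2 / 1) * ι cmin        ≈⟨ ι-* (ℤ.+ 2 / 1) cmin ⟨
    ι ((ℤ.+ 2 / 1) ℚ.* cmin)      ≲⟨ ≤-trans (ι-mono (ℚ.≤ᵇ⇒≤ tt)) α-lower ⟩
    ι ⅔ * (c * Γ)                 ≈⟨ solve 3 (λ t c g → t :* (c :* g) := c :* (t :* g)) ≈-refl (ι ⅔) c Γ ⟩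
    c * γ                         ≲⟨ *-monoˡ-≤ 0≤c γ≤2 ⟩
    c * ι (ℤ.+ 2 / 1)             ≈⟨ *-comm c _ ⟩
    ι (ℤ.+ 2 / 1) * c             ∎)

  𝒲₂-asymptotic : (λ n → 𝒲₂ 1 n ℝ./ n !) ℝ.≈ (λ n → α ℝ.* γ ℝ.^ (n ∸ 1)) [1+O (λ n → κ ℝ.^ n) ]
  𝒲₂-asymptotic = asymptotic (λ n → 𝒲₂ 1 n ℝ./ n !) (λ n → α ℝ.* γ ℝ.^ (n ∸ 1)) (λ _ → c) h cmin (toℚ 20000) 1 0<cmin (0≤toℚ 20000) (λ _ _ → cmin≤c) ∣h∣≤ shift
    (λ n _ → W-expansion′ n)
    where
    -- α = c γ absorbs one power of γ. For n = 0 the truncated subtraction would give γ⁰ again, so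
    -- the formula starts at n = 1.
    shift : ∀ n → 1 ℕ.≤ n → c * geometric γ n ≃ α ℝ.* γ ℝ.^ (n ∸ 1)
    shift n 1≤n = ≡.subst (c * geometric γ n ≃_) (*^-def α γ (n ∸ 1)) (wrapped n 1≤n)
      where
      wrapped : ∀ n → 1 ℕ.≤ n → c * geometric γ n ≃ α * geometric γ (n ∸ 1)
      wrapped (suc n) _ = solve 4 (λ c t g p → c :* (t :* g :* p) := t :* (c :* g) :* p) ≈-refl c (ι ⅔) Γ (geometric γ n)

  -- The remainder is eventually at most half of c γⁿ, so the expansion puts
  -- 𝒲₂ 1 n / n ! between two positive multiples of γⁿ.
  module _ where
    private
      u : ℕ → ℚ
      u n = quotient (𝒲₂ 1 n) n

      0≤u : ∀ n → 0ℚ ℚ.≤ u n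
      0≤u n = ≡.subst (0ℚ ℚ.≤_) (/!-def 1 n) (ℚᵃ.0≤-* (≡.subst (0ℚ ℚ.≤_) (≡.sym (ℚᵃ.⊛-identityʳ w n)) (0≤w n)) (0≤⅔^ n))

      u-expansion : ∀ n → ι (u n) ≃ c * geometric γ n + h n * (geometric γ n * (Γ⁻^ n))
      u-expansion n = ≈-trans (≈-trans (≈-reflexive (ι-def (u n))) (W-expansion′ n))
        (+-congˡ (*-congˡ (*-congˡ (geometric-cong κ≃Γ⁻¹ n))))

      root : ℕ → ℝ
      -- A default: the roots are specified for n ≥ 1.
      root zero    = 0ᴿ
      root (suc n) = Root.root n (u (suc n)) (0≤u (suc n))

      root^ : ∀ n → 1 ℕ.≤ n → geometric (root n) n ≃ ι (u n)
      root^ (suc n) _ = Root.root^ n (u (suc n)) (0≤u (suc n))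

      0≤root : ∀ n → 0ᴿ ≤ root n
      0≤root zero    = ≤-refl
      0≤root (suc n) = Root.0≤root n (u (suc n)) (0≤u (suc n))

      B C : ℚ
      B = toℚ 20000
      C = proj₁ (ℝ-bounded c)

      0≤γ^ : ∀ n → 0ᴿ ≤ geometric γ n
      0≤γ^ n = proj₁ (geometric-mono 0≤γ ≤-refl n)

      u≤ : ∀ n → ι (u n) ≤ ι (C ℚ.+ B) * geometric γ n
      u≤ n = begin
        ι (u n)
          ≈⟨ u-expansion n ⟩
        c * geometric γ n + h n * (geometric γ n * (Γ⁻^ n))
          ≈⟨ solve 4 (λ c g h x → c :* g :+ h :* (g :* x) := (c :+ h :* x) :* g) ≈-refl c (geometric γ n) (h n) (Γ⁻^ n) ⟩
        (c + h n * (Γ⁻^ n)) * geometric γ n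
          ≲⟨ *-monoʳ-≤ (0≤γ^ n) (+-mono-≤ (≤-trans (≤∣∣ c) (proj₂ (proj₂ (ℝ-bounded c))))
               (≤-trans (*-monoʳ-≤ (0≤Γ⁻^ n) (≤-trans (≤∣∣ (h n)) (∣h∣≤ n)))
                 (≤-trans (*-monoˡ-≤ 0≤⟦ 20000 ⟧ (Γ⁻^-mono 0 n)) (≤-reflexive (*-identityʳ ⟦ 20000 ⟧))))) ⟩
        (ι C + ι B) * geometric γ n
          ≈⟨ *-congʳ (ι-+ C B) ⟨
        ι (C ℚ.+ B) * geometric γ n ∎

      A : ℚ
      A = cmin ℚ.* ½

      0<A : 0ℚ ℚ.< A
      0<A = ℚ.positive⁻¹ A

      M : ℕ
      M = proj₁ (⅔^-small B A 0<A)

      small : ∀ n → M ℕ.≤ n → abs (h n * (Γ⁻^ n)) ≤ ι A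
      small n M≤n = begin
        abs (h n * (Γ⁻^ n))
          ≲⟨ ∣*∣≤ (∣h∣≤ n) (0≤x⇒∣x∣≈x (0≤Γ⁻^ n)) ⟩
        ι B * (Γ⁻^ n)
          ≲⟨ *-monoˡ-≤ 0≤⟦ 20000 ⟧ (≤-trans (≤-reflexive (≈-reflexive (≡.cong Γ⁻^_ (≡.sym (ℕ.m+[n∸m]≡n M≤n))))) (Γ⁻^-mono M (n ∸ M))) ⟩
        ι B * (Γ⁻^ M)
          ≲⟨ *-monoˡ-≤ 0≤⟦ 20000 ⟧ (Γ⁻^≤⅔^ M) ⟩
        ι B * ι (ℚᵃ.geometric ⅔ M)
          ≈⟨ ι-* B _ ⟨
        ι (B ℚ.* ℚᵃ.geometric ⅔ M)
          ≲⟨ ι-mono (proj₂ (⅔^-small B A 0<A)) ⟩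
        ι A ∎

      ≤u : ∀ n → M ℕ.≤ n → ι A * geometric γ n ≤ ι (u n)
      ≤u n M≤n = begin
        ι A * geometric γ n
          ≲⟨ *-monoʳ-≤ (0≤γ^ n) (begin
               ι A                     ≈⟨ solve 0 (con A := con cmin :- con A) ≈-refl ⟩
               ι cmin - ι A            ≲⟨ +-mono-≤ cmin≤c (-‿anti-≤ (≤-trans (≤∣∣ _) (≤-trans (≤-reflexive (∣-∣ (h n * (Γ⁻^ n)))) (small n M≤n)))) ⟩
               c - - (h n * (Γ⁻^ n))   ∎) ⟩
        (c - - (h n * (Γ⁻^ n))) * geometric γ n
          ≈⟨ solve 4 (λ c g h x → c :* g :+ h :* (g :* x) := (c :- (:- (h :* x))) :* g) ≈-refl c (geometric γ n) (h n) (Γ⁻^ n) ⟨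
        c * geometric γ n + h n * (geometric γ n * (Γ⁻^ n))
          ≈⟨ u-expansion n ⟨
        ι (u n) ∎

      γΓ⁻¹ : γ * (ι (ℤ.+ 3 / 2) * Γ⁻¹) ≃ 1ᴿ
      γΓ⁻¹ = ≈-trans (solve 2 (λ g x → con ⅔ :* g :* (con (ℤ.+ 3 / 2) :* x) := g :* x) ≈-refl Γ Γ⁻¹) Γ⁻¹.*-reciprocal

    𝒲₂-root : (λ n → 𝒲₂ 1 n ℝ./ n !) ℝ.^1/n⟶ γ
    𝒲₂-root = root , (λ n 1≤n → ≡.subst (ℝ._≤ root n) 0ᴿ-def (unwrap (0≤root n)) ,
        ≡.subst₂ ℝ._≃_ (^-def (root n) n) (ι-def (u n)) (unwrap (root^ n 1≤n))) ,
      λ ε 0<ε →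
        let open RootLimit 0≤γ γ≤2 (0≤-* (0≤ι {ℤ.+ 3 / 2} (ℚ.≤ᵇ⇒≤ tt)) Γ⁻¹.0≤reciprocal) γΓ⁻¹ A (C ℚ.+ B) 0<A (proj₁ 0<ε) (proj₁ (proj₂ 0<ε))
        in 1 ℕ.⊔ (M ℕ.⊔ N) , λ n h →
          let 1≤n = ℕ.m⊔n≤o⇒m≤o 1 (M ℕ.⊔ N) h
              h′ = ℕ.m⊔n≤o⇒n≤o 1 (M ℕ.⊔ N) h
              e = root^ n 1≤n
          in unwrap-∣-∣≤ {root n} {γ} (≤-trans (close {n} {root n} (ℕ.m⊔n≤o⇒n≤o M N h′) (0≤root n)
               (≤-trans (≤u n (ℕ.m⊔n≤o⇒m≤o M N h′)) (≤-reflexive (≈-sym e))) (≤-trans (≤-reflexive e) (u≤ n))) (0<⇒ι≤ {ε} 0<ε))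

  module _ (r : ℕ) where
    private
      -- The general induction starts from K = 1, whose quotient by 1 - Γz has residue 1 and no
      -- remainder.
      𝟙-pole : SimplePole (Γ^_ ⊛ 𝟙)
      𝟙-pole = simplePole 1ᴿ 𝟘 Summable-𝟘 λ n → ≈-trans (⊛-identityʳ Γ^_ n) (≈-sym (≈-trans (+-identityʳ _) (*-identityˡ _)))

      open Expansion (power-expansion W-pole r Summable-𝟙 𝟙-pole)

      !-positive : 0ℚ ℚ.< toℚ (r !)
      !-positive = ℚ.<-≤-trans (0<toℚ-suc 0) (toℚ-mono (ℕ.1≤n! r))

      1/! : ℚ
      1/! = quotient 1 r

      reciprocals≡1/! : reciprocals 0 r ≡ 1/!
      reciprocals≡1/! = ℚ.≤-antisym (cancel (ℚ.≤-reflexive e)) (cancel (ℚ.≤-reflexive (≡.sym e)))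
        where
        e : toℚ (r !) ℚ.* reciprocals 0 r ≡ toℚ (r !) ℚ.* 1/!
        e = ≡.trans (reciprocals-! 0 r) (≡.sym (toℚ-/ 1 (r !) {{r ℕ.!≢0}}))
        cancel : ∀ {p q} → toℚ (r !) ℚ.* p ℚ.≤ toℚ (r !) ℚ.* q → p ℚ.≤ q
        cancel = ℚ.*-cancelˡ-≤-pos (toℚ (r !)) {{ℚ.positive !-positive}}

      0<1/! : 0ℚ ℚ.< 1/!
      0<1/! = ℚ.positive⁻¹ 1/! {{ℚ.normalize-pos 1 (r !) {{r ℕ.!≢0}}}}

    P : Vec ℝ (suc r)
    P = monomials 0 coefficients

    private
      last-P : last P ≃ geometric c (suc r) * ι 1/!
      last-P = begin-equality
        last P                                       ≈⟨ last-monomials 0 coefficients ⟩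
        last coefficients * ι (reciprocals 0 r)      ≈⟨ *-cong (≈-trans leading (*-identityʳ _)) (≈-reflexive (≡.cong ι reciprocals≡1/!)) ⟩
        geometric c (suc r) * ι 1/!                  ∎

      -- A positive rational below the leading coefficient cʳ⁺¹/r!, obtained from c ≥ 1/10, as
      -- `eventually-positive` asks for.
      leadmin : ℚ
      leadmin = ℚᵃ.geometric cmin (suc r) ℚ.* 1/!

      0<leadmin : 0ℚ ℚ.< leadmin
      0<leadmin = ℚ.positive⁻¹ leadmin {{ℚ.pos*pos⇒pos (ℚᵃ.geometric cmin (suc r)) {{geometric-positive (suc r)}} 1/! {{ℚ.positive 0<1/!}}}}
        where
        geometric-positive : ∀ n → ℚ.Positive (ℚᵃ.geometric cmin n)
        geometric-positive zero    = _
        geometric-positive (suc n) = ℚ.pos*pos⇒pos cmin (ℚᵃ.geometric cmin n) {{geometric-positive n}}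

      leadmin≤last : ι leadmin ≤ last P
      leadmin≤last = begin
        ι leadmin                                    ≈⟨ ≈-trans (ι-* _ 1/!) (*-congʳ (ι-geometric cmin (suc r))) ⟩
        geometric (ι cmin) (suc r) * ι 1/!           ≲⟨ *-monoʳ-≤ (0≤ι (ℚ.<⇒≤ 0<1/!)) (proj₂ (geometric-mono (0≤ι (ℚ.<⇒≤ 0<cmin)) cmin≤c (suc r))) ⟩
        geometric c (suc r) * ι 1/!                  ≈⟨ last-P ⟨
        last P                                       ∎

      P-expansion : ∀ n → (W ⊛^ suc r) n ≃ eval P ⟦ n ⟧ * (Γ^ n) + remainder n
      P-expansion n = begin-equality
        (W ⊛^ suc r) n
          ≈⟨ ⊛-identityʳ (W ⊛^ suc r) n ⟨
        (W ⊛^ suc r ⊛ 𝟙) n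
          ≈⟨ expansion n ⟩
        newton 0 coefficients n * (Γ^ n) + remainder n
          ≈⟨ +-congʳ (*-congʳ (≈-trans (newton-monomials 0 coefficients n)
               (≈-trans (*-congʳ (≈-trans (≈-reflexive (≡.cong ι toℚ-1)) ι-1)) (*-identityˡ _)))) ⟩
        eval P ⟦ n ⟧ * (Γ^ n) + remainder n ∎

    P-leading : last P ℝ.≃ (α ℝ.÷ γ [ 0<γ ]) ℝ.^ suc r ℝ.* (1 ℝ./ r !)
    P-leading = unwrap (≡.subst (last P ≃_) (^*-def (α ℝ.÷ γ [ 0<γ ]) (suc r) 1/!)
      (≡.subst (λ z → last P ≃ geometric z (suc r) * ι 1/!) {α * γ⁻¹.reciprocal-of} {α ℝ.÷ γ [ 0<γ ]} (÷-def α γ 0<γ)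
        (≈-trans last-P (*-congʳ (geometric-cong c≃α/γ (suc r))))))
      where
      c≃α/γ : c ≃ α * γ⁻¹.reciprocal-of
      c≃α/γ = begin-equality
        c                                  ≈⟨ ≈-trans (*-congˡ γ⁻¹.*-reciprocal) (*-identityʳ c) ⟨
        c * (γ * γ⁻¹.reciprocal-of)        ≈⟨ solve 4 (λ c t g x → c :* ((t :* g) :* x) := (t :* (c :* g)) :* x) ≈-refl c (ι ⅔) Γ γ⁻¹.reciprocal-of ⟩
        α * γ⁻¹.reciprocal-of              ∎

    𝒲₂-asymptotics : (λ n → 𝒲₂ (suc r) n ℝ./ n !) ℝ.≈ (λ n → ℝ.evaluate P (ℝ.fromℕ n) ℝ.* γ ℝ.^ n) [1+O (λ n → κ ℝ.^ n) ]
    𝒲₂-asymptotics =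
      let δ , 0<δ , N , δ≤P = eventually-positive P leadmin 0<leadmin leadmin≤last
          B , 0≤B , ‖remainder‖≤ = summable
      in asymptotic (λ n → 𝒲₂ (suc r) n ℝ./ n !) (λ n → ℝ.evaluate P (ℝ.fromℕ n) ℝ.* γ ℝ.^ n) (λ n → eval P ⟦ n ⟧) remainder δ B N 0<δ 0≤B
        δ≤P (term≤ ‖remainder‖≤)
        (λ n _ → ≡.subst (eval P ⟦ n ⟧ * geometric γ n ≃_) (evaluate*^-def P n γ) ≈-refl)
        (λ n _ → /!-expansion (suc r) n (P-expansion n))

open import Defs
open import Data.Nat.Base using (_∸_)
open import Data.Vec.Base using (Vec; last)

theorem2 :
  Σ[ 𝒲₂ ∈ (ℕ → ℕ → ℕ) ] Is𝒲₂ 𝒲₂ ×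
  Σ[ γ ∈ ℝ ] (λ n → 𝒲₂ 1 n / n !) ^1/n⟶ γ × γ ≐ 11926743412 ·10⁻¹⁰… ×
  Σ[ 0<γ ∈ 0ℝ < γ ] Σ[ 0<3γ ∈ 0ℝ < fromℕ 3 * γ ]
  Σ[ α ∈ ℝ ] α ≐ 2963720490 ·10⁻¹⁰… ×
    (let κ = fromℕ 2 ÷ (fromℕ 3 * γ) [ 0<3γ ] in
     κ < 1ℝ ×
     (λ n → 𝒲₂ 1 n / n !) ≈ (λ n → α * γ ^ (n ∸ 1)) [1+O (λ n → κ ^ n) ] ×
     (∀ r → let s = suc r in
       Σ[ P ∈ Vec ℝ s ]
         last P ≃ (α ÷ γ [ 0<γ ]) ^ s * (1 / r !) ×
         (λ n → 𝒲₂ s n / n !) ≈ (λ n → evaluate P (fromℕ n) * γ ^ n) [1+O (λ n → κ ^ n) ]))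
theorem2 = MaximalCount.𝒲₂ , MaximalCount.𝒲₂-isMaximum ,
  Constants.γ , Asymptotics.𝒲₂-root , Constants.γ-decimals , Constants.0<γ , Constants.0<3γ ,
  Constants.α , Constants.α-decimals , Constants.κ<1 , Asymptotics.𝒲₂-asymptotic ,
  λ r → Asymptotics.P r , Asymptotics.P-leading r , Asymptotics.𝒲₂-asymptotics r
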